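{- Let ${\boldsymbol{\nu}}$ be a tuple of skew shapes. The LLT graph $\mathcal{L}_{\boldsymbol{\nu}}$ is a dual equivalence graph if and only if $\mathrm{diam}({\boldsymbol{\nu}})\le 3$.
   Context: Diagrams are in French notation in $\mathbb Z^2$; a cell in column $j$, row $i$ has content $c=j-i$. For a $k$-tuple ${\boldsymbol{\nu}}=(\nu^{(0)},\dots,\nu^{(k-1)})$ of skew shapes with $n$ cells in total, a standard filling is a bijection from the cells to $[n]$ increasing along rows (left to right) and up columns in each $\nu^{(i)}$; $\mathrm{SYT}({\boldsymbol{\nu}})$ is their set. A cell $x$ of $\nu^{(i)}$ has shifted content $\tilde c(x)=k\,c(x)+i$. The shifted content word of a filling lists its entries by increasing shifted content, equal shifted contents read southwest to northeast. $\mathrm{diam}({\boldsymbol{\nu}})$ is the maximal size of a set $R$ of distinct shifted contents of cells with $|x-y|\le k$ for all $x,y\in R$. Number the cells $1,\dots,n$ in shifted content reading order, with $\tilde c_j$ the shifted content of cell $j$, and set $\tau_i=\max\{j\in[n]:\tilde c_j-\tilde c_i\le k\}$, $\tau({\boldsymbol{\nu}})=\tau_1\cdots\tau_n$. For $w\in S_n$, $\sigma(w)_i=+1$ if $i$ appears before $i+1$ in $w$, else $-1$. For $1<i<n$: $d_i$ fixes $w$ if the value $i$ lies positionally between $i-1$ and $i+1$, and otherwise interchanges $i$ with whichever of $i-1,i+1$ is not in the middle of the three positions. $\tilde d_i$ fixes $w$ if $i-1,i,i+1$ occur in increasing or decreasing order, and otherwise acts on the relative order of these three values by $(i,i-1,i+1)\leftrightarrow(i-1,i+1,i)$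 and $(i,i+1,i-1)\leftrightarrow(i+1,i-1,i)$ (the positions occupied are unchanged). Let $m(i)$ and $M(i)$ be the positions in $w$ of the first and last occurring of $i-1,i,i+1$; then $D_i^{(\tau)}(w)=d_i(w)$ if $\tau_{m(i)}<M(i)$ and $D_i^{(\tau)}(w)=\tilde d_i(w)$ if $\tau_{m(i)}\ge M(i)$. The LLT graph $\mathcal L_{\boldsymbol{\nu}}$ is the signed colored graph whose vertices are the shifted content words of the fillings in $\mathrm{SYT}({\boldsymbol{\nu}})$, with signature $\sigma(w)$, and with $i$-edges the nontrivial orbits $\{w,D_i^{(\tau({\boldsymbol{\nu}}))}(w)\}$ for $1<i<n$. Tableaux: the row reading word reads rows left to right starting from the top row; a tableau's signature is that of its row reading word; $d_i$ acts on tableaux via row reading words. $\mathcal G_\lambda$ ($\lambda\vdash n$) has vertices $\mathrm{SYT}(\lambda)$, tableau signatures, $i$-edges $\{T,d_i(T)\}$ with $d_i(T)\neq T$. A signed colored graph $(V,\sigma,E_{m+1}\cup\dots\cup E_{n-1})$ has finite $V$, sets $E_i$ ($m<i<n$) of unordered pairs of distinct vertices, and $\sigma\colon V\to\{\pm1\}^{N-1}$, $N\ge n$. Isomorphisms of edge colored graphs (no $\sigma$) are vertex bijections preserving $i$-edges both ways. $v$ admits an $i$-neighbor if $\sigma(v)_{i-1}=-\sigma(v)_i$. A dual equivalence graph is a signed colored graph satisfying: (Ax1) for $m<i<n$, $E_i$ is a complete matching on the vertices admitting an $i$-neighbor; (Ax2) if $\{v,w\}\in E_i$ then $\sigma(v)_i=-\sigma(w)_i$,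 $\sigma(v)_{i-1}=-\sigma(w)_{i-1}$, and $\sigma(v)_h=\sigma(w)_h$ for $h<i-2$ and $h>i+1$; (Ax3) for $\{v,w\}\in E_i$: if $\sigma_{i-2}$ is defined then $v$ or $w$ admits an $(i-1)$-neighbor; if $\sigma_{i+1}$ is defined then $v$ or $w$ admits an $(i+1)$-neighbor; (Ax4) for $m+1<i<n$, each connected component of the edge colored graph $(V,E_{i-2}\cup E_{i-1}\cup E_i)$ is isomorphic to a component of $(V',E'_{i-2}\cup E'_{i-1}\cup E'_i)$ for some $\mathcal G_\lambda=(V',\sigma',E')$ ($E_{i-2}$ omitted if $i=m+2$); (Ax5) if $|i-j|>2$, $\{v,w\}\in E_i$, $\{w,x\}\in E_j$, then some $y$ has $\{v,y\}\in E_j$ and $\{x,y\}\in E_i$; (Ax6) for $m<i<n$, any two vertices in one connected component of $(V,\sigma,E_{m+1}\cup\dots\cup E_i)$ are joined by a path using at most one edge of $E_i$. -}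

module Defs where

open import Data.Bool using (Bool; true; false; if_then_else_; _∧_; _∨_; not)
open import Data.Nat as ℕ using (ℕ; zero; suc; _+_; _*_; _∸_; _≤_; _<_; _<ᵇ_; _≤ᵇ_; _⊔_; _⊓_)
open import Data.Integer as ℤ using (ℤ; ∣_∣)
open import Data.List using (List; []; _∷_; _++_; map; length; concat; concatMap; reverse; upTo; foldr; filter; deduplicate)
open import Data.List.Relation.Unary.All using (All)
open import Data.List.Relation.Unary.Linked using (Linked)
open import Data.List.Membership.Propositional using (_∈_)
open import Data.List.Relation.Binary.Permutation.Propositional using (_↭_)
open import Data.Product using (Σ; ∃; _×_; _,_)
open import Data.Sum using (_⊎_)
open import Data.Sign as Sg using (Sign; opposite)
open import Relation.Binary.PropositionalEquality using (_≡_; _≢_)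
open import Relation.Binary.Construct.Closure.ReflexiveTransitive using (Star)
open import Relation.Nullary.Decidable using (⌊_⌋)
open import Function.Bundles using (_⇔_)

-- Partitions and skew shapes (French notation; row 0 is the bottom row).
-- A skew shape λ/μ occupies the cells (row r, column c) with
-- μ_r ≤ c < λ_r.  (Any skew diagram in ℤ² is a translate of such a
-- diagram by a diagonal vector, which changes no content.)

part : List ℕ → ℕ → ℕ
part []       _       = 0
part (p ∷ ps) zero    = p
part (p ∷ ps) (suc r) = part ps r

IsPartition : List ℕ → Set
IsPartition p = Linked (λ a b → b ≤ a) p × All (λ a → 0 < a) p

record Skew : Set where
  field
    outer      : List ℕ
    inner      : List ℕ
    outerPart  : IsPartition outer
    innerPart  : IsPartition inner
    contained  : ∀ r → part inner r ≤ part outer r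
open Skew public

Cell : Set
Cell = ℕ × ℕ × ℕ

compOf rowOf colOf : Cell → ℕ
compOf (i , r , c) = i
rowOf  (i , r , c) = r
colOf  (i , r , c) = c

cellsSkew : ℕ → Skew → List Cell
cellsSkew i s =
  concatMap (λ r → map (λ c → (i , r , part (inner s) r + c))
                       (upTo (part (outer s) r ∸ part (inner s) r)))
            (upTo (length (outer s)))

cellsFrom : ℕ → List Skew → List Cell
cellsFrom i []       = []
cellsFrom i (s ∷ ss) = cellsSkew i s ++ cellsFrom (suc i) ss

cells : List Skew → List Cell
cells ν = cellsFrom 0 ν

content : Cell → ℤ
content (i , r , c) = ℤ.+ c ℤ.- ℤ.+ r

shiftedContent : ℕ → Cell → ℤ
shiftedContent k x = ℤ.+ k ℤ.* content x ℤ.+ ℤ.+ (compOf x)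

record IsStandardFilling (ν : List Skew) (T : Cell → ℕ) : Set where
  field
    range      : ∀ x → x ∈ cells ν → 1 ≤ T x × T x ≤ length (cells ν)
    injective  : ∀ x y → x ∈ cells ν → y ∈ cells ν → T x ≡ T y → x ≡ y
    rowIncr    : ∀ x y → x ∈ cells ν → y ∈ cells ν →
                 compOf x ≡ compOf y → rowOf x ≡ rowOf y → colOf x < colOf y → T x < T y
    colIncr    : ∀ x y → x ∈ cells ν → y ∈ cells ν →
                 compOf x ≡ compOf y → colOf x ≡ colOf y → rowOf x < rowOf y → T x < T y

-- Shifted content reading order: increasing shifted content, ties
-- (cells on one diagonal of one component) read southwest to northeast,
-- i.e. by increasing row.

before : ℕ → Cell → Cell → Bool
before k x y =
  ⌊ shiftedContent k x ℤ.<? shiftedContent k y ⌋ ∨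
  (⌊ shiftedContent k x ℤ.≟ shiftedContent k y ⌋ ∧ (rowOf x <ᵇ rowOf y))

insertBy : ℕ → Cell → List Cell → List Cell
insertBy k x []       = x ∷ []
insertBy k x (y ∷ ys) = if before k x y then x ∷ y ∷ ys else y ∷ insertBy k x ys

sortCells : ℕ → List Cell → List Cell
sortCells k = foldr (insertBy k) []

readingOrder : List Skew → List Cell
readingOrder ν = sortCells (length ν) (cells ν)

scWord : List Skew → (Cell → ℕ) → List ℕ
scWord ν T = map T (readingOrder ν)

-- 1-indexed lookup with default
nth : {A : Set} → A → List A → ℕ → A
nth d []       _             = d
nth d (x ∷ xs) zero          = d
nth d (x ∷ xs) (suc zero)    = x
nth d (x ∷ xs) (suc (suc j)) = nth d xs (suc j)

c̃ : List Skew → ℕ → ℤ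
c̃ ν j = nth (ℤ.+ 0) (map (shiftedContent (length ν)) (readingOrder ν)) j

range1 : ℕ → List ℕ
range1 n = map suc (upTo n)

τ : List Skew → ℕ → ℕ
τ ν i = foldr _⊔_ 0
  (filter (λ j → (c̃ ν j ℤ.- c̃ ν i) ℤ.≤? ℤ.+ (length ν)) (range1 (length (cells ν))))

sublists : {A : Set} → List A → List (List A)
sublists []       = [] ∷ []
sublists (x ∷ xs) = sublists xs ++ map (x ∷_) (sublists xs)

allB : {A : Set} → (A → Bool) → List A → Bool
allB p []       = true
allB p (x ∷ xs) = p x ∧ allB p xs

pairwiseClose : ℕ → List ℤ → Bool
pairwiseClose k R = allB (λ x → allB (λ y → ∣ x ℤ.- y ∣ ≤ᵇ k) R) R

diam : List Skew → ℕ
diam ν = foldr _⊔_ 0 (map length (filter (λ R → T? (pairwiseClose k R)) (sublists distinctSC)))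
  where
    open import Relation.Nullary.Decidable using () renaming (T? to T?)
    k = length ν
    distinctSC = deduplicate ℤ._≟_ (map (shiftedContent k) (cells ν))

-- Words (permutations of [n] written as lists of values)

-- position (1-indexed) of the value v in the word w (0 if absent)
pos : List ℕ → ℕ → ℕ
pos []       v = 0
pos (x ∷ xs) v = if x ℕ.≡ᵇ v then 1 else (if pos xs v ℕ.≡ᵇ 0 then 0 else suc (pos xs v))

sig : List ℕ → ℕ → Sign
sig w h = if pos w h <ᵇ pos w (suc h) then Sg.+ else Sg.-

swapV : ℕ → ℕ → ℕ → ℕ
swapV a b x = if x ℕ.≡ᵇ a then b else (if x ℕ.≡ᵇ b then a else x)

cycV : ℕ → ℕ → ℕ → ℕ → ℕ
cycV a b c x = if x ℕ.≡ᵇ a then b else (if x ℕ.≡ᵇ b then c else (if x ℕ.≡ᵇ c then a else x))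

-- d_i as a value map on w: identity if i lies positionally between
-- i−1 and i+1, otherwise interchange i with whichever of i−1, i+1
-- is not in the middle of the three positions.
dMap : ℕ → List ℕ → ℕ → ℕ
dMap i w =
  if ((pa <ᵇ pb) ∧ (pb <ᵇ pc)) ∨ ((pc <ᵇ pb) ∧ (pb <ᵇ pa)) then (λ x → x)
  else if ((pb <ᵇ pa) ∧ (pb <ᵇ pc))
    then swapV i (if (pa <ᵇ pc) then suc i else i ∸ 1)
    else swapV i (if (pa <ᵇ pc) then i ∸ 1 else suc i)
  where
    pa = pos w (i ∸ 1)
    pb = pos w i
    pc = pos w (suc i)

d : ℕ → List ℕ → List ℕ
d i w = map (dMap i w) w

-- d̃_i: fixes monotone patterns of i−1, i, i+1, otherwise (relative
-- orders, positions unchanged)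
--   (i, i−1, i+1) ↔ (i−1, i+1, i)   and   (i, i+1, i−1) ↔ (i+1, i−1, i)
d̃Map : ℕ → List ℕ → ℕ → ℕ
d̃Map i w =
  if (pb <ᵇ pa) ∧ (pa <ᵇ pc) then cycV i a c
  else if (pa <ᵇ pc) ∧ (pc <ᵇ pb) then cycV a i c
  else if (pb <ᵇ pc) ∧ (pc <ᵇ pa) then cycV a i c
  else if (pc <ᵇ pa) ∧ (pa <ᵇ pb) then cycV i a c
  else (λ x → x)
  where
    a = i ∸ 1
    c = suc i
    pa = pos w a
    pb = pos w i
    pc = pos w c

d̃ : ℕ → List ℕ → List ℕ
d̃ i w = map (d̃Map i w) w

D : (ℕ → ℕ) → ℕ → List ℕ → List ℕ
D t i w = if t mi <ᵇ Mi then d i w else d̃ i w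
  where
    pa = pos w (i ∸ 1)
    pb = pos w i
    pc = pos w (suc i)
    mi = pa ⊓ pb ⊓ pc
    Mi = pa ⊔ pb ⊔ pc

-- Signed colored graphs.  Vertices are the elements v of a carrier X
-- with Vtx v; σ(v)_h is meaningful for 1 ≤ h ≤ N−1; E i v w means
-- {v, w} ∈ E_i (a symmetric relation).

record SCGraph : Set₁ where
  field
    X   : Set
    Vtx : X → Set
    m   : ℕ
    n   : ℕ
    N   : ℕ
    σ   : X → ℕ → Sign
    E   : ℕ → X → X → Set

module _ (G : SCGraph) where
  open SCGraph G

  Admits : ℕ → X → Set
  Admits i v = σ v (i ∸ 1) ≡ opposite (σ v i)

  EdgeIn : (ℕ → Set) → X → X → Set
  EdgeIn P v w = Σ ℕ (λ c → P c × E c v w)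

  Reach : (ℕ → Set) → X → X → Set
  Reach P = Star (EdgeIn P)

Cols : ℕ → ℕ → ℕ → Set
Cols m i c = c ≡ i ⊎ c ≡ i ∸ 1 ⊎ (c ≡ i ∸ 2 × m < c)

record CompIso (G H : SCGraph) (P : ℕ → Set) (v₀ : SCGraph.X G) (u₀ : SCGraph.X H) : Set where
  private
    module G = SCGraph G
    module H = SCGraph H
  field
    f    : G.X → H.X
    g    : H.X → G.X
    f∈   : ∀ v → Reach G P v₀ v → Reach H P u₀ (f v)
    g∈   : ∀ u → Reach H P u₀ u → Reach G P v₀ (g u)
    gf   : ∀ v → Reach G P v₀ v → g (f v) ≡ v
    fg   : ∀ u → Reach H P u₀ u → f (g u) ≡ u
    edge : ∀ c v w → P c → Reach G P v₀ v → Reach G P v₀ w →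
           (G.E c v w ⇔ H.E c (f v) (f w))

-- The standard dual equivalence graphs 𝒢_λ.  A tableau is a list of
-- rows, bottom row first (French notation).

nthL : {A : Set} → List A → ℕ → List A
nthL []       _       = []
nthL (x ∷ xs) zero    = x ∷ []
nthL (x ∷ xs) (suc j) = nthL xs j

entry : List (List ℕ) → ℕ → ℕ → List ℕ
entry T r c = concatMap (λ row → nthL row c) (nthL T r)
-- (entry T r c = [a] if the cell (r,c) of T holds a, and [] otherwise)

record IsSYT (λp : List ℕ) (T : List (List ℕ)) : Set where
  field
    shape   : map length T ≡ λp
    perm    : concat T ↭ range1 (foldr _+_ 0 λp)
    rowIncr : ∀ r c c' a b → entry T r c ≡ a ∷ [] → entry T r c' ≡ b ∷ [] → c < c' → a < b
    colIncr : ∀ r r' c a b → entry T r c ≡ a ∷ [] → entry T r' c ≡ b ∷ [] → r < r' → a < b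

rowWord : List (List ℕ) → List ℕ
rowWord T = concat (reverse T)

dT : ℕ → List (List ℕ) → List (List ℕ)
dT i T = map (map (dMap i (rowWord T))) T

𝒢 : List ℕ → SCGraph
𝒢 λp = record
  { X   = List (List ℕ)
  ; Vtx = IsSYT λp
  ; m   = 1
  ; n   = nn
  ; N   = nn
  ; σ   = λ T → sig (rowWord T)
  ; E   = λ i T U → 1 < i × i < nn × IsSYT λp T × IsSYT λp U × T ≢ U ×
                    (U ≡ dT i T ⊎ T ≡ dT i U)
  }
  where nn = foldr _+_ 0 λp

IsLLTVertex : List Skew → List ℕ → Set
IsLLTVertex ν w = Σ (Cell → ℕ) (λ T → IsStandardFilling ν T × w ≡ scWord ν T)

LLT : List Skew → SCGraph
LLT ν = record
  { X   = List ℕ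
  ; Vtx = IsLLTVertex ν
  ; m   = 1
  ; n   = nn
  ; N   = nn
  ; σ   = sig
  ; E   = λ i v w → 1 < i × i < nn × IsLLTVertex ν v × IsLLTVertex ν w × v ≢ w ×
                    (w ≡ D (τ ν) i v ⊎ v ≡ D (τ ν) i w)
  }
  where nn = length (cells ν)

record IsDEG (G : SCGraph) : Set₁ where
  open SCGraph G
  field
    ax1 : ∀ i → m < i → i < n → ∀ v → Vtx v →
          (Admits G i v → Σ X (λ w → E i v w × (∀ w' → E i v w' → w' ≡ w))) ×
          (∀ w → E i v w → Admits G i v)
    ax2 : ∀ i → m < i → i < n → ∀ v w → E i v w →
          σ v i ≡ opposite (σ w i) × σ v (i ∸ 1) ≡ opposite (σ w (i ∸ 1)) ×
          (∀ h → 1 ≤ h → h < N → (h + 2 < i ⊎ i + 1 < h) → σ v h ≡ σ w h)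
    ax3 : ∀ i → m < i → i < n → ∀ v w → E i v w →
          (3 ≤ i → Admits G (i ∸ 1) v ⊎ Admits G (i ∸ 1) w) ×
          (i + 2 ≤ N → Admits G (suc i) v ⊎ Admits G (suc i) w)
    ax4 : ∀ i → suc m < i → i < n → ∀ v₀ → Vtx v₀ →
          Σ (List ℕ) (λ λp → IsPartition λp × Σ (List (List ℕ)) (λ T₀ →
            IsSYT λp T₀ × CompIso G (𝒢 λp) (Cols m i) v₀ T₀))
    ax5 : ∀ i j v w x → (i + 2 < j ⊎ j + 2 < i) → E i v w → E j w x →
          Σ X (λ y → E j v y × E i x y)
    ax6 : ∀ i → m < i → i < n → ∀ v w → Vtx v →
          Reach G (λ c → m < c × c ≤ i) v w →
          Σ X (λ a → Σ X (λ b →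
            Reach G (λ c → m < c × c < i) v a × (a ≡ b ⊎ E i a b) ×
            Reach G (λ c → m < c × c < i) b w))

{-# OPTIONS --safe #-}
module Submission where

-- A vertex is read as the word of the shifted contents of its entries 1, …, n.  On this word D_i
-- acts on three consecutive letters, by a Knuth move if the outer two of them differ by more than
-- k and by a rotation otherwise, so (Ax1), (Ax2), (Ax3) and (Ax5) are local.  If the diameter is
-- at most 3, only letters at rank distance at most two can be close, hence a window of at most six
-- letters has finitely many patterns, and local laws are verified on all of them by evaluation;
-- (Ax4) is such a law, comparing windows of five letters with tableaux of size five.  For (Ax6),
-- every word is paired with a recording tableau having the same descents along every walk.  The
-- pairing determines the word within its component, and this reduces (Ax6) to the case of standard
-- Young tableaux, where removing the largest entry gives it.
-- Conversely, four contents within k can be placed at four consecutive entries in the relative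
-- order 2143 or 3412.  Rotations then give an i-edge and an (i − 1)-edge from this vertex to
-- different ends, both admitting i, while in 𝒢_λ two such edges have the same end.

open import Defs
open import Data.Bool using (Bool; true; false; if_then_else_; not; _∧_; _∨_)
import Data.Bool
open import Data.Bool.Properties using (∧-comm; not-involutive)
open import Data.Empty
import Data.Integer as ℤ
open ℤ using (ℤ; +_)
import Data.Integer.Properties as ℤP
open import Algebra.Properties.AbelianGroup ℤP.+-0-abelianGroup using () renaming (∙-cancelʳ to +ℤ-cancelʳ)
open import Data.Integer.Solver using (module +-*-Solver)
import Data.List
open import Data.List using (List; []; _∷_; length; map; _++_; reverse; [_]; concat; concatMap; upTo; applyUpTo; foldr; cartesianProductWith)
open import Data.List.Membership.DecPropositional ℤ._≟_ using (_∈?_)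
open import Data.List.Membership.Propositional using (_∈_; _∉_; lose; find)
open import Data.List.Membership.Propositional.Properties
open import Data.List.Properties using (length-map; length-++; length-upTo; map-id; map-cong; map-∘; map-cong-local; map-injective; map-applyUpTo; map-++; ++-assoc; ++-identityʳ; ++-cancelˡ; ++-cancelʳ; concat-map; concat-++; unfold-reverse; reverse-involutive; reverse-map; ∷-injectiveˡ; ∷-injectiveʳ; ≡-dec)
import Data.List.Relation.Binary.Permutation.Setoid.Properties as ↭ₛP
open import Data.List.Relation.Binary.Permutation.Propositional using (_↭_; ↭-refl; ↭-trans; ↭-sym; prep; swap; ↭⇒↭ₛ)
open import Data.List.Relation.Binary.Permutation.Propositional.Properties using (∈-resp-↭; ↭-length; ++-comm; ++⁺ˡ) renaming (map⁺ to ↭-map⁺)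
open import Data.List.Relation.Unary.All using (All; []; _∷_)
import Data.List.Relation.Unary.All as All
import Data.List.Relation.Unary.All.Properties as AllP
open import Data.List.Relation.Unary.AllPairs using (AllPairs; []; _∷_)
import Data.List.Relation.Unary.AllPairs as AllPairs
import Data.List.Relation.Unary.AllPairs.Properties as AllPairsP
open import Data.List.Relation.Unary.Any using (Any; here; there; any?)
open import Data.List.Relation.Unary.Linked using (Linked; []; [-]; _∷_)
import Data.List.Relation.Unary.Linked
open import Data.List.Relation.Unary.Linked.Properties using (Linked⇒AllPairs)
import Data.List.Relation.Unary.Linked.Properties as LinkedP
open import Data.List.Relation.Unary.Unique.DecPropositional.Properties using (deduplicate-!)
open import Data.List.Relation.Unary.Unique.Propositional using (Unique)
import Data.List.Relation.Unary.Unique.Propositional.Properties as UniqueP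
import Data.List.Sort
open import Data.Nat
open import Data.Nat.Properties
open import Data.Product using (∃; Σ; _×_; _,_; proj₁; proj₂)
open import Data.Product.Properties using () renaming (≡-dec to ×-≡-dec)
open import Data.Sign as Sg using (Sign; opposite)
open import Data.Sum using (_⊎_; inj₁; inj₂) renaming (swap to ⊎-swap)
open import Data.Unit using (⊤; tt)
open import Function using (_∘_; case_of_; id)
open import Function.Bundles using (_⇔_; mk⇔; Equivalence)
open import Relation.Binary.Construct.Closure.ReflexiveTransitive using (Star; ε; _◅_; _◅◅_)
open import Relation.Binary.Definitions using (tri<; tri≈; tri>)
open import Relation.Binary.PropositionalEquality hiding ([_])
open import Relation.Nullary

-- `D_i` mixes exchanges and rotations, so recording tableaux are not obtained by an insertion
-- algorithm. They are built entry by entry and characterised by descents alone: a new letter `t` is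
-- compared with the last letter along all walks of the shorter word, and its cell is the addable
-- cell that cuts the corners in the same way. This makes sense only if the comparison depends on
-- nothing but the corner in which the tableau ends, hence only if closed walks of tableaux are
-- closed on words. That is a monodromy question. Words over the tableaux of one shape split into
-- classes by the last corner, and moves at depth 0 cross between classes. What is needed: a move
-- that keeps the corner keeps the class, a crossing depends only on its two corners, and two
-- crossings compose to the direct one. These are identities of walks on four, five and six letters
-- respectively, which is where the number six comes from. Equal contents may occur in such a
-- window, but only with t - k and t + k between them; the patterns have to encode this restriction.

_==_ : Bool → Bool → Bool
true  == b = b
false == b = not b

-- Words and their local moves.

module Walks {A : Set} (lt cl : A → A → Bool) where

  -- The letters of the entries i-1, i, i+1 in this order. In a non-monotone triple the middle value
  -- is `r` or `p`; the other two letters are outermost in position, and their closeness decides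
  -- between the exchange of `d` and the rotation of `d̃`.
  tri : A → A → A → A × A × A
  tri p q r =
    if lt p q == lt q r then (p , q , r)
    else if lt p q == lt p r
      then (if cl p q then (r , p , q) else (q , p , r))
      else (if cl q r then (q , r , p) else (p , r , q))

  put : A × A × A → List A → List A
  put (p , q , r) α = r ∷ q ∷ p ∷ α

  -- Words list the latest letter first. Thus the letters of the entries up to m form a tail, and
  -- the walks that leave the largest entry alone are those of positive depth. A move too deep for
  -- the word does nothing.
  mv : ℕ → List A → List A
  mv zero    (r ∷ q ∷ p ∷ α) = put (tri p q r) α
  mv zero    α               = α
  mv (suc d) []              = []
  mv (suc d) (t ∷ α)         = t ∷ mv d α

  run : List ℕ → List A → List A
  run []       α = α
  run (d ∷ ds) α = run ds (mv d α)

  asc : List A → A → Bool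
  -- A default for the letter that nothing precedes, the same for words and for chains.
  asc []      t = true
  asc (q ∷ _) t = lt q t

  sgn : ℕ → List A → Bool
  sgn i       []      = true
  sgn zero    (t ∷ α) = asc α t
  sgn (suc i) (t ∷ α) = sgn i α

  run-++ : ∀ ds es α → run (ds ++ es) α ≡ run es (run ds α)
  run-++ []       es α = refl
  run-++ (d ∷ ds) es α = run-++ ds es (mv d α)

  run-suc : ∀ ds t α → run (map suc ds) (t ∷ α) ≡ t ∷ run ds α
  run-suc []       t α = refl
  run-suc (d ∷ ds) t α = run-suc ds t (mv d α)

  run-suc-[] : ∀ ds → run (map suc ds) [] ≡ []
  run-suc-[] []       = refl
  run-suc-[] (d ∷ ds) = run-suc-[] ds

  length-mv : ∀ d α → length (mv d α) ≡ length α
  length-mv zero []              = refl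
  length-mv zero (_ ∷ [])        = refl
  length-mv zero (_ ∷ _ ∷ [])    = refl
  length-mv zero (_ ∷ _ ∷ _ ∷ α) = refl
  length-mv (suc d) []      = refl
  length-mv (suc d) (t ∷ α) = cong suc (length-mv d α)

  length-run : ∀ ds α → length (run ds α) ≡ length α
  length-run []       α = refl
  length-run (d ∷ ds) α = trans (length-run ds (mv d α)) (length-mv d α)

  suc³ : List ℕ → List ℕ
  suc³ ds = map suc (map suc (map suc ds))

  mv-comm : ∀ d α → mv 0 (mv (3 + d) α) ≡ mv (3 + d) (mv 0 α)
  mv-comm d []              = refl
  mv-comm d (_ ∷ [])        = refl
  mv-comm d (_ ∷ _ ∷ [])    = refl
  mv-comm d (_ ∷ _ ∷ _ ∷ α) = refl

  -- The move at depth 0 touches three letters, so walks at depths three and more are disjoint from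
  -- it.
  run-comm : ∀ ds α → mv 0 (run (suc³ ds) α) ≡ run (suc³ ds) (mv 0 α)
  run-comm []       α = refl
  run-comm (d ∷ ds) α = trans (run-comm ds _) (cong (run (suc³ ds)) (mv-comm d α))

  run-suc³ : ∀ ds r q p α → run (suc³ ds) (r ∷ q ∷ p ∷ α) ≡ r ∷ q ∷ p ∷ run ds α
  run-suc³ []       r q p α = refl
  run-suc³ (d ∷ ds) r q p α = run-suc³ ds r q p (mv d α)

-- Boundaries of shapes, and standard tableaux as chains of added cells.

never : ℕ → ℕ → Bool
never _ _ = false

-- With no two letters close, every move is an exchange. On the contents of the cells of a standard
-- tableau these are the elementary dual equivalences.
module C = Walks _<ᵇ_ never

upd : ℕ → (ℕ → Bool) → ℕ → Bool
upd c s j = if ⌊ j ≟ c ⌋ then true else if ⌊ j ≟ suc c ⌋ then false else s j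

-- A valley of the boundary, where a cell fits; `Cor` below is a peak, from which a cell can be
-- removed.
record Add (s : ℕ → Bool) (c : ℕ) : Set where
  constructor _,_
  field
    at   : s c ≡ false
    next : s (suc c) ≡ true

record Cor (s : ℕ → Bool) (c : ℕ) : Set where
  constructor _,_
  field
    at   : s c ≡ true
    next : s (suc c) ≡ false

-- Neither equal nor adjacent: the two changes of the boundary do not overlap, so the cells can be
-- added in either order.
Far : ℕ → ℕ → Set
Far a b = suc a < b ⊎ suc b < a

Btw : ℕ → ℕ → ℕ → Set
Btw x e y = (x < e × e < y) ⊎ (y < e × e < x)

upd-at : ∀ c s → upd c s c ≡ true
upd-at c s with c ≟ c
... | yes _ = refl
... | no n  = ⊥-elim (n refl)

upd-suc : ∀ c s → upd c s (suc c) ≡ false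
upd-suc c s with suc c ≟ c | suc c ≟ suc c
... | yes e | _ = ⊥-elim (1+n≢n e)
... | no _ | yes _ = refl
... | no _ | no n = ⊥-elim (n refl)

upd-off : ∀ c s {j} → j ≢ c → j ≢ suc c → upd c s j ≡ s j
upd-off c s {j} n n' with j ≟ c | j ≟ suc c
... | yes e | _ = ⊥-elim (n e)
... | no _ | yes e = ⊥-elim (n' e)
... | no _ | no _ = refl

upd-cong : ∀ c {s s'} → s ≗ s' → upd c s ≗ upd c s'
upd-cong c e j with j ≟ c | j ≟ suc c
... | yes _ | _ = refl
... | no _ | yes _ = refl
... | no _ | no _ = e j

upd-cancel : ∀ {c s s'} → Add s c → Add s' c → upd c s ≗ upd c s' → s ≗ s'
upd-cancel {c} {s} {s'} (a , b) (a' , b') e j with j ≟ c | j ≟ suc c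
... | yes refl | _ = trans a (sym a')
... | no _ | yes refl = trans b (sym b')
... | no n | no n' = trans (sym (upd-off c s n n')) (trans (e j) (upd-off c s' n n'))

far-sym : ∀ {a b} → Far a b → Far b a
far-sym = ⊎-swap

far-≢ : ∀ {a b} → Far a b → (a ≢ b) × (a ≢ suc b) × (suc a ≢ b)
far-≢ (inj₁ l) = (λ { refl → <-irrefl refl (<-trans (n<1+n _) l) }) ,
  (λ { refl → <-irrefl refl (<-trans (n<1+n _) (<-trans (n<1+n _) l)) }) , (λ { refl → <-irrefl refl l })
far-≢ (inj₂ l) = (λ { refl → <-irrefl refl (<-trans (n<1+n _) l) }) ,
  (λ { refl → <-irrefl refl l }) , (λ { refl → <-irrefl refl (<-trans (n<1+n _) (<-trans (n<1+n _) l)) })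

upd-far : ∀ {a b} s → Far a b → upd b s a ≡ s a × upd b s (suc a) ≡ s (suc a)
upd-far {a} {b} s f with far-≢ f
... | n₁ , n₂ , n₃ = upd-off b s n₁ n₂ , upd-off b s n₃ (n₁ ∘ suc-injective)

upd-comm : ∀ {a b} s → Far a b → upd a (upd b s) ≗ upd b (upd a s)
upd-comm {a} {b} s f j with far-≢ f | j ≟ a | j ≟ suc a | j ≟ b | j ≟ suc b
... | n₁ , n₂ , n₃ | yes refl | _ | yes e | _ = ⊥-elim (n₁ e)
... | n₁ , n₂ , n₃ | yes refl | _ | no _ | yes e = ⊥-elim (n₂ e)
... | _ | yes refl | _ | no x | no y = refl
... | n₁ , n₂ , n₃ | no x | yes refl | yes e | _ = ⊥-elim (n₃ e)
... | n₁ , n₂ , n₃ | no x | yes refl | no _ | yes e = ⊥-elim (n₁ (suc-injective e))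
... | _ | no x | yes refl | no _ | no _ = refl
... | _ | no x | no y | yes refl | _ = refl
... | _ | no x | no y | no _ | yes refl = refl
... | _ | no x | no y | no _ | no _ = refl

add-resp : ∀ {s s' c} → s ≗ s' → Add s c → Add s' c
add-resp e (a , b) = trans (sym (e _)) a , trans (sym (e _)) b

cor-resp : ∀ {s s' c} → s ≗ s' → Cor s c → Cor s' c
cor-resp e (a , b) = trans (sym (e _)) a , trans (sym (e _)) b

add⁺ : ∀ {s a b} → Far a b → Add s a → Add (upd b s) a
add⁺ {s} f (x , y) with upd-far s f
... | e , e' = trans e x , trans e' y

add⁻ : ∀ {s a b} → Far a b → Add (upd b s) a → Add s a
add⁻ {s} f (x , y) with upd-far s f
... | e , e' = trans (sym e) x , trans (sym e') y

cor⁻ : ∀ {s a b} → Far a b → Cor (upd b s) a → Cor s a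
cor⁻ {s} f (x , y) with upd-far s f
... | e , e' = trans (sym e) x , trans (sym e') y

cor⁺ : ∀ {s a b} → Far a b → Cor s a → Cor (upd b s) a
cor⁺ {s} f (x , y) with upd-far s f
... | e , e' = trans e x , trans e' y

cor-upd : ∀ c s → Cor (upd c s) c
cor-upd c s = upd-at c s , upd-suc c s

clash : ∀ {b : Bool} → b ≡ true → b ≡ false → ⊥
clash refl ()

≢-suc⇒far : ∀ {a b} → a ≢ b → suc a ≢ b → a ≢ suc b → Far a b
≢-suc⇒far {a} {b} n₁ n₂ n₃ with <-cmp a b
... | tri< l _ _ = inj₁ (≤∧≢⇒< l n₂)
... | tri≈ _ e _ = ⊥-elim (n₁ e)
... | tri> _ _ l = inj₂ (≤∧≢⇒< l (n₃ ∘ sym))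

cor-far : ∀ {s a b} → Cor s a → Cor s b → a ≢ b → Far a b
cor-far (x , y) (x' , y') n = ≢-suc⇒far n (λ { refl → clash x' y }) (λ { refl → clash x y' })

btw-far : ∀ {x e y} → Btw x e y → Far x y
btw-far (inj₁ (l , l')) = inj₁ (<-≤-trans (s≤s l) l')
btw-far (inj₂ (l , l')) = inj₂ (<-≤-trans (s≤s l) l')

btw-sym : ∀ {x e y} → Btw x e y → Btw y e x
btw-sym = ⊎-swap

scan : ∀ s d i → s i ≡ true → s (d + i) ≡ false → ∃ λ a → i ≤ a × a < d + i × Cor s a
scan s zero i t f = ⊥-elim (clash t f)
scan s (suc d) i t f with s (suc i) in eq
... | false = i , ≤-refl , s≤s (m≤n+m i d) , t , eq
... | true with scan s d (suc i) eq (trans (cong s (+-suc d i)) f)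
...   | a , l , l' , c = a , <⇒≤ l , subst (a <_) (+-suc d i) l' , c

between< : ∀ {s c c'} → Add s c → Add s c' → c < c' → ∃ λ a → c < a × a < c' × Cor s a
between< {s} {c} {c'} (x , y) (x' , y') l with scan s (c' ∸ suc c) (suc c) y (trans (cong s (m∸n+n≡m l)) x')
... | a , l₁ , l₂ , k = a , l₁ , subst (a <_) (m∸n+n≡m l) l₂ , k

-- A discrete intermediate value argument: two valleys are separated by a peak. It supplies the
-- witness cells needed to make exchanges possible.
between : ∀ {s c c'} → Add s c → Add s c' → c ≢ c' → ∃ λ a → Btw c a c' × Cor s a
between {s} {c} {c'} A A' n with <-cmp c c'
... | tri≈ _ e _ = ⊥-elim (n e)
... | tri< l _ _ = let a , l₁ , l₂ , k = between< A A' l in a , inj₁ (l₁ , l₂) , k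
... | tri> _ _ l = let a , l₁ , l₂ , k = between< A' A l in a , inj₂ (l₁ , l₂) , k

-- Two addable cells have a corner between them, so an addable cell is identified by the corners to
-- its left. This is how cells are recovered from ascents.
add-unique : ∀ {s c c'} → Add s c → Add s c' → (∀ a → Cor s a → (a <ᵇ c) ≡ (a <ᵇ c')) → c ≡ c'
add-unique {s} {c} {c'} A A' h with <-cmp c c'
... | tri≈ _ e _ = e
... | tri< l _ _ = let a , l₁ , l₂ , k = between< A A' l in
      ⊥-elim (<-asym l₁ (<ᵇ⇒< a c (subst T′ (sym (h a k)) (<⇒<ᵇ l₂))))
  where open import Data.Bool using () renaming (T to T′)
... | tri> _ _ l = let a , l₁ , l₂ , k = between< A' A l in
      ⊥-elim (<-asym l₁ (<ᵇ⇒< a c' (subst T′ (h a k) (<⇒<ᵇ l₂))))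
  where open import Data.Bool using () renaming (T to T′)

<ᵇ-true : ∀ {m n} → m < n → (m <ᵇ n) ≡ true
<ᵇ-true {m} {n} l with m <ᵇ n | <⇒<ᵇ l
... | true | _ = refl

<ᵇ-false : ∀ {m n} → n ≤ m → (m <ᵇ n) ≡ false
<ᵇ-false {m} {n} l with m <ᵇ n in eq
... | false = refl
... | true = ⊥-elim (<-irrefl refl (<-≤-trans (<ᵇ⇒< m n (subst T′ (sym eq) tt)) l))
  where open import Data.Bool using () renaming (T to T′); open import Data.Unit

<ᵇ-true⁻ : ∀ {m n} → (m <ᵇ n) ≡ true → m < n
<ᵇ-true⁻ {m} {n} e = <ᵇ⇒< m n (subst T′ (sym e) tt)
  where open import Data.Bool using () renaming (T to T′); open import Data.Unit

<ᵇ-false⁻ : ∀ {m n} → (m <ᵇ n) ≡ false → n ≤ m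
<ᵇ-false⁻ {m} {n} e = ≮⇒≥ λ l → clash (<ᵇ-true l) e

-- The chain (c_n , … , c_1) records the contents, shifted by N, of the cells
-- added along a standard Young tableau; sl T is the boundary of its shape
-- (false = down step, true = up step, in Russian convention).
module Chains (N : ℕ) where

  sl : List ℕ → ℕ → Bool
  -- The empty shape, whose only addable cell has content `N − 1`. Chains of up to `N` cells fit
  -- without leaving the natural numbers.
  sl []      j = not (j <ᵇ N)
  sl (c ∷ T) = upd c (sl T)

  data Ch : List ℕ → Set where
    []  : Ch []
    _∷_ : ∀ {c T} → Add (sl T) c → Ch T → Ch (c ∷ T)

  ch-tail : ∀ {c T} → Ch (c ∷ T) → Ch T
  ch-tail (_ ∷ h) = h

  ch-head : ∀ {c T} → Ch (c ∷ T) → Add (sl T) c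
  ch-head (a ∷ _) = a

  ch-swap : ∀ {p q V} → Far p q → Ch (q ∷ p ∷ V) → Ch (p ∷ q ∷ V) × sl (p ∷ q ∷ V) ≗ sl (q ∷ p ∷ V)
  ch-swap {V = V} f (aq ∷ ap ∷ h) = (add⁺ f ap ∷ add⁻ (far-sym f) aq ∷ h) , upd-comm (sl V) f

  ch-≢ : ∀ {p q V} → Ch (q ∷ p ∷ V) → p ≢ q
  ch-≢ {p} {V = V} ((x , _) ∷ _) refl = clash (upd-at p (sl V)) x

  -- To repeat a content, the cells at both neighbouring contents must be added in between, which
  -- takes two steps and not one.
  ch-≢₂ : ∀ {p q r V} → Ch (r ∷ q ∷ p ∷ V) → p ≢ r
  ch-≢₂ {p} {q} {.p} {V} ((x , y) ∷ h) refl = go (p ≟ q) (p ≟ suc q)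
    where
    go : Dec (p ≡ q) → Dec (p ≡ suc q) → ⊥
    go (yes e) _       = ch-≢ h e
    go (no n) (no n')  = clash (trans (upd-off q (sl (p ∷ V)) n n') (upd-at p (sl V))) x
    go (no n) (yes e)  = clash y (trans (upd-off q (sl (p ∷ V))
      (λ e' → <-irrefl (trans (sym e') (cong suc e)) (<-trans (n<1+n q) (n<1+n (suc q)))) (n ∘ suc-injective)) (upd-suc p (sl V)))

  swap-last : ∀ {p e q} → Btw p e q → C.tri e p q ≡ (e , q , p)
  swap-last (inj₁ (l , l')) rewrite <ᵇ-false (<⇒≤ l) | <ᵇ-true (<-trans l l') | <ᵇ-true l' = refl
  swap-last (inj₂ (l , l')) rewrite <ᵇ-true l' | <ᵇ-false (<⇒≤ (<-trans l l')) | <ᵇ-false (<⇒≤ l) = refl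

  swap-first : ∀ {p e q} → Btw p e q → C.tri p q e ≡ (q , p , e)
  swap-first (inj₁ (l , l')) rewrite <ᵇ-true (<-trans l l') | <ᵇ-false (<⇒≤ l') | <ᵇ-true l = refl
  swap-first (inj₂ (l , l')) rewrite <ᵇ-false (<⇒≤ (<-trans l l')) | <ᵇ-true l | <ᵇ-false (<⇒≤ l') = refl

  -- The names tell which pair the move exchanges: the first two letters in time, `p` and `q`, with
  -- `r` between them in value, or the last two, with `p` between them.
  data Shape₃ (r q p : ℕ) : Set where
    mono  : (p <ᵇ q) ≡ (q <ᵇ r) → Shape₃ r q p
    first : (q <ᵇ r) ≡ not (p <ᵇ q) → Btw p r q → Shape₃ r q p
    last  : (q <ᵇ r) ≡ not (p <ᵇ q) → Btw q p r → Shape₃ r q p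

  shape₃ : ∀ {r q p V} → Ch (r ∷ q ∷ p ∷ V) → Shape₃ r q p
  shape₃ {r} {q} {p} h with <-cmp p q | <-cmp q r | <-cmp p r
  ... | tri≈ _ e _ | _ | _ = ⊥-elim (ch-≢ (ch-tail h) e)
  ... | _ | tri≈ _ e _ | _ = ⊥-elim (ch-≢ h e)
  ... | _ | _ | tri≈ _ e _ = ⊥-elim (ch-≢₂ h e)
  ... | tri< l _ _ | tri< l' _ _ | _ = mono (trans (<ᵇ-true l) (sym (<ᵇ-true l')))
  ... | tri> _ _ l | tri> _ _ l' | _ = mono (trans (<ᵇ-false (<⇒≤ l)) (sym (<ᵇ-false (<⇒≤ l'))))
  ... | tri< l _ _ | tri> _ _ l' | tri< m _ _ = first (trans (<ᵇ-false (<⇒≤ l')) (cong not (sym (<ᵇ-true l)))) (inj₁ (m , l'))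
  ... | tri< l _ _ | tri> _ _ l' | tri> _ _ m = last (trans (<ᵇ-false (<⇒≤ l')) (cong not (sym (<ᵇ-true l)))) (inj₂ (m , l))
  ... | tri> _ _ l | tri< l' _ _ | tri< m _ _ = last (trans (<ᵇ-true l') (cong not (sym (<ᵇ-false (<⇒≤ l))))) (inj₁ (l , m))
  ... | tri> _ _ l | tri< l' _ _ | tri> _ _ m = first (trans (<ᵇ-true l') (cong not (sym (<ᵇ-false (<⇒≤ l))))) (inj₂ (l' , m))

  tri-mono : ∀ {p q r} → (p <ᵇ q) ≡ (q <ᵇ r) → C.tri p q r ≡ (p , q , r)
  tri-mono {p} {q} {r} e with p <ᵇ q | q <ᵇ r
  ... | true | true = refl
  ... | false | false = refl

  Ok : List ℕ → List ℕ → Set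
  Ok T U = Ch U × sl U ≗ sl T

  -- The exchanged contents have a third one strictly between them, so they are far and their cells
  -- can be added in the other order.
  ch-mv : ∀ d {T} → Ch T → Ok T (C.mv d T)
  ch-mv zero [] = [] , λ _ → refl
  ch-mv zero (a ∷ []) = (a ∷ []) , λ _ → refl
  ch-mv zero (a ∷ b ∷ []) = (a ∷ b ∷ []) , λ _ → refl
  ch-mv zero {r ∷ q ∷ p ∷ V} h@(a ∷ h'@(b ∷ c ∷ k)) with shape₃ h
  ... | mono e rewrite tri-mono {p} {q} {r} e = h , λ _ → refl
  ... | first _ bt rewrite swap-first bt =
        let k₁ , e₁ = ch-swap (btw-far bt) h' in (add-resp (λ j → sym (e₁ j)) a ∷ k₁) , upd-cong r e₁
  ... | last _ bt rewrite swap-last bt = ch-swap (btw-far bt) h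
  ch-mv (suc d) [] = [] , λ _ → refl
  ch-mv (suc d) {c ∷ T} (a ∷ h) with ch-mv d h
  ... | k , e = (add-resp (λ j → sym (e j)) a ∷ k) , upd-cong c e

  ch-run : ∀ ds {T} → Ch T → Ok T (C.run ds T)
  ch-run []       h = h , λ _ → refl
  ch-run (d ∷ ds) h = let k , e = ch-mv d h ; k' , e' = ch-run ds k in k' , λ j → trans (e' j) (e j)

  mv-inv : ∀ d {T} → Ch T → C.mv d (C.mv d T) ≡ T
  mv-inv zero [] = refl
  mv-inv zero (a ∷ []) = refl
  mv-inv zero (a ∷ b ∷ []) = refl
  mv-inv zero {r ∷ q ∷ p ∷ V} h@(_ ∷ _ ∷ _ ∷ _) with shape₃ h
  ... | mono e rewrite tri-mono {p} {q} {r} e | tri-mono {p} {q} {r} e = refl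
  ... | first _ bt rewrite swap-first bt | swap-first (btw-sym bt) = refl
  ... | last _ bt rewrite swap-last bt | swap-last (btw-sym bt) = refl
  mv-inv (suc d) [] = refl
  mv-inv (suc d) (a ∷ h) = cong (_ ∷_) (mv-inv d h)

  private
    base-cor : ∀ a → ¬ Cor (sl []) a
    base-cor a (x , y) with a <ᵇ N in e | suc a <ᵇ N in e'
    base-cor a (() , y) | true | _
    base-cor a (x , ()) | false | false
    base-cor a (x , y) | false | true =
      <-irrefl refl (<-≤-trans (<-trans (n<1+n a) (<ᵇ-true⁻ {suc a} {N} e')) (<ᵇ-false⁻ {a} {N} e))

  Rem : List ℕ → ℕ → Set
  Rem T a = ∃ λ T' → Ch (a ∷ T') × length T ≡ suc (length T') × sl (a ∷ T') ≗ sl T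

  -- If `a` is not the last cell `b`, both are corners of the same shape and therefore far; the cell
  -- `a` is made last below `b` by induction and then swapped past it.
  remove : ∀ {T a} → Ch T → Cor (sl T) a → Rem T a
  remove {[]} {a} h k = ⊥-elim (base-cor a k)
  remove {b ∷ T} {a} (x ∷ h) k with a ≟ b
  ... | yes refl = T , (x ∷ h) , refl , λ _ → refl
  ... | no n with cor-far k (cor-upd b (sl T)) n
  ... | f with remove h (cor⁻ f k)
  ... | T' , (y ∷ h') , l , e =
        let x' = add-resp (λ j → sym (e j)) x
            k , e' = ch-swap f (x' ∷ y ∷ h')
        in b ∷ T' , k , cong suc l , λ j → trans (e' j) (upd-cong b e j)

  cor-of : ∀ {c T T'} → sl (c ∷ T) ≗ sl T' → Cor (sl T') c
  cor-of {c} {T} e = cor-resp e (cor-upd c (sl T))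

  -- Connectedness by at most one move at depth 0, which is (Ax6) for chains. The crossing case
  -- exposes the three cells involved, since the exchange has to be evaluated on them.
  data Conn (T U : List ℕ) : Set where
    within : ∀ ds → C.run (map suc ds) T ≡ U → Conn T U
    cross : ∀ ds {b a e V} es → C.run (map suc ds) T ≡ b ∷ a ∷ e ∷ V → Btw b e a →
            C.run (map suc es) (a ∷ b ∷ e ∷ V) ≡ U → Conn T U

  conn-walk : ∀ {T U} → Conn T U → ∃ λ ds → C.run ds T ≡ U
  conn-walk (within ds e) = map suc ds , e
  conn-walk {T} {U} (cross ds {b} {a} {e} {V} es q bt q') = map suc ds ++ 0 ∷ map suc es ,
    trans (C.run-++ (map suc ds) (0 ∷ map suc es) T)
      (trans (cong (C.run (map suc es)) (trans (cong (C.mv 0) q) (cong (λ t → C.put t V) (swap-last (btw-sym bt))))) q')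

  -- If the last cells `b` and `a` differ, remove both; a corner `c` lies between them in what
  -- remains. The chains ending in c, a, b and in c, b, a differ by one exchange, and induction
  -- below the last cell leads from `T` to the former and from the latter to `U`.
  conn : ∀ m {T U} → length T ≡ m → length U ≡ m → Ch T → Ch U → sl T ≗ sl U → Conn T U
  conn zero {[]} {[]} _ _ _ _ _ = within [] refl
  conn (suc m) {b ∷ T} {a ∷ U} l l' (x ∷ h) (y ∷ k) e with a ≟ b
  ... | yes refl = let ds , q = conn-walk (conn m (suc-injective l) (suc-injective l') h k (upd-cancel x y e)) in
        within ds (trans (C.run-suc ds b T) (cong (b ∷_) q))
  ... | no n with cor-far (cor-of {a} {U} {b ∷ T} (λ j → sym (e j))) (cor-upd b (sl T)) n
  ... | f with remove h (cor⁻ f (cor-of {a} {U} {b ∷ T} (λ j → sym (e j))))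
  ... | T₁ , h₁@(z ∷ h₁') , l₁ , e₁ with between (add⁻ (far-sym f) (add-resp (λ j → sym (e₁ j)) x)) z (n ∘ sym)
  ... | c , bt , kc with remove h₁' kc
  ... | V , hV@(_ ∷ _) , l₂ , e₂ =
    let lT = suc-injective l
        e₃ : sl (a ∷ c ∷ V) ≗ sl T
        e₃ j = trans (upd-cong a e₂ j) (e₁ j)
        hac = add-resp (λ j → sym (e₂ j)) z ∷ hV
        hb = add-resp (λ j → sym (e₃ j)) x ∷ hac
        hab , e₄ = ch-swap f hb
        lac : length (a ∷ c ∷ V) ≡ m
        lac = trans (cong suc (sym l₂)) (trans (sym l₁) lT)
        ds , q = conn-walk (conn m lT lac h hac (λ j → sym (e₃ j)))
        es , q' = conn-walk (conn m {b ∷ c ∷ V} {U} lac (suc-injective l') (ch-tail hab) k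
                    (upd-cancel (ch-head hab) y (λ j → trans (e₄ j) (trans (upd-cong b e₃ j) (e j)))))
    in cross ds {b} {a} {c} {V} es (trans (C.run-suc ds b T) (cong (b ∷_) q)) bt
         (trans (C.run-suc es a _) (cong (a ∷_) q'))

-- Laws of words of at most six letters.  The argument o selects one of the
-- two mutually complementary forms of a law.
record System : Set₁ where
  field
    A     : Set
    lt cl : A → A → Bool
    Good  : List A → Set
  open Walks lt cl public
  field
    good-mv   : ∀ d {u} → Good u → Good (mv d u)
    good-tail : ∀ {t u} → Good (t ∷ u) → Good u
    invol     : ∀ d {u} → Good u → mv d (mv d u) ≡ u
    flip-sgn  : ∀ {u} → Good u → 3 ≤ length u → sgn 0 u ≡ not (sgn 1 u) →
                sgn 0 (mv 0 u) ≡ sgn 1 u × sgn 1 (mv 0 u) ≡ sgn 0 u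
    -- For a new letter above two corners: a descent over the left corner forces a descent over the
    -- right one.
    mon : ∀ {u} → Good u → 4 ≤ length u → sgn 0 u ≡ false → sgn 1 u ≡ false → sgn 2 u ≡ true →
          sgn 0 (mv 1 u) ≡ false
    -- The source of double edges: two neighbouring colours lead to the same word.
    k4d : ∀ o {u} → Good u → 4 ≤ length u → sgn 0 u ≡ o → sgn 1 u ≡ not o → sgn 2 u ≡ o →
          sgn 0 (mv 1 u) ≡ not o → mv 0 u ≡ mv 1 u
    k4n : ∀ {u} → Good u → 4 ≤ length u → sgn 0 u ≡ true → sgn 1 u ≡ false → sgn 2 u ≡ true →
          sgn 0 (mv 1 u) ≡ true → sgn 2 (mv 0 u) ≡ true
    k4m : ∀ o {u} → Good u → 4 ≤ length u → sgn 0 u ≡ o → sgn 1 u ≡ not o → sgn 2 u ≡ not o →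
          sgn 2 (mv 0 u) ≡ not o
    k4q : ∀ {u} → Good u → 4 ≤ length u → sgn 0 u ≡ false → sgn 1 u ≡ true → sgn 2 u ≡ false →
          sgn 2 (mv 0 u) ≡ false → sgn 0 (mv 1 u) ≡ false
    -- The counterpart of `k4m` for (Ax3): there the neighbouring colour is the smaller one, here
    -- the larger one.
    k4a : ∀ o {u} → Good u → 4 ≤ length u → sgn 0 u ≡ o → sgn 1 u ≡ o → sgn 2 u ≡ not o →
          sgn 0 (mv 1 u) ≡ o
    k5e : ∀ o {u} → Good u → 5 ≤ length u → sgn 0 u ≡ o → sgn 1 u ≡ not o → sgn 2 u ≡ o →
          sgn 3 u ≡ not o → sgn 0 (mv 1 u) ≡ o →
          sgn 1 (mv 2 u) ≡ sgn 0 (run (0 ∷ 2 ∷ 1 ∷ []) u)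
    -- Depths 0 and 2 share one letter, so commutation is not automatic; it holds under these signs.
    k5l : ∀ o {u} → Good u → 5 ≤ length u → sgn 0 u ≡ o → sgn 1 u ≡ not o → sgn 2 u ≡ not o →
          sgn 3 u ≡ o → sgn 0 (run (2 ∷ 1 ∷ []) u) ≡ o →
          run (2 ∷ 0 ∷ []) u ≡ run (0 ∷ 2 ∷ []) u
    -- In this law and the next the two walks go from one corner to another, directly and through a
    -- third corner. On suitable chains both end in the same chain; the law asserts the same for
    -- words.
    k6a : ∀ o {u} → Good u → 6 ≤ length u → sgn 0 u ≡ o → sgn 1 u ≡ not o → sgn 2 u ≡ o →
          sgn 3 u ≡ not o → sgn 4 u ≡ o → sgn 2 (mv 3 u) ≡ not o →
          run (1 ∷ 3 ∷ 2 ∷ 0 ∷ []) u ≡ run (0 ∷ 3 ∷ 1 ∷ 3 ∷ 2 ∷ 0 ∷ 2 ∷ 1 ∷ 3 ∷ 2 ∷ []) u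
    k6b : ∀ o {u} → Good u → 6 ≤ length u → sgn 0 u ≡ o → sgn 1 u ≡ not o → sgn 2 u ≡ not o →
          sgn 3 u ≡ o → sgn 4 u ≡ o →
          run (2 ∷ 1 ∷ 3 ∷ 2 ∷ 0 ∷ []) u ≡ run (0 ∷ 2 ∷ 3 ∷ 1 ∷ 0 ∷ 3 ∷ 1 ∷ 3 ∷ 2 ∷ []) u

  good-run : ∀ ds {u} → Good u → Good (run ds u)
  good-run []       g = g
  good-run (d ∷ ds) g = good-run ds (good-mv d g)

  run-rev : ∀ ds {u} → Good u → run (reverse ds) (run ds u) ≡ u
  run-rev []       g = refl
  run-rev (d ∷ ds) {u} g = begin
    run (reverse (d ∷ ds)) (run ds (mv d u))     ≡⟨ cong (λ es → run es (run ds (mv d u))) (unfold-reverse d ds) ⟩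
    run (reverse ds ++ [ d ]) (run ds (mv d u))  ≡⟨ run-++ (reverse ds) [ d ] _ ⟩
    mv d (run (reverse ds) (run ds (mv d u)))    ≡⟨ cong (mv d) (run-rev ds (good-mv d g)) ⟩
    mv d (mv d u)                                ≡⟨ invol d g ⟩
    u ∎
    where open ≡-Reasoning

  run-rev′ : ∀ ds {u} → Good u → run ds (run (reverse ds) u) ≡ u
  run-rev′ ds {u} g = trans (cong (λ es → run es (run (reverse ds) u)) (sym (reverse-involutive ds)))
                            (run-rev (reverse ds) g)

  mv-mono : ∀ {u} → sgn 0 u ≡ sgn 1 u → mv 0 u ≡ u
  mv-mono {[]} e = refl
  mv-mono {_ ∷ []} e = refl
  mv-mono {_ ∷ _ ∷ []} e = refl
  mv-mono {r ∷ q ∷ p ∷ α} e rewrite e with lt p q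
  ... | true = refl
  ... | false = refl

-- Words over chains: classes with a fixed last letter, and crossings between them.

module Core (S : System) (N : ℕ) where
  open System S
  open Chains N

  c-rev : ∀ ds {T} → Ch T → C.run (reverse ds) (C.run ds T) ≡ T
  c-rev []       h = refl
  c-rev (d ∷ ds) {T} h = begin
    C.run (reverse (d ∷ ds)) (C.run ds (C.mv d T))    ≡⟨ cong (λ es → C.run es (C.run ds (C.mv d T))) (unfold-reverse d ds) ⟩
    C.run (reverse ds ++ [ d ]) (C.run ds (C.mv d T)) ≡⟨ C.run-++ (reverse ds) [ d ] _ ⟩
    C.mv d (C.run (reverse ds) (C.run ds (C.mv d T))) ≡⟨ cong (C.mv d) (c-rev ds (proj₁ (ch-mv d h))) ⟩
    C.mv d (C.mv d T)                                 ≡⟨ mv-inv d h ⟩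
    T ∎
    where open ≡-Reasoning

  -- A word together with a chain having the same ascents along every walk;
  -- the chain is the recording tableau of the word.
  record OK (α : List A) (T : List ℕ) : Set where
    constructor ok
    field
      good : Good α
      ch   : Ch T
      len  : length α ≡ length T
      same : ∀ ds i → sgn i (run ds α) ≡ C.sgn i (C.run ds T)
  open OK

  ok-mv : ∀ d {α T} → OK α T → OK (mv d α) (C.mv d T)
  ok-mv d {α} {T} (ok g h l s) = ok (good-mv d g) (proj₁ (ch-mv d h))
    (trans (length-mv d α) (trans l (sym (C.length-mv d T)))) (s ∘ (d ∷_))

  ok-run : ∀ ds {α T} → OK α T → OK (run ds α) (C.run ds T)
  ok-run []       o = o
  ok-run (d ∷ ds) o = ok-run ds (ok-mv d o)

  ok-tail : ∀ {t α c T} → OK (t ∷ α) (c ∷ T) → OK α T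
  ok-tail {t} {α} {c} {T} (ok g h l s) = ok (good-tail g) (ch-tail h) (suc-injective l) λ ds i →
    trans (sym (cong (sgn (suc i)) (run-suc ds t α)))
          (trans (s (map suc ds) (suc i)) (cong (C.sgn (suc i)) (C.run-suc ds c T)))

  St : Set
  St = List A × List ℕ

  OKˢ : St → Set
  OKˢ (u , T) = OK u T

  step : ℕ → St → St
  step d (u , T) = mv d u , C.mv d T

  steps : List ℕ → St → St
  steps ds (u , T) = run ds u , C.run ds T

  steps-++ : ∀ ds es s → steps (ds ++ es) s ≡ steps es (steps ds s)
  steps-++ ds es (u , T) = cong₂ _,_ (run-++ ds es u) (C.run-++ ds es T)

  steps-rev : ∀ ds {s} → OKˢ s → steps (reverse ds) (steps ds s) ≡ s
  steps-rev ds o = cong₂ _,_ (run-rev ds (good o)) (c-rev ds (ch o))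

  -- `Sub` keeps the last letter and the last cell, so its classes are the components for the
  -- smaller colours. `Sub³` keeps the last three and hence commutes with the move at depth 0.
  Sub Sub³ : St → St → Set
  Sub  s s′ = ∃ λ ds → steps (map suc ds) s ≡ s′
  Sub³ s s′ = ∃ λ ds → steps (suc³ ds) s ≡ s′

  sub-refl : ∀ {s} → Sub s s
  sub-refl = [] , refl

  sub-trans : ∀ {s s′ s″} → Sub s s′ → Sub s′ s″ → Sub s s″
  sub-trans {s} (ds , refl) (es , refl) = ds ++ es ,
    trans (cong (λ xs → steps xs s) (map-++ suc ds es)) (steps-++ (map suc ds) (map suc es) s)

  map-reverse : ∀ (ds : List ℕ) → map suc (reverse ds) ≡ reverse (map suc ds)
  map-reverse ds = reverse-map suc ds

  sub-sym : ∀ {s s′} → OKˢ s → Sub s s′ → Sub s′ s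
  sub-sym {s} o (ds , refl) = reverse ds ,
    trans (cong (λ xs → steps xs (steps (map suc ds) s)) (map-reverse ds)) (steps-rev (map suc ds) o)

  sub³⇒sub : ∀ {s s′} → Sub³ s s′ → Sub s s′
  sub³⇒sub (ds , e) = map suc (map suc ds) , e

  sub³-step : ∀ {s s′} → Sub³ s s′ → Sub³ (step 0 s) (step 0 s′)
  sub³-step {u , T} (ds , refl) = ds , sym (cong₂ _,_ (run-comm ds u) (C.run-comm ds T))

  sub-ok : ∀ {s s′} → OKˢ s → Sub s s′ → OKˢ s′
  sub-ok o (ds , refl) = ok-run (map suc ds) o

  sub-sl : ∀ {s s′} → OKˢ s → Sub s s′ → sl (proj₂ s′) ≗ sl (proj₂ s)
  sub-sl o (ds , refl) = proj₂ (ch-run (map suc ds) (ch o))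

  length-crun : ∀ {s s′} → Sub s s′ → length (proj₂ s′) ≡ length (proj₂ s)
  length-crun {u , T} (ds , refl) = C.length-run (map suc ds) T

  sub-heads : ∀ {s w w′ b b′ X X′} → 1 ≤ length (proj₂ s) → Sub s (w , b ∷ X) → Sub s (w′ , b′ ∷ X′) → b ≡ b′
  sub-heads {u , c ∷ T} l (ds , q) (es , q′) =
    trans (hd (trans (sym (cong proj₂ q)) (C.run-suc ds c T))) (sym (hd (trans (sym (cong proj₂ q′)) (C.run-suc es c T))))
    where
    hd : ∀ {x y : ℕ} {X Y : List ℕ} → x ∷ X ≡ y ∷ Y → x ≡ y
    hd refl = refl

  mvL : ∀ {p e q V} → Btw p e q → C.mv 0 (q ∷ p ∷ e ∷ V) ≡ p ∷ q ∷ e ∷ V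
  mvL {V = V} bt = cong (λ t → C.put t V) (swap-last bt)

  mvF : ∀ {p e q V} → Btw p e q → C.mv 0 (e ∷ q ∷ p ∷ V) ≡ e ∷ p ∷ q ∷ V
  mvF {V = V} bt = cong (λ t → C.put t V) (swap-first bt)

  -- Connectedness of the chains of one shape, applied below three fixed cells; the word is carried
  -- along by the same walk.
  retail : ∀ {u r q p V V′} → OK u (r ∷ q ∷ p ∷ V) → Ch V′ → sl V′ ≗ sl V → length V′ ≡ length V →
           ∃ λ u′ → Sub³ (u , r ∷ q ∷ p ∷ V) (u′ , r ∷ q ∷ p ∷ V′)
  retail {u} {r} {q} {p} {V} o h e l with conn-walk (conn (length V) refl l (ch-tail (ch-tail (ch-tail (ch o)))) h (λ j → sym (e j)))
  ... | ds , eq = run (suc³ ds) u , ds , cong (_ ,_) (trans (C.run-suc³ ds r q p V) (cong (λ W → r ∷ q ∷ p ∷ W) eq))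

  relocate : ∀ {u b T T′} → OK u (b ∷ T) → Ch T′ → sl T′ ≗ sl T → length T′ ≡ length T →
             ∃ λ u′ → Sub (u , b ∷ T) (u′ , b ∷ T′)
  relocate {u} {b} {T} o h e l with conn-walk (conn (length T) refl l (ch-tail (ch o)) h (λ j → sym (e j)))
  ... | ds , eq = run (map suc ds) u , ds , cong (_ ,_) (trans (C.run-suc ds b T) (cong (b ∷_) eq))

  sl-cancel : ∀ {c T T′} → Ch (c ∷ T) → Ch (c ∷ T′) → sl (c ∷ T) ≗ sl (c ∷ T′) → sl T ≗ sl T′
  sl-cancel h h′ = upd-cancel (ch-head h) (ch-head h′)

  -- Trivial monodromy: a walk that closes on the chain closes on the word.
  Inj : ℕ → Set
  Inj n = ∀ {α T} → length α ≡ n → OK α T → ∀ ds → C.run ds T ≡ T → run ds α ≡ α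

  inj-eq : ∀ {n} → Inj n → ∀ {α T} → length α ≡ n → OK α T → ∀ ds es → C.run ds T ≡ C.run es T → run ds α ≡ run es α
  inj-eq inj {α} {T} l o ds es e = begin
    run ds α                                   ≡⟨ sym (run-rev′ es (good-run ds (good o))) ⟩
    run es (run (reverse es) (run ds α))       ≡⟨ cong (run es) (sym (run-++ ds (reverse es) α)) ⟩
    run es (run (ds ++ reverse es) α)          ≡⟨ cong (run es) (inj l o (ds ++ reverse es) loop) ⟩
    run es α ∎
    where
    open ≡-Reasoning
    loop : C.run (ds ++ reverse es) T ≡ T
    loop = trans (C.run-++ ds (reverse es) T) (trans (cong (C.run (reverse es)) e) (c-rev es (ch o)))

  module Lift {n} (inj : Inj n) where

    -- Such walks act below a fixed last letter, where `inj` for the shorter length applies.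
    sub-unique : ∀ {s s₁ s₂} → length (proj₁ s) ≡ suc n → OKˢ s → Sub s s₁ → Sub s s₂ → proj₂ s₁ ≡ proj₂ s₂ → s₁ ≡ s₂
    sub-unique {t ∷ α , c ∷ T} l o (ds , refl) (es , refl) e = cong₂ _,_ w e
      where
      w : run (map suc ds) (t ∷ α) ≡ run (map suc es) (t ∷ α)
      w = trans (run-suc ds t α) (trans (cong (t ∷_) (inj-eq inj (suc-injective l) (ok-tail o) ds es
            (tail-eq (trans (sym (C.run-suc ds c T)) (trans e (C.run-suc es c T)))))) (sym (run-suc es t α)))
        where
        tail-eq : ∀ {c : ℕ} {X Y : List ℕ} → c ∷ X ≡ c ∷ Y → X ≡ Y
        tail-eq refl = refl
    sub-unique {t ∷ α , []} l o _ _ _ with () ← len o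

    -- A point of the class of `s` at which the move at depth 0 replaces the last cell `b` by `a`.
    -- The cell `e` between them in content is what makes this exchange take place.
    record Cr (s : St) (a : ℕ) (x : St) : Set where
      constructor cr
      field
        {b e} : ℕ
        {V}   : List ℕ
        sub   : Sub s x
        form  : proj₂ x ≡ b ∷ a ∷ e ∷ V
        btw   : Btw b e a

    module _ {s : St} (l : length (proj₁ s) ≡ suc n) (o : OKˢ s) where

      -- With the same witness `e` the two chains differ only below three cells. Moves at depths
      -- three and more bring one to the other, and they commute with the crossing.
      cross-same : ∀ {w w′ b a e V V′} → Sub s (w , b ∷ a ∷ e ∷ V) → Sub s (w′ , b ∷ a ∷ e ∷ V′) →
                   Sub (step 0 (w , b ∷ a ∷ e ∷ V)) (step 0 (w′ , b ∷ a ∷ e ∷ V′))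
      cross-same {w} {w′} {b} {a} {e} {V} {V′} p p′ with sub-ok o p | sub-ok o p′
      ... | k | k′ with retail {V′ = V′} k (ch-tail (ch-tail (ch-tail (ch k′))))
                 (λ j → sym (sl-cancel (ch-tail (ch-tail (ch k))) (ch-tail (ch-tail (ch k′)))
                   (sl-cancel (ch-tail (ch k)) (ch-tail (ch k′)) (sl-cancel (ch k) (ch k′)
                     (λ j → trans (sub-sl o p j) (sym (sub-sl o p′ j))))) j))
                 (suc-injective (suc-injective (suc-injective (trans (length-crun p′) (sym (length-crun p))))))
      ... | u′ , z with sub-unique l o (sub-trans p (sub³⇒sub z)) p′ refl
      ... | refl = sub³⇒sub (sub³-step z)

      Closer : ℕ → ℕ → ℕ → ℕ → Set
      Closer b e′ e a = (b < e′ × e′ < e × e < a) ⊎ (a < e × e < e′ × e′ < b)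

      -- Both witnesses are corners below `b` and `a`. Put them on top there, with a cell `g`
      -- between them in content underneath; then depth 2 exchanges the witnesses, and `k5l` makes
      -- this commute with the crossing.
      cross-closer : ∀ {w w′ b a e e′ V V′} → Sub s (w , b ∷ a ∷ e ∷ V) → Sub s (w′ , b ∷ a ∷ e′ ∷ V′) →
                     Closer b e′ e a →
                     Sub (step 0 (w , b ∷ a ∷ e ∷ V)) (step 0 (w′ , b ∷ a ∷ e′ ∷ V′))
      cross-closer {w} {w′} {b} {a} {e} {e′} {V} {V′} p p′ cls
        with sub-ok o p | sub-ok o p′
      ... | k | k′ with sl-cancel (ch-tail (ch k)) (ch-tail (ch k′)) (sl-cancel (ch k) (ch k′)
                     (λ j → trans (sub-sl o p j) (sym (sub-sl o p′ j))))
      ... | eqs with cor-far (cor-of {e′} {V′} {e ∷ V} (λ j → sym (eqs j))) (cor-upd e (sl V)) (λ { refl → e≢ cls })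
        where
        e≢ : Closer b e e a → ⊥
        e≢ (inj₁ (_ , x , _)) = <-irrefl refl x
        e≢ (inj₂ (_ , x , _)) = <-irrefl refl x
      ... | f with remove (ch-tail (ch-tail (ch-tail (ch k)))) (cor⁻ f (cor-of {e′} {V′} {e ∷ V} (λ j → sym (eqs j))))
      ... | V₁ , h₁@(x₁ ∷ h₁′) , l₁ , s₁
        with between (add⁻ (far-sym f) (add-resp (λ j → sym (s₁ j)) (ch-head (ch-tail (ch-tail (ch k)))))) x₁ (proj₁ (far-≢ (far-sym f)))
      ... | g , bt , kg with remove h₁′ kg
      ... | V₂ , h₂ , l₂ , s₂ with retail {V′ = e′ ∷ g ∷ V₂} k (add-resp (λ j → sym (s₂ j)) x₁ ∷ h₂)
               (λ j → trans (upd-cong e′ s₂ j) (s₁ j)) (sym (trans l₁ (cong suc l₂)))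
      -- In `Sub` the walk `1 ∷ []` is the move at depth 2. Crossing and then exchanging the
      -- witnesses ends, by `comm`, where exchanging them and crossing over `e′` does.
      ... | w₂ , z = sub-trans (sub³⇒sub (sub³-step z)) (sub-trans (subst (Sub (step 0 Z)) (sym comm) (1 ∷ [] , refl))
                       (cross-same (subst (Sub s) zeq (sub-trans (sub-trans p (sub³⇒sub z)) (1 ∷ [] , refl))) p′))
        where
        Zc = b ∷ a ∷ e ∷ e′ ∷ g ∷ V₂
        Z : St
        Z = w₂ , Zc
        kz : OK w₂ Zc
        kz = sub-ok o (sub-trans p (sub³⇒sub z))
        e₂ : C.mv 2 Zc ≡ b ∷ a ∷ e′ ∷ e ∷ g ∷ V₂
        e₂ = cong (λ W → b ∷ a ∷ W) (mvL (btw-sym bt))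
        zeq : step 2 Z ≡ (mv 2 w₂ , b ∷ a ∷ e′ ∷ e ∷ g ∷ V₂)
        zeq = cong (mv 2 w₂ ,_) e₂
        bt₃ : Btw e′ e a
        bt₃ = case cls of λ { (inj₁ (_ , x , y)) → inj₁ (x , y) ; (inj₂ (x , y , _)) → inj₂ (x , y) }
        bea : Btw b e a
        bea = case cls of λ { (inj₁ (x , y , v)) → inj₁ (<-trans x y , v) ; (inj₂ (x , y , v)) → inj₂ (x , <-trans y v) }
        be′a : Btw b e′ a
        be′a = case cls of λ { (inj₁ (x , y , v)) → inj₁ (x , <-trans y v) ; (inj₂ (x , y , v)) → inj₂ (<-trans x y , v) }
        e₂₁ : C.run (2 ∷ 1 ∷ []) Zc ≡ b ∷ e′ ∷ a ∷ e ∷ g ∷ V₂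
        e₂₁ = trans (cong (C.mv 1) e₂) (cong (b ∷_) (cong (λ t → C.put t (g ∷ V₂)) (swap-last (bt₃))))
        len5 : 5 ≤ length w₂
        len5 = subst (5 ≤_) (sym (len kz)) (s≤s (s≤s (s≤s (s≤s (s≤s z≤n)))))
        law : ∀ o → (a <ᵇ b) ≡ o → (e <ᵇ a) ≡ not o → (e′ <ᵇ e) ≡ not o → (g <ᵇ e′) ≡ o → (e′ <ᵇ b) ≡ o →
              run (2 ∷ 0 ∷ []) w₂ ≡ run (0 ∷ 2 ∷ []) w₂
        law o p₀ p₁ p₂ p₃ p₄ = k5l o (good kz) len5 (trans (same kz [] 0) p₀) (trans (same kz [] 1) p₁)
          (trans (same kz [] 2) p₂) (trans (same kz [] 3) p₃) (trans (same kz (2 ∷ 1 ∷ []) 0) (trans (cong (C.sgn 0) e₂₁) p₄))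
        gs : (g <ᵇ e′) ≡ (e <ᵇ e′)
        gs = case bt of λ { (inj₁ (x , y)) → trans (<ᵇ-true y) (sym (<ᵇ-true (<-trans x y)))
                          ; (inj₂ (x , y)) → trans (<ᵇ-false (<⇒≤ x)) (sym (<ᵇ-false (<⇒≤ (<-trans x y)))) }
        wcomm : run (2 ∷ 0 ∷ []) w₂ ≡ run (0 ∷ 2 ∷ []) w₂
        wcomm = case cls of λ
          { (inj₁ (x , y , v)) → law false (<ᵇ-false (<⇒≤ (<-trans x (<-trans y v)))) (<ᵇ-true v) (<ᵇ-true y)
              (trans gs (<ᵇ-false (<⇒≤ y))) (<ᵇ-false (<⇒≤ x))
          ; (inj₂ (x , y , v)) → law true (<ᵇ-true (<-trans x (<-trans y v))) (<ᵇ-false (<⇒≤ x)) (<ᵇ-false (<⇒≤ y))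
              (trans gs (<ᵇ-true y)) (<ᵇ-true v) }
        comm : step 0 (mv 2 w₂ , b ∷ a ∷ e′ ∷ e ∷ g ∷ V₂) ≡ step 2 (step 0 Z)
        comm = cong₂ _,_ wcomm
          (trans (mvL {V = e ∷ g ∷ V₂} (btw-sym be′a)) (sym (trans (cong (C.mv 2) (mvL {V = e′ ∷ g ∷ V₂} (btw-sym bea)))
            (cong (λ W → a ∷ b ∷ W) (mvL {V = V₂} (btw-sym bt))))))

      closer : ∀ {b e e′ a} → Btw b e a → Btw b e′ a → e ≢ e′ → Closer b e′ e a ⊎ Closer b e e′ a
      closer {b} {e} {e′} {a} x y n with <-cmp e e′ | x | y
      ... | tri≈ _ q _ | _ | _ = ⊥-elim (n q)
      ... | tri< q _ _ | inj₁ (x₁ , x₂) | inj₁ (y₁ , y₂) = inj₂ (inj₁ (x₁ , q , y₂))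
      ... | tri< q _ _ | inj₂ (x₁ , x₂) | inj₂ (y₁ , y₂) = inj₁ (inj₂ (x₁ , q , y₂))
      ... | tri> _ _ q | inj₁ (x₁ , x₂) | inj₁ (y₁ , y₂) = inj₁ (inj₁ (y₁ , q , x₂))
      ... | tri> _ _ q | inj₂ (x₁ , x₂) | inj₂ (y₁ , y₂) = inj₂ (inj₂ (y₁ , q , x₂))
      ... | _ | inj₁ (x₁ , x₂) | inj₂ (y₁ , y₂) = ⊥-elim (<-asym (<-trans x₁ x₂) (<-trans y₁ y₂))
      ... | _ | inj₂ (x₁ , x₂) | inj₁ (y₁ , y₂) = ⊥-elim (<-asym (<-trans x₁ x₂) (<-trans y₁ y₂))

      -- Two witnesses coincide or one is closer to `b`, so the class reached depends on the corner
      -- `a` alone.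
      cross-unique : ∀ {a x x′} → Cr s a x → Cr s a x′ → Sub (step 0 x) (step 0 x′)
      cross-unique {a} {w , _} {w′ , _} (cr {b} {e} {V} p refl bt) (cr {b′} {e′} {V′} p′ refl bt′)
        with sub-heads (subst (1 ≤_) (trans (sym l) (len o)) (s≤s z≤n)) p p′
      ... | refl with e ≟ e′
      ... | yes refl = cross-same p p′
      ... | no n with closer bt bt′ n
      ... | inj₁ c = cross-closer p p′ c
      ... | inj₂ c = sub-sym (ok-mv 0 (sub-ok o p′)) (cross-closer p′ p c)

    -- Here depth 0 exchanges the two cells below `b` and keeps `b` last, yet on the word it
    -- involves the last letter. With a cell `e` between `x` and `y` placed fourth, `k4d` replaces
    -- this move by the one at depth 1; the walk that places `e` has depth at least three and is
    -- undone after the move.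
    stay : ∀ {w b x y V} → OK w (b ∷ x ∷ y ∷ V) → Btw x b y → Sub (w , b ∷ x ∷ y ∷ V) (step 0 (w , b ∷ x ∷ y ∷ V))
    stay {w} {b} {x} {y} {V} o bt
      with between (add⁻ (btw-far bt) (ch-head (ch-tail (ch o)))) (ch-head (ch-tail (ch-tail (ch o)))) (proj₁ (far-≢ (btw-far bt)))
    ... | e , be , ke with remove (ch-tail (ch-tail (ch-tail (ch o)))) ke
    ... | V′ , h , lv , sv with retail {V′ = e ∷ V′} o h sv (sym lv)
    ... | w₁ , z = sub-trans (sub³⇒sub z) (sub-trans (0 ∷ [] , sym s01) (sub³⇒sub (sub³-step (rev³ z))))
      where
      Zc = b ∷ x ∷ y ∷ e ∷ V′
      kz : OK w₁ Zc
      kz = sub-ok o (sub³⇒sub z)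
      rev³ : Sub³ (w , b ∷ x ∷ y ∷ V) (w₁ , Zc) → Sub³ (w₁ , Zc) (w , b ∷ x ∷ y ∷ V)
      rev³ (ds , q) = reverse ds , trans (cong₂ steps (trans (cong (map suc) (trans (cong (map suc) (map-reverse ds)) (map-reverse (map suc ds)))) (map-reverse (map suc (map suc ds)))) (sym q)) (steps-rev (suc³ ds) o)
      e₁ : C.mv 1 Zc ≡ b ∷ y ∷ x ∷ e ∷ V′
      e₁ = cong (b ∷_) (mvL (btw-sym be))
      law : ∀ o → (x <ᵇ b) ≡ o → (y <ᵇ x) ≡ not o → (e <ᵇ y) ≡ o → (y <ᵇ b) ≡ not o → mv 0 w₁ ≡ mv 1 w₁
      law o p₀ p₁ p₂ p₃ = k4d o (good kz) (subst (4 ≤_) (sym (len kz)) (s≤s (s≤s (s≤s (s≤s z≤n)))))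
        (trans (same kz [] 0) p₀) (trans (same kz [] 1) p₁) (trans (same kz [] 2) p₂)
        (trans (same kz (1 ∷ []) 0) (trans (cong (C.sgn 0) e₁) p₃))
      w01 : mv 0 w₁ ≡ mv 1 w₁
      w01 = case (bt , be) of λ
        { (inj₁ (p , q) , inj₁ (p′ , q′)) → law true (<ᵇ-true p) (<ᵇ-false (<⇒≤ (<-trans p q))) (<ᵇ-true q′) (<ᵇ-false (<⇒≤ q))
        ; (inj₂ (p , q) , inj₂ (p′ , q′)) → law false (<ᵇ-false (<⇒≤ q)) (<ᵇ-true (<-trans p q)) (<ᵇ-false (<⇒≤ p′)) (<ᵇ-true p)
        ; (inj₁ (p , q) , inj₂ (p′ , q′)) → ⊥-elim (<-asym (<-trans p q) (<-trans p′ q′))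
        ; (inj₂ (p , q) , inj₁ (p′ , q′)) → ⊥-elim (<-asym (<-trans p q) (<-trans p′ q′)) }
      s01 : step 0 (w₁ , Zc) ≡ step 1 (w₁ , Zc)
      s01 = cong₂ _,_ w01 (trans (mvF (btw-sym bt)) (sym e₁))

-- An orientation, so that each argument on contents covers its mirror image as well.
Lt : Bool → ℕ → ℕ → Set
Lt true  x y = x < y
Lt false x y = y < x

lt-fwd : ∀ {o x y} → Lt o x y → (x <ᵇ y) ≡ o
lt-fwd {true}  l = <ᵇ-true l
lt-fwd {false} l = <ᵇ-false (<⇒≤ l)

lt-bwd : ∀ {o x y} → Lt o x y → (y <ᵇ x) ≡ not o
lt-bwd {true}  l = <ᵇ-false (<⇒≤ l)
lt-bwd {false} l = <ᵇ-true l

lt-trans : ∀ {o x y z} → Lt o x y → Lt o y z → Lt o x z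
lt-trans {true}  l l′ = <-trans l l′
lt-trans {false} l l′ = <-trans l′ l

lt-btw : ∀ {o x e y} → Lt o x e → Lt o e y → Btw x e y
lt-btw {true}  l l′ = inj₁ (l , l′)
lt-btw {false} l l′ = inj₂ (l′ , l)

btw-lt : ∀ {o x e y} → Lt o x y → Btw x e y → Lt o x e × Lt o e y
btw-lt {true}  l (inj₁ p) = p
btw-lt {true}  l (inj₂ (p , q)) = ⊥-elim (<-asym l (<-trans p q))
btw-lt {false} l (inj₁ (p , q)) = ⊥-elim (<-asym l (<-trans p q))
btw-lt {false} l (inj₂ (p , q)) = q , p

lt-≢ : ∀ o {x y} → Lt o x y → x ≢ y
lt-≢ true  l refl = <-irrefl refl l
lt-≢ false l refl = <-irrefl refl l

-- Within its component a word is determined by its chain.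

module Injectivity (S : System) (N : ℕ) where
  open System S
  open Chains N
  open Core S N
  open OK

  corners₂ : ∀ {b T a c} → Ch (b ∷ T) → Cor (sl (b ∷ T)) a → Cor (sl (b ∷ T)) c → a ≢ b → c ≢ b → a ≢ c →
             ∃ λ T₂ → Ch T₂ × Add (sl T₂) a × Add (sl T₂) b × Add (sl T₂) c ×
             sl (a ∷ c ∷ T₂) ≗ sl T × length T ≡ 2 + length T₂
  corners₂ {b} {T} {a} {c} (x ∷ h) ka kc na nc nac
    with cor-far ka (cor-upd b (sl T)) na | cor-far kc (cor-upd b (sl T)) nc | cor-far ka kc nac
  ... | fa | fc | f with remove h (cor⁻ fa ka)
  ... | T₁ , y ∷ h₁ , l₁ , s₁ with remove h₁ (cor⁻ (far-sym f) (cor-resp (λ j → sym (s₁ j)) (cor⁻ fc kc)))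
  ... | T₂ , z ∷ h₂ , l₂ , s₂ = T₂ , h₂ ,
        add⁻ f (add-resp (λ j → sym (s₂ j)) y) ,
        add⁻ (far-sym fc) (add-resp (λ j → sym (s₂ j)) (add⁻ (far-sym fa) (add-resp (λ j → sym (s₁ j)) x))) ,
        z , (λ j → trans (upd-cong a s₂ j) (s₁ j)) , trans l₁ (cong suc l₂)

  corners-between : ∀ {T e e′} → Ch T → Cor (sl T) e → Cor (sl T) e′ → e ≢ e′ →
                    ∃ λ f → ∃ λ V → Ch (e ∷ e′ ∷ f ∷ V) × sl (e ∷ e′ ∷ f ∷ V) ≗ sl T ×
                    length T ≡ 3 + length V × Btw e f e′
  corners-between {T} {e} {e′} h k k′ n with cor-far k k′ n
  ... | f with remove h k
  ... | T₁ , x ∷ h₁ , l₁ , s₁ with remove h₁ (cor⁻ (far-sym f) (cor-resp (λ j → sym (s₁ j)) k′))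
  ... | T₂ , y ∷ h₂ , l₂ , s₂ with between (add⁻ f (add-resp (λ j → sym (s₂ j)) x)) y n
  ... | g , bt , kg with remove h₂ kg
  ... | V , h₃ , l₃ , s₃ =
        let s₂₃ = λ j → trans (upd-cong e′ s₃ j) (s₂ j) in
        g , V , add-resp (λ j → sym (s₂₃ j)) x ∷ (add-resp (λ j → sym (s₃ j)) y ∷ h₃) ,
        (λ j → trans (upd-cong e s₂₃ j) (s₁ j)) , trans l₁ (cong suc (trans l₂ (cong suc l₃))) , bt

  -- Exchanges of the two later of three cells, the earliest being the witness. Long walks on chains
  -- with unknown contents are spelled out in such steps, each with its own evidence, instead of
  -- being evaluated.
  data Sw : ℕ → List ℕ → List ℕ → Set where
    sw : ∀ {x e y V} → Btw x e y → Sw 0 (x ∷ y ∷ e ∷ V) (y ∷ x ∷ e ∷ V)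
    up : ∀ {d z X Y} → Sw d X Y → Sw (suc d) (z ∷ X) (z ∷ Y)

  infixr 5 _▸_
  data Walk : List ℕ → List ℕ → List ℕ → Set where
    done : ∀ {X} → Walk [] X X
    _▸_  : ∀ {d ds X Y Z} → Sw d X Y → Walk ds Y Z → Walk (d ∷ ds) X Z

  sw-mv : ∀ {d X Y} → Sw d X Y → C.mv d X ≡ Y
  sw-mv (sw bt) = mvL (btw-sym bt)
  sw-mv (up w)  = cong (_ ∷_) (sw-mv w)

  walk-run : ∀ {ds X Y} → Walk ds X Y → C.run ds X ≡ Y
  walk-run done = refl
  walk-run {d ∷ ds} (w ▸ ws) = trans (cong (C.run ds) (sw-mv w)) (walk-run ws)

  walk-++ : ∀ {ds es X Y Z} → Walk ds X Y → Walk es Y Z → Walk (ds ++ es) X Z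
  walk-++ done     v = v
  walk-++ (s ▸ w) v = s ▸ walk-++ w v

  6≤ : ∀ {u a b c d e f V} → OK u (a ∷ b ∷ c ∷ d ∷ e ∷ f ∷ V) → 6 ≤ length u
  6≤ k = subst (6 ≤_) (sym (len k)) (s≤s (s≤s (s≤s (s≤s (s≤s (s≤s z≤n))))))

  module Triangle {n} (inj : Inj n) {u b T} (l : length u ≡ suc n) (o : OK u (b ∷ T)) where
    open Lift inj

    s : St
    s = u , b ∷ T

    -- Crossing from `b` to `a` and on to `c` reaches the same class as crossing from `b` to `c`
    -- directly.
    Tri : ℕ → ℕ → St → St → Set
    Tri a c x x′ = ∃ λ y → ∃ λ e → ∃ λ V → Sub (step 0 x) y × proj₂ y ≡ a ∷ c ∷ e ∷ V × Btw a e c × Sub (step 0 y) (step 0 x′)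

    tri-from : ∀ {a c x x′ x₀ x₁} → Cr s a x → Cr s c x′ → Cr s a x₀ → Cr s c x₁ → Tri a c x₀ x₁ → Tri a c x x′
    tri-from k k′ k₀ k₁ (y , e , V , p , q , bt , z) =
      y , e , V , sub-trans (cross-unique l o k k₀) p , q , bt , sub-trans z (cross-unique l o k₁ k′)

    tri-sym : ∀ {a c x x′} → OKˢ x → Tri a c x x′ → Tri c a x′ x
    tri-sym {a} {c} {x} ox (y , e , V , p , q , bt , z) with sub-ok (ok-mv 0 ox) p
    ... | oy = step 0 y , e , V , sub-sym (ok-mv 0 oy) z , trans (cong (C.mv 0) q) (mvL (btw-sym bt)) , btw-sym bt ,
               subst (λ w → Sub w (step 0 x)) (sym (cong₂ _,_ (invol 0 (good oy)) (mv-inv 0 (ch oy)))) (sub-sym (ok-mv 0 ox) p)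

    Tri∃ : ℕ → ℕ → Set
    Tri∃ a c = ∃ λ x₀ → ∃ λ x₁ → Cr s a x₀ × Cr s c x₁ × Tri a c x₀ x₁

    -- From a point `x` for the crossing to `a`, the walk `ds` leads to a point for the crossing to
    -- `c`, the walk `es` after the first crossing leads to a point for crossing from `a` to `c`,
    -- and `fs` closes the triangle.
    assemble : ∀ {a c x e₀ V₀ e₁ V₁ e₂ V₂} ds es fs → Sub s x →
      proj₂ x ≡ b ∷ a ∷ e₀ ∷ V₀ → Btw b e₀ a →
      C.run (map suc ds) (proj₂ x) ≡ b ∷ c ∷ e₁ ∷ V₁ → Btw b e₁ c →
      C.run (0 ∷ map suc es) (proj₂ x) ≡ a ∷ c ∷ e₂ ∷ V₂ → Btw a e₂ c →
      run ((0 ∷ map suc es) ++ 0 ∷ map suc fs) (proj₁ x) ≡ run (map suc ds ++ 0 ∷ []) (proj₁ x) →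
      C.run ((0 ∷ map suc es) ++ 0 ∷ map suc fs) (proj₂ x) ≡ C.run (map suc ds ++ 0 ∷ []) (proj₂ x) →
      Tri∃ a c
    assemble {x = x} {e₂ = e₂} {V₂} ds es fs p q bt q₁ bt₁ q₂ bt₂ w W =
      x , steps (map suc ds) x , cr p q bt , cr (sub-trans p (ds , refl)) q₁ bt₁ ,
      steps (0 ∷ map suc es) x , e₂ , V₂ , (es , refl) , q₂ , bt₂ ,
      (fs , trans (sym (steps-++ (0 ∷ map suc es) (0 ∷ map suc fs) x))
              (trans (cong₂ _,_ w W) (steps-++ (map suc ds) (0 ∷ []) x)))

    module _ {a c} (ka : Cor (sl (b ∷ T)) a) (kc : Cor (sl (b ∷ T)) c) (na : a ≢ b) (nc : c ≢ b) (nac : a ≢ c) where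

      private
        base = corners₂ (ch o) ka kc na nc nac
        T₂   = proj₁ base
        fac  = cor-far ka kc nac

      -- The corner `c` lies between `a` and `b`. The cells `e′` between `a` and `c`, `e` between
      -- `c` and `b`, and `f` between `e′` and `e` make every exchange in the three walks legal; the
      -- words agree by `k6a`.
      tri-side : ∀ {o′} → Lt o′ a c → Lt o′ c b → Tri∃ a c
      tri-side {o′} ac cb with base
      ... | T₂ , h₂ , Aa , Ab , Ac , sT , lT with between Aa Ac nac | between Ac Ab nc
      ... | e′ , be′ , ke′ | e , be , ke with btw-lt ac be′ | btw-lt cb be
      ... | ae′ , e′c | ce , eb with lt-trans e′c ce
      ... | e′e with corners-between h₂ ke′ ke (lt-≢ o′ e′e)
      ... | f , V , hV , sV , lV , bf with btw-lt e′e bf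
      ... | e′f , fe with relocate {T′ = a ∷ c ∷ e′ ∷ e ∷ f ∷ V} o
                 (add⁺ fac (add-resp (λ j → sym (sV j)) Aa) ∷ add-resp (λ j → sym (sV j)) Ac ∷ hV)
                 (λ j → trans (upd-cong a (upd-cong c sV) j) (sT j))
                 (sym (trans lT (cong (λ h → 2 + h) lV)))
      ... | w , z = from _ refl z
        where
        from : ∀ X → X ≡ b ∷ a ∷ c ∷ e′ ∷ e ∷ f ∷ V → Sub s (w , X) → Tri∃ a c
        from X eq z = assemble (0 ∷ 2 ∷ 1 ∷ []) (2 ∷ 0 ∷ 2 ∷ 1 ∷ []) (1 ∷ 0 ∷ 2 ∷ 1 ∷ []) z eq (btw-sym (lt-btw ac cb))
            (walk-run wX₁) (btw-sym (lt-btw ce eb)) (walk-run wY) (lt-btw ae′ e′c) (sym wl)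
            (trans (walk-run (walk-++ wY wYr)) (sym (walk-run (walk-++ wX₁ (sw (btw-sym (lt-btw ce eb)) ▸ done)))))
          where
          k : OK w X
          k = sub-ok o z
          start : ∀ {ds Y} → Walk ds (b ∷ a ∷ c ∷ e′ ∷ e ∷ f ∷ V) Y → Walk ds X Y
          start {ds} {Y} = subst (λ X → Walk ds X Y) (sym eq)
          wX₁ : Walk (1 ∷ 3 ∷ 2 ∷ []) X (b ∷ c ∷ e ∷ a ∷ e′ ∷ f ∷ V)
          wX₁ = start (up (sw (lt-btw ae′ e′c)) ▸ up (up (up (sw (lt-btw e′f fe)))) ▸ up (up (sw (lt-btw ae′ e′e))) ▸ done)
          wY : Walk (0 ∷ 3 ∷ 1 ∷ 3 ∷ 2 ∷ []) X (a ∷ c ∷ e′ ∷ b ∷ e ∷ f ∷ V)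
          wY = start (sw (btw-sym (lt-btw ac cb)) ▸ up (up (up (sw (lt-btw e′f fe)))) ▸ up (sw (btw-sym (lt-btw ce eb)))
               ▸ up (up (up (sw (btw-sym (lt-btw e′f fe))))) ▸ up (up (sw (btw-sym (lt-btw e′e eb)))) ▸ done)
          wYr : Walk (0 ∷ 2 ∷ 1 ∷ 3 ∷ 2 ∷ []) (a ∷ c ∷ e′ ∷ b ∷ e ∷ f ∷ V) (c ∷ b ∷ e ∷ a ∷ e′ ∷ f ∷ V)
          wYr = sw (lt-btw ae′ e′c) ▸ up (up (sw (lt-btw e′e eb))) ▸ up (sw (lt-btw ae′ (lt-trans e′e eb)))
                ▸ up (up (up (sw (lt-btw e′f fe)))) ▸ up (up (sw (lt-btw ae′ e′e))) ▸ done
          sg : ∀ i → sgn i w ≡ C.sgn i (b ∷ a ∷ c ∷ e′ ∷ e ∷ f ∷ V)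
          sg i = trans (same k [] i) (cong (C.sgn i) eq)
          wl : run (1 ∷ 3 ∷ 2 ∷ 0 ∷ []) w ≡ run (0 ∷ 3 ∷ 1 ∷ 3 ∷ 2 ∷ 0 ∷ 2 ∷ 1 ∷ 3 ∷ 2 ∷ []) w
          wl = k6a o′ (good k) (6≤ (subst (OK w) eq k)) (trans (sg 0) (lt-fwd (lt-trans ac cb))) (trans (sg 1) (lt-bwd ac))
                 (trans (sg 2) (lt-fwd e′c)) (trans (sg 3) (lt-bwd e′e)) (trans (sg 4) (lt-fwd fe))
                 (trans (same k (3 ∷ []) 2) (trans (cong (C.sgn 2) (walk-run (start (up (up (up (sw (lt-btw e′f fe)))) ▸ done)))) (lt-bwd ce)))

      -- Now `b` is the middle corner, with `e′` between `a` and `b` and `e` between `b` and `c`.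
      -- Starting with `e′` above `c` makes the sign pattern that of `k6b`.
      tri-mid : ∀ {o′} → Lt o′ a b → Lt o′ b c → Tri∃ a c
      tri-mid {o′} ab bc with base
      ... | T₂ , h₂ , Aa , Ab , Ac , sT , lT with between Aa Ab na | between Ab Ac (nc ∘ sym)
      ... | e′ , be′ , ke′ | e , be , ke with btw-lt ab be′ | btw-lt bc be
      ... | ae′ , e′b | eb , ec with lt-trans e′b eb
      ... | e′e with corners-between h₂ ke′ ke (lt-≢ o′ e′e)
      ... | f , V , hV , sV , lV , bf with btw-lt e′e bf
      ... | e′f , fe with ch-swap {e′} {c} {e ∷ f ∷ V} (btw-far (lt-btw e′b bc)) (add-resp (λ j → sym (sV j)) Ac ∷ hV)
      ... | hc , sc with relocate {T′ = a ∷ e′ ∷ c ∷ e ∷ f ∷ V} o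
                 (add-resp (λ j → sym (sc j)) (add⁺ fac (add-resp (λ j → sym (sV j)) Aa)) ∷ hc)
                 (λ j → trans (upd-cong a (λ j → trans (sc j) (upd-cong c sV j)) j) (sT j))
                 (sym (trans lT (cong (λ h → 2 + h) lV)))
      ... | w , z = from _ refl z
        where
        from : ∀ X → X ≡ b ∷ a ∷ e′ ∷ c ∷ e ∷ f ∷ V → Sub s (w , X) → Tri∃ a c
        from X eq z = assemble (1 ∷ 0 ∷ 2 ∷ 1 ∷ []) (1 ∷ 2 ∷ 0 ∷ []) (2 ∷ 0 ∷ 2 ∷ 1 ∷ []) z eq (btw-sym (lt-btw ae′ e′b))
            (walk-run wX₁) (lt-btw eb ec) (walk-run wY) (lt-btw ab bc) (sym wl)
            (trans (walk-run (walk-++ wY wYr)) (sym (walk-run (walk-++ wX₁ (sw (lt-btw eb ec) ▸ done)))))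
          where
          k : OK w X
          k = sub-ok o z
          e′c = lt-trans e′b bc
          start : ∀ {ds Y} → Walk ds (b ∷ a ∷ e′ ∷ c ∷ e ∷ f ∷ V) Y → Walk ds X Y
          start {ds} {Y} = subst (λ X → Walk ds X Y) (sym eq)
          wX₁ : Walk (2 ∷ 1 ∷ 3 ∷ 2 ∷ []) X (b ∷ c ∷ e ∷ a ∷ e′ ∷ f ∷ V)
          wX₁ = start (up (up (sw (lt-btw e′e ec))) ▸ up (sw (lt-btw ae′ e′c)) ▸ up (up (up (sw (lt-btw e′f fe)))) ▸ up (up (sw (lt-btw ae′ e′e))) ▸ done)
          wY : Walk (0 ∷ 2 ∷ 3 ∷ 1 ∷ []) X (a ∷ c ∷ b ∷ e ∷ e′ ∷ f ∷ V)
          wY = start (sw (btw-sym (lt-btw ae′ e′b)) ▸ up (up (sw (lt-btw e′e ec))) ▸ up (up (up (sw (lt-btw e′f fe)))) ▸ up (sw (lt-btw eb ec)) ▸ done)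
          wYr : Walk (0 ∷ 3 ∷ 1 ∷ 3 ∷ 2 ∷ []) (a ∷ c ∷ b ∷ e ∷ e′ ∷ f ∷ V) (c ∷ b ∷ e ∷ a ∷ e′ ∷ f ∷ V)
          wYr = sw (lt-btw ab bc) ▸ up (up (up (sw (btw-sym (lt-btw e′f fe))))) ▸ up (sw (lt-btw ae′ e′b))
                ▸ up (up (up (sw (lt-btw e′f fe)))) ▸ up (up (sw (lt-btw ae′ e′e))) ▸ done
          sg : ∀ i → sgn i w ≡ C.sgn i (b ∷ a ∷ e′ ∷ c ∷ e ∷ f ∷ V)
          sg i = trans (same k [] i) (cong (C.sgn i) eq)
          wl : run (2 ∷ 1 ∷ 3 ∷ 2 ∷ 0 ∷ []) w ≡ run (0 ∷ 2 ∷ 3 ∷ 1 ∷ 0 ∷ 3 ∷ 1 ∷ 3 ∷ 2 ∷ []) w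
          wl = k6b o′ (good k) (6≤ (subst (OK w) eq k)) (trans (sg 0) (lt-fwd ab)) (trans (sg 1) (lt-bwd ae′))
                 (trans (sg 2) (lt-bwd e′c)) (trans (sg 3) (lt-fwd ec)) (trans (sg 4) (lt-fwd fe))

    cr-cor : ∀ {a x} → Cr s a x → Cor (sl (b ∷ T)) a × a ≢ b
    cr-cor {a} {w , _} (cr {b′} {e} {V} p refl bt) with sub-heads {w = u} (s≤s z≤n) sub-refl p
    ... | refl = cor-resp (sub-sl o p) (cor⁺ (far-sym (btw-far bt)) (cor-upd a (sl (e ∷ V)))) , proj₁ (far-≢ (far-sym (btw-far bt)))

    -- Up to mirror image `b` is either the middle corner or an outer one. If it is outer and `a` is
    -- the corner nearer to it, the triangle is read backwards by `tri-sym`.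
    triangle : ∀ {a c x x′} → Cr s a x → Cr s c x′ → a ≢ c → Tri a c x x′
    triangle {a} {c} k k′ n with cr-cor k | cr-cor k′
    ... | ka , na | kc , nc with <-cmp a b | <-cmp c b | <-cmp a c
    ... | tri≈ _ e _ | _ | _ = ⊥-elim (na e)
    ... | _ | tri≈ _ e _ | _ = ⊥-elim (nc e)
    ... | _ | _ | tri≈ _ e _ = ⊥-elim (n e)
    ... | tri< ab _ _ | tri> _ _ bc | _ = use (tri-mid ka kc na nc n {true} ab bc)
      where use : Tri∃ a c → _ ; use (_ , _ , k₀ , k₁ , t) = tri-from k k′ k₀ k₁ t
    ... | tri> _ _ ab | tri< bc _ _ | _ = use (tri-mid ka kc na nc n {false} ab bc)
      where use : Tri∃ a c → _ ; use (_ , _ , k₀ , k₁ , t) = tri-from k k′ k₀ k₁ t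
    ... | tri< ab _ _ | tri< cb _ _ | tri< ac _ _ = use (tri-side ka kc na nc n {true} ac cb)
      where use : Tri∃ a c → _ ; use (_ , _ , k₀ , k₁ , t) = tri-from k k′ k₀ k₁ t
    ... | tri> _ _ ab | tri> _ _ cb | tri> _ _ ac = use (tri-side ka kc na nc n {false} ac cb)
      where use : Tri∃ a c → _ ; use (_ , _ , k₀ , k₁ , t) = tri-from k k′ k₀ k₁ t
    ... | tri< ab _ _ | tri< cb _ _ | tri> _ _ ca = use (tri-side kc ka nc na (n ∘ sym) {true} ca ab)
      where use : Tri∃ c a → _ ; use (x₀ , x₁ , k₀ , k₁ , t) = tri-from k k′ k₁ k₀ (tri-sym {x = x₀} {x′ = x₁} (sub-ok o (Cr.sub k₀)) t)
    ... | tri> _ _ ab | tri> _ _ cb | tri< ca _ _ = use (tri-side kc ka nc na (n ∘ sym) {false} ca ab)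
      where use : Tri∃ c a → _ ; use (x₀ , x₁ , k₀ , k₁ , t) = tri-from k k′ k₁ k₀ (tri-sym {x = x₀} {x′ = x₁} (sub-ok o (Cr.sub k₀)) t)

  module Classes {n} (inj : Inj n) where
    open Lift inj

    -- The subcomponent with last cell a in the component of s.
    data Class (s : St) (a : ℕ) (y : St) : Set where
      here  : ∀ {T} → proj₂ s ≡ a ∷ T → Sub s y → Class s a y
      there : ∀ {x} → Cr s a x → Sub (step 0 x) y → Class s a y

    class-sub : ∀ {s s′ a y} → OKˢ s → Sub s s′ → Class s a y → Class s′ a y
    class-sub {u , a ∷ T} o p@(ds , refl) (here refl q) =
      here (C.run-suc ds a T) (sub-trans (sub-sym o p) q)
    class-sub o p (there (cr q f bt) z) = there (cr (sub-trans (sub-sym o p) q) f bt) z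

    -- The class assigned to each corner is an invariant of the component. A move that exchanges
    -- earlier cells keeps the class by `stay`; a crossing is compared with the crossing to `a` by
    -- `cross-unique` if both have the same target, and by `triangle` otherwise.
    class-step₀ : ∀ {s a y} → length (proj₁ s) ≡ suc n → OKˢ s → Class s a y → Class (step 0 s) a y
    class-step₀ {u , []} {a} {y} l o k with u | len o
    ... | [] | _ = k
    class-step₀ {u , _ ∷ []} {a} {y} l o k with u | len o
    ... | _ ∷ [] | _ = k
    class-step₀ {u , _ ∷ _ ∷ []} {a} {y} l o k with u | len o
    ... | _ ∷ _ ∷ [] | _ = k
    class-step₀ {u , r ∷ q ∷ p ∷ V} {a} {y} l o k with shape₃ (ch o)
    ... | mono e = subst (λ s → Class s a y) (sym (cong₂ _,_
            (mv-mono (trans (same o [] 0) (trans (sym e) (sym (same o [] 1))))) (cong (λ t → C.put t V) (tri-mono e)))) k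
    ... | first _ bt = class-sub o (stay o (btw-sym bt)) k
    ... | last _ bt = go k
      where
      s = u , r ∷ q ∷ p ∷ V
      self : Cr s q s
      self = cr sub-refl refl (btw-sym bt)
      back : step 0 (step 0 s) ≡ s
      back = cong₂ _,_ (invol 0 (good o)) (mv-inv 0 (ch o))
      go : Class s a y → Class (step 0 s) a y
      go (here refl z) = there (cr sub-refl (mvL bt) bt) (subst (λ s → Sub s y) (sym back) z)
      go (there {x} c z) with a ≟ q
      ... | yes refl = here (mvL bt) (sub-trans (cross-unique l o self c) z)
      ... | no a≢q with Triangle.triangle inj l o self c (a≢q ∘ sym)
      ... | w , e , W , p₁ , q₁ , bt₁ , z₁ = there (cr p₁ q₁ bt₁) (sub-trans z₁ z)

    class-steps : ∀ ds {s a y} → length (proj₁ s) ≡ suc n → OKˢ s → Class s a y → Class (steps ds s) a y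
    class-steps []           l o k = k
    class-steps (zero ∷ ds)  {u , T} l o k = class-steps ds (trans (length-mv 0 u) l) (ok-mv 0 o) (class-step₀ l o k)
    class-steps (suc d ∷ ds) {u , T} l o k = class-steps ds (trans (length-mv (suc d) u) l) (ok-mv (suc d) o) (class-sub o (d ∷ [] , refl) k)

  -- The class assigned to the last cell `b` is carried along the walk. When the chain is back at
  -- its start, start and end of the word lie in one class, where the chain determines the word by
  -- induction.
  inj : ∀ n → Inj n
  inj zero {[]} l o ds e = length-0 (length-run ds [])
    where
    length-0 : ∀ {u : List A} → length u ≡ 0 → u ≡ []
    length-0 {[]} _ = refl
  inj (suc n) {α} {[]} l o ds e with () ← trans (sym l) (len o)
  inj (suc n) {α} {b ∷ T} l o ds e = cong proj₁ (go (subst (λ X → Class (run ds α , X) b (α , b ∷ T)) e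
                                       (class-steps ds l o (here refl sub-refl))))
    where
    open Lift (inj n)
    open Classes (inj n)
    o′ : OK (run ds α) (b ∷ T)
    o′ = subst (OK (run ds α)) e (ok-run ds o)
    go : Class (run ds α , b ∷ T) b (α , b ∷ T) → (run ds α , b ∷ T) ≡ (α , b ∷ T)
    go (here _ z) = sub-unique (trans (length-run ds α) l) o′ sub-refl z refl
    go (there {w , _} (cr p refl bt) _) with sub-heads {w = run ds α} (s≤s z≤n) sub-refl p
    ... | refl = ⊥-elim (proj₁ (far-≢ (btw-far bt)) refl)

-- The cell that records a new letter.

module Extension (S : System) (N : ℕ) where
  open System S
  open Chains N
  open Core S N
  open Injectivity S N using (inj; 6≤; Sw; sw; up; sw-mv)
  open OK

  below : ∀ {T} → Ch T → ∀ j → j + length T < N → sl T j ≡ false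
  below {[]} h j l = cong not (<ᵇ-true (subst (_< N) (+-identityʳ j) l))
  below {c ∷ T} (x ∷ h) j l with j ≟ c | j ≟ suc c
  ... | yes refl | _ = ⊥-elim (clash (Add.next x) (below h (suc c) (subst (_< N) (+-suc c (length T)) l)))
  ... | no n | yes e = refl
  ... | no n | no n′ = below h j (<-trans (+-monoʳ-< j (n<1+n _)) l)

  above : ∀ {T} → Ch T → ∀ j → N + length T ≤ j → sl T j ≡ true
  above {[]} h j l = cong not (<ᵇ-false (≤-trans (m≤m+n N 0) l))
  above {c ∷ T} (x ∷ h) j l with j ≟ c | j ≟ suc c
  ... | yes e | _ = refl
  ... | no n | yes refl = ⊥-elim (clash (above h c (≤-pred (subst (_≤ suc c) (+-suc N (length T)) l))) (Add.at x))
  ... | no n | no n′ = above h j (≤-trans (+-monoʳ-≤ N (n≤1+n _)) l)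

  -- Between a corner lying left of the cut and the next one to the right
  -- there is an addable cell.
  module Search (s : ℕ → Bool) (Up Dn : ℕ → Set) (choice : ∀ a → Cor s a → Up a ⊎ Dn a)
                (mono : ∀ {a a′} → Cor s a → Cor s a′ → a < a′ → Dn a → Dn a′)
                (M : ℕ) (top : ∀ j → M ≤ j → s j ≡ true) where

    Res : Set
    Res = ∃ λ c → Add s c × (∀ a → Cor s a → a < c → Up a) × (∀ a → Cor s a → c < a → Dn a)

    -- `down` follows a descending slope to the next valley, having met only `Up` corners. `hill`
    -- climbs from the valley `c` and asks at the next peak whether `c` is the place of the cut or
    -- the search has to go on.
    down : ∀ fuel j → M ≤ fuel + j → s j ≡ false → (∀ a → Cor s a → a < j → Up a) → Res
    hill : ∀ fuel i c → M ≤ fuel + i → s i ≡ true → Add s c → (∀ a → Cor s a → c < a → i ≤ a) →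
           (∀ a → Cor s a → a < c → Up a) → Res
    down zero j l f ups = ⊥-elim (clash (top j l) f)
    down (suc fuel) j l f ups with s (suc j) in eq
    ... | false = down fuel (suc j) (subst (M ≤_) (sym (+-suc fuel j)) l) eq
                    (λ a k p → ups a k (≤∧≢⇒< (≤-pred p) λ { refl → clash (Cor.at k) f }))
    ... | true = hill fuel (suc j) j (subst (M ≤_) (sym (+-suc fuel j)) l) eq (f , eq) (λ a k p → p) ups
    hill zero i c l t ad gap ups = c , ad , ups , λ a k p → ⊥-elim (clash (top (suc a) (≤-trans l (≤-trans (gap a k p) (n≤1+n a)))) (Cor.next k))
    hill (suc fuel) i c l t ad gap ups with s (suc i) in eq
    ... | true = hill fuel (suc i) c (subst (M ≤_) (sym (+-suc fuel i)) l) eq ad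
                   (λ a k p → ≤∧≢⇒< (gap a k p) λ { refl → clash eq (Cor.next k) }) ups
    ... | false with choice i (t , eq)
    ... | inj₂ d = c , ad , ups , λ a k p → case i ≟ a of λ
            { (yes refl) → d ; (no n) → mono (t , eq) k (≤∧≢⇒< (gap a k p) n) d }
    ... | inj₁ u = down fuel (suc i) (subst (M ≤_) (sym (+-suc fuel i)) l) eq λ a k p → case <-cmp a c of λ
            { (tri< q _ _) → ups a k q
            ; (tri≈ _ refl _) → ⊥-elim (clash (Cor.at k) (Add.at ad))
            ; (tri> _ _ q) → subst Up (≤-antisym (gap a k q) (≤-pred p)) u }

  reach : ∀ {T U} → Ch T → Ch U → length U ≡ length T → sl U ≗ sl T → ∃ λ ds → C.run ds T ≡ U
  reach {T} h k l e = conn-walk (conn (length T) refl l h k (λ j → sym (e j)))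

  Cut : A → List A → List ℕ → ℕ → Set
  Cut t α T c = ∀ ds → asc (run ds α) t ≡ C.asc (C.run ds T) c

  ok-cut : ∀ {t α c T} → OK (t ∷ α) (c ∷ T) → Cut t α T c
  ok-cut {t} {α} {c} {T} o ds = trans (sym (cong (sgn 0) (run-suc ds t α)))
    (trans (same o (map suc ds) 0) (cong (C.sgn 0) (C.run-suc ds c T)))

  inj-eq′ : ∀ {α T} → OK α T → ∀ ds es → C.run ds T ≡ C.run es T → run ds α ≡ run es α
  inj-eq′ {α} o = inj-eq (inj (length α)) refl o

  -- By injectivity the comparison of `t` with the last letter depends only on the corner in which
  -- the chain ends. By `mon` the corners with a descent are closed under passing to the right, so
  -- they are cut off by an addable cell.
  cut-exists : ∀ {t α T} → length T < N → Good (t ∷ α) → OK α T → ∃ λ c → Add (sl T) c × Cut t α T c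
  cut-exists {t} {α} {T} lN g o with Search.down (sl T) Up Dn choice dn-mono (N + length T) (above (ch o)) (N + length T) 0
                                   (m≤m+n _ 0) (below (ch o) 0 lN) (λ a k ())
    where
    Up Dn : ℕ → Set
    Up a = ∀ ds {V} → C.run ds T ≡ a ∷ V → asc (run ds α) t ≡ true
    Dn a = ∀ ds {V} → C.run ds T ≡ a ∷ V → asc (run ds α) t ≡ false
    head-eq : ∀ {a V V′} ds es → C.run ds T ≡ a ∷ V → C.run es T ≡ a ∷ V′ → asc (run ds α) t ≡ asc (run es α) t
    head-eq {a} {V} {V′} ds es p q with reach {V} {V′} (ch-tail (subst Ch p (proj₁ (ch-run ds (ch o))))) (ch-tail (subst Ch q (proj₁ (ch-run es (ch o)))))
              (suc-injective (trans (cong length (sym q)) (trans (C.length-run es T) (trans (sym (C.length-run ds T)) (cong length p)))))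
              (λ j → sym (sl-cancel (subst Ch p (proj₁ (ch-run ds (ch o)))) (subst Ch q (proj₁ (ch-run es (ch o))))
                 (λ j → trans (cong (λ X → sl X j) (sym p)) (trans (proj₂ (ch-run ds (ch o)) j)
                    (trans (sym (proj₂ (ch-run es (ch o)) j)) (cong (λ X → sl X j) q)))) j))
    ... | fs , w = trans (sym (asc-suc fs (run ds α))) (cong (λ u → asc u t) (trans (sym (run-++ ds (map suc fs) α))
            (inj-eq′ o (ds ++ map suc fs) es (trans (C.run-++ ds (map suc fs) T) (trans (cong (C.run (map suc fs)) p)
               (trans (C.run-suc fs a V) (trans (cong (a ∷_) w) (sym q))))))))
      where
      asc-suc : ∀ fs u → asc (run (map suc fs) u) t ≡ asc u t
      asc-suc fs []      = cong (λ u → asc u t) (run-suc-[] fs)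
      asc-suc fs (x ∷ u) = cong (λ u → asc u t) (run-suc fs x u)
    realize : ∀ {a} → Cor (sl T) a → ∃ λ ds → ∃ λ V → C.run ds T ≡ a ∷ V
    realize {a} k with remove (ch o) k
    ... | V , h , l , e with reach (ch o) h (sym l) e
    ... | ds , w = ds , V , w
    choice : ∀ a → Cor (sl T) a → Up a ⊎ Dn a
    choice a k with realize k
    ... | es , V , w with asc (run es α) t in eq
    ... | true  = inj₁ λ ds p → trans (head-eq ds es p w) eq
    ... | false = inj₂ λ ds p → trans (head-eq ds es p w) eq
    dn-mono : ∀ {a a′} → Cor (sl T) a → Cor (sl T) a′ → a < a′ → Dn a → Dn a′
    dn-mono {a} {a′} k k′ l d with cor-far k k′ (<⇒≢ l) | remove (ch o) k
    ... | f | T₁ , h₁@(x ∷ h₁′) , l₁ , s₁ with remove h₁′ (cor⁻ (far-sym f) (cor-resp (λ j → sym (s₁ j)) k′))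
    ... | T₂ , h₂@(y ∷ h₂′) , l₂ , s₂ with between (add⁻ f (add-resp (λ j → sym (s₂ j)) x)) y (<⇒≢ l)
    ... | e , bt , ke with remove h₂′ ke | btw-lt {true} l bt
    -- On a chain that ends in `e`, `a′`, `a`, depth 0 exchanges the last two cells; `mon` compares
    -- `t` with the last letters before and after.
    ... | V , h₃ , l₃ , s₃ | ae , ea′ with reach {T} {a ∷ a′ ∷ e ∷ V} (ch o)
              (add-resp (λ j → trans (sym (s₂ j)) (sym (upd-cong a′ s₃ j))) x ∷ (add-resp (λ j → sym (s₃ j)) y ∷ h₃))
              (sym (trans l₁ (cong suc (trans l₂ (cong suc l₃)))))
              (λ j → trans (upd-cong a (λ j → trans (upd-cong a′ s₃ j) (s₂ j)) j) (s₁ j))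
    ... | es , w = λ ds p → trans (head-eq ds (es ++ 0 ∷ []) p (trans (C.run-++ es (0 ∷ []) T) (trans (cong (C.mv 0) w) (mvL (btw-sym bt)))))
            (trans (cong (λ u → asc u t) (run-++ es (0 ∷ []) α)) law)
      where
      oe : OK (run es α) (a ∷ a′ ∷ e ∷ V)
      oe = subst (OK (run es α)) w (ok-run es o)
      g′ : Good (t ∷ run es α)
      g′ = subst Good (run-suc es t α) (good-run (map suc es) g)
      law : asc (mv 0 (run es α)) t ≡ false
      law = mon g′ (s≤s (subst (3 ≤_) (sym (len oe)) (s≤s (s≤s (s≤s z≤n))))) (d es w)
              (trans (same oe [] 0) (<ᵇ-false (<⇒≤ l))) (trans (same oe [] 1) (<ᵇ-true ea′))
  ... | c , ad , ups , dns = c , ad , cut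
    where
    cut : Cut t α T c
    cut ds with C.run ds T in eq | ok-run ds o | ch-run ds (ch o)
    ... | [] | o′ | _ with run ds α | len o′
    ... | [] | _ = refl
    cut ds | a ∷ V | o′ | h , e with <-cmp a c
    ... | tri< l _ _ = trans (ups a (cor-of {a} {V} {T} e) l ds eq) (sym (<ᵇ-true l))
    ... | tri≈ _ refl _ = ⊥-elim (clash (Cor.at (cor-of {a} {V} {T} e)) (Add.at ad))
    ... | tri> _ _ l = trans (dns a (cor-of {a} {V} {T} e) l ds eq) (sym (<ᵇ-false (<⇒≤ l)))

  cut-unique : ∀ {t α T c c′} → OK α T → Add (sl T) c → Add (sl T) c′ → Cut t α T c → Cut t α T c′ → c ≡ c′
  cut-unique {t} {α} {T} {c} {c′} o x x′ k k′ = add-unique x x′ λ a ka → go a ka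
    where
    go : ∀ a → Cor (sl T) a → (a <ᵇ c) ≡ (a <ᵇ c′)
    go a ka with remove (ch o) ka
    ... | V , h , l , e with reach (ch o) h (sym l) e
    ... | ds , w = trans (sym (trans (k ds) (cong (λ X → C.asc X c) w))) (trans (k′ ds) (cong (λ X → C.asc X c′) w))

  -- The part of `OK` that is available as soon as a cut is chosen: agreement along all walks that
  -- leave the last letter in place. What is missing is the move at depth 0.
  data Rel : List A → List ℕ → Set where
    rel : ∀ {t α c T} → Good (t ∷ α) → OK α T → Add (sl T) c → Cut t α T c → Rel (t ∷ α) (c ∷ T)

  ok⇒rel : ∀ {t α c T} → OK (t ∷ α) (c ∷ T) → Rel (t ∷ α) (c ∷ T)
  ok⇒rel o = rel (good o) (ok-tail o) (ch-head (ch o)) (ok-cut o)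

  rel-ch : ∀ {u U} → Rel u U → Ch U
  rel-ch (rel g o x k) = x ∷ ch o

  rel-good : ∀ {u U} → Rel u U → Good u
  rel-good (rel g o x k) = g

  rel-len : ∀ {u U} → Rel u U → length u ≡ length U
  rel-len (rel g o x k) = cong suc (len o)

  rel-sgn : ∀ {u U} → Rel u U → ∀ i → sgn i u ≡ C.sgn i U
  rel-sgn (rel g o x k) zero    = k []
  rel-sgn (rel g o x k) (suc i) = same o [] i

  rel-mv : ∀ {u U} d → Rel u U → Rel (mv (suc d) u) (C.mv (suc d) U)
  rel-mv {c ∷ _} d (rel {T = T} g o x k) = rel (good-mv (suc d) g) (ok-mv d o)
    (add-resp (λ j → sym (proj₂ (ch-mv d (ch o)) j)) x) (k ∘ (d ∷_))

  rel-run : ∀ {u U} ds → Rel u U → Rel (run (map suc ds) u) (C.run (map suc ds) U)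
  rel-run []       r = r
  rel-run (d ∷ ds) r = rel-run ds (rel-mv d r)

  rel-unique : ∀ {t α c c′ T} → Rel (t ∷ α) (c ∷ T) → Rel (t ∷ α) (c′ ∷ T) → c ≡ c′
  rel-unique (rel g o x k) (rel _ _ x′ k′) = cut-unique o x x′ k k′

  rel-tail : ∀ {t α c T} → Rel (t ∷ α) (c ∷ T) → OK α T
  rel-tail (rel g o x k) = o

  rel-unique₃ : ∀ {r q p β c₃ c₂ c₁ d₃ d₂ d₁ B} → Rel (r ∷ q ∷ p ∷ β) (c₃ ∷ c₂ ∷ c₁ ∷ B) →
                Rel (r ∷ q ∷ p ∷ β) (d₃ ∷ d₂ ∷ d₁ ∷ B) → c₁ ≡ d₁ × c₂ ≡ d₂ × c₃ ≡ d₃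
  rel-unique₃ R R′ with rel-unique (ok⇒rel (ok-tail (rel-tail R))) (ok⇒rel (ok-tail (rel-tail R′)))
  ... | refl with rel-unique (ok⇒rel (rel-tail R)) (ok⇒rel (rel-tail R′))
  ... | refl = refl , refl , rel-unique R R′

  4≤ : ∀ {u a b c d V} → Rel u (a ∷ b ∷ c ∷ d ∷ V) → 4 ≤ length u
  4≤ R = subst (4 ≤_) (sym (rel-len R)) (s≤s (s≤s (s≤s (s≤s z≤n))))

  5≤ : ∀ {u a b c d e V} → Rel u (a ∷ b ∷ c ∷ d ∷ e ∷ V) → 5 ≤ length u
  5≤ R = subst (5 ≤_) (sym (rel-len R)) (s≤s (s≤s (s≤s (s≤s (s≤s z≤n)))))

  -- Two words joined by the move at depth 0, with chains that share everything below three cells.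
  -- The chain of `v` is constructed on its own, so the goal is to identify its top cells with those
  -- of the moved chain of `u`.
  record Twin (u v : List A) (x₃ x₂ x₁ y₃ y₂ y₁ : ℕ) (θ : List ℕ) : Set where
    constructor twin
    field
      fwd : mv 0 u ≡ v
      bwd : mv 0 v ≡ u
      ru  : Rel u (x₃ ∷ x₂ ∷ x₁ ∷ θ)
      rv  : Rel v (y₃ ∷ y₂ ∷ y₁ ∷ θ)
  open Twin

  twin-sym : ∀ {u v x₃ x₂ x₁ y₃ y₂ y₁ θ} → Twin u v x₃ x₂ x₁ y₃ y₂ y₁ θ → Twin v u y₃ y₂ y₁ x₃ x₂ x₁ θ
  twin-sym (twin f b r r′) = twin b f r′ r

  twin-retail : ∀ {u v x₃ x₂ x₁ y₃ y₂ y₁ θ θ′} → Twin u v x₃ x₂ x₁ y₃ y₂ y₁ θ → Ch θ′ →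
                length θ′ ≡ length θ → sl θ′ ≗ sl θ →
                ∃ λ u′ → ∃ λ v′ → Twin u′ v′ x₃ x₂ x₁ y₃ y₂ y₁ θ′
  twin-retail {u} {v} {x₃} {x₂} {x₁} {y₃} {y₂} {y₁} {θ} (twin f b r r′) h l e with reach (ch-tail (ch-tail (ch-tail (rel-ch r)))) h l e
  ... | ds , w = run (suc³ ds) u , run (suc³ ds) v , twin
        (trans (run-comm ds u) (cong (run (suc³ ds)) f)) (trans (run-comm ds v) (cong (run (suc³ ds)) b))
        (subst (Rel _) (trans (C.run-suc³ ds x₃ x₂ x₁ θ) (cong (λ W → x₃ ∷ x₂ ∷ x₁ ∷ W) w)) (rel-run (map suc (map suc ds)) r))
        (subst (Rel _) (trans (C.run-suc³ ds y₃ y₂ y₁ θ) (cong (λ W → y₃ ∷ y₂ ∷ y₁ ∷ W) w)) (rel-run (map suc (map suc ds)) r′))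

-- The move at depth 0 acts on recording chains as it does on words.

module Recording (S : System) (N : ℕ) where
  open System S
  open Chains N
  open Core S N
  open Injectivity S N using (inj)
  open Extension S N
  open OK
  open Twin

  rel-unique₃′ : ∀ {u c₃ c₂ c₁ d₃ d₂ d₁ B} → Rel u (c₃ ∷ c₂ ∷ c₁ ∷ B) → Rel u (d₃ ∷ d₂ ∷ d₁ ∷ B) →
                 c₁ ≡ d₁ × c₂ ≡ d₂ × c₃ ≡ d₃
  rel-unique₃′ {_ ∷ []} R R′ with () ← rel-len R
  rel-unique₃′ {_ ∷ _ ∷ []} R R′ with () ← rel-len R
  rel-unique₃′ {_ ∷ _ ∷ _ ∷ _} R R′ = rel-unique₃ R R′

  newest : ∀ p q r → proj₂ (proj₂ (C.tri p q r)) ≡ r ⊎ proj₂ (proj₂ (C.tri p q r)) ≡ q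
  newest p q r with (p <ᵇ q) == (q <ᵇ r) | (p <ᵇ q) == (p <ᵇ r)
  ... | true  | _     = inj₁ refl
  ... | false | true  = inj₁ refl
  ... | false | false = inj₂ refl

  newest-lt : ∀ {o} x₃ x₂ x₁ x₀ V → (x₂ <ᵇ x₃) ≡ o → (x₁ <ᵇ x₃) ≡ o → C.sgn 0 (C.mv 1 (x₃ ∷ x₂ ∷ x₁ ∷ x₀ ∷ V)) ≡ o
  newest-lt x₃ x₂ x₁ x₀ V e e′ with newest x₀ x₁ x₂
  ... | inj₁ q = trans (cong (_<ᵇ x₃) q) e
  ... | inj₂ q = trans (cong (_<ᵇ x₃) q) e′

  -- In the chain of `u`, depth 2 brings `x₀` next to `x₂`; in that of `v`, depths 2 and 1 bring it
  -- next to `y₃`. The law `k5e` equates the two ascents.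
  five : ∀ o {u v x₃ x₂ x₁ x₀ w y₃ y₂ V} → Twin u v x₃ x₂ x₁ y₃ y₂ x₁ (x₀ ∷ w ∷ V) →
         (x₂ <ᵇ x₃) ≡ o → (x₁ <ᵇ x₂) ≡ not o → Lt o x₀ x₁ → (x₁ <ᵇ x₃) ≡ o → Btw x₀ w x₁ → Btw x₀ x₁ y₂ →
         (x₀ <ᵇ x₂) ≡ (x₀ <ᵇ y₃)
  five o {u} {v} {x₃} {x₂} {x₁} {x₀} {w} {y₃} {y₂} {V} (twin f b r r′) s₀ s₁ l s₂ bt bt′ = begin
    (x₀ <ᵇ x₂)                                            ≡⟨ cong (C.sgn 1) (sym (cong (λ W → x₃ ∷ x₂ ∷ W) (mvL {V = V} bt))) ⟩
    C.sgn 1 (C.mv 2 (x₃ ∷ x₂ ∷ x₁ ∷ x₀ ∷ w ∷ V))          ≡⟨ sym (rel-sgn (rel-mv 1 r) 1) ⟩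
    sgn 1 (mv 2 u)                                        ≡⟨ k5e o (rel-good r) (5≤ r) (trans (rel-sgn r 0) s₀) (trans (rel-sgn r 1) s₁)
                                                               (trans (rel-sgn r 2) (lt-fwd l)) (trans (rel-sgn r 3) (lt-bwd (proj₁ (btw-lt l bt))))
                                                               (trans (rel-sgn (rel-mv 0 r) 0) (newest-lt x₃ x₂ x₁ x₀ (w ∷ V) s₀ s₂)) ⟩
    sgn 0 (run (2 ∷ 1 ∷ []) (mv 0 u))                     ≡⟨ cong (λ z → sgn 0 (run (2 ∷ 1 ∷ []) z)) f ⟩
    sgn 0 (run (2 ∷ 1 ∷ []) v)                            ≡⟨ rel-sgn (rel-run (1 ∷ 0 ∷ []) r′) 0 ⟩
    C.sgn 0 (C.mv 1 (C.mv 2 (y₃ ∷ y₂ ∷ x₁ ∷ x₀ ∷ w ∷ V))) ≡⟨ cong (λ W → C.sgn 0 (C.mv 1 (y₃ ∷ y₂ ∷ W))) (mvL {V = V} bt) ⟩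
    C.sgn 0 (C.mv 1 (y₃ ∷ y₂ ∷ x₀ ∷ x₁ ∷ w ∷ V))          ≡⟨ cong (λ W → C.sgn 0 (y₃ ∷ W)) (mvL {V = w ∷ V} bt′) ⟩
    (x₀ <ᵇ y₃) ∎
    where open ≡-Reasoning

  below-five : ∀ {θ x₁ x₀} → Ch (x₁ ∷ θ) → Cor (sl (x₁ ∷ θ)) x₀ → x₀ ≢ x₁ →
               ∃ λ w → ∃ λ V → Ch (x₀ ∷ w ∷ V) × sl (x₀ ∷ w ∷ V) ≗ sl θ × length (x₀ ∷ w ∷ V) ≡ length θ × Btw x₀ w x₁
  below-five {θ} {x₁} {x₀} (a ∷ h) k n with cor-far k (cor-upd x₁ (sl θ)) n
  ... | f with remove h (cor⁻ f k)
  ... | θ′ , b ∷ h′ , l , s with between b (add⁻ (far-sym f) (add-resp (λ j → sym (s j)) a)) n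
  ... | w , bt , kw with remove h′ kw
  ... | V , h″ , l′ , s′ = w , V , add-resp (λ j → sym (s′ j)) b ∷ h″ , (λ j → trans (upd-cong x₀ s′ j) (s j)) ,
        sym (trans l (cong suc l′)) , bt

  -- Both `x₂` and `y₃` are addable to the shape of `x₁ ∷ θ`, so it is enough that no corner
  -- separates them. A corner on their side of `x₁` is compared by `five`; any other one lies beyond
  -- both.
  same-cell : ∀ o {u v x₃ x₂ x₁ y₃ y₂ θ} → Twin u v x₃ x₂ x₁ y₃ y₂ x₁ θ →
              Lt o x₂ x₁ → Lt o x₂ x₃ → Lt o x₁ x₃ → Lt o x₁ y₂ → Lt o y₃ x₁ → x₂ ≡ y₃
  same-cell o {u} {v} {x₃} {x₂} {x₁} {y₃} {y₂} {θ} tw l₂₁ l₂₃ l₁₃ m₁₂ m₃₁ =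
    add-unique (ch-head (ch-tail (rel-ch (ru tw))))
      (add⁻ (btw-far (lt-btw m₃₁ m₁₂)) (ch-head (rel-ch (rv tw)))) go
    where
    both : ∀ x₀ → Lt o x₁ x₀ ⊎ x₁ ≡ x₀ → (x₀ <ᵇ x₂) ≡ (x₀ <ᵇ y₃)
    both x₀ (inj₁ l)    = trans (lt-bwd (lt-trans l₂₁ l)) (sym (lt-bwd (lt-trans m₃₁ l)))
    both x₀ (inj₂ refl) = trans (lt-bwd l₂₁) (sym (lt-bwd m₃₁))
    far : ∀ x₀ → Cor (sl (x₁ ∷ θ)) x₀ → Lt o x₀ x₁ → (x₀ <ᵇ x₂) ≡ (x₀ <ᵇ y₃)
    far x₀ k l with below-five (ch-tail (ch-tail (rel-ch (ru tw)))) k (lt-≢ o l)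
    ... | w , V , h , s , ln , bt with twin-retail tw h ln s
    ... | u′ , v′ , tw′ = five o tw′ (lt-fwd l₂₃) (lt-bwd l₂₁) l (lt-fwd l₁₃) bt (lt-btw l m₁₂)
    split : ∀ o x₀ → Lt o x₀ x₁ ⊎ (Lt o x₁ x₀ ⊎ x₁ ≡ x₀)
    split true x₀ with <-cmp x₀ x₁
    ... | tri< l _ _ = inj₁ l
    ... | tri≈ _ e _ = inj₂ (inj₂ (sym e))
    ... | tri> _ _ l = inj₂ (inj₁ l)
    split false x₀ with <-cmp x₀ x₁
    ... | tri< l _ _ = inj₂ (inj₁ l)
    ... | tri≈ _ e _ = inj₂ (inj₂ (sym e))
    ... | tri> _ _ l = inj₁ l
    go : ∀ x₀ → Cor (sl (x₁ ∷ θ)) x₀ → (x₀ <ᵇ x₂) ≡ (x₀ <ᵇ y₃)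
    go x₀ k with split o x₀
    ... | inj₁ l = far x₀ k l
    ... | inj₂ p = both x₀ p

  ≤∧≢ : ∀ {m n} → m ≤ n → n ≢ m → m < n
  ≤∧≢ l n = ≤∧≢⇒< l (n ∘ sym)

  3≤ : ∀ {u a b c V} → Rel u (a ∷ b ∷ c ∷ V) → 3 ≤ length u
  3≤ R = subst (3 ≤_) (sym (rel-len R)) (s≤s (s≤s (s≤s z≤n)))

  -- If `x₃ < x₁`, a cell between `x₂` and `x₁` is placed below them; then `k4d` turns the move into
  -- one at depth 1, whose effect on chains is known. If `x₁ < x₃`, the ascents at all corners of
  -- `θ` give `y₁ = x₁`, and the two other cells are matched crosswise by `same-cell`.
  valley : ∀ {u v x₃ x₂ x₁ y₃ y₂ y₁ θ} → Twin u v x₃ x₂ x₁ y₃ y₂ y₁ θ → x₂ < x₁ → x₂ < x₃ →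
           y₃ ∷ y₂ ∷ y₁ ∷ θ ≡ C.mv 0 (x₃ ∷ x₂ ∷ x₁ ∷ θ)
  valley {u} {v} {x₃} {x₂} {x₁} {y₃} {y₂} {y₁} {θ} tw l₂₁ l₂₃ with <-cmp x₃ x₁
  ... | tri≈ _ e _ = ⊥-elim (ch-≢₂ (rel-ch (ru tw)) (sym e))
  ... | tri< l₃₁ _ _ with between (add⁻ (btw-far (inj₁ (l₂₃ , l₃₁))) (ch-head (ch-tail (rel-ch (ru tw)))))
                                  (ch-head (ch-tail (ch-tail (rel-ch (ru tw))))) (<⇒≢ l₂₁)
  ... | x₀ , bt , k with remove (ch-tail (ch-tail (ch-tail (rel-ch (ru tw))))) k
  ... | θ′ , h , l , s with twin-retail tw h (sym l) s
  ... | u′ , v′ , twin f b r r′ with rel-unique₃′ r′ (subst (λ z → Rel z (x₃ ∷ x₁ ∷ x₂ ∷ x₀ ∷ θ′)) e₀₁ r₁)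
    where
    e₁ : C.mv 1 (x₃ ∷ x₂ ∷ x₁ ∷ x₀ ∷ θ′) ≡ x₃ ∷ x₁ ∷ x₂ ∷ x₀ ∷ θ′
    e₁ = cong (x₃ ∷_) (mvL (btw-sym bt))
    r₁ : Rel (mv 1 u′) (x₃ ∷ x₁ ∷ x₂ ∷ x₀ ∷ θ′)
    r₁ = subst (Rel (mv 1 u′)) e₁ (rel-mv 0 r)
    e₀₁ : mv 1 u′ ≡ v′
    e₀₁ = trans (sym (k4d true (rel-good r) (4≤ r) (trans (rel-sgn r 0) (<ᵇ-true l₂₃)) (trans (rel-sgn r 1) (<ᵇ-false (<⇒≤ l₂₁)))
                 (trans (rel-sgn r 2) (<ᵇ-true (proj₂ (btw-lt {true} l₂₁ bt)))) (trans (rel-sgn r₁ 0) (<ᵇ-false (<⇒≤ l₃₁))))) f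
  ... | refl , refl , refl = sym (mvF (inj₂ (l₂₃ , l₃₁)))
  valley {u} {v} {x₃} {x₂} {x₁} {y₃} {y₂} {y₁} {θ} tw l₂₁ l₂₃ | tri> _ _ l₁₃
    with add-unique (ch-head (ch-tail (ch-tail (rel-ch (rv tw))))) (ch-head (ch-tail (ch-tail (rel-ch (ru tw))))) go
    where
    go : ∀ x₀ → Cor (sl θ) x₀ → (x₀ <ᵇ y₁) ≡ (x₀ <ᵇ x₁)
    go x₀ k with remove (ch-tail (ch-tail (ch-tail (rel-ch (ru tw))))) k
    ... | θ′ , h , l , s with twin-retail tw h (sym l) s
    ... | u′ , v′ , twin f b r r′ with x₀ <ᵇ x₁ in eq
    ... | true = trans (sym (rel-sgn r′ 2)) (trans (cong (sgn 2) (sym f)) (k4n (rel-good r) (4≤ r) (trans (rel-sgn r 0) (<ᵇ-true l₂₃))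
                   (trans (rel-sgn r 1) (<ᵇ-false (<⇒≤ l₂₁))) (trans (rel-sgn r 2) eq)
                   (trans (rel-sgn (rel-mv 0 r) 0) (newest-lt x₃ x₂ x₁ x₀ θ′ (<ᵇ-true l₂₃) (<ᵇ-true l₁₃)))))
    ... | false = trans (sym (rel-sgn r′ 2)) (trans (cong (sgn 2) (sym f)) (k4m true (rel-good r) (4≤ r) (trans (rel-sgn r 0) (<ᵇ-true l₂₃))
                   (trans (rel-sgn r 1) (<ᵇ-false (<⇒≤ l₂₁))) (trans (rel-sgn r 2) eq)))
  ... | refl = trans (cong₂ (λ a b → a ∷ b ∷ x₁ ∷ θ) y₃≡x₂ y₂≡x₃) (sym (mvL (inj₁ (l₂₁ , l₁₃))))
    where
    R  = ru tw
    R′ = rv tw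
    fl = flip-sgn (rel-good R) (3≤ R) (trans (trans (rel-sgn R 0) (<ᵇ-true l₂₃)) (cong not (sym (trans (rel-sgn R 1) (<ᵇ-false (<⇒≤ l₂₁))))))
    m₁₂ : x₁ < y₂
    m₁₂ = <ᵇ-true⁻ (trans (sym (rel-sgn R′ 1)) (trans (cong (sgn 1) (sym (fwd tw))) (trans (proj₂ fl) (trans (rel-sgn R 0) (<ᵇ-true l₂₃)))))
    m₃₂ : y₃ < y₂
    m₃₂ = ≤∧≢ (<ᵇ-false⁻ (trans (sym (rel-sgn R′ 0)) (trans (cong (sgn 0) (sym (fwd tw))) (trans (proj₁ fl) (trans (rel-sgn R 1) (<ᵇ-false (<⇒≤ l₂₁)))))))
              (ch-≢ (rel-ch R′))
    -- If `y₂` directly follows `x₁`, then `y₃ < y₂` suffices. Otherwise a corner `x₀` between them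
    -- lets depth 1 bring `x₁` next to `y₃`, and `k4q` gives the sign.
    m₃₁′ : y₃ ≤ x₁
    m₃₁′ with y₂ ≟ suc x₁
    ... | yes refl = ≤-pred m₃₂
    ... | no n with between (ch-head (ch-tail (ch-tail (rel-ch R′)))) (add⁻ (inj₂ (≤∧≢⇒< m₁₂ (n ∘ sym))) (ch-head (ch-tail (rel-ch R′)))) (<⇒≢ m₁₂)
    ... | x₀ , bt , k with remove (ch-tail (ch-tail (ch-tail (rel-ch R)))) k
    ... | θ′ , h , l , s with twin-retail tw h (sym l) s
    ... | u′ , v′ , twin f b r r′ with btw-lt {true} m₁₂ bt
    ... | p , p′ = <ᵇ-false⁻ (trans (sym (trans (rel-sgn (rel-mv 0 r′) 0) (cong (λ W → C.sgn 0 (y₃ ∷ W)) (mvL {V = θ′} bt))))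
          (k4q (rel-good r′) (4≤ r′) (trans (rel-sgn r′ 0) (<ᵇ-false (<⇒≤ m₃₂))) (trans (rel-sgn r′ 1) (<ᵇ-true m₁₂))
             (trans (rel-sgn r′ 2) (<ᵇ-false (<⇒≤ p))) (trans (cong (sgn 2) b) (trans (rel-sgn r 2) (<ᵇ-false (<⇒≤ p))))))
    m₃₁ : y₃ < x₁
    m₃₁ = ≤∧≢ m₃₁′ (ch-≢₂ (rel-ch R′))
    y₃≡x₂ : y₃ ≡ x₂
    y₃≡x₂ = sym (same-cell true tw l₂₁ l₂₃ l₁₃ m₁₂ m₃₁)
    y₂≡x₃ : y₂ ≡ x₃
    y₂≡x₃ = same-cell false (twin-sym tw) m₁₂ m₃₂ m₃₁ l₂₁ l₁₃

  Ext : ℕ → Set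
  Ext n = ∀ {t α T} → length T ≡ n → n < N → Good (t ∷ α) → OK α T → ∃ λ c → OK (t ∷ α) (c ∷ T)

  module Extend (n : ℕ) (n<N : n < N) (ext : ∀ m → m < n → Ext m) where

    mv-short : ∀ u → length u ≤ 2 → mv 0 u ≡ u
    mv-short [] l = refl
    mv-short (_ ∷ []) l = refl
    mv-short (_ ∷ _ ∷ []) l = refl
    mv-short (_ ∷ _ ∷ _ ∷ _) (s≤s (s≤s ()))

    -- Two of the three cells come from extensions of smaller length; the third is available only as
    -- a cut, which is why `Rel` and not `OK` results.
    build : ∀ {r q p α θ} → length θ + 2 ≡ n → OK α θ → Good (r ∷ q ∷ p ∷ α) →
            ∃ λ y₃ → ∃ λ y₂ → ∃ λ y₁ → Rel (r ∷ q ∷ p ∷ α) (y₃ ∷ y₂ ∷ y₁ ∷ θ)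
    build {θ = θ} l o g
      with ext (length θ) (subst (length θ <_) n≡ (s≤s (n≤1+n _))) refl (<-trans (subst (length θ <_) n≡ (s≤s (n≤1+n _))) n<N) (good-tail (good-tail g)) o
      where
      n≡ : suc (suc (length θ)) ≡ n
      n≡ = trans (+-comm 2 (length θ)) l
    ... | y₁ , o₁ with ext (suc (length θ)) (subst (suc (length θ) <_) (trans (+-comm 2 (length θ)) l) ≤-refl) refl
                        (<-trans (subst (suc (length θ) <_) (trans (+-comm 2 (length θ)) l) ≤-refl) n<N) (good-tail g) o₁
    ... | y₂ , o₂ with cut-exists (subst (_< N) (sym (trans (+-comm 2 (length θ)) l)) n<N) g o₂
    ... | y₃ , x , k = y₃ , y₂ , y₁ , rel g o₂ x k

    build′ : ∀ {v r q p α θ} → v ≡ r ∷ q ∷ p ∷ α → length θ + 2 ≡ n → OK α θ → Good v →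
             ∃ λ y₃ → ∃ λ y₂ → ∃ λ y₁ → Rel v (y₃ ∷ y₂ ∷ y₁ ∷ θ)
    build′ refl = build

    mv-tail : ∀ {u v r q p α} → u ≡ r ∷ q ∷ p ∷ α → mv 0 u ≡ v → ∃ λ r′ → ∃ λ q′ → ∃ λ p′ → v ≡ r′ ∷ q′ ∷ p′ ∷ α
    mv-tail refl refl = _ , _ , _ , refl

    triple : ∀ (u : List A) {k} → length u ≡ suc (suc (suc k)) → ∃ λ r → ∃ λ q → ∃ λ p → ∃ λ α → u ≡ r ∷ q ∷ p ∷ α
    triple (r ∷ q ∷ p ∷ α) _ = r , q , p , α , refl

    rel-tail₃ : ∀ {u x₃ x₂ x₁ θ r q p α} → u ≡ r ∷ q ∷ p ∷ α → Rel u (x₃ ∷ x₂ ∷ x₁ ∷ θ) → OK α θ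
    rel-tail₃ refl R = ok-tail (ok-tail (rel-tail R))

    twinned : ∀ {u x₃ x₂ x₁ θ} v → length θ + 2 ≡ n → Rel u (x₃ ∷ x₂ ∷ x₁ ∷ θ) → mv 0 u ≡ v →
              ∃ λ y₃ → ∃ λ y₂ → ∃ λ y₁ → Twin u v x₃ x₂ x₁ y₃ y₂ y₁ θ
    twinned {u} {θ = θ} v l R f with triple u (rel-len R)
    ... | r , q , p , α , eu with mv-tail eu f
    ... | r′ , q′ , p′ , ev with build′ ev l (rel-tail₃ eu R) (subst Good f (good-mv 0 (rel-good R)))
    ... | y₃ , y₂ , y₁ , R′ = y₃ , y₂ , y₁ , twin f (trans (cong (mv 0) (sym f)) (invol 0 (rel-good R))) R R′

    -- The move turns a valley of ascents into a peak and conversely, so a peak is treated by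
    -- reading the twin backwards.
    turn : ∀ {u x₃ x₂ x₁ θ} → length θ + 2 ≡ n → Rel u (x₃ ∷ x₂ ∷ x₁ ∷ θ) → (x₂ <ᵇ x₃) ≡ not (x₁ <ᵇ x₂) →
           ∀ U → U ≡ C.mv 0 (x₃ ∷ x₂ ∷ x₁ ∷ θ) → Rel (mv 0 u) U
    turn {u} {x₃} {x₂} {x₁} {θ} l R e U eU with twinned (mv 0 u) l R refl
    ... | y₃ , y₂ , y₁ , tw = go (x₁ <ᵇ x₂) refl
      where
      go : ∀ b → (x₁ <ᵇ x₂) ≡ b → Rel (mv 0 u) U
      go false s₁ = subst (Rel (mv 0 u))
        (trans (valley tw (≤∧≢ (<ᵇ-false⁻ s₁) (ch-≢ (ch-tail (rel-ch R)))) (<ᵇ-true⁻ (trans e (cong not s₁)))) (sym eU)) (rv tw)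
      go true s₁ = subst (Rel (mv 0 u)) (trans eq (sym eU)) (rv tw)
        where
        s₀ = trans e (cong not s₁)
        fl = flip-sgn (rel-good R) (3≤ R) (trans (trans (rel-sgn R 0) s₀) (cong not (sym (trans (rel-sgn R 1) s₁))))
        down : y₂ < y₁
        down = ≤∧≢ (<ᵇ-false⁻ (trans (sym (rel-sgn (rv tw) 1)) (trans (proj₂ fl) (trans (rel-sgn R 0) s₀)))) (ch-≢ (ch-tail (rel-ch (rv tw))))
        up′ : y₂ < y₃
        up′ = <ᵇ-true⁻ (trans (sym (rel-sgn (rv tw) 0)) (trans (proj₁ fl) (trans (rel-sgn R 1) s₁)))
        eq : y₃ ∷ y₂ ∷ y₁ ∷ θ ≡ C.mv 0 (x₃ ∷ x₂ ∷ x₁ ∷ θ)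
        eq = trans (sym (mv-inv 0 (rel-ch (rv tw)))) (cong (C.mv 0) (sym (valley (twin-sym tw) down up′)))

    rel-mv₀ : ∀ {u U} → length U ≡ suc n → Rel u U → Rel (mv 0 u) (C.mv 0 U)
    rel-mv₀ {u} {_ ∷ []} l R = subst (λ z → Rel z _) (sym (mv-short u (≤-trans (≤-reflexive (rel-len R)) (s≤s z≤n)))) R
    rel-mv₀ {u} {_ ∷ _ ∷ []} l R = subst (λ z → Rel z _) (sym (mv-short u (≤-reflexive (rel-len R)))) R
    rel-mv₀ {u} {x₃ ∷ x₂ ∷ x₁ ∷ θ} l R with shape₃ (rel-ch R)
    ... | mono e = subst₂ Rel (sym (mv-mono (trans (rel-sgn R 0) (trans (sym e) (sym (rel-sgn R 1))))))
                     (sym (cong (λ t → C.put t θ) (tri-mono e))) R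
    ... | first e _ = turn (trans (+-comm (length θ) 2) (suc-injective l)) R e _ refl
    ... | last e _  = turn (trans (+-comm (length θ) 2) (suc-injective l)) R e _ refl

    rel-runs : ∀ ds {u U} → length U ≡ suc n → Rel u U → Rel (run ds u) (C.run ds U)
    rel-runs []           l R = R
    rel-runs (zero ∷ ds)  {u} {U} l R = rel-runs ds (trans (C.length-mv 0 U) l) (rel-mv₀ l R)
    rel-runs (suc d ∷ ds) {u} {U} l R = rel-runs ds (trans (C.length-mv (suc d) U) l) (rel-mv d R)

    extend : Ext n
    extend l _ g o with cut-exists (subst (_< N) (sym l) n<N) g o
    ... | c , x , k = c , ok g (x ∷ ch o) (cong suc (len o)) λ ds → rel-sgn (rel-runs ds (cong suc l) (rel g o x k))

  ext-below : ∀ n m → m < n → Ext m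
  ext-below (suc n) m (s≤s p) l q = Extend.extend m q (λ i i<m → ext-below n i (<-≤-trans i<m p)) l q

  recording : ∀ α → Good α → length α ≤ N → ∃ λ T → OK α T
  recording [] g l = [] , ok g [] refl λ ds i → trans (cong (sgn i) (run-[] ds)) (sym (cong (C.sgn i) (crun-[] ds)))
    where
    run-[] : ∀ ds → run ds [] ≡ []
    run-[] []             = refl
    run-[] (zero ∷ ds)    = run-[] ds
    run-[] (suc d ∷ ds)   = run-[] ds
    crun-[] : ∀ ds → C.run ds [] ≡ []
    crun-[] []            = refl
    crun-[] (zero ∷ ds)   = crun-[] ds
    crun-[] (suc d ∷ ds)  = crun-[] ds
  recording (t ∷ α) g l with recording α (good-tail g) (≤-trans (n≤1+n _) l)
  ... | T , o with ext-below (suc (length T)) (length T) ≤-refl refl (subst (_< N) (len o) l) g o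
  ... | c , o′ = c ∷ T , o′

  data Few (u v : List A) : Set where
    within : ∀ ds → run (map suc ds) u ≡ v → Few u v
    cross : ∀ ds es → run (map suc ds ++ 0 ∷ map suc es) u ≡ v → Few u v

  -- A walk keeps the shape of the recording chain. The chains at its two ends are therefore joined
  -- by a walk with at most one move at depth 0, and injectivity carries this to the words.
  few : ∀ {u} → Good u → length u ≤ N → ∀ ds → Few u (run ds u)
  few {u} g l ds with recording u g l
  ... | T , o with conn (length T) refl (C.length-run ds T) (ch o) (proj₁ (ch-run ds (ch o))) (λ j → sym (proj₂ (ch-run ds (ch o)) j))
  ... | within es e = within es (inj-eq′ o (map suc es) ds e)
  ... | cross es {b} {a} {x} {V} fs e bt e′ = cross es fs (inj-eq′ o (map suc es ++ 0 ∷ map suc fs) ds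
          (trans (C.run-++ (map suc es) (0 ∷ map suc fs) T) (trans (cong (C.run (map suc fs)) (trans (cong (C.mv 0) e) (mvL (btw-sym bt)))) e′)))
 

-- A window of a word is recorded by the ranks p of its letters among the M
-- distinct letters that occur, and by the booleans gl telling which letters
-- at rank distance two are close; no others are once the diameter is at most 3.
bump : ℕ → ℕ → ℕ
bump a x = if x <ᵇ a then x else suc x

grow : ℕ × List ℕ → List (ℕ × List ℕ)
grow (M , p) = map (λ a → M , a ∷ p) (upTo M) ++ map (λ a → suc M , a ∷ map (bump a) p) (upTo (suc M))

patterns : ℕ → List (ℕ × List ℕ)
patterns zero    = (0 , []) ∷ []
patterns (suc m) = concatMap grow (patterns m)

gaps : ℕ → List (List Bool)
gaps zero    = [] ∷ []
gaps (suc n) = map (true ∷_) (gaps n) ++ map (false ∷_) (gaps n)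

at : List Bool → ℕ → Bool
at []       _       = false
at (b ∷ _)  zero    = b
at (_ ∷ bs) (suc i) = at bs i

-- Adjacent ranks count as not close, which does no harm: a move asks for the closeness of two
-- letters only when the third one lies strictly between them.
close : List Bool → ℕ → ℕ → Bool
close gl x z = ((z ≡ᵇ 2 + x) ∧ at gl x) ∨ ((x ≡ᵇ 2 + z) ∧ at gl z)

-- The neighbours of rank `l` on both sides are not close; at rank 0 there is no lower neighbour.
notPred : List Bool → ℕ → Bool
notPred gl zero    = true
notPred gl (suc l) = not (at gl l)

-- lo and hi stand for t − k and t + k.
tie : List Bool → ℕ → ℕ → ℕ → Bool
tie gl t lo hi =
  (((suc lo ≡ᵇ t) ∧ notPred gl lo) ∨ ((2 + lo ≡ᵇ t) ∧ at gl lo)) ∧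
  (((hi ≡ᵇ suc t) ∧ not (at gl t)) ∨ ((hi ≡ᵇ 2 + t) ∧ at gl t)) ∧
  (if (suc lo ≡ᵇ t) ∨ (hi ≡ᵇ suc t) then notPred gl t else true)

anyᵇ : {A : Set} → (A → Bool) → List A → Bool
anyᵇ P []       = false
anyᵇ P (x ∷ xs) = P x ∨ anyᵇ P xs

allᵇ : {A : Set} → (A → Bool) → List A → Bool
allᵇ P []       = true
allᵇ P (x ∷ xs) = P x ∧ allᵇ P xs

-- Between two successive occurrences of a content, the contents smaller and larger by k must occur:
-- they belong to the cells above and to the right of the earlier cell.
tied : List Bool → ℕ → List ℕ → List ℕ → Bool
tied gl t between []      = true
tied gl t between (x ∷ p) =
  if x ≡ᵇ t then anyᵇ (λ lo → anyᵇ (tie gl t lo) between) between else tied gl t (x ∷ between) p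

valid : List Bool → List ℕ → Bool
valid gl []      = true
valid gl (t ∷ p) = tied gl t [] p ∧ valid gl p

module R (gl : List Bool) = Walks _<ᵇ_ (close gl)

-- Local laws as Boolean statements over all patterns.

Hyp : Set
Hyp = List ℕ × ℕ × Bool

data Claim : Set where
  walks : List ℕ → List ℕ → Claim
  sign  : List ℕ → ℕ → Bool → Claim
  signs : List ℕ → ℕ → List ℕ → ℕ → Claim

eqList : List ℕ → List ℕ → Bool
eqList []       []       = true
eqList (x ∷ xs) (y ∷ ys) = (x ≡ᵇ y) ∧ eqList xs ys
eqList _        _        = false

holds : List Bool → List ℕ → Hyp → Bool
holds gl p (ds , i , b) = R.sgn gl i (R.run gl ds p) == b

claims : List Bool → List ℕ → Claim → Bool
claims gl p (walks ds es)     = eqList (R.run gl ds p) (R.run gl es p)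
claims gl p (sign ds i b)     = R.sgn gl i (R.run gl ds p) == b
claims gl p (signs ds i es j) = R.sgn gl i (R.run gl ds p) == R.sgn gl j (R.run gl es p)

_⇒_ : Bool → Bool → Bool
a ⇒ b = if a then b else true

-- Ascents do not depend on closeness, so this test can use an empty `gl` and discard a pattern
-- before the bit lists are enumerated.
starts : ℕ → List Bool → List ℕ → Bool
starts i []       p = true
starts i (s ∷ ss) p = (R.sgn [] i p == s) ∧ starts (suc i) ss p

deep : ℕ → List ℕ → Bool
deep m = allᵇ (λ d → 2 + d <ᵇ m)

fitsHyp : ℕ → Hyp → Bool
fitsHyp m (ds , i , b) = deep m ds ∧ (suc i <ᵇ m)

fits : ℕ → Claim → Bool
fits m (walks ds es)     = deep m ds ∧ deep m es
fits m (sign ds i b)     = deep m ds ∧ (suc i <ᵇ m)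
fits m (signs ds i es j) = deep m ds ∧ (suc i <ᵇ m) ∧ deep m es ∧ (suc j <ᵇ m)

-- Among `M` ranks there are `M ∸ 2` pairs at distance two, with one bit for each.
everyWindow : ℕ → (ℕ → List ℕ → Bool) → (List Bool → List ℕ → Bool) → Bool
everyWindow m pre P = allᵇ (λ Mp → pre (proj₁ Mp) (proj₂ Mp) ⇒ allᵇ (λ gl → valid gl (proj₂ Mp) ⇒ P gl (proj₂ Mp)) (gaps (proj₁ Mp ∸ 2))) (patterns m)

law : ℕ → List Bool → List Hyp → Claim → Bool
law m ss hs c = (length ss <ᵇ m) ∧ allᵇ (fitsHyp m) hs ∧ fits m c ∧
  everyWindow m (λ _ → starts 0 ss) (λ gl p → allᵇ (holds gl p) hs ⇒ claims gl p c)

-- A record, so that the evaluation takes place where a law is declared while its uses compare only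
-- the parameters.
record Law (m : ℕ) (ss : List Bool) (hs : List Hyp) (c : Claim) : Set where
  constructor by
  field
    checked : law m ss hs c ≡ true

mon-law : Law 4 (false ∷ false ∷ true ∷ []) [] (sign (1 ∷ []) 0 false)
mon-law = by refl

k4d-law : ∀ o → Law 4 (o ∷ not o ∷ o ∷ []) ((1 ∷ [] , 0 , not o) ∷ []) (walks (0 ∷ []) (1 ∷ []))
k4d-law true  = by refl
k4d-law false = by refl

k4n-law : Law 4 (true ∷ false ∷ true ∷ []) ((1 ∷ [] , 0 , true) ∷ []) (sign (0 ∷ []) 2 true)
k4n-law = by refl

k4m-law : ∀ o → Law 4 (o ∷ not o ∷ not o ∷ []) [] (sign (0 ∷ []) 2 (not o))
k4m-law true  = by refl
k4m-law false = by refl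

k4q-law : Law 4 (false ∷ true ∷ false ∷ []) ((0 ∷ [] , 2 , false) ∷ []) (sign (1 ∷ []) 0 false)
k4q-law = by refl

k4a-law : ∀ o → Law 4 (o ∷ o ∷ not o ∷ []) [] (sign (1 ∷ []) 0 o)
k4a-law true  = by refl
k4a-law false = by refl

k5e-law : ∀ o → Law 5 (o ∷ not o ∷ o ∷ not o ∷ []) ((1 ∷ [] , 0 , o) ∷ []) (signs (2 ∷ []) 1 (0 ∷ 2 ∷ 1 ∷ []) 0)
k5e-law true  = by refl
k5e-law false = by refl

k5l-law : ∀ o → Law 5 (o ∷ not o ∷ not o ∷ o ∷ []) ((2 ∷ 1 ∷ [] , 0 , o) ∷ []) (walks (2 ∷ 0 ∷ []) (0 ∷ 2 ∷ []))
k5l-law true  = by refl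
k5l-law false = by refl

k6a-law : ∀ o → Law 6 (o ∷ not o ∷ o ∷ not o ∷ o ∷ []) ((3 ∷ [] , 2 , not o) ∷ [])
                  (walks (1 ∷ 3 ∷ 2 ∷ 0 ∷ []) (0 ∷ 3 ∷ 1 ∷ 3 ∷ 2 ∷ 0 ∷ 2 ∷ 1 ∷ 3 ∷ 2 ∷ []))
k6a-law true  = by refl
k6a-law false = by refl

k6b-law : ∀ o → Law 6 (o ∷ not o ∷ not o ∷ o ∷ o ∷ []) []
                  (walks (2 ∷ 1 ∷ 3 ∷ 2 ∷ 0 ∷ []) (0 ∷ 2 ∷ 3 ∷ 1 ∷ 0 ∷ 3 ∷ 1 ∷ 3 ∷ 2 ∷ []))
k6b-law true  = by refl
k6b-law false = by refl

flip₀-law : ∀ o → Law 3 (o ∷ not o ∷ []) [] (sign (0 ∷ []) 0 (not o))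
flip₀-law true  = by refl
flip₀-law false = by refl

flip₁-law : ∀ o → Law 3 (o ∷ not o ∷ []) [] (sign (0 ∷ []) 1 o)
flip₁-law true  = by refl
flip₁-law false = by refl

invol-law : Law 3 [] [] (walks (0 ∷ 0 ∷ []) [])
invol-law = by refl

-- Transfer of the checked laws from patterns to words.

∧-true⁻ : ∀ {a b} → a ∧ b ≡ true → a ≡ true × b ≡ true
∧-true⁻ {true} {true} _ = refl , refl

∧-true⁺ : ∀ {a b} → a ≡ true → b ≡ true → a ∧ b ≡ true
∧-true⁺ refl refl = refl

∨-trueˡ : ∀ {a b} → a ≡ true → a ∨ b ≡ true
∨-trueˡ refl = refl

∨-trueʳ : ∀ {a b} → b ≡ true → a ∨ b ≡ true
∨-trueʳ {true}  _ = refl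
∨-trueʳ {false} e = e

≡ᵇ-refl : ∀ n → (n ≡ᵇ n) ≡ true
≡ᵇ-refl zero    = refl
≡ᵇ-refl (suc n) = ≡ᵇ-refl n

≡ᵇ-≢ : ∀ {m n} → m ≢ n → (m ≡ᵇ n) ≡ false
≡ᵇ-≢ {zero}  {zero}  n = ⊥-elim (n refl)
≡ᵇ-≢ {zero}  {suc _} _ = refl
≡ᵇ-≢ {suc _} {zero}  _ = refl
≡ᵇ-≢ {suc m} {suc k} n = ≡ᵇ-≢ {m} {k} (n ∘ cong suc)

≡ᵇ-true⁻ : ∀ {m n} → (m ≡ᵇ n) ≡ true → m ≡ n
≡ᵇ-true⁻ {m} {n} e with m ≟ n
... | yes p = p
... | no p = ⊥-elim (clash e (≡ᵇ-≢ p))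

==⇒≡ : ∀ {a b} → (a == b) ≡ true → a ≡ b
==⇒≡ {true}  {true}  _ = refl
==⇒≡ {false} {false} _ = refl

≡⇒== : ∀ {a b} → a ≡ b → (a == b) ≡ true
≡⇒== {true}  refl = refl
≡⇒== {false} refl = refl

⇒-mp : ∀ {a b} → (a ⇒ b) ≡ true → a ≡ true → b ≡ true
⇒-mp e refl = e

eqList⇒≡ : ∀ xs ys → eqList xs ys ≡ true → xs ≡ ys
eqList⇒≡ []       []       _ = refl
eqList⇒≡ (x ∷ xs) (y ∷ ys) e with ∧-true⁻ {x ≡ᵇ y} e
... | a , b = cong₂ _∷_ (≡ᵇ-true⁻ a) (eqList⇒≡ xs ys b)

anyᵇ-∈ : ∀ {A : Set} {P : A → Bool} {x xs} → x ∈ xs → P x ≡ true → anyᵇ P xs ≡ true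
anyᵇ-∈ (here refl) e = ∨-trueˡ e
anyᵇ-∈ {P = P} {xs = y ∷ _} (there i) e = ∨-trueʳ {P y} (anyᵇ-∈ i e)

allᵇ-∈ : ∀ {A : Set} {P : A → Bool} {x xs} → allᵇ P xs ≡ true → x ∈ xs → P x ≡ true
allᵇ-∈ {P = P} {xs = y ∷ _} e (here refl) = proj₁ (∧-true⁻ {P y} e)
allᵇ-∈ {P = P} {xs = y ∷ _} e (there i)   = allᵇ-∈ (proj₂ (∧-true⁻ {P y} e)) i

table : (ℕ → Bool) → ℕ → List Bool
table h zero    = []
table h (suc n) = h 0 ∷ table (h ∘ suc) n

at-table : ∀ h n x → x < n → at (table h n) x ≡ h x
at-table h (suc n) zero    _       = refl
at-table h (suc n) (suc x) (s≤s l) = at-table (h ∘ suc) n x l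

at-beyond : ∀ h n x → n ≤ x → at (table h n) x ≡ false
at-beyond h zero    x       _       = refl
at-beyond h (suc n) (suc x) (s≤s l) = at-beyond (h ∘ suc) n x l

table∈gaps : ∀ h n → table h n ∈ gaps n
table∈gaps h zero    = here refl
table∈gaps h (suc n) with h 0
... | true  = ∈-++⁺ˡ (∈-map⁺ (true ∷_) (table∈gaps (h ∘ suc) n))
... | false = ∈-++⁺ʳ (map (true ∷_) (gaps n)) (∈-map⁺ (false ∷_) (table∈gaps (h ∘ suc) n))

bump-< : ∀ {a x} → x < a → bump a x ≡ x
bump-< l rewrite <ᵇ-true l = refl

bump-≥ : ∀ {a x} → a ≤ x → bump a x ≡ suc x
bump-≥ l rewrite <ᵇ-false l = refl

-- What the patterns retain of `lo` = t - k and `hi` = t + k: they are the farthest letters close to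
-- `t` on either side, and `t` is the farthest letter close to each of them in its direction.
record IsTie {A : Set} (lt cl : A → A → Bool) (lo t hi : A) : Set where
  field
    lo<t    : lt lo t ≡ true
    t<hi    : lt t hi ≡ true
    lo-t    : cl lo t ≡ true
    t-hi    : cl t hi ≡ true
    below   : ∀ x → lt x lo ≡ true → cl x t ≡ false
    above   : ∀ x → lt hi x ≡ true → cl t x ≡ false
    lo-wide : ∀ y → lt t y ≡ true → cl lo y ≡ false
    hi-wide : ∀ x → lt x t ≡ true → cl x hi ≡ false

-- There are two instances: shifted contents, when the diameter is at most 3, and positions in
-- permutations, where no letters are close and none repeat.
record Letters : Set₁ where
  field
    A     : Set
    lt cl : A → A → Bool
    lt-irr : ∀ x → lt x x ≡ false
    lt-tr  : ∀ {x y z} → lt x y ≡ true → lt y z ≡ true → lt x z ≡ true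
    lt-tri : ∀ x y → lt x y ≡ true ⊎ x ≡ y ⊎ lt y x ≡ true
    cl-sym : ∀ x y → cl x y ≡ cl y x
    Good   : List A → Set
  open Walks lt cl
  field
    good-mv   : ∀ d {u} → Good u → Good (mv d u)
    good-tail : ∀ {t u} → Good (t ∷ u) → Good u
    distinct  : ∀ {r q p α} → Good (r ∷ q ∷ p ∷ α) → p ≢ q × q ≢ r × p ≢ r
    narrow    : ∀ {u a b c d} → Good u → a ∈ u → b ∈ u → c ∈ u → d ∈ u →
                lt a b ≡ true → lt b c ≡ true → lt c d ≡ true → cl a d ≡ false
    tie-gap   : ∀ {t β γ} → Good (t ∷ β ++ t ∷ γ) → t ∉ β →
                ∃ λ lo → ∃ λ hi → lo ∈ β × hi ∈ β × IsTie lt cl lo t hi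

module Windows (L : Letters) where
  open Letters L
  open Walks lt cl

  Increasing : ℕ → (ℕ → A) → Set
  Increasing M f = ∀ {x y} → x < y → y < M → lt (f x) (f y) ≡ true

  -- The map `f` turns ranks into letters, and `β` is the part of the word older than its `m` latest
  -- letters.
  record Window (m : ℕ) (u : List A) : Set where
    field
      M      : ℕ
      f      : ℕ → A
      p      : List ℕ
      β      : List A
      split  : u ≡ map f p ++ β
      len    : length p ≡ m
      small  : All (_< M) p
      incr   : Increasing M f
      used   : ∀ x → x < M → x ∈ p
      listed : (M , p) ∈ patterns m

  locate : ∀ M f → Increasing M f → ∀ l → (∃ λ a → a < M × f a ≡ l) ⊎
           (∃ λ a → a ≤ M × (∀ x → x < a → lt (f x) l ≡ true) × (∀ x → a ≤ x → x < M → lt l (f x) ≡ true))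
  locate zero f inc l = inj₂ (0 , z≤n , (λ x ()) , λ x _ ())
  locate (suc M) f inc l with lt-tri (f M) l
  ... | inj₂ (inj₁ e) = inj₁ (M , ≤-refl , e)
  ... | inj₁ q = inj₂ (suc M , ≤-refl , (λ x x<M → case m≤n⇒m<n∨m≡n (≤-pred x<M) of λ
          { (inj₁ y) → lt-tr (inc y ≤-refl) q ; (inj₂ refl) → q }) , λ x a b → ⊥-elim (<-irrefl refl (<-≤-trans b a)))
  ... | inj₂ (inj₂ q) with locate M f (λ x y → inc x (<-trans y (n<1+n M))) l
  ... | inj₁ (a , a<M , e) = inj₁ (a , <-trans a<M (n<1+n M) , e)
  ... | inj₂ (a , a≤M , lo , hi) = inj₂ (a , ≤-trans a≤M (n≤1+n M) , lo , λ x a≤x x<M → case m≤n⇒m<n∨m≡n (≤-pred x<M) of λ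
          { (inj₁ y) → hi x a≤x y ; (inj₂ refl) → q })

  insert : ℕ → A → (ℕ → A) → ℕ → A
  insert a l f x = if x <ᵇ a then f x else if x ≡ᵇ a then l else f (pred x)

  insert-< : ∀ {a l f x} → x < a → insert a l f x ≡ f x
  insert-< p rewrite <ᵇ-true p = refl

  insert-≡ : ∀ {a l f} → insert a l f a ≡ l
  insert-≡ {a} rewrite <ᵇ-false (≤-refl {a}) | ≡ᵇ-refl a = refl

  insert-> : ∀ {a l f x} → a ≤ x → insert a l f (suc x) ≡ f x
  insert-> {a} {x = x} p rewrite <ᵇ-false (≤-trans p (n≤1+n x)) | ≡ᵇ-≢ {suc x} {a} (λ e → <-irrefl (sym e) (s≤s p)) = refl

  insert-bump : ∀ a l f x → insert a l f (bump a x) ≡ f x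
  insert-bump a l f x with x <? a
  ... | yes p = trans (cong (insert a l f) (bump-< p)) (insert-< {a} {l} {f} p)
  ... | no p  = trans (cong (insert a l f) (bump-≥ (≮⇒≥ p))) (insert-> {a} {l} {f} (≮⇒≥ p))

  insert-incr : ∀ {M f a l} → Increasing M f → a ≤ M → (∀ x → x < a → lt (f x) l ≡ true) →
                (∀ x → a ≤ x → x < M → lt l (f x) ≡ true) → Increasing (suc M) (insert a l f)
  insert-incr {M} {f} {a} {l} inc a≤M lo hi {x} {y} x<y y<M with <-cmp x a | <-cmp y a
  ... | tri< p _ _ | tri< q _ _ = trans (cong₂ lt (insert-< {l = l} {f} p) (insert-< {l = l} {f} q)) (inc x<y (<-≤-trans q a≤M))
  ... | tri< p _ _ | tri≈ _ refl _ = trans (cong₂ lt (insert-< {l = l} {f} p) (insert-≡ {a} {l} {f})) (lo x p)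
  insert-incr {M} {f} {a} {l} inc a≤M lo hi {x} {suc y} x<y y<M | tri< p _ _ | tri> _ _ q =
    trans (cong₂ lt (insert-< {l = l} {f} p) (insert-> {a} {l} {f} (≤-pred q))) (lt-tr (lo x p) (hi y (≤-pred q) (≤-pred y<M)))
  insert-incr {M} {f} {a} {l} inc a≤M lo hi {x} {y} x<y y<M | tri≈ _ refl _ | tri< q _ _ = ⊥-elim (<-asym x<y q)
  insert-incr {M} {f} {a} {l} inc a≤M lo hi {x} {y} x<y y<M | tri≈ _ refl _ | tri≈ _ refl _ = ⊥-elim (<-irrefl refl x<y)
  insert-incr {M} {f} {a} {l} inc a≤M lo hi {x} {suc y} x<y y<M | tri≈ _ refl _ | tri> _ _ q =
    trans (cong₂ lt (insert-≡ {a} {l} {f}) (insert-> {a} {l} {f} (≤-pred q))) (hi y (≤-pred q) (≤-pred y<M))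
  insert-incr {M} {f} {a} {l} inc a≤M lo hi {x} {y} x<y y<M | tri> _ _ p | tri< q _ _ = ⊥-elim (<-asym x<y (<-trans q p))
  insert-incr {M} {f} {a} {l} inc a≤M lo hi {x} {y} x<y y<M | tri> _ _ p | tri≈ _ refl _ = ⊥-elim (<-asym x<y p)
  insert-incr {M} {f} {a} {l} inc a≤M lo hi {suc x} {suc y} x<y y<M | tri> _ _ p | tri> _ _ q =
    trans (cong₂ lt (insert-> {a} {l} {f} (≤-pred p)) (insert-> {a} {l} {f} (≤-pred q))) (inc (≤-pred x<y) (≤-pred y<M))

  window : A → ∀ m u → m ≤ length u → Window m u
  window a₀ zero u _ = record { M = 0 ; f = λ _ → a₀ ; p = [] ; β = u ; split = refl ; len = refl ; small = []
    ; incr = λ _ () ; used = λ x () ; listed = here refl }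
  window a₀ (suc m) (l ∷ u) (s≤s q) with window a₀ m u q
  ... | w = go (locate M f incr l)
    where
    open Window w
    go : _ → Window (suc m) (l ∷ u)
    go (inj₁ (a , a<M , e)) = record { M = M ; f = f ; p = a ∷ p ; β = β ; split = cong₂ _∷_ (sym e) split
      ; len = cong suc len ; small = a<M ∷ small ; incr = incr ; used = λ x x<M → there (used x x<M)
      ; listed = ∈-concatMap⁺ grow (lose listed (∈-++⁺ˡ (∈-map⁺ (λ a → M , a ∷ p) (∈-upTo⁺ a<M)))) }
    go (inj₂ (a , a≤M , lo , hi)) = record { M = suc M ; f = insert a l f ; p = a ∷ map (bump a) p ; β = β
      ; split = cong₂ _∷_ (sym (insert-≡ {a} {l} {f})) (trans split (cong (_++ β) (sym (map-bump p))))
      ; len = cong suc (trans (length-map (bump a) p) len) ; small = s≤s a≤M ∷ all-bump small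
      ; incr = insert-incr incr a≤M lo hi ; used = used′
      ; listed = ∈-concatMap⁺ grow (lose listed (∈-++⁺ʳ (map (λ a → M , a ∷ p) (upTo M))
                   (∈-map⁺ (λ a → suc M , a ∷ map (bump a) p) (∈-upTo⁺ (s≤s a≤M))))) }
      where
      map-bump : ∀ p → map (insert a l f) (map (bump a) p) ≡ map f p
      map-bump []      = refl
      map-bump (x ∷ p) = cong₂ _∷_ (insert-bump a l f x) (map-bump p)
      all-bump : ∀ {p} → All (_< M) p → All (_< suc M) (map (bump a) p)
      all-bump []       = []
      all-bump {x ∷ p} (q ∷ qs) = bound ∷ all-bump qs
        where
        bound : bump a x < suc M
        bound with x <ᵇ a
        ... | true  = <-trans q (n<1+n M)
        ... | false = s≤s q
      used′ : ∀ x → x < suc M → x ∈ a ∷ map (bump a) p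
      used′ x x<M with <-cmp x a
      ... | tri≈ _ refl _ = here refl
      ... | tri< q _ _ = there (subst (_∈ map (bump a) p) (bump-< q) (∈-map⁺ (bump a) (used x (<-≤-trans q a≤M))))
      used′ (suc x) x<M | tri> _ _ q = there (subst (_∈ map (bump a) p) (bump-≥ (≤-pred q)) (∈-map⁺ (bump a) (used x (≤-pred x<M))))

  module Read {m u} (g : Good u) (w : Window m u) where
    open Window w public

    gl : List Bool
    gl = table (λ x → cl (f x) (f (2 + x))) (M ∸ 2)

    module P = Walks _<ᵇ_ (close gl)

    gl∈ : gl ∈ gaps (M ∸ 2)
    gl∈ = table∈gaps _ (M ∸ 2)

    at-gl : ∀ x → 2 + x < M → at gl x ≡ cl (f x) (f (2 + x))
    at-gl x l = at-table (λ x → cl (f x) (f (2 + x))) (M ∸ 2) x (∸-monoˡ-≤ 2 l)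

    lt-f : ∀ {x y} → x < M → y < M → lt (f x) (f y) ≡ (x <ᵇ y)
    lt-f {x} {y} lx ly with <-cmp x y
    ... | tri< l _ _ = trans (incr l ly) (sym (<ᵇ-true l))
    ... | tri≈ _ refl _ = trans (lt-irr (f x)) (sym (<ᵇ-false (≤-refl {x})))
    ... | tri> _ _ l with lt (f x) (f y) in e
    ... | false = sym (<ᵇ-false (<⇒≤ l))
    ... | true = ⊥-elim (clash (lt-tr e (incr l lx)) (lt-irr (f x)))

    f-inj : ∀ {x y} → x < M → y < M → f x ≡ f y → x ≡ y
    f-inj {x} {y} lx ly e with <-cmp x y
    ... | tri< l _ _ = ⊥-elim (clash (incr l ly) (trans (cong (lt (f x)) (sym e)) (lt-irr (f x))))
    ... | tri≈ _ p _ = p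
    ... | tri> _ _ l = ⊥-elim (clash (incr l lx) (trans (cong (lt (f y)) e) (lt-irr (f y))))

    occurs : ∀ {x} → x < M → f x ∈ u
    occurs l = subst (_ ∈_) (sym split) (∈-++⁺ˡ (∈-map⁺ f (used _ l)))

    -- Every rank below `M` occurs in the word, so letters three or more ranks apart have two
    -- further letters between them and `narrow` forbids closeness.
    close-f : ∀ {x z} → 2 + x ≤ z → z < M → cl (f x) (f z) ≡ close gl x z
    close-f {x} {z} l lz rewrite ≡ᵇ-≢ {x} {2 + z} (λ e → <-irrefl e (<-trans (<-≤-trans (s≤s (n≤1+n x)) l) (<-trans (n<1+n z) (n<1+n (suc z)))))
      with m≤n⇒m<n∨m≡n l
    ... | inj₂ refl rewrite ≡ᵇ-refl x = trans (sym (at-gl x lz)) (sym (∨-false (at gl x)))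
      where
      ∨-false : ∀ b → b ∨ false ≡ b
      ∨-false true  = refl
      ∨-false false = refl
    ... | inj₁ q rewrite ≡ᵇ-≢ {z} {2 + x} (λ e → <-irrefl (sym e) q) =
      narrow g (occurs (<-trans (<-≤-trans (s≤s (n≤1+n x)) l) lz)) (occurs (<-trans l lz)) (occurs (<-trans q lz)) (occurs lz)
        (incr (n<1+n x) (<-trans l lz)) (incr (n<1+n (suc x)) (<-trans q lz)) (incr q lz)

    gap-true : ∀ {x z} → 2 + x ≤ z → z < M → cl (f x) (f z) ≡ true → z ≡ 2 + x × at gl x ≡ true
    gap-true {x} {z} l lz e with m≤n⇒m<n∨m≡n l
    ... | inj₂ refl = refl , trans (at-gl x lz) e
    ... | inj₁ q = ⊥-elim (clash e
      (narrow g (occurs (<-trans (<-≤-trans (s≤s (n≤1+n x)) l) lz)) (occurs (<-trans l lz)) (occurs (<-trans q lz)) (occurs lz)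
        (incr (n<1+n x) (<-trans l lz)) (incr (n<1+n (suc x)) (<-trans q lz)) (incr q lz)))

    close-sym : ∀ x z → close gl x z ≡ close gl z x
    close-sym x z = ∨-comm ((z ≡ᵇ 2 + x) ∧ at gl x) ((x ≡ᵇ 2 + z) ∧ at gl z)
      where open import Data.Bool.Properties using (∨-comm)

    close-f′ : ∀ {x z} → 2 + z ≤ x → x < M → cl (f x) (f z) ≡ close gl x z
    close-f′ {x} {z} l lx = trans (cl-sym (f x) (f z)) (trans (close-f l lx) (close-sym z x))

    map₃ : ℕ × ℕ × ℕ → A × A × A
    map₃ (x , y , z) = f x , f y , f z

    if-map : ∀ b {x y : ℕ × ℕ × ℕ} → (if b then map₃ x else map₃ y) ≡ map₃ (if b then x else y)
    if-map true  = refl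
    if-map false = refl

    tri-f : ∀ {p q r} → p < M → q < M → r < M → p ≢ q → q ≢ r → p ≢ r →
            tri (f p) (f q) (f r) ≡ map₃ (P.tri p q r)
    tri-f {p} {q} {r} lp lq lr n₁ n₂ n₃ rewrite lt-f lp lq | lt-f lq lr | lt-f lp lr
      with p <ᵇ q in e₁ | q <ᵇ r in e₂ | p <ᵇ r in e₃
    ... | true | true | _ = refl
    ... | false | false | _ = refl
    ... | true | false | true rewrite close-f {p} {q} (≤-trans (s≤s (<ᵇ-true⁻ e₃)) (≤∧≢⇒< (<ᵇ-false⁻ e₂) (n₂ ∘ sym))) lq =
          if-map (close gl p q)
    ... | true | false | false rewrite close-f′ {q} {r} (≤-trans (s≤s (≤∧≢⇒< (<ᵇ-false⁻ e₃) (n₃ ∘ sym))) (<ᵇ-true⁻ e₁)) lq =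
          if-map (close gl q r)
    ... | false | true | true rewrite close-f {q} {r} (≤-trans (s≤s (≤∧≢⇒< (<ᵇ-false⁻ e₁) (n₁ ∘ sym))) (<ᵇ-true⁻ e₃)) lr =
          if-map (close gl q r)
    ... | false | true | false rewrite close-f′ {p} {q} (≤-trans (s≤s (<ᵇ-true⁻ e₂)) (≤∧≢⇒< (<ᵇ-false⁻ e₃) (n₃ ∘ sym))) lp =
          if-map (close gl p q)

    small-tri : ∀ {p q r} → p < M → q < M → r < M → let (a , b , c) = P.tri p q r in c < M × b < M × a < M
    small-tri {p} {q} {r} lp lq lr with (p <ᵇ q) == (q <ᵇ r) | (p <ᵇ q) == (p <ᵇ r) | close gl p q | close gl q r
    ... | true  | _     | _     | _     = lr , lq , lp
    ... | false | true  | true  | _     = lq , lp , lr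
    ... | false | true  | false | _     = lr , lp , lq
    ... | false | false | _     | true  = lp , lr , lq
    ... | false | false | _     | false = lq , lr , lp

    small-mv : ∀ d {p} → All (_< M) p → All (_< M) (P.mv d p)
    small-mv zero []              = []
    small-mv zero (a ∷ [])        = a ∷ []
    small-mv zero (a ∷ b ∷ [])    = a ∷ b ∷ []
    small-mv zero (a ∷ b ∷ c ∷ s) = let x , y , z = small-tri c b a in x ∷ y ∷ z ∷ s
    small-mv (suc d) []      = []
    small-mv (suc d) (a ∷ s) = a ∷ small-mv d s

    mv-f : ∀ d {p β} → All (_< M) p → 2 + d < length p → Good (map f p ++ β) →
           mv d (map f p ++ β) ≡ map f (P.mv d p) ++ β
    mv-f zero {r ∷ q ∷ p ∷ _} {β} (a ∷ b ∷ c ∷ s) _ g with distinct g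
    ... | n₁ , n₂ , n₃ = cong (λ t → put t (map f _ ++ β)) (tri-f c b a (n₁ ∘ cong f) (n₂ ∘ cong f) (n₃ ∘ cong f))
    mv-f zero {[]} _ ()
    mv-f zero {_ ∷ []} _ (s≤s ())
    mv-f zero {_ ∷ _ ∷ []} _ (s≤s (s≤s ()))
    mv-f (suc d) {_ ∷ p} (a ∷ s) (s≤s l) g = cong (_ ∷_) (mv-f d s l (good-tail g))

    run-f : ∀ ds {p β} → All (_< M) p → deep (length p) ds ≡ true → Good (map f p ++ β) →
            run ds (map f p ++ β) ≡ map f (P.run ds p) ++ β
    run-f [] s l g = refl
    run-f (d ∷ ds) {p} {β} s l g with ∧-true⁻ {2 + d <ᵇ length p} l
    ... | a , b with mv-f d {β = β} s (<ᵇ-true⁻ a) g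
    ... | e = trans (cong (run ds) e) (run-f ds (small-mv d s) (subst (λ n → deep n ds ≡ true) (sym (P.length-mv d p)) b)
                (subst Good e (good-mv d g)))

    sgn-f : ∀ i {p β} → All (_< M) p → suc i < length p → sgn i (map f p ++ β) ≡ P.sgn i p
    sgn-f zero {x ∷ y ∷ p} (a ∷ b ∷ s) _ = lt-f b a
    sgn-f (suc i) {x ∷ p} (a ∷ s) (s≤s l) = sgn-f i s l
    sgn-f zero {_ ∷ []} _ (s≤s ())

    small-run : ∀ ds {p} → All (_< M) p → All (_< M) (P.run ds p)
    small-run [] s = s
    small-run (d ∷ ds) s = small-run ds (small-mv d s)

    good-p : Good (map f p ++ β)
    good-p = subst Good split g

    run-u : ∀ ds → deep m ds ≡ true → run ds u ≡ map f (P.run ds p) ++ β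
    run-u ds l = trans (cong (run ds) split) (run-f ds small (subst (λ n → deep n ds ≡ true) (sym len) l) good-p)

    sgn-u : ∀ ds i → deep m ds ≡ true → suc i < m → sgn i (run ds u) ≡ P.sgn i (P.run ds p)
    sgn-u ds i l l′ = trans (cong (sgn i) (run-u ds l))
      (sgn-f i (small-run ds small) (subst (suc i <_) (sym (trans (P.length-run ds p) len)) l′))

    module _ {t lo hi} (lt′ : t < M) (llo : lo < M) (lhi : hi < M) (T : IsTie lt cl (f lo) (f t) (f hi)) where
      open IsTie T

      lo<t′ : lo < t
      lo<t′ = <ᵇ-true⁻ (trans (sym (lt-f llo lt′)) lo<t)

      t<hi′ : t < hi
      t<hi′ = <ᵇ-true⁻ (trans (sym (lt-f lt′ lhi)) t<hi)

      -- Being close to `t`, the letters t - k and t + k are at most two ranks away. If one of them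
      -- is adjacent to `t`, the two neighbours of `t` are not close to each other, since the reach
      -- of that one ends exactly at `t`.
      is-tie : tie gl t lo hi ≡ true
      is-tie = ∧-true⁺ low (∧-true⁺ high middle)
        where
        low : ((suc lo ≡ᵇ t) ∧ notPred gl lo) ∨ ((2 + lo ≡ᵇ t) ∧ at gl lo) ≡ true
        low with m≤n⇒m<n∨m≡n lo<t′
        ... | inj₂ refl = ∨-trueˡ (∧-true⁺ (≡ᵇ-refl lo) (pr lo refl))
          where
          pr : ∀ x → x ≡ lo → notPred gl x ≡ true
          pr zero    _ = refl
          pr (suc x) e = cong not (trans (at-gl x (subst (_< M) (cong suc (sym e)) lt′))
            (trans (cong (λ y → cl (f x) (f (suc y))) e) (below (f x) (incr (subst (x <_) e (n<1+n x)) llo))))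
        ... | inj₁ q with gap-true q lt′ lo-t
        ... | refl , e = ∨-trueʳ {(suc lo ≡ᵇ t) ∧ notPred gl lo} (∧-true⁺ (≡ᵇ-refl lo) e)
        high : ((hi ≡ᵇ suc t) ∧ not (at gl t)) ∨ ((hi ≡ᵇ 2 + t) ∧ at gl t) ≡ true
        high with m≤n⇒m<n∨m≡n t<hi′
        ... | inj₁ q with gap-true q lhi t-hi
        ... | refl , e = ∨-trueʳ {(hi ≡ᵇ suc t) ∧ not (at gl t)} (∧-true⁺ (≡ᵇ-refl t) e)
        high | inj₂ refl = ∨-trueˡ (∧-true⁺ (≡ᵇ-refl t) (cong not far))
          where
          far : at gl t ≡ false
          far with 2 + t <? M
          ... | yes l = trans (at-gl t l) (above (f (2 + t)) (incr (n<1+n (suc t)) l))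
          ... | no l  = at-beyond (λ x → cl (f x) (f (2 + x))) (M ∸ 2) t (∸-monoˡ-≤ 2 (≮⇒≥ l))
        pred-far : ∀ x → x ≡ t → suc lo ≡ t ⊎ hi ≡ suc t → notPred gl x ≡ true
        pred-far zero    _    _ = refl
        pred-far (suc x) refl c = cong not (trans (at-gl x (≤-trans (s≤s t<hi′) lhi)) (wide c))
          where
          wide : suc lo ≡ suc x ⊎ hi ≡ suc (suc x) → cl (f x) (f (2 + x)) ≡ false
          wide (inj₁ refl) = lo-wide (f (2 + x)) (incr (n<1+n (suc x)) (≤-trans (s≤s t<hi′) lhi))
          wide (inj₂ refl) = hi-wide (f x) (incr (n<1+n x) lt′)
        middle : (if (suc lo ≡ᵇ t) ∨ (hi ≡ᵇ suc t) then notPred gl t else true) ≡ true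
        middle with suc lo ≡ᵇ t in e | hi ≡ᵇ suc t in e′
        ... | true  | _     = pred-far t refl (inj₁ (≡ᵇ-true⁻ {suc lo} e))
        ... | false | true  = pred-far t refl (inj₂ (≡ᵇ-true⁻ {hi} e′))
        ... | false | false = refl

    tied-true : ∀ {t} bs between p {β} → t < M → All (_< M) bs → All (_< M) p → (∀ {x} → x ∈ bs → x ∈ between) → t ∉ bs →
                Good (f t ∷ map f bs ++ map f p ++ β) → tied gl t between p ≡ true
    tied-true bs between [] _ _ _ _ _ _ = refl
    tied-true {t} bs between (x ∷ p) {β} lt′ sb (lx ∷ sp) sub n g with x ≟ t
    ... | yes refl rewrite ≡ᵇ-refl t with tie-gap g (λ i → let y , y∈ , e = ∈-map⁻ f i in n (subst (_∈ bs) (sym (f-inj lt′ (All.lookup sb y∈) e)) y∈))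
    ... | lo , hi , lo∈ , hi∈ , T with ∈-map⁻ f lo∈ | ∈-map⁻ f hi∈
    ... | a , a∈ , refl | b , b∈ , refl =
          anyᵇ-∈ (sub a∈) (anyᵇ-∈ (sub b∈) (is-tie lt′ (All.lookup sb a∈) (All.lookup sb b∈) T))
    tied-true {t} bs between (x ∷ p) {β} lt′ sb (lx ∷ sp) sub n g | no ne rewrite ≡ᵇ-≢ ne =
      tied-true (bs ++ x ∷ []) (x ∷ between) p lt′ (AllP.++⁺ sb (lx ∷ [])) sp
        (λ i → case ∈-++⁻ bs i of λ { (inj₁ j) → there (sub j) ; (inj₂ (here refl)) → here refl })
        (λ i → case ∈-++⁻ bs i of λ { (inj₁ j) → n j ; (inj₂ (here e)) → ne (sym e) })
        (subst (λ w → Good (f t ∷ w)) (trans (sym (++-assoc (map f bs) (f x ∷ []) (map f p ++ β))) (cong (_++ map f p ++ β) (sym (map-++ f bs (x ∷ []))))) g)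

    valid-true : ∀ p {β} → All (_< M) p → Good (map f p ++ β) → valid gl p ≡ true
    valid-true []      _       _ = refl
    valid-true (t ∷ p) (a ∷ s) g = ∧-true⁺ (tied-true [] [] p a [] s (λ ()) (λ ()) g) (valid-true p s (good-tail g))

    everyWindow-true : ∀ {pre P} → everyWindow m pre P ≡ true → pre M p ≡ true → P gl p ≡ true
    everyWindow-true {pre} {P} e h = ⇒-mp {valid gl p} (allᵇ-∈ {P = λ gl → valid gl p ⇒ P gl p}
      (⇒-mp {pre M p} (allᵇ-∈ {P = λ Mp → pre (proj₁ Mp) (proj₂ Mp) ⇒ allᵇ (λ gl → valid gl (proj₂ Mp) ⇒ P gl (proj₂ Mp)) (gaps (proj₁ Mp ∸ 2))} e listed) h) gl∈)
      (valid-true p small good-p)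

    Starts : ℕ → List Bool → Set
    Starts i []       = ⊤
    Starts i (s ∷ ss) = sgn i u ≡ s × Starts (suc i) ss

    Holds : List Hyp → Set
    Holds []                  = ⊤
    Holds ((ds , i , b) ∷ hs) = sgn i (run ds u) ≡ b × Holds hs

    Claims : Claim → Set
    Claims (walks ds es)     = run ds u ≡ run es u
    Claims (sign ds i b)     = sgn i (run ds u) ≡ b
    Claims (signs ds i es j) = sgn i (run ds u) ≡ sgn j (run es u)

    holds-true : ∀ hs → allᵇ (fitsHyp m) hs ≡ true → Holds hs → allᵇ (holds gl p) hs ≡ true
    holds-true [] _ _ = refl
    holds-true ((ds , i , b) ∷ hs) e (h , k) with ∧-true⁻ {fitsHyp m (ds , i , b)} e
    ... | e₁ , e₂ with ∧-true⁻ {deep m ds} e₁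
    ... | a , c = ∧-true⁺ (≡⇒== (trans (sym (sgn-u ds i a (<ᵇ-true⁻ c))) h)) (holds-true hs e₂ k)

    claims-true : ∀ c → fits m c ≡ true → claims gl p c ≡ true → Claims c
    claims-true (walks ds es) e h with ∧-true⁻ {deep m ds} e
    ... | a , b = trans (run-u ds a) (trans (cong (λ p → map f p ++ β) (eqList⇒≡ _ _ h)) (sym (run-u es b)))
    claims-true (sign ds i b) e h with ∧-true⁻ {deep m ds} e
    ... | a , c = trans (sgn-u ds i a (<ᵇ-true⁻ c)) (==⇒≡ {P.sgn i (P.run ds p)} h)
    claims-true (signs ds i es j) e h with ∧-true⁻ {deep m ds} e
    ... | a , e′ with ∧-true⁻ {suc i <ᵇ m} e′
    ... | c , e″ with ∧-true⁻ {deep m es} e″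
    ... | a′ , c′ = trans (sgn-u ds i a (<ᵇ-true⁻ c)) (trans (==⇒≡ {P.sgn i (P.run ds p)} h) (sym (sgn-u es j a′ (<ᵇ-true⁻ c′))))

    sgn-cl : ∀ {cl′ : ℕ → ℕ → Bool} i p → Walks.sgn _<ᵇ_ cl′ i p ≡ P.sgn i p
    sgn-cl i       []          = refl
    sgn-cl zero    (_ ∷ [])    = refl
    sgn-cl zero    (_ ∷ _ ∷ _) = refl
    sgn-cl {cl′} (suc i) (_ ∷ p) = sgn-cl {cl′} i p

    starts-true : ∀ i ss → i + length ss < m → Starts i ss → starts i ss p ≡ true
    starts-true i []       l h       = refl
    starts-true i (s ∷ ss) l (h , k) = ∧-true⁺
      (≡⇒== (trans (sgn-cl {close []} i p) (trans (sym (sgn-u [] i refl (≤-<-trans (subst (suc i ≤_) (sym (+-suc i (length ss))) (s≤s (m≤m+n i (length ss)))) l))) h)))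
      (starts-true (suc i) ss (subst (_< m) (+-suc i (length ss)) l) k)

    law-true : ∀ {ss hs c} → law m ss hs c ≡ true → Starts 0 ss → Holds hs → Claims c
    law-true {ss} {hs} {c} e st h with ∧-true⁻ {length ss <ᵇ m} e
    ... | a , e₁ with ∧-true⁻ {allᵇ (fitsHyp m) hs} e₁
    ... | b , e₂ with ∧-true⁻ {fits m c} e₂
    ... | k , e₃ = claims-true c k (⇒-mp {allᵇ (holds gl p) hs}
          (everyWindow-true {λ _ → starts 0 ss} {λ gl p → allᵇ (holds gl p) hs ⇒ claims gl p c} e₃ (starts-true 0 ss (<ᵇ-true⁻ a) st))
          (holds-true hs b h))

  module _ (a₀ : A) where

    read : ∀ m {u ss hs c} (g : Good u) (l : m ≤ length u) → Law m ss hs c → let module W = Read g (window a₀ m u l) in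
           W.Starts 0 ss → W.Holds hs → W.Claims c
    read m g l (by e) = Read.law-true g (window a₀ m _ l) e

    flip-word : ∀ o {u} → Good u → 3 ≤ length u → sgn 0 u ≡ o → sgn 1 u ≡ not o →
                sgn 0 (mv 0 u) ≡ not o × sgn 1 (mv 0 u) ≡ o
    flip-word o g l a b = read 3 g l (flip₀-law o) (a , b , tt) tt , read 3 g l (flip₁-law o) (a , b , tt) tt

  invol₀ : ∀ d {u} → Good u → mv d (mv d u) ≡ u
  invol₀ zero {[]} g = refl
  invol₀ zero {_ ∷ []} g = refl
  invol₀ zero {_ ∷ _ ∷ []} g = refl
  invol₀ zero {u@(a₀ ∷ _ ∷ _ ∷ _)} g = read a₀ 3 {u} g (s≤s (s≤s (s≤s z≤n))) invol-law tt tt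
  invol₀ (suc d) {[]} g = refl
  invol₀ (suc d) {x ∷ u} g = cong (x ∷_) (invol₀ d (good-tail g))

  head-of : ∀ {k} (u : List A) → suc k ≤ length u → A
  head-of (a ∷ _) _ = a

  system : System
  system = record
    { A = A ; lt = lt ; cl = cl ; Good = Good ; good-mv = good-mv ; good-tail = good-tail ; invol = invol₀
    ; flip-sgn = λ {u} g l e → let h = flip-word (head-of u l) (not (sgn 1 u)) g l e (sym (not-involutive _)) in
        trans (proj₁ h) (not-involutive _) , trans (proj₂ h) (sym e)
    ; mon = λ {u} g l a b c → read (head-of u l) 4 g l mon-law (a , b , c , tt) tt
    ; k4d = λ o {u} g l a b c d → read (head-of u l) 4 g l (k4d-law o) (a , b , c , tt) (d , tt)
    ; k4n = λ {u} g l a b c d → read (head-of u l) 4 g l k4n-law (a , b , c , tt) (d , tt)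
    ; k4m = λ o {u} g l a b c → read (head-of u l) 4 g l (k4m-law o) (a , b , c , tt) tt
    ; k4q = λ {u} g l a b c d → read (head-of u l) 4 g l k4q-law (a , b , c , tt) (d , tt)
    ; k4a = λ o {u} g l a b c → read (head-of u l) 4 g l (k4a-law o) (a , b , c , tt) tt
    ; k5e = λ o {u} g l a b c d e → read (head-of u l) 5 g l (k5e-law o) (a , b , c , d , tt) (e , tt)
    ; k5l = λ o {u} g l a b c d e → read (head-of u l) 5 g l (k5l-law o) (a , b , c , d , tt) (e , tt)
    ; k6a = λ o {u} g l a b c d e h → read (head-of u l) 6 g l (k6a-law o) (a , b , c , d , e , tt) (h , tt)
    ; k6b = λ o {u} g l a b c d e → read (head-of u l) 6 g l (k6b-law o) (a , b , c , d , e , tt) tt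
    }

-- Cells of tuples of skew shapes.

data At : List Skew → ℕ → Skew → Set where
  here  : ∀ {s ss} → At (s ∷ ss) 0 s
  there : ∀ {s s′ ss j} → At ss j s → At (s′ ∷ ss) (suc j) s

at-unique : ∀ {ν j s s′} → At ν j s → At ν j s′ → s ≡ s′
at-unique here      here      = refl
at-unique (there a) (there b) = at-unique a b

at-< : ∀ {ν j s} → At ν j s → j < length ν
at-< here      = s≤s z≤n
at-< (there a) = s≤s (at-< a)

InShape : Skew → ℕ → ℕ → Set
InShape s r c = part (inner s) r ≤ c × c < part (outer s) r

part-short : ∀ p r → length p ≤ r → part p r ≡ 0
part-short []       r       _       = refl
part-short (_ ∷ p) (suc r) (s≤s l) = part-short p r l

part-step : ∀ {p} → Linked (λ a b → b ≤ a) p → ∀ r → part p (suc r) ≤ part p r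
part-step []            r       = z≤n
part-step [-]           zero    = z≤n
part-step [-]           (suc r) = z≤n
part-step (l ∷ ls)      zero    = l
part-step (l ∷ ls)      (suc r) = part-step ls r

part-anti : ∀ {p r r′} → Linked (λ a b → b ≤ a) p → r ≤ r′ → part p r′ ≤ part p r
part-anti {p} {r} {r′} ls l = subst (λ x → part p x ≤ part p r) (m∸n+n≡m l) (go (r′ ∸ r))
  where
  go : ∀ d → part p (d + r) ≤ part p r
  go zero    = ≤-refl
  go (suc d) = ≤-trans (part-step ls (d + r)) (go d)

shape-convex : ∀ s {r c r₁ c₁ r₂ c₂} → InShape s r₁ c₁ → InShape s r₂ c₂ →
               r₁ ≤ r → r ≤ r₂ → c₁ ≤ c → c ≤ c₂ → InShape s r c
shape-convex s (l , _) (_ , u) a b a′ b′ =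
  ≤-trans (part-anti (proj₁ (innerPart s)) a) (≤-trans l a′) ,
  <-≤-trans (≤-<-trans b′ u) (part-anti (proj₁ (outerPart s)) b)

rowCells : ℕ → Skew → ℕ → List Cell
rowCells i s r = map (λ c → (i , r , part (inner s) r + c)) (upTo (part (outer s) r ∸ part (inner s) r))

skew⁺ : ∀ {i s r c} → InShape s r c → (i , r , c) ∈ cellsSkew i s
skew⁺ {i} {s} {r} {c} (l , u) = ∈-concatMap⁺ (rowCells i s) (lose (∈-upTo⁺ r<) 
  (subst (λ x → (i , r , x) ∈ rowCells i s r) (m+[n∸m]≡n l)
    (∈-map⁺ (λ c → (i , r , part (inner s) r + c)) (∈-upTo⁺ (∸-monoˡ-< u l)))))
  where
  r< : r < length (outer s)
  r< with r <? length (outer s)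
  ... | yes p = p
  ... | no p with () ← subst (c <_) (part-short (outer s) r (≮⇒≥ p)) u

skew⁻ : ∀ {i s x} → x ∈ cellsSkew i s → ∃ λ r → ∃ λ c → x ≡ (i , r , c) × InShape s r c
skew⁻ {i} {s} x∈ with find (∈-concatMap⁻ (rowCells i s) {xs = upTo (length (outer s))} x∈)
... | r , _ , x∈r with ∈-map⁻ (λ c → (i , r , part (inner s) r + c)) x∈r
... | c , c∈ , refl = r , part (inner s) r + c , refl , m≤m+n _ c ,
      subst (part (inner s) r + c <_) (m+[n∸m]≡n (contained s r)) (+-monoʳ-< (part (inner s) r) (∈-upTo⁻ c∈))

cells⁺ : ∀ {i ν j s r c} → At ν j s → InShape s r c → (i + j , r , c) ∈ cellsFrom i ν
cells⁺ {i} {s ∷ ν} {r = r} {c} here h = ∈-++⁺ˡ (subst (λ z → (z , r , c) ∈ cellsSkew i s) (sym (+-identityʳ i)) (skew⁺ {i} {s} h))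
cells⁺ {i} {s ∷ ν} {suc j} {r = r} {c} (there a) h = ∈-++⁺ʳ (cellsSkew i s)
  (subst (λ z → (z , r , c) ∈ cellsFrom (suc i) ν) (sym (+-suc i j)) (cells⁺ {suc i} {ν} a h))

cells⁻ : ∀ {i} ν {x} → x ∈ cellsFrom i ν → ∃ λ j → ∃ λ s → ∃ λ r → ∃ λ c → x ≡ (i + j , r , c) × At ν j s × InShape s r c
cells⁻ {i} (s ∷ ν) x∈ with ∈-++⁻ (cellsSkew i s) x∈
... | inj₁ y with skew⁻ {i} {s} y
... | r , c , refl , h = 0 , s , r , c , cong (_, r , c) (sym (+-identityʳ i)) , here , h
cells⁻ {i} (s ∷ ν) x∈ | inj₂ y with cells⁻ {suc i} ν y
... | j , s′ , r , c , refl , a , h = suc j , s′ , r , c , cong (_, r , c) (sym (+-suc i j)) , there a , h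

comp-< : ∀ {ν x} → x ∈ cells ν → compOf x < length ν
comp-< {ν} x∈ with cells⁻ ν x∈
... | j , s , r , c , refl , a , h = at-< a

cells-convex : ∀ {ν x y r c} → x ∈ cells ν → y ∈ cells ν → compOf x ≡ compOf y →
               rowOf x ≤ r → r ≤ rowOf y → colOf x ≤ c → c ≤ colOf y → (compOf x , r , c) ∈ cells ν
cells-convex {ν} x∈ y∈ e a b a′ b′ with cells⁻ ν x∈ | cells⁻ ν y∈
... | j , s , r , c , refl , p , h | j′ , s′ , r′ , c′ , refl , p′ , h′ with e
... | refl with at-unique p p′
... | refl = cells⁺ p (shape-convex s h h′ a b a′ b′)

row-unique : ∀ i s r → Unique (rowCells i s r)
row-unique i s r = UniqueP.map⁺ (λ e → +-cancelˡ-≡ (part (inner s) r) _ _ (cong colOf e)) (UniqueP.upTo⁺ _)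

skew-unique : ∀ i s → Unique (cellsSkew i s)
skew-unique i s = UniqueP.concat⁺ (AllP.map⁺ (All.tabulate λ {r} _ → row-unique i s r))
  (AllPairsP.map⁺ (AllPairs.map disjoint (UniqueP.upTo⁺ (length (outer s)))))
  where
  row-of : ∀ {r x} → x ∈ rowCells i s r → rowOf x ≡ r
  row-of {r} x∈ with ∈-map⁻ (λ c → (i , r , part (inner s) r + c)) x∈
  ... | _ , _ , refl = refl
  disjoint : ∀ {r r′} → r ≢ r′ → ∀ {x} → ¬ (x ∈ rowCells i s r × x ∈ rowCells i s r′)
  disjoint n (p , q) = n (trans (sym (row-of p)) (row-of q))

cells-unique : ∀ i ν → Unique (cellsFrom i ν)
cells-unique i []      = []
cells-unique i (s ∷ ν) = UniqueP.++⁺ (skew-unique i s) (cells-unique (suc i) ν) λ (p , q) → apart p q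
  where
  apart : ∀ {x} → x ∈ cellsSkew i s → x ∈ cellsFrom (suc i) ν → ⊥
  apart p q with skew⁻ {i} {s} p | cells⁻ ν q
  ... | r , c , refl , _ | j , _ , r′ , c′ , e , _ = <-irrefl (cong compOf e) (s≤s (m≤m+n i j))

-- Reading order and positions in words.

module Reading (ν : List Skew) where

  k n : ℕ
  k = length ν
  n = length (cells ν)

  sc : Cell → ℤ
  sc = shiftedContent k

  W : Cell → Cell → Set
  W x y = sc x ℤ.< sc y ⊎ (sc x ≡ sc y × rowOf x ≤ rowOf y)

  w-refl : ∀ x → W x x
  w-refl x = inj₂ (refl , ≤-refl)

  w-trans : ∀ {x y z} → W x y → W y z → W x z
  w-trans (inj₁ a) (inj₁ b) = inj₁ (ℤP.<-trans a b)
  w-trans (inj₁ a) (inj₂ (e , _)) = inj₁ (subst (_ ℤ.<_) e a)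
  w-trans (inj₂ (e , _)) (inj₁ b) = inj₁ (subst (ℤ._< _) (sym e) b)
  w-trans (inj₂ (e , l)) (inj₂ (e′ , l′)) = inj₂ (trans e e′ , ≤-trans l l′)

  w-≤ : ∀ {x y} → W x y → sc x ℤ.≤ sc y
  w-≤ (inj₁ a) = ℤP.<⇒≤ a
  w-≤ (inj₂ (e , _)) = ℤP.≤-reflexive e

  before-W : ∀ x y → (before k x y ≡ true → W x y) × (before k x y ≡ false → W y x)
  before-W x y with sc x ℤ.<? sc y | sc x ℤ.≟ sc y
  ... | yes p | _ = (λ _ → inj₁ p) , λ ()
  ... | no p | yes e = (λ q → inj₂ (e , <⇒≤ (<ᵇ-true⁻ q))) , λ q → inj₂ (sym e , <ᵇ-false⁻ q)
  ... | no p | no e = (λ ()) , λ _ → inj₁ (ℤP.≤∧≢⇒< (ℤP.≮⇒≥ p) (e ∘ sym))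

  insert-↭ : ∀ x ys → insertBy k x ys ↭ x ∷ ys
  insert-↭ x []       = ↭-refl
  insert-↭ x (y ∷ ys) with before k x y
  ... | true  = ↭-refl
  ... | false = ↭-trans (prep y (insert-↭ x ys)) (swap y x ↭-refl)

  sort-↭ : ∀ xs → sortCells k xs ↭ xs
  sort-↭ []       = ↭-refl
  sort-↭ (x ∷ xs) = ↭-trans (insert-↭ x (sortCells k xs)) (prep x (sort-↭ xs))

  insert-sorted : ∀ x {ys} → AllPairs W ys → AllPairs W (insertBy k x ys)
  insert-sorted x [] = [] ∷ []
  insert-sorted x {y ∷ ys} (a ∷ as) with before k x y in e
  ... | true  = (proj₁ (before-W x y) e ∷ All.map (w-trans (proj₁ (before-W x y) e)) a) ∷ a ∷ as
  ... | false = All.tabulate (λ {z} z∈ → case ∈-resp-↭ (insert-↭ x ys) z∈ of λ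
                  { (here refl) → proj₂ (before-W x y) e ; (there i) → All.lookup a i }) ∷ insert-sorted x as

  sort-sorted : ∀ xs → AllPairs W (sortCells k xs)
  sort-sorted []       = []
  sort-sorted (x ∷ xs) = insert-sorted x (sort-sorted xs)

  ro : List Cell
  ro = readingOrder ν

  ro-sorted : AllPairs W ro
  ro-sorted = sort-sorted (cells ν)

  ro⁻ : ∀ {x} → x ∈ ro → x ∈ cells ν
  ro⁻ = ∈-resp-↭ (sort-↭ (cells ν))

  ro⁺ : ∀ {x} → x ∈ cells ν → x ∈ ro
  ro⁺ = ∈-resp-↭ (↭-sym (sort-↭ (cells ν)))

  ro-length : length ro ≡ n
  ro-length = ↭-length (sort-↭ (cells ν))


pos-here : ∀ x w → pos (x ∷ w) x ≡ 1
pos-here x w rewrite ≡ᵇ-refl x = refl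

pos-there : ∀ {x v} w → x ≢ v → 0 < pos w v → pos (x ∷ w) v ≡ suc (pos w v)
pos-there {x} {v} w n l rewrite ≡ᵇ-≢ n | ≡ᵇ-≢ {pos w v} {0} (λ e → <-irrefl (sym e) l) = refl

pos-pos : ∀ {w v} → v ∈ w → 0 < pos w v
pos-pos {x ∷ w} {v} v∈ with x ≟ v | v∈
... | yes refl | _ = subst (0 <_) (sym (pos-here x w)) (s≤s z≤n)
... | no n | here e = ⊥-elim (n (sym e))
... | no n | there i = subst (0 <_) (sym (pos-there w n (pos-pos i))) (s≤s z≤n)

pos-≤ : ∀ {w v} → v ∈ w → pos w v ≤ length w
pos-≤ {x ∷ w} {v} v∈ with x ≟ v | v∈
... | yes refl | _ = subst (_≤ suc (length w)) (sym (pos-here x w)) (s≤s z≤n)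
... | no n | here e = ⊥-elim (n (sym e))
... | no n | there i = subst (_≤ suc (length w)) (sym (pos-there w n (pos-pos i))) (s≤s (pos-≤ i))

nth-suc : ∀ {B : Set} (d : B) y ys p → 0 < p → nth d (y ∷ ys) (suc p) ≡ nth d ys p
nth-suc d y ys (suc p) _ = refl

module Labelled {B : Set} (T : B → ℕ) where

  InjOn : List B → Set
  InjOn xs = ∀ {x y} → x ∈ xs → y ∈ xs → T x ≡ T y → x ≡ y

  nth-pos : ∀ {C : Set} (d : C) (h : B → C) {xs x} → InjOn xs → x ∈ xs → nth d (map h xs) (pos (map T xs) (T x)) ≡ h x
  nth-pos d h {y ∷ xs} {x} inj x∈ with T y ≟ T x
  ... | yes e with inj (here refl) x∈ e
  ... | refl rewrite pos-here (T y) (map T xs) = refl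
  nth-pos d h {y ∷ xs} {x} inj (here refl) | no n = ⊥-elim (n refl)
  nth-pos d h {y ∷ xs} {x} inj (there i) | no n
    rewrite pos-there (map T xs) n (pos-pos (∈-map⁺ T i)) =
      trans (nth-suc d (h y) (map h xs) _ (pos-pos (∈-map⁺ T i))) (nth-pos d h (λ a b → inj (there a) (there b)) i)

  pos-< : ∀ {R : B → B → Set} {xs x y} → (∀ z → R z z) → AllPairs R xs → InjOn xs → x ∈ xs → y ∈ xs → ¬ R y x →
          pos (map T xs) (T x) < pos (map T xs) (T y)
  pos-< {xs = z ∷ xs} {x} {y} rfl (a ∷ as) inj x∈ y∈ nr with T z ≟ T x | T z ≟ T y
  ... | yes e | yes e′ with inj (here refl) x∈ e | inj (here refl) y∈ e′
  ... | refl | refl = ⊥-elim (nr (rfl z))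
  pos-< {xs = z ∷ xs} {x} {y} rfl (a ∷ as) inj x∈ (here e) nr | _ | no n = ⊥-elim (n (cong T (sym e)))
  pos-< {xs = z ∷ xs} {x} {y} rfl (a ∷ as) inj x∈ (there j) nr | yes e | no n =
    subst₂ _<_ (sym (trans (cong (pos (T z ∷ map T xs)) (sym e)) (pos-here (T z) (map T xs))))
      (sym (pos-there (map T xs) n (pos-pos (∈-map⁺ T j)))) (s≤s (pos-pos (∈-map⁺ T j)))
  pos-< {xs = z ∷ xs} {x} {y} rfl (a ∷ as) inj (here e₀) y∈ nr | no n | _ = ⊥-elim (n (cong T (sym e₀)))
  pos-< {xs = z ∷ xs} {x} {y} rfl (a ∷ as) inj (there i) y∈ nr | no n | yes e with inj (here refl) y∈ e
  ... | refl = ⊥-elim (nr (All.lookup a i))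
  pos-< {xs = z ∷ xs} {x} {y} rfl (a ∷ as) inj (there i) (there j) nr | no n | no n′ =
    subst₂ _<_ (sym (pos-there (map T xs) n (pos-pos (∈-map⁺ T i)))) (sym (pos-there (map T xs) n′ (pos-pos (∈-map⁺ T j))))
      (s≤s (pos-< rfl as (λ a b → inj (there a) (there b)) i j nr))

module _ {B : Set} where

  remove-∈ : ∀ {x : B} {ys} → x ∈ ys → ∃ λ zs → length ys ≡ suc (length zs) × (∀ {y} → y ∈ ys → y ≢ x → y ∈ zs)
  remove-∈ {ys = y ∷ ys} (here refl) = ys , refl , λ { (here e) n → ⊥-elim (n e) ; (there i) n → i }
  remove-∈ {ys = y ∷ ys} (there i) with remove-∈ i
  ... | zs , l , f = y ∷ zs , cong suc l , λ { (here e) n → here e ; (there j) n → there (f j n) }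

  unique-⊆ : ∀ {xs ys : List B} → Unique xs → (∀ {x} → x ∈ xs → x ∈ ys) → length xs ≤ length ys
  unique-⊆ {[]} _ _ = z≤n
  unique-⊆ {x ∷ xs} (a ∷ as) sub with remove-∈ (sub (here refl))
  ... | zs , l , f = subst (suc (length xs) ≤_) (sym l) (s≤s (unique-⊆ as λ i → f (sub (there i)) λ { refl → All.lookup a i refl }))

  unique-covers : ∀ {xs ys : List B} → (∀ x y → Dec (x ≡ y)) → Unique xs → (∀ {x} → x ∈ xs → x ∈ ys) → length ys ≤ length xs → ∀ {y} → y ∈ ys → y ∈ xs
  unique-covers {xs} {ys} _≟′_ u sub l {y} y∈ with Data.List.Relation.Unary.Any.any? (y ≟′_) xs
    where import Data.List.Relation.Unary.Any
  ... | yes p = p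
  ... | no p with remove-∈ y∈
  ... | zs , e , f = ⊥-elim (<-irrefl refl (<-≤-trans (subst (length zs <_) (sym e) (n<1+n _)) (≤-trans l (unique-⊆ u λ i → f (sub i) λ { refl → p i }))))

-- Arithmetic of shifted contents.

unzip : ∀ a b c d e → (+ a ℤ.- + b) ℤ.≤ (+ c ℤ.- + d) ℤ.+ + e → a + d ≤ (c + b) + e
zip   : ∀ a b c d e → a + d ≤ (c + b) + e → (+ a ℤ.- + b) ℤ.≤ (+ c ℤ.- + d) ℤ.+ + e
module Shift (a b c d e : ℕ) where
  open +-*-Solver
  left : (+ a ℤ.- + b) ℤ.+ (+ b ℤ.+ + d) ≡ + (a + d)
  left = trans (solve 3 (λ a b d → (a :- b) :+ (b :+ d) := a :+ d) refl (+ a) (+ b) (+ d)) (sym (ℤP.pos-+ a d))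
  right : ((+ c ℤ.- + d) ℤ.+ + e) ℤ.+ (+ b ℤ.+ + d) ≡ + ((c + b) + e)
  right = trans (solve 4 (λ b c d e → ((c :- d) :+ e) :+ (b :+ d) := (c :+ b) :+ e) refl (+ b) (+ c) (+ d) (+ e))
    (sym (trans (ℤP.pos-+ (c + b) e) (cong (ℤ._+ + e) (ℤP.pos-+ c b))))
unzip a b c d e l = ℤP.drop‿+≤+ (subst₂ ℤ._≤_ (Shift.left a b c d e) (Shift.right a b c d e) (ℤP.+-monoˡ-≤ (+ b ℤ.+ + d) l))
zip a b c d e l = ℤP.≤-trans (ℤP.≤-reflexive (sym (back (+ a ℤ.- + b)))) (ℤP.≤-trans
    (ℤP.+-monoˡ-≤ (ℤ.- (+ b ℤ.+ + d)) (subst₂ ℤ._≤_ (sym (Shift.left a b c d e)) (sym (Shift.right a b c d e)) (ℤ.+≤+ l)))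
    (ℤP.≤-reflexive (back ((+ c ℤ.- + d) ℤ.+ + e))))
  where
  open +-*-Solver
  back : ∀ x → (x ℤ.+ (+ b ℤ.+ + d)) ℤ.- (+ b ℤ.+ + d) ≡ x
  back x = solve 3 (λ x b d → (x :+ (b :+ d)) :- (b :+ d) := x) refl x (+ b) (+ d)

digit : ∀ {k a b i j} → i < k → j < k → k * a + i ≡ k * b + j → i ≡ j × a ≡ b
digit {k} {a} {b} {i} {j} li lj e with <-cmp a b
... | tri≈ _ refl _ = +-cancelˡ-≡ (k * a) i j e , refl
... | tri< l _ _ = ⊥-elim (<-irrefl e (<-≤-trans (+-monoʳ-< (k * a) li)
      (≤-trans (≤-reflexive (trans (+-comm (k * a) k) (sym (*-suc k a)))) (≤-trans (*-monoʳ-≤ k l) (m≤m+n (k * b) j)))))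
... | tri> _ _ l = ⊥-elim (<-irrefl (sym e) (<-≤-trans (+-monoʳ-< (k * b) lj)
      (≤-trans (≤-reflexive (trans (+-comm (k * b) k) (sym (*-suc k b)))) (≤-trans (*-monoʳ-≤ k l) (m≤m+n (k * a) i)))))

module Contents (k : ℕ) where

  sc : Cell → ℤ
  sc = shiftedContent k

  sc-split : ∀ x → sc x ≡ + (k * colOf x + compOf x) ℤ.- + (k * rowOf x)
  sc-split (i , r , c) = trans (solve 4 (λ k c r i → k :* (c :- r) :+ i := (k :* c :+ i) :- (k :* r)) refl (+ k) (+ c) (+ r) (+ i))
    (cong₂ ℤ._-_ (sym (trans (ℤP.pos-+ (k * c) i) (cong (ℤ._+ + i) (ℤP.pos-* k c)))) (sym (ℤP.pos-* k r)))
    where open +-*-Solver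

  P : Cell → ℕ
  P x = k * colOf x + compOf x

  Q : Cell → ℕ
  Q x = k * rowOf x

  near⁻ : ∀ {x y e} → sc y ℤ.≤ sc x ℤ.+ + e → P y + Q x ≤ (P x + Q y) + e
  near⁻ {x} {y} {e} l = unzip (P y) (Q y) (P x) (Q x) e (subst₂ (λ a b → a ℤ.≤ b ℤ.+ + e) (sc-split y) (sc-split x) l)

  near⁺ : ∀ {x y e} → P y + Q x ≤ (P x + Q y) + e → sc y ℤ.≤ sc x ℤ.+ + e
  near⁺ {x} {y} {e} l = subst₂ (λ a b → a ℤ.≤ b ℤ.+ + e) (sym (sc-split y)) (sym (sc-split x)) (zip (P y) (Q y) (P x) (Q x) e l)

  row-gap : ∀ i r {c c′} → c < c′ → sc (i , r , c) ℤ.+ + k ℤ.≤ sc (i , r , c′)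
  row-gap i r {c} {c′} l = ℤP.≤-trans (ℤP.≤-reflexive (step i r c)) (≤-sc c′ l)
    where
    step : ∀ i r c → sc (i , r , c) ℤ.+ + k ≡ sc (i , r , suc c)
    step i r c = trans (solve 4 (λ k c r i → (k :* (c :- r) :+ i) :+ k := k :* ((con (+ 1) :+ c) :- r) :+ i) refl (+ k) (+ c) (+ r) (+ i)) refl
      where open +-*-Solver
    ≤-sc : ∀ c′ → c < c′ → sc (i , r , suc c) ℤ.≤ sc (i , r , c′)
    ≤-sc c′ l = subst (sc (i , r , suc c) ℤ.≤_) (ℤP.+-identityʳ _)
      (near⁺ {i , r , c′} {i , r , suc c} {0} (≤-trans (+-monoˡ-≤ (k * r) (+-monoˡ-≤ i (*-monoʳ-≤ k l))) (m≤m+n (k * c′ + i + k * r) 0)))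

  row-step : ∀ i r c → sc (i , r , suc c) ≡ sc (i , r , c) ℤ.+ + k
  row-step i r c = solve 4 (λ k c r i → k :* ((con (+ 1) :+ c) :- r) :+ i := (k :* (c :- r) :+ i) :+ k) refl (+ k) (+ c) (+ r) (+ i)
    where open +-*-Solver

  col-step : ∀ i r c → sc (i , r , c) ≡ sc (i , suc r , c) ℤ.+ + k
  col-step i r c = solve 4 (λ k c r i → k :* (c :- r) :+ i := (k :* (c :- (con (+ 1) :+ r)) :+ i) :+ k) refl (+ k) (+ c) (+ r) (+ i)
    where open +-*-Solver

  col-gap : ∀ i c {r r′} → r < r′ → sc (i , r′ , c) ℤ.+ + k ℤ.≤ sc (i , r , c)
  col-gap i c {r} {r′} l = subst (sc (i , r′ , c) ℤ.+ + k ℤ.≤_) (sym (col-step i r c)) (ℤP.+-monoˡ-≤ (+ k) {sc (i , r′ , c)} {sc (i , suc r , c)} (subst (sc (i , r′ , c) ℤ.≤_) (ℤP.+-identityʳ _)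
      (near⁺ {i , suc r , c} {i , r′ , c} {0} (≤-trans (+-monoʳ-≤ (k * c + i) (*-monoʳ-≤ k l)) (m≤m+n (k * c + i + k * r′) 0)))))

  -- The component is the remainder of the shifted content modulo k. The comparison is moved to
  -- natural numbers by adding the row terms on both sides.
  same-diagonal : ∀ {x y} → compOf x < k → compOf y < k → sc x ≡ sc y → compOf x ≡ compOf y × colOf x + rowOf y ≡ colOf y + rowOf x
  same-diagonal {i , r , c} {i′ , r′ , c′} l l′ e = digit l l′ (trans (shuffle c r′ i) (trans both (sym (shuffle c′ r i′))))
    where
    ≤-of : ∀ {x y} → sc x ≡ sc y → P y + Q x ≤ P x + Q y
    ≤-of {x} {y} e = subst (P y + Q x ≤_) (+-identityʳ (P x + Q y)) (near⁻ {x} {y} {0} (ℤP.≤-reflexive (trans (sym e) (sym (ℤP.+-identityʳ (sc x))))))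
    both : P (i , r , c) + Q (i′ , r′ , c′) ≡ P (i′ , r′ , c′) + Q (i , r , c)
    both = ≤-antisym (≤-of {i′ , r′ , c′} {i , r , c} (sym e)) (≤-of {i , r , c} {i′ , r′ , c′} e)
    shuffle : ∀ c r i → k * (c + r) + i ≡ k * c + i + k * r
    shuffle c r i = trans (cong (_+ i) (*-distribˡ-+ k c r)) (trans (+-assoc (k * c) (k * r) i)
      (trans (cong (_+_ (k * c)) (+-comm (k * r) i)) (sym (+-assoc (k * c) i (k * r)))))

-- Standard fillings.

module Fillings (ν : List Skew) where
  open Reading ν public
  open Contents k public using (row-gap; row-step; col-step; col-gap; same-diagonal; near⁺; near⁻)

  module Std {T : Cell → ℕ} (S : IsStandardFilling ν T) where
    open IsStandardFilling S public
    open Labelled T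

    word : List ℕ
    word = scWord ν T

    inj-ro : InjOn ro
    inj-ro a b = injective _ _ (ro⁻ a) (ro⁻ b)

    -- The letter of the entry `v`. It is read off the word alone, so a vertex has letters without
    -- reference to a chosen filling.
    κ : ℕ → ℤ
    κ v = c̃ ν (pos word v)

    κ-cell : ∀ {x} → x ∈ cells ν → κ (T x) ≡ sc x
    κ-cell x∈ = nth-pos (+ 0) sc inj-ro (ro⁺ x∈)

    onto : ∀ {v} → 1 ≤ v → v ≤ n → ∃ λ x → x ∈ cells ν × T x ≡ v
    onto {suc v} _ l with ∈-map⁻ T (unique-covers _≟_ (unique-map (cells-unique 0 ν) injOn) sub (≤-reflexive len) (∈-map⁺ suc (∈-upTo⁺ l)))
      where
      injOn : InjOn (cells ν)
      injOn = injective _ _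
      unique-map : ∀ {xs} → Unique xs → InjOn xs → Unique (map T xs)
      unique-map [] _ = []
      unique-map (a ∷ as) i = AllP.map⁺ (All.tabulate λ z∈ e → All.lookup a z∈ (i (here refl) (there z∈) e)) ∷
                              unique-map as (λ p q → i (there p) (there q))
      sub : ∀ {v} → v ∈ map T (cells ν) → v ∈ range1 n
      sub v∈ with ∈-map⁻ T v∈
      ... | x , x∈ , refl with T x | range x x∈
      ... | suc t | _ , l = ∈-map⁺ suc (∈-upTo⁺ l)
      len : length (range1 n) ≡ length (map T (cells ν))
      len = trans (length-map suc (upTo n)) (trans (length-upTo n) (sym (length-map T (cells ν))))
    ... | x , x∈ , e = x , x∈ , sym e

    pos-bounds : ∀ {x} → x ∈ cells ν → 1 ≤ pos word (T x) × pos word (T x) ≤ n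
    pos-bounds {x} x∈ = pos-pos (∈-map⁺ T (ro⁺ x∈)) ,
      subst (pos word (T x) ≤_) (trans (length-map T ro) ro-length) (pos-≤ (∈-map⁺ T (ro⁺ x∈)))

    pos-mono : ∀ {x y} → x ∈ cells ν → y ∈ cells ν → sc x ℤ.< sc y → pos word (T x) < pos word (T y)
    pos-mono x∈ y∈ l = pos-< w-refl ro-sorted inj-ro (ro⁺ x∈) (ro⁺ y∈) λ w → ℤP.<-irrefl refl (ℤP.<-≤-trans l (w-≤ w))

    mono-≤ : ∀ {i r c r′ c′} → (i , r , c) ∈ cells ν → (i , r′ , c′) ∈ cells ν → r ≤ r′ → c ≤ c′ → T (i , r , c) ≤ T (i , r′ , c′)
    mono-≤ {i} {r} {c} {r′} {c′} x∈ y∈ a b = ≤-trans up right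
      where
      z∈ = cells-convex {ν} x∈ y∈ refl a (≤-refl {r′}) (≤-refl {c}) b
      up : T (i , r , c) ≤ T (i , r′ , c)
      up with m≤n⇒m<n∨m≡n a
      ... | inj₁ l = <⇒≤ (colIncr _ _ x∈ z∈ refl refl l)
      ... | inj₂ refl = ≤-refl
      right : T (i , r′ , c) ≤ T (i , r′ , c′)
      right with m≤n⇒m<n∨m≡n b
      ... | inj₁ l = <⇒≤ (rowIncr _ _ z∈ y∈ refl refl l)
      ... | inj₂ refl = ≤-refl

    -- Two entries of one diagonal are separated in time by the cells above
    -- and to the right of the first.
    record Square (x y : Cell) : Set where
      field
        above right : Cell
        above∈  : above ∈ cells ν
        right∈  : right ∈ cells ν
        above-< : T x < T above × T above < T y
        right-< : T x < T right × T right < T y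
        above-c : sc x ≡ sc above ℤ.+ + k
        right-c : sc right ≡ sc x ℤ.+ + k

    -- A cell `y` weakly southwest of `x` would have the smaller entry. So it lies strictly
    -- northeast, and convexity of the shape gives the rest of a unit square at `x`.
    square : ∀ {x y} → x ∈ cells ν → y ∈ cells ν → sc x ≡ sc y → T x < T y → Square x y
    square {i , r , c} {i′ , r′ , c′} x∈ y∈ e l with same-diagonal {i , r , c} {i′ , r′ , c′} (comp-< {ν} x∈) (comp-< {ν} y∈) e
    ... | refl , d with <-cmp r r′
    ... | tri≈ _ refl _ with +-cancelʳ-≡ r c c′ d
    ... | refl = ⊥-elim (<-irrefl refl l)
    square {i , r , c} {i′ , r′ , c′} x∈ y∈ e l | refl , d | tri> _ _ q =
      ⊥-elim (<-irrefl refl (<-≤-trans l (mono-≤ y∈ x∈ (<⇒≤ q) (+-cancelʳ-≤ r c′ c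
        (≤-trans (≤-reflexive (sym d)) (+-monoʳ-≤ c (<⇒≤ q)))))))
    square {i , r , c} {i′ , r′ , c′} x∈ y∈ e l | refl , d | tri< q _ _ = record
      { above = i , suc r , c ; right = i , r , suc c ; above∈ = a∈ ; right∈ = b∈
      ; above-< = colIncr _ _ x∈ a∈ refl refl (n<1+n r) , ≤-trans (rowIncr _ _ a∈ z∈ refl refl (n<1+n c)) (mono-≤ z∈ y∈ q cc)
      ; right-< = rowIncr _ _ x∈ b∈ refl refl (n<1+n c) , ≤-trans (colIncr _ _ b∈ z∈ refl refl (n<1+n r)) (mono-≤ z∈ y∈ q cc)
      ; above-c = col-step i r c ; right-c = row-step i r c }
      where
      cc : c < c′
      cc = +-cancelʳ-≤ r (suc c) c′ (≤-trans (≤-reflexive (sym (+-suc c r))) (≤-trans (+-monoʳ-≤ c q) (≤-reflexive d)))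
      a∈ = cells-convex {ν} x∈ y∈ refl (n≤1+n r) q (≤-refl {c}) (<⇒≤ cc)
      b∈ = cells-convex {ν} x∈ y∈ refl (≤-refl {r}) (<⇒≤ q) (n≤1+n c) cc
      z∈ = cells-convex {ν} x∈ y∈ refl (n≤1+n r) q (n≤1+n c) cc

-- The operators as permutations of three consecutive values.

data Kind : Set where
  none swap₁ swap₂ cycle₁ cycle₂ : Kind

kind : Bool → Bool → Bool → Bool → Bool → Kind
kind pq qr pr c₁ c₂ =
  if pq == qr then none else if pq == pr then (if c₁ then cycle₁ else swap₁) else (if c₂ then cycle₂ else swap₂)

act : Kind → ℕ → ℕ → ℕ
act none   j = λ x → x
act swap₁  j = swapV (2 + j) (1 + j)
act swap₂  j = swapV (2 + j) (3 + j)
act cycle₁ j = cycV (1 + j) (2 + j) (3 + j)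
act cycle₂ j = cycV (2 + j) (1 + j) (3 + j)

place : ∀ {A : Set} → Kind → A → A → A → A × A × A
place none   p q r = p , q , r
place swap₁  p q r = q , p , r
place swap₂  p q r = p , r , q
place cycle₁ p q r = r , p , q
place cycle₂ p q r = q , r , p

-- `act` moves the values among cells and `place` moves the letters among values, so the two
-- permutations are inverse to each other.
undo : Kind → Kind
undo none   = none
undo swap₁  = swap₁
undo swap₂  = swap₂
undo cycle₁ = cycle₂
undo cycle₂ = cycle₁

module _ {A : Set} (lt cl : A → A → Bool) where

  tri-place : ∀ p q r → Walks.tri lt cl p q r ≡ place (kind (lt p q) (lt q r) (lt p r) (cl p q) (cl q r)) p q r
  tri-place p q r with lt p q == lt q r | lt p q == lt p r | cl p q | cl q r
  ... | true  | _     | _     | _     = refl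
  ... | false | true  | true  | _     = refl
  ... | false | true  | false | _     = refl
  ... | false | false | _     | true  = refl
  ... | false | false | _     | false = refl

act-abc : ∀ K j → act K j (1 + j) ≡ proj₁ (place (undo K) (1 + j) (2 + j) (3 + j)) ×
                  act K j (2 + j) ≡ proj₁ (proj₂ (place (undo K) (1 + j) (2 + j) (3 + j))) ×
                  act K j (3 + j) ≡ proj₂ (proj₂ (place (undo K) (1 + j) (2 + j) (3 + j)))
act-abc K j with ≡ᵇ-refl j | ≡ᵇ-≢ {j} {1 + j} (λ e → 1+n≢n (sym e)) | ≡ᵇ-≢ {j} {2 + j} (λ e → <-irrefl e (<-trans (n<1+n j) (n<1+n (suc j)))) |
                     ≡ᵇ-≢ {1 + j} {j} 1+n≢n | ≡ᵇ-≢ {2 + j} {j} (λ e → <-irrefl (sym e) (<-trans (n<1+n j) (n<1+n (suc j))))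
act-abc none   j | a | b | c | d | e = refl , refl , refl
act-abc swap₁  j | a | b | c | d | e rewrite a | b | d | e = refl , refl , refl
act-abc swap₂  j | a | b | c | d | e rewrite a | b | c | d = refl , refl , refl
act-abc cycle₁ j | a | b | c | d | e rewrite a | d | e = refl , refl , refl
act-abc cycle₂ j | a | b | c | d | e rewrite a | b | d | e = refl , refl , refl

Off : ℕ → ℕ → Set
Off j v = v ≢ 1 + j × v ≢ 2 + j × v ≢ 3 + j

act-off : ∀ K {j v} → Off j v → act K j v ≡ v
act-off none   _ = refl
act-off swap₁  {j} {v} (x , y , z) rewrite ≡ᵇ-≢ {v} {2 + j} y | ≡ᵇ-≢ {v} {1 + j} x = refl
act-off swap₂  {j} {v} (x , y , z) rewrite ≡ᵇ-≢ {v} {2 + j} y | ≡ᵇ-≢ {v} {3 + j} z = refl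
act-off cycle₁ {j} {v} (x , y , z) rewrite ≡ᵇ-≢ {v} {1 + j} x | ≡ᵇ-≢ {v} {2 + j} y | ≡ᵇ-≢ {v} {3 + j} z = refl
act-off cycle₂ {j} {v} (x , y , z) rewrite ≡ᵇ-≢ {v} {1 + j} x | ≡ᵇ-≢ {v} {2 + j} y | ≡ᵇ-≢ {v} {3 + j} z = refl

data Slot (j : ℕ) : ℕ → Set where
  isA : Slot j (1 + j)
  isB : Slot j (2 + j)
  isC : Slot j (3 + j)
  off : ∀ {v} → Off j v → Slot j v

slot : ∀ j v → Slot j v
slot j v with v ≟ 1 + j | v ≟ 2 + j | v ≟ 3 + j
... | yes refl | _ | _ = isA
... | no _ | yes refl | _ = isB
... | no _ | no _ | yes refl = isC
... | no x | no y | no z = off (x , y , z)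

act-undo : ∀ K j v → act (undo K) j (act K j v) ≡ v
act-undo K j v with slot j v
... | off o = trans (cong (act (undo K) j) (act-off K o)) (act-off (undo K) o)
act-undo none   j _ | isA = refl
act-undo none   j _ | isB = refl
act-undo none   j _ | isC = refl
act-undo swap₁  j _ | isA = trans (cong (act swap₁ j) (proj₁ (act-abc swap₁ j))) (proj₁ (proj₂ (act-abc swap₁ j)))
act-undo swap₁  j _ | isB = trans (cong (act swap₁ j) (proj₁ (proj₂ (act-abc swap₁ j)))) (proj₁ (act-abc swap₁ j))
act-undo swap₁  j _ | isC = trans (cong (act swap₁ j) (proj₂ (proj₂ (act-abc swap₁ j)))) (proj₂ (proj₂ (act-abc swap₁ j)))
act-undo swap₂  j _ | isA = trans (cong (act swap₂ j) (proj₁ (act-abc swap₂ j))) (proj₁ (act-abc swap₂ j))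
act-undo swap₂  j _ | isB = trans (cong (act swap₂ j) (proj₁ (proj₂ (act-abc swap₂ j)))) (proj₂ (proj₂ (act-abc swap₂ j)))
act-undo swap₂  j _ | isC = trans (cong (act swap₂ j) (proj₂ (proj₂ (act-abc swap₂ j)))) (proj₁ (proj₂ (act-abc swap₂ j)))
act-undo cycle₁ j _ | isA = trans (cong (act cycle₂ j) (proj₁ (act-abc cycle₁ j))) (proj₁ (proj₂ (act-abc cycle₂ j)))
act-undo cycle₁ j _ | isB = trans (cong (act cycle₂ j) (proj₁ (proj₂ (act-abc cycle₁ j)))) (proj₂ (proj₂ (act-abc cycle₂ j)))
act-undo cycle₁ j _ | isC = trans (cong (act cycle₂ j) (proj₂ (proj₂ (act-abc cycle₁ j)))) (proj₁ (act-abc cycle₂ j))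
act-undo cycle₂ j _ | isA = trans (cong (act cycle₁ j) (proj₁ (act-abc cycle₂ j))) (proj₂ (proj₂ (act-abc cycle₁ j)))
act-undo cycle₂ j _ | isB = trans (cong (act cycle₁ j) (proj₁ (proj₂ (act-abc cycle₂ j)))) (proj₁ (act-abc cycle₁ j))
act-undo cycle₂ j _ | isC = trans (cong (act cycle₁ j) (proj₂ (proj₂ (act-abc cycle₂ j)))) (proj₁ (proj₂ (act-abc cycle₁ j)))

act-inj : ∀ K j {u v} → act K j u ≡ act K j v → u ≡ v
act-inj K j {u} {v} e = trans (sym (act-undo K j u)) (trans (cong (act (undo K) j) e) (act-undo K j v))

undo-undo : ∀ K → undo (undo K) ≡ K
undo-undo none   = refl
undo-undo swap₁  = refl
undo-undo swap₂  = refl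
undo-undo cycle₁ = refl
undo-undo cycle₂ = refl

act-undo′ : ∀ K j v → act K j (act (undo K) j v) ≡ v
act-undo′ K j v = trans (cong (λ K′ → act K′ j (act (undo K) j v)) (sym (undo-undo K))) (act-undo (undo K) j v)

module _ (t : ℕ → ℕ) (w : List ℕ) (j : ℕ) where
  private
    pa = pos w (1 + j)
    pb = pos w (2 + j)
    pc = pos w (3 + j)

  Consistent : Bool → Bool → Bool → Set
  Consistent true  true  false = ⊥
  Consistent false false true  = ⊥
  Consistent _     _     _     = ⊤

  -- The nested conditionals of `d` and `d̃` are evaluated once for each order of three positions
  -- and each outcome of the test on `t`; `Consistent` excludes the two cyclic comparisons.
  D-eval : ∀ x y z F → Consistent x y z → (pa <ᵇ pb) ≡ x → (pb <ᵇ pa) ≡ not x → (pb <ᵇ pc) ≡ y → (pc <ᵇ pb) ≡ not y →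
           (pa <ᵇ pc) ≡ z → (pc <ᵇ pa) ≡ not z → (t (pa ⊓ pb ⊓ pc) <ᵇ pa ⊔ pb ⊔ pc) ≡ F →
           D t (2 + j) w ≡ map (act (kind x y z (not F) (not F)) j) w
  D-eval true  true  true  true  _ e₁ e₂ e₃ e₄ e₅ e₆ e₇ rewrite e₇ | e₁ | e₂ | e₃ = refl
  D-eval true  true  true  false _ e₁ e₂ e₃ e₄ e₅ e₆ e₇ rewrite e₇ | e₁ | e₂ | e₃ | e₄ | e₅ | e₆ = refl
  D-eval true  false true  true  _ e₁ e₂ e₃ e₄ e₅ e₆ e₇ rewrite e₇ | e₁ | e₂ | e₃ | e₄ | e₅ = refl
  D-eval true  false true  false _ e₁ e₂ e₃ e₄ e₅ e₆ e₇ rewrite e₇ | e₁ | e₂ | e₃ | e₄ | e₅ = refl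
  D-eval true  false false true  _ e₁ e₂ e₃ e₄ e₅ e₆ e₇ rewrite e₇ | e₁ | e₂ | e₃ | e₄ | e₅ = refl
  D-eval true  false false false _ e₁ e₂ e₃ e₄ e₅ e₆ e₇ rewrite e₇ | e₁ | e₂ | e₃ | e₄ | e₅ | e₆ = refl
  D-eval false true  true  true  _ e₁ e₂ e₃ e₄ e₅ e₆ e₇ rewrite e₇ | e₁ | e₂ | e₃ | e₄ | e₅ = refl
  D-eval false true  true  false _ e₁ e₂ e₃ e₄ e₅ e₆ e₇ rewrite e₇ | e₁ | e₂ | e₃ | e₄ | e₅ = refl
  D-eval false true  false true  _ e₁ e₂ e₃ e₄ e₅ e₆ e₇ rewrite e₇ | e₁ | e₂ | e₃ | e₄ | e₅ = refl
  D-eval false true  false false _ e₁ e₂ e₃ e₄ e₅ e₆ e₇ rewrite e₇ | e₁ | e₂ | e₃ | e₄ | e₅ | e₆ = refl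
  D-eval false false false true  _ e₁ e₂ e₃ e₄ e₅ e₆ e₇ rewrite e₇ | e₁ | e₂ | e₃ | e₄ = refl
  D-eval false false false false _ e₁ e₂ e₃ e₄ e₅ e₆ e₇ rewrite e₇ | e₁ | e₂ | e₃ | e₄ | e₅ | e₆ = refl

  data Order₃ : Set where
    abc : pa < pb → pb < pc → Order₃
    acb : pa < pc → pc < pb → Order₃
    bac : pb < pa → pa < pc → Order₃
    bca : pb < pc → pc < pa → Order₃
    cab : pc < pa → pa < pb → Order₃
    cba : pc < pb → pb < pa → Order₃

  order₃ : pa ≢ pb → pb ≢ pc → pa ≢ pc → Order₃
  order₃ n₁ n₂ n₃ with <-cmp pa pb | <-cmp pb pc | <-cmp pa pc
  ... | tri≈ _ e _ | _ | _ = ⊥-elim (n₁ e)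
  ... | _ | tri≈ _ e _ | _ = ⊥-elim (n₂ e)
  ... | _ | _ | tri≈ _ e _ = ⊥-elim (n₃ e)
  ... | tri< x _ _ | tri< y _ _ | _          = abc x y
  ... | tri> _ _ x | tri> _ _ y | _          = cba y x
  ... | tri< x _ _ | tri> _ _ y | tri< z _ _ = acb z y
  ... | tri< x _ _ | tri> _ _ y | tri> _ _ z = cab z x
  ... | tri> _ _ x | tri< y _ _ | tri< z _ _ = bac x z
  ... | tri> _ _ x | tri< y _ _ | tri> _ _ z = bca y z

  ends : ∀ {lo mid hi : ℕ} → lo < mid → mid < hi → pa ⊓ pb ⊓ pc ≡ lo → pa ⊔ pb ⊔ pc ≡ hi →
         ∀ {F} → (t lo <ᵇ hi) ≡ F → (t (pa ⊓ pb ⊓ pc) <ᵇ pa ⊔ pb ⊔ pc) ≡ F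
  ends _ _ e e′ h = trans (cong₂ (λ x y → t x <ᵇ y) e e′) h

  private
    T′ = <ᵇ-true
    F′ : ∀ {m k} → m < k → (k <ᵇ m) ≡ false
    F′ l = <ᵇ-false (<⇒≤ l)

  kind-cong : ∀ {x x′ y y′ z z′ F c₁ c₂} → x ≡ x′ → y ≡ y′ → z ≡ z′ →
              kind x′ y′ z′ (not F) (not F) ≡ kind x′ y′ z′ c₁ c₂ →
              D t (2 + j) w ≡ map (act (kind x′ y′ z′ (not F) (not F)) j) w → D t (2 + j) w ≡ map (act (kind x y z c₁ c₂) j) w
  kind-cong refl refl refl e h = trans h (cong (λ K → map (act K j) w) e)

  not-not : ∀ c {K K′ : Kind} → (if not (not c) then K else K′) ≡ (if c then K else K′)
  not-not true  = refl
  not-not false = refl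

  -- In a non-monotone order the outermost positions are those of the first two or of the last two
  -- values, never of the first and the third. Hence two closeness bits describe the test.
  D-kind : (o : Order₃) →
           (c₁ c₂ : Bool) → (∀ {x y} → (pa ≡ x × pb ≡ y) ⊎ (pb ≡ x × pa ≡ y) → x < y → (t x <ᵇ y) ≡ not c₁) →
           (∀ {x y} → (pb ≡ x × pc ≡ y) ⊎ (pc ≡ x × pb ≡ y) → x < y → (t x <ᵇ y) ≡ not c₂) →
           D t (2 + j) w ≡ map (act (kind (pa <ᵇ pb) (pb <ᵇ pc) (pa <ᵇ pc) c₁ c₂) j) w
  D-kind (abc l l′) c₁ c₂ f₁ f₂ = kind-cong {F = t (pa ⊓ pb ⊓ pc) <ᵇ pa ⊔ pb ⊔ pc} {c₁} {c₂} (T′ l) (T′ l′) (T′ (<-trans l l′)) refl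
    (D-eval true true true _ tt (T′ l) (F′ l) (T′ l′) (F′ l′) (T′ (<-trans l l′)) (F′ (<-trans l l′)) refl)
  D-kind (cba l l′) c₁ c₂ f₁ f₂ = kind-cong {F = t (pa ⊓ pb ⊓ pc) <ᵇ pa ⊔ pb ⊔ pc} {c₁} {c₂} (F′ l′) (F′ l) (F′ (<-trans l l′)) refl
    (D-eval false false false _ tt (F′ l′) (T′ l′) (F′ l) (T′ l) (F′ (<-trans l l′)) (T′ (<-trans l l′)) refl)
  D-kind (acb l l′) c₁ c₂ f₁ f₂ = kind-cong {F = not c₁} {c₁} {c₂} (T′ (<-trans l l′)) (F′ l′) (T′ l) (not-not c₁ {cycle₁} {swap₁})
    (D-eval true false true (not c₁) tt (T′ (<-trans l l′)) (F′ (<-trans l l′)) (F′ l′) (T′ l′) (T′ l) (F′ l)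
      (ends l l′ (trans (cong (_⊓ pc) (m≤n⇒m⊓n≡m (<⇒≤ (<-trans l l′)))) (m≤n⇒m⊓n≡m (<⇒≤ l)))
                 (trans (cong (_⊔ pc) (m≤n⇒m⊔n≡n (<⇒≤ (<-trans l l′)))) (m≥n⇒m⊔n≡m (<⇒≤ l′)))
            (f₁ (inj₁ (refl , refl)) (<-trans l l′))))
  D-kind (bca l l′) c₁ c₂ f₁ f₂ = kind-cong {F = not c₁} {c₁} {c₂} (F′ (<-trans l l′)) (T′ l) (F′ l′) (not-not c₁ {cycle₁} {swap₁})
    (D-eval false true false (not c₁) tt (F′ (<-trans l l′)) (T′ (<-trans l l′)) (T′ l) (F′ l) (F′ l′) (T′ l′)
      (ends l l′ (trans (cong (_⊓ pc) (m≥n⇒m⊓n≡n (<⇒≤ (<-trans l l′)))) (m≤n⇒m⊓n≡m (<⇒≤ l)))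
                 (trans (cong (_⊔ pc) (m≥n⇒m⊔n≡m (<⇒≤ (<-trans l l′)))) (m≥n⇒m⊔n≡m (<⇒≤ l′)))
            (f₁ (inj₂ (refl , refl)) (<-trans l l′))))
  D-kind (cab l l′) c₁ c₂ f₁ f₂ = kind-cong {F = not c₂} {c₁} {c₂} (T′ l′) (F′ (<-trans l l′)) (F′ l) (not-not c₂ {cycle₂} {swap₂})
    (D-eval true false false (not c₂) tt (T′ l′) (F′ l′) (F′ (<-trans l l′)) (T′ (<-trans l l′)) (F′ l) (T′ l)
      (ends l l′ (trans (cong (_⊓ pc) (m≤n⇒m⊓n≡m (<⇒≤ l′))) (m≥n⇒m⊓n≡n (<⇒≤ l)))
                 (trans (cong (_⊔ pc) (m≤n⇒m⊔n≡n (<⇒≤ l′))) (m≥n⇒m⊔n≡m (<⇒≤ (<-trans l l′))))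
            (f₂ (inj₂ (refl , refl)) (<-trans l l′))))
  D-kind (bac l l′) c₁ c₂ f₁ f₂ = kind-cong {F = not c₂} {c₁} {c₂} (F′ l) (T′ (<-trans l l′)) (T′ l′) (not-not c₂ {cycle₂} {swap₂})
    (D-eval false true true (not c₂) tt (F′ l) (T′ l) (T′ (<-trans l l′)) (F′ (<-trans l l′)) (T′ l′) (F′ l′)
      (ends l l′ (trans (cong (_⊓ pc) (m≥n⇒m⊓n≡n (<⇒≤ l))) (m≤n⇒m⊓n≡m (<⇒≤ (<-trans l l′))))
                 (trans (cong (_⊔ pc) (m≥n⇒m⊔n≡m (<⇒≤ l))) (m≤n⇒m⊔n≡n (<⇒≤ l′)))
            (f₂ (inj₁ (refl , refl)) (<-trans l l′))))

-- Closeness of contents and the bound `τ`.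

module Operators (ν : List Skew) where
  open Fillings ν

  lt : ℤ → ℤ → Bool
  lt x y = ⌊ x ℤ.<? y ⌋

  cl : ℤ → ℤ → Bool
  cl x y = ⌊ y ℤ.≤? x ℤ.+ + k ⌋ ∧ ⌊ x ℤ.≤? y ℤ.+ + k ⌋

  lt-true : ∀ {x y} → x ℤ.< y → lt x y ≡ true
  lt-true {x} {y} l with x ℤ.<? y
  ... | yes _ = refl
  ... | no n  = ⊥-elim (n l)

  lt-false : ∀ {x y} → y ℤ.≤ x → lt x y ≡ false
  lt-false {x} {y} l with x ℤ.<? y
  ... | no _  = refl
  ... | yes p = ⊥-elim (ℤP.<-irrefl refl (ℤP.<-≤-trans p l))

  lt-true⁻ : ∀ {x y} → lt x y ≡ true → x ℤ.< y
  lt-true⁻ {x} {y} e with x ℤ.<? y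
  ... | yes p = p

  lt-false⁻ : ∀ {x y} → lt x y ≡ false → y ℤ.≤ x
  lt-false⁻ {x} {y} e with x ℤ.<? y
  ... | no n = ℤP.≮⇒≥ n

  ≤?-true : ∀ {x y} → x ℤ.≤ y → ⌊ x ℤ.≤? y ⌋ ≡ true
  ≤?-true {x} {y} l with x ℤ.≤? y
  ... | yes _ = refl
  ... | no n  = ⊥-elim (n l)

  ≤?-false : ∀ {x y} → y ℤ.< x → ⌊ x ℤ.≤? y ⌋ ≡ false
  ≤?-false {x} {y} l with x ℤ.≤? y
  ... | no _  = refl
  ... | yes p = ⊥-elim (ℤP.<-irrefl refl (ℤP.<-≤-trans l p))

  +k-mono : ∀ {x y} → x ℤ.≤ y → x ℤ.+ + k ℤ.≤ y ℤ.+ + k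
  +k-mono {x} {y} = ℤP.+-monoˡ-≤ (+ k) {x} {y}

  ≤+k : ∀ x → x ℤ.≤ x ℤ.+ + k
  ≤+k x = ℤP.≤-trans (ℤP.≤-reflexive (sym (ℤP.+-identityʳ x))) (ℤP.+-monoʳ-≤ x (ℤ.+≤+ z≤n))

  cl-true : ∀ {x y} → x ℤ.≤ y → y ℤ.≤ x ℤ.+ + k → cl x y ≡ true
  cl-true {x} {y} l l′ rewrite ≤?-true l′ | ≤?-true (ℤP.≤-trans l (≤+k y)) = refl

  cl-false : ∀ {x y} → x ℤ.+ + k ℤ.< y → cl x y ≡ false
  cl-false {x} {y} l rewrite ≤?-false l = refl

  cl-sym : ∀ x y → cl x y ≡ cl y x
  cl-sym x y = ∧-comm ⌊ y ℤ.≤? x ℤ.+ + k ⌋ ⌊ x ℤ.≤? y ℤ.+ + k ⌋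

  cl-true⁻ : ∀ {x y} → cl x y ≡ true → y ℤ.≤ x ℤ.+ + k × x ℤ.≤ y ℤ.+ + k
  cl-true⁻ {x} {y} e with y ℤ.≤? x ℤ.+ + k | x ℤ.≤? y ℤ.+ + k
  ... | yes p | yes q = p , q

  data View (α β γ : ℤ) : Kind → Set where
    none   : View α β γ none
    swap₁  : cl α β ≡ false → View α β γ swap₁
    swap₂  : cl β γ ≡ false → View α β γ swap₂
    cycle₁ : cl α β ≡ true → (α ℤ.< γ × γ ℤ.< β) ⊎ (β ℤ.< γ × γ ℤ.< α) → View α β γ cycle₁
    cycle₂ : cl β γ ≡ true → (β ℤ.< α × α ℤ.< γ) ⊎ (γ ℤ.< α × α ℤ.< β) → View α β γ cycle₂

  kindOf : ℤ → ℤ → ℤ → Kind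
  kindOf α β γ = kind (lt α β) (lt β γ) (lt α γ) (cl α β) (cl β γ)

  ≤∧≢ : ∀ {x y : ℤ} → x ℤ.≤ y → y ≢ x → x ℤ.< y
  ≤∧≢ l n = ℤP.≤∧≢⇒< l (n ∘ sym)

  view : ∀ {α β γ} → α ≢ β → β ≢ γ → α ≢ γ → View α β γ (kindOf α β γ)
  view {α} {β} {γ} n₁ n₂ n₃ with lt α β in e₁ | lt β γ in e₂ | lt α γ in e₃ | cl α β in e₄ | cl β γ in e₅
  ... | true  | true  | _     | _     | _     = none
  ... | false | false | _     | _     | _     = none
  ... | true  | false | true  | true  | _     = cycle₁ e₄ (inj₁ (lt-true⁻ e₃ , ≤∧≢ (lt-false⁻ e₂) n₂))
  ... | true  | false | true  | false | _     = swap₁ e₄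
  ... | false | true  | false | true  | _     = cycle₁ e₄ (inj₂ (lt-true⁻ e₂ , ≤∧≢ (lt-false⁻ e₃) n₃))
  ... | false | true  | false | false | _     = swap₁ e₄
  ... | true  | false | false | _     | true  = cycle₂ e₅ (inj₂ (≤∧≢ (lt-false⁻ e₃) n₃ , lt-true⁻ e₁))
  ... | true  | false | false | _     | false = swap₂ e₅
  ... | false | true  | true  | _     | true  = cycle₂ e₅ (inj₁ (≤∧≢ (lt-false⁻ e₁) n₁ , lt-true⁻ e₃))
  ... | false | true  | true  | _     | false = swap₂ e₅

  -- Cells comparable in one shape: far apart in content, unless consecutive.
  Spread : ℤ → ℤ → Set
  Spread x y = x ℤ.+ + k ℤ.≤ y ⊎ y ℤ.+ + k ℤ.≤ x

  -- A letter strictly between two close ones is at distance less than k from each, whereas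
  -- comparable cells of one row or column are at distance at least k.
  inside : ∀ {x y z} → cl x y ≡ true → (x ℤ.< z × z ℤ.< y) ⊎ (y ℤ.< z × z ℤ.< x) → ¬ Spread x z × ¬ Spread y z
  inside {x} {y} {z} e (inj₁ (a , b)) = (λ
    { (inj₁ s) → ℤP.<-irrefl refl (ℤP.<-≤-trans b (ℤP.≤-trans (proj₁ (cl-true⁻ e)) s))
    ; (inj₂ s) → ℤP.<-irrefl refl (ℤP.<-≤-trans a (ℤP.≤-trans (≤+k z) s)) }) , λ
    { (inj₁ s) → ℤP.<-irrefl refl (ℤP.<-≤-trans b (ℤP.≤-trans (≤+k y) s))
    ; (inj₂ s) → ℤP.<-irrefl refl (ℤP.<-≤-trans (ℤP.+-monoˡ-< (+ k) a) (ℤP.≤-trans s (proj₁ (cl-true⁻ e)))) }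
  inside {x} {y} {z} e (inj₂ (a , b)) = let p , q = inside {y} {x} {z} (trans (cl-sym y x) e) (inj₁ (a , b)) in q , p

  module Act {T : Cell → ℕ} (S : IsStandardFilling ν T) where
    open Std S

    -- Between two entries of one diagonal come the entries above and to the right of the first, so
    -- such entries differ by at least 3.
    distinct : ∀ {u v} → 1 ≤ u → v ≤ n → u < v → v < 3 + u → κ u ≢ κ v
    distinct {u} {v} l l′ u<v v< e with onto l (≤-trans (<⇒≤ u<v) l′) | onto (≤-trans l (<⇒≤ u<v)) l′
    ... | x , x∈ , refl | y , y∈ , refl = impossible (square x∈ y∈ eq u<v)
      where
      eq = trans (sym (κ-cell x∈)) (trans e (κ-cell y∈))
      impossible : Square x y → ⊥
      impossible s with <-cmp (T (Square.above s)) (T (Square.right s))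
      ... | tri< p _ _ = <-irrefl refl (<-≤-trans v< (≤-trans (s≤s (≤-trans (s≤s (proj₁ (Square.above-< s))) p)) (proj₂ (Square.right-< s))))
      ... | tri> _ _ p = <-irrefl refl (<-≤-trans v< (≤-trans (s≤s (≤-trans (s≤s (proj₁ (Square.right-< s))) p)) (proj₂ (Square.above-< s))))
      ... | tri≈ _ p _ with injective _ _ (Square.above∈ s) (Square.right∈ s) p
      ... | refl = ℤP.<-irrefl refl (ℤP.<-≤-trans (subst (ℤ._< sc x ℤ.+ + k) (ℤP.+-identityʳ (sc x)) (ℤP.+-monoʳ-< (sc x) (ℤ.+<+ k>0)))
              (ℤP.≤-trans (ℤP.≤-reflexive (sym (Square.right-c s))) (ℤP.≤-trans (≤+k _) (ℤP.≤-reflexive (sym (Square.above-c s))))))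
        where
        k>0 : 0 < k
        k>0 = ≤-trans (s≤s z≤n) (comp-< {ν} x∈)

    pos-lt : ∀ {u v} → 1 ≤ u → u ≤ n → 1 ≤ v → v ≤ n → κ u ≢ κ v → (pos word u <ᵇ pos word v) ≡ lt (κ u) (κ v)
    pos-lt a b c d ne with onto a b | onto c d
    ... | x , x∈ , refl | y , y∈ , refl with ℤP.<-cmp (κ (T x)) (κ (T y))
    ... | tri≈ _ e _ = ⊥-elim (ne e)
    ... | tri< l _ _ = trans (<ᵇ-true (pos-mono x∈ y∈ (subst₂ ℤ._<_ (κ-cell x∈) (κ-cell y∈) l))) (sym (lt-true l))
    ... | tri> _ _ l = trans (<ᵇ-false (<⇒≤ (pos-mono y∈ x∈ (subst₂ ℤ._<_ (κ-cell y∈) (κ-cell x∈) l)))) (sym (lt-false (ℤP.<⇒≤ l)))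

    pos-≢ : ∀ {u v} → κ u ≢ κ v → pos word u ≢ pos word v
    pos-≢ ne e = ne (cong (c̃ ν) e)

    pos-in : ∀ {u} → 1 ≤ u → u ≤ n → 1 ≤ pos word u × pos word u ≤ n
    pos-in a b with onto a b
    ... | x , x∈ , refl = pos-bounds x∈

  max-≥ : ∀ {v xs} → v ∈ xs → v ≤ foldr _⊔_ 0 xs
  max-≥ {xs = x ∷ xs} (here refl) = m≤m⊔n x _
  max-≥ {xs = x ∷ xs} (there i) = ≤-trans (max-≥ i) (m≤n⊔m x _)

  max-< : ∀ {b xs} → 0 < b → (∀ {v} → v ∈ xs → v < b) → foldr _⊔_ 0 xs < b
  max-< {xs = []} l h = l
  max-< {xs = x ∷ xs} l h = ⊔-lub (h (here refl)) (max-< l (h ∘ there))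

  nth-mono : ∀ {xs : List Cell} → AllPairs W xs → ∀ {p q} → 1 ≤ p → p ≤ q → q ≤ length xs →
             nth (+ 0) (map sc xs) p ℤ.≤ nth (+ 0) (map sc xs) q
  nth-mono {x ∷ xs} (a ∷ as) {suc zero} {suc zero} _ _ _ = ℤP.≤-refl
  nth-mono {x ∷ xs} (a ∷ as) {suc zero} {suc (suc q)} _ _ (s≤s l) = go xs a q l
    where
    go : ∀ ys → All (W x) ys → ∀ q → suc q ≤ length ys → sc x ℤ.≤ nth (+ 0) (map sc ys) (suc q)
    go (y ∷ ys) (w ∷ ws) zero    _       = w-≤ w
    go (y ∷ ys) (w ∷ ws) (suc q) (s≤s l) = go ys ws q l
  nth-mono {x ∷ xs} (a ∷ as) {suc (suc p)} {suc (suc q)} _ (s≤s l) (s≤s l′) = nth-mono as (s≤s z≤n) l l′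

  c̃-mono : ∀ {p q} → 1 ≤ p → p ≤ q → q ≤ n → c̃ ν p ℤ.≤ c̃ ν q
  c̃-mono a b c = nth-mono ro-sorted a b (subst (_ ≤_) (sym ro-length) c)

  diff-≤ : ∀ {x y} → (y ℤ.- x ℤ.≤ + k → y ℤ.≤ x ℤ.+ + k) × (y ℤ.≤ x ℤ.+ + k → y ℤ.- x ℤ.≤ + k)
  diff-≤ {x} {y} = (λ l → subst₂ ℤ._≤_ (cancel y x) (ℤP.+-comm (+ k) x) (ℤP.+-monoˡ-≤ x l)) ,
    λ l → subst (y ℤ.- x ℤ.≤_) (solve 2 (λ x k → (x :+ k) :- x := k) refl x (+ k)) (ℤP.+-monoˡ-≤ (ℤ.- x) l)
    where
    open +-*-Solver
    cancel : ∀ y x → (y ℤ.- x) ℤ.+ x ≡ y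
    cancel y x = solve 2 (λ y x → (y :- x) :+ x := y) refl y x

  -- Contents increase weakly with position, so a position is at most the maximum in `τ` exactly
  -- when its content is still within k.
  τ-cl : ∀ {p q} → 1 ≤ p → p ≤ n → 1 ≤ q → q ≤ n → c̃ ν p ℤ.< c̃ ν q → (τ ν p <ᵇ q) ≡ not (cl (c̃ ν p) (c̃ ν q))
  τ-cl {p} {suc q} p₁ p₂ q₁ q₂ l with c̃ ν (suc q) ℤ.≤? c̃ ν p ℤ.+ + k
  ... | yes h = trans (<ᵇ-false (max-≥ (∈-filter⁺ (λ j → (c̃ ν j ℤ.- c̃ ν p) ℤ.≤? + k) (∈-map⁺ suc (∈-upTo⁺ q₂)) (proj₂ (diff-≤ {c̃ ν p}) h))))
                  (cong not (sym (cong (true ∧_) (≤?-true (ℤP.≤-trans (ℤP.<⇒≤ l) (≤+k _))))))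
  ... | no h = <ᵇ-true (max-< (s≤s z≤n) below)
    where
    below : ∀ {v} → v ∈ Data.List.filter (λ j → (c̃ ν j ℤ.- c̃ ν p) ℤ.≤? + k) (range1 n) → v < suc q
    below {v} v∈ with ∈-filter⁻ (λ j → (c̃ ν j ℤ.- c̃ ν p) ℤ.≤? + k) {xs = range1 n} v∈
    ... | r , near with ∈-map⁻ suc r
    ... | u , u∈ , refl = ≰⇒> λ le → h (ℤP.≤-trans (c̃-mono (s≤s z≤n) le (∈-upTo⁻ u∈)) (proj₁ (diff-≤ {c̃ ν p}) near))

-- Content words, and closure of the vertices under the operators.

cw : ∀ {A : Set} → (ℕ → A) → ℕ → List A
cw κ zero    = []
cw κ (suc m) = κ (suc m) ∷ cw κ m

cw-cong : ∀ {A : Set} {κ κ′ : ℕ → A} m → (∀ v → 1 ≤ v → v ≤ m → κ v ≡ κ′ v) → cw κ m ≡ cw κ′ m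
cw-cong zero    h = refl
cw-cong (suc m) h = cong₂ _∷_ (h (suc m) (s≤s z≤n) ≤-refl) (cw-cong m λ v a b → h v a (≤-trans b (n≤1+n m)))

cw-length : ∀ {A : Set} (κ : ℕ → A) m → length (cw κ m) ≡ m
cw-length κ zero    = refl
cw-length κ (suc m) = cong suc (cw-length κ m)

cw-∈ : ∀ {A : Set} (κ : ℕ → A) m {a} → a ∈ cw κ m → ∃ λ v → 1 ≤ v × v ≤ m × κ v ≡ a
cw-∈ κ (suc m) (here e) = suc m , s≤s z≤n , ≤-refl , sym e
cw-∈ κ (suc m) (there i) with cw-∈ κ m i
... | v , a , b , e = v , a , ≤-trans b (n≤1+n m) , e

cw-split : ∀ {A : Set} (κ : ℕ → A) m β {t γ} → cw κ m ≡ β ++ t ∷ γ → ∃ λ v → 1 ≤ v × v ≤ m × κ v ≡ t × (∀ u → v < u → u ≤ m → κ u ∈ β)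
cw-split κ (suc m) [] refl = suc m , s≤s z≤n , ≤-refl , refl , λ u a b → ⊥-elim (<-irrefl refl (<-≤-trans a b))
cw-split κ (suc m) (b ∷ β) e with cw-split κ m β (∷-injectiveʳ e)
... | v , p , q , r , f = v , p , ≤-trans q (n≤1+n m) , r , λ u a b → case m≤n⇒m<n∨m≡n b of λ
      { (inj₁ l) → there (f u a (≤-pred l)) ; (inj₂ refl) → here (∷-injectiveˡ e) }
cw-split κ zero (_ ∷ _) ()

act-in : ∀ K j {v} → Slot j v → (1 ≤ v → 1 ≤ act K j v) × (∀ {n} → 3 + j ≤ n → v ≤ n → act K j v ≤ n)
act-in K j (off o) rewrite act-off K o = id , λ _ l → l
act-in K j {v} s = bounds K s
  where
  hi : ∀ {x y n} → x ≡ y → y ≤ 3 + j → 3 + j ≤ n → x ≤ n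
  hi refl l l′ = ≤-trans l l′
  lo : ∀ {x y} → x ≡ suc y → 1 ≤ x
  lo refl = s≤s z≤n
  a = s≤s (m≤n+m j 2)
  b = s≤s (s≤s (n≤1+n j))
  bounds : ∀ K {v} → Slot j v → (1 ≤ v → 1 ≤ act K j v) × (∀ {n} → 3 + j ≤ n → v ≤ n → act K j v ≤ n)
  bounds K (off o) rewrite act-off K o = id , λ _ l → l
  bounds none   isA = id , λ _ l → l
  bounds none   isB = id , λ _ l → l
  bounds none   isC = id , λ _ l → l
  bounds swap₁  isA = let e = proj₁ (act-abc swap₁ j) in (λ _ → lo e) , λ l _ → hi e b l
  bounds swap₁  isB = let e = proj₁ (proj₂ (act-abc swap₁ j)) in (λ _ → lo e) , λ l _ → hi e a l
  bounds swap₁  isC = let e = proj₂ (proj₂ (act-abc swap₁ j)) in (λ _ → lo e) , λ l _ → hi e ≤-refl l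
  bounds swap₂  isA = let e = proj₁ (act-abc swap₂ j) in (λ _ → lo e) , λ l _ → hi e a l
  bounds swap₂  isB = let e = proj₁ (proj₂ (act-abc swap₂ j)) in (λ _ → lo e) , λ l _ → hi e ≤-refl l
  bounds swap₂  isC = let e = proj₂ (proj₂ (act-abc swap₂ j)) in (λ _ → lo e) , λ l _ → hi e b l
  bounds cycle₁ isA = let e = proj₁ (act-abc cycle₁ j) in (λ _ → lo e) , λ l _ → hi e b l
  bounds cycle₁ isB = let e = proj₁ (proj₂ (act-abc cycle₁ j)) in (λ _ → lo e) , λ l _ → hi e ≤-refl l
  bounds cycle₁ isC = let e = proj₂ (proj₂ (act-abc cycle₁ j)) in (λ _ → lo e) , λ l _ → hi e a l
  bounds cycle₂ isA = let e = proj₁ (act-abc cycle₂ j) in (λ _ → lo e) , λ l _ → hi e ≤-refl l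
  bounds cycle₂ isB = let e = proj₁ (proj₂ (act-abc cycle₂ j)) in (λ _ → lo e) , λ l _ → hi e a l
  bounds cycle₂ isC = let e = proj₂ (proj₂ (act-abc cycle₂ j)) in (λ _ → lo e) , λ l _ → hi e b l

off-below : ∀ {j v} → v ≤ j → Off j v
off-below {j} l = (λ e → <-irrefl e (s≤s l)) , (λ e → <-irrefl e (s≤s (≤-trans l (n≤1+n j)))) , λ e → <-irrefl e (s≤s (≤-trans l (m≤n+m j 2)))

off-above : ∀ {j v} → 3 + j < v → Off j v
off-above {j} l = (λ e → <-irrefl (sym e) (≤-trans (s≤s (s≤s (m≤n+m j 2))) l)) , (λ e → <-irrefl (sym e) (≤-trans (n≤1+n (3 + j)) l)) , λ e → <-irrefl (sym e) l

module Vertices (ν : List Skew) where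
  open Fillings ν
  open Operators ν

  -- The three consecutive values are permuted among themselves, so comparisons with any other value
  -- do not change.
  between-slots : ∀ K j {u v} → Slot j u → Slot j v → Off j u ⊎ Off j v → u < v → act K j u < act K j v
  between-slots K j {u} {v} su sv o l = go su sv o
    where
    images : ∀ K → (∀ w → w ≡ 1 + j ⊎ w ≡ 2 + j ⊎ w ≡ 3 + j →
            act K j w ≡ 1 + j ⊎ act K j w ≡ 2 + j ⊎ act K j w ≡ 3 + j)
    images none   w p = p
    images swap₁  w (inj₁ refl) = inj₂ (inj₁ (proj₁ (act-abc swap₁ j)))
    images swap₁  w (inj₂ (inj₁ refl)) = inj₁ (proj₁ (proj₂ (act-abc swap₁ j)))
    images swap₁  w (inj₂ (inj₂ refl)) = inj₂ (inj₂ (proj₂ (proj₂ (act-abc swap₁ j))))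
    images swap₂  w (inj₁ refl) = inj₁ (proj₁ (act-abc swap₂ j))
    images swap₂  w (inj₂ (inj₁ refl)) = inj₂ (inj₂ (proj₁ (proj₂ (act-abc swap₂ j))))
    images swap₂  w (inj₂ (inj₂ refl)) = inj₂ (inj₁ (proj₂ (proj₂ (act-abc swap₂ j))))
    images cycle₁ w (inj₁ refl) = inj₂ (inj₁ (proj₁ (act-abc cycle₁ j)))
    images cycle₁ w (inj₂ (inj₁ refl)) = inj₂ (inj₂ (proj₁ (proj₂ (act-abc cycle₁ j))))
    images cycle₁ w (inj₂ (inj₂ refl)) = inj₁ (proj₂ (proj₂ (act-abc cycle₁ j)))
    images cycle₂ w (inj₁ refl) = inj₂ (inj₂ (proj₁ (act-abc cycle₂ j)))
    images cycle₂ w (inj₂ (inj₁ refl)) = inj₁ (proj₁ (proj₂ (act-abc cycle₂ j)))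
    images cycle₂ w (inj₂ (inj₂ refl)) = inj₂ (inj₁ (proj₂ (proj₂ (act-abc cycle₂ j))))
    In : ℕ → Set
    In w = w ≡ 1 + j ⊎ w ≡ 2 + j ⊎ w ≡ 3 + j
    in-≥ : ∀ {w} → In w → 1 + j ≤ w
    in-≥ (inj₁ refl) = ≤-refl
    in-≥ (inj₂ (inj₁ refl)) = n≤1+n (suc j)
    in-≥ (inj₂ (inj₂ refl)) = ≤-trans (n≤1+n (suc j)) (n≤1+n (2 + j))
    in-≤ : ∀ {w} → In w → w ≤ 3 + j
    in-≤ (inj₁ refl) = ≤-trans (n≤1+n (suc j)) (n≤1+n (2 + j))
    in-≤ (inj₂ (inj₁ refl)) = n≤1+n (2 + j)
    in-≤ (inj₂ (inj₂ refl)) = ≤-refl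
    out-< : ∀ {u v} → Off j u → In v → u < v → u < 1 + j
    out-< {u} (x , y , z) i l = ≤∧≢⇒< (≤-pred (≤∧≢⇒< (≤-pred (≤∧≢⇒< (≤-pred (<-≤-trans l (≤-trans (in-≤ i) (n≤1+n (3 + j))))) z)) y)) x
    out-> : ∀ {u v} → Off j v → In u → u < v → 3 + j < v
    out-> (x , y , z) i l = ≤∧≢⇒< (≤∧≢⇒< (≤∧≢⇒< (≤-trans (in-≥ i) (<⇒≤ l)) (x ∘ sym)) (y ∘ sym)) (z ∘ sym)
    slot-in : ∀ {w} → Slot j w → In w ⊎ Off j w
    slot-in isA = inj₁ (inj₁ refl)
    slot-in isB = inj₁ (inj₂ (inj₁ refl))
    slot-in isC = inj₁ (inj₂ (inj₂ refl))
    slot-in (off o) = inj₂ o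
    go : Slot j u → Slot j v → Off j u ⊎ Off j v → act K j u < act K j v
    go su sv _ with slot-in su | slot-in sv
    go su sv _ | inj₂ o | inj₂ o′ = subst₂ _<_ (sym (act-off K o)) (sym (act-off K o′)) l
    go su sv _ | inj₂ o | inj₁ i = subst (_< act K j v) (sym (act-off K o)) (<-≤-trans (out-< o i l) (in-≥ (images K v i)))
    go su sv _ | inj₁ i | inj₂ o = subst (act K j u <_) (sym (act-off K o)) (≤-<-trans (in-≤ (images K u i)) (out-> o i l))
    go su sv (inj₁ (x , y , z)) | inj₁ (inj₁ e) | inj₁ _ = ⊥-elim (x e)
    go su sv (inj₁ (x , y , z)) | inj₁ (inj₂ (inj₁ e)) | inj₁ _ = ⊥-elim (y e)
    go su sv (inj₁ (x , y , z)) | inj₁ (inj₂ (inj₂ e)) | inj₁ _ = ⊥-elim (z e)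
    go su sv (inj₂ (x , y , z)) | inj₁ _ | inj₁ (inj₁ e) = ⊥-elim (x e)
    go su sv (inj₂ (x , y , z)) | inj₁ _ | inj₁ (inj₂ (inj₁ e)) = ⊥-elim (y e)
    go su sv (inj₂ (x , y , z)) | inj₁ _ | inj₁ (inj₂ (inj₂ e)) = ⊥-elim (z e)

  module Next {T : Cell → ℕ} (S : IsStandardFilling ν T) (j : ℕ) (j< : 3 + j ≤ n) where
    open Std S
    open Act S

    private
      a≤ : 1 + j ≤ n
      a≤ = ≤-trans (s≤s (m≤n+m j 2)) j<
      b≤ : 2 + j ≤ n
      b≤ = ≤-trans (n≤1+n (2 + j)) j<
      1≤ : ∀ {m} → 1 ≤ suc m
      1≤ = s≤s z≤n
      α = κ (1 + j)
      β = κ (2 + j)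
      γ = κ (3 + j)
      α≢β : α ≢ β
      α≢β = distinct 1≤ b≤ ≤-refl (n≤1+n (3 + j))
      β≢γ : β ≢ γ
      β≢γ = distinct 1≤ j< ≤-refl (n≤1+n (4 + j))
      α≢γ : α ≢ γ
      α≢γ = distinct 1≤ j< (s≤s (n≤1+n (suc j))) ≤-refl

    K : Kind
    K = kindOf α β γ

    T′ : Cell → ℕ
    T′ = act K j ∘ T

    word-D : D (τ ν) (2 + j) word ≡ scWord ν T′
    word-D = trans (D-kind (τ ν) word j (order₃ (τ ν) word j (pos-≢ α≢β) (pos-≢ β≢γ) (pos-≢ α≢γ)) (cl α β) (cl β γ)
        (far 1≤ a≤ 1≤ b≤ α≢β) (far 1≤ b≤ 1≤ j< β≢γ))
      (trans (cong (λ K → map (act K j) word) kinds) (sym (map-∘ ro)))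
      where
      kinds : kind (pos word (1 + j) <ᵇ pos word (2 + j)) (pos word (2 + j) <ᵇ pos word (3 + j)) (pos word (1 + j) <ᵇ pos word (3 + j)) (cl α β) (cl β γ) ≡ K
      kinds = eq₃ (pos-lt 1≤ a≤ 1≤ b≤ α≢β) (pos-lt 1≤ b≤ 1≤ j< β≢γ) (pos-lt 1≤ a≤ 1≤ j< α≢γ)
        where
        eq₃ : ∀ {x x′ y y′ z z′} → x ≡ x′ → y ≡ y′ → z ≡ z′ → kind x y z (cl α β) (cl β γ) ≡ kind x′ y′ z′ (cl α β) (cl β γ)
        eq₃ refl refl refl = refl
      far : ∀ {u v} → 1 ≤ u → u ≤ n → 1 ≤ v → v ≤ n → κ u ≢ κ v →
            ∀ {x y} → (pos word u ≡ x × pos word v ≡ y) ⊎ (pos word v ≡ x × pos word u ≡ y) → x < y → (τ ν x <ᵇ y) ≡ not (cl (κ u) (κ v))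
      far {u} {v} a b c d ne (inj₁ (refl , refl)) l =
        τ-cl (proj₁ (pos-in a b)) (proj₂ (pos-in a b)) (proj₁ (pos-in c d)) (proj₂ (pos-in c d))
          (lt-true⁻ (trans (sym (pos-lt a b c d ne)) (<ᵇ-true l)))
      far {u} {v} a b c d ne (inj₂ (refl , refl)) l = trans
        (τ-cl (proj₁ (pos-in c d)) (proj₂ (pos-in c d)) (proj₁ (pos-in a b)) (proj₂ (pos-in a b))
          (lt-true⁻ (trans (sym (pos-lt c d a b (ne ∘ sym))) (<ᵇ-true l)))) (cong not (cl-sym (κ v) (κ u)))

    private
      -- Two of the three values reverse their order only if their cells are unrelated. Exchanged
      -- letters with consecutive values are not close, while related cells with consecutive entries
      -- are adjacent and thus close. In a rotation, a reversed pair contains the letter strictly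
      -- between two close ones, and `inside` applies.
      mono-slots : ∀ K → View α β γ K → ∀ {u v} → Slot j u → Slot j v → u < v → Spread (κ u) (κ v) →
                   (v ≡ suc u → cl (κ u) (κ v) ≡ true) → act K j u < act K j v
      mono-slots K w (off o) sv l _ _ = between-slots K j (off o) sv (inj₁ o) l
      mono-slots K w isA (off o) l _ _ = between-slots K j isA (off o) (inj₂ o) l
      mono-slots K w isB (off o) l _ _ = between-slots K j isB (off o) (inj₂ o) l
      mono-slots K w isC (off o) l _ _ = between-slots K j isC (off o) (inj₂ o) l
      mono-slots K w isA isA l _ _ = ⊥-elim (<-irrefl refl l)
      mono-slots K w isB isB l _ _ = ⊥-elim (<-irrefl refl l)
      mono-slots K w isC isC l _ _ = ⊥-elim (<-irrefl refl l)
      mono-slots K w isB isA l _ _ = ⊥-elim (<-asym l (n<1+n (suc j)))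
      mono-slots K w isC isA l _ _ = ⊥-elim (<-asym l (<-trans (n<1+n (suc j)) (n<1+n (2 + j))))
      mono-slots K w isC isB l _ _ = ⊥-elim (<-asym l (n<1+n (2 + j)))
      mono-slots none   none isA isB l _ _ = l
      mono-slots none   none isA isC l _ _ = l
      mono-slots none   none isB isC l _ _ = l
      mono-slots swap₁  (swap₁ f) isA isB l _ h = ⊥-elim (clash (h refl) f)
      mono-slots swap₁  (swap₁ f) isA isC l _ h = subst₂ _<_ (sym (proj₁ (act-abc swap₁ j))) (sym (proj₂ (proj₂ (act-abc swap₁ j)))) (n<1+n (2 + j))
      mono-slots swap₁  (swap₁ f) isB isC l _ h = subst₂ _<_ (sym (proj₁ (proj₂ (act-abc swap₁ j)))) (sym (proj₂ (proj₂ (act-abc swap₁ j)))) (s≤s (n≤1+n (suc j)))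
      mono-slots swap₂  (swap₂ f) isA isB l _ h = subst₂ _<_ (sym (proj₁ (act-abc swap₂ j))) (sym (proj₁ (proj₂ (act-abc swap₂ j)))) (s≤s (n≤1+n (suc j)))
      mono-slots swap₂  (swap₂ f) isA isC l _ h = subst₂ _<_ (sym (proj₁ (act-abc swap₂ j))) (sym (proj₂ (proj₂ (act-abc swap₂ j)))) (n<1+n (suc j))
      mono-slots swap₂  (swap₂ f) isB isC l _ h = ⊥-elim (clash (h refl) f)
      mono-slots cycle₁ (cycle₁ t b) isA isB l _ h = subst₂ _<_ (sym (proj₁ (act-abc cycle₁ j))) (sym (proj₁ (proj₂ (act-abc cycle₁ j)))) (n<1+n (2 + j))
      mono-slots cycle₁ (cycle₁ t b) isA isC l s h = ⊥-elim (proj₁ (inside t b) s)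
      mono-slots cycle₁ (cycle₁ t b) isB isC l s h = ⊥-elim (proj₂ (inside t b) s)
      mono-slots cycle₂ (cycle₂ t b) isA isB l s h = ⊥-elim (proj₁ (inside t b) (⊎-swap s))
      mono-slots cycle₂ (cycle₂ t b) isA isC l s h = ⊥-elim (proj₂ (inside t b) (⊎-swap s))
      mono-slots cycle₂ (cycle₂ t b) isB isC l _ h = subst₂ _<_ (sym (proj₁ (proj₂ (act-abc cycle₂ j)))) (sym (proj₂ (proj₂ (act-abc cycle₂ j)))) (n<1+n (suc j))

      mono : ∀ {x y} → x ∈ cells ν → y ∈ cells ν → T x < T y → Spread (sc x) (sc y) → (T y ≡ suc (T x) → cl (sc x) (sc y) ≡ true) → T′ x < T′ y
      mono x∈ y∈ l s h = mono-slots K (view α≢β β≢γ α≢γ) (slot j _) (slot j _) l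
        (subst₂ Spread (sym (κ-cell x∈)) (sym (κ-cell y∈)) s) λ e → trans (cong₂ cl (κ-cell x∈) (κ-cell y∈)) (h e)

    S′ : IsStandardFilling ν T′
    S′ = record
      { range = λ x x∈ → proj₁ (act-in K j (slot j (T x))) (proj₁ (range x x∈)) , proj₂ (act-in K j (slot j (T x))) j< (proj₂ (range x x∈))
      ; injective = λ x y x∈ y∈ e → injective x y x∈ y∈ (act-inj K j e)
      ; rowIncr = row
      ; colIncr = col }
      where
      row : ∀ x y → x ∈ cells ν → y ∈ cells ν → compOf x ≡ compOf y → rowOf x ≡ rowOf y → colOf x < colOf y → T′ x < T′ y
      row (i , r , c) (.i , .r , c′) x∈ y∈ refl refl l = mono x∈ y∈ (rowIncr _ _ x∈ y∈ refl refl l) (inj₁ (row-gap i r l)) near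
        where
        near : T (i , r , c′) ≡ suc (T (i , r , c)) → cl (sc (i , r , c)) (sc (i , r , c′)) ≡ true
        -- Consecutive entries of a row are in adjacent cells, since a cell between them would need
        -- an entry between them.
        near e with m≤n⇒m<n∨m≡n l
        ... | inj₂ refl = cl-true (ℤP.≤-trans (≤+k _) (ℤP.≤-reflexive (sym (row-step i r c)))) (ℤP.≤-reflexive (row-step i r c))
        ... | inj₁ l′ = ⊥-elim (<-irrefl (sym e) (≤-trans (s≤s (rowIncr _ _ x∈ z∈ refl refl (n<1+n c))) (rowIncr _ _ z∈ y∈ refl refl l′)))
          where z∈ = cells-convex {ν} x∈ y∈ refl (≤-refl {r}) (≤-refl {r}) (n≤1+n c) (<⇒≤ l′)
      col : ∀ x y → x ∈ cells ν → y ∈ cells ν → compOf x ≡ compOf y → colOf x ≡ colOf y → rowOf x < rowOf y → T′ x < T′ y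
      col (i , r , c) (.i , r′ , .c) x∈ y∈ refl refl l = mono x∈ y∈ (colIncr _ _ x∈ y∈ refl refl l) (inj₂ (col-gap i c l)) near
        where
        near : T (i , r′ , c) ≡ suc (T (i , r , c)) → cl (sc (i , r , c)) (sc (i , r′ , c)) ≡ true
        near e with m≤n⇒m<n∨m≡n l
        ... | inj₂ refl = trans (cl-sym (sc (i , r , c)) (sc (i , suc r , c)))
                (cl-true (ℤP.≤-trans (≤+k _) (ℤP.≤-reflexive (sym (col-step i r c)))) (ℤP.≤-reflexive (col-step i r c)))
        ... | inj₁ l′ = ⊥-elim (<-irrefl (sym e) (≤-trans (s≤s (colIncr _ _ x∈ z∈ refl refl (n<1+n r))) (colIncr _ _ z∈ y∈ refl refl l′)))
          where z∈ = cells-convex {ν} x∈ y∈ refl (n≤1+n r) (<⇒≤ l′) (≤-refl {c}) (≤-refl {c})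

    κ′ : ℕ → ℤ
    κ′ = Std.κ S′

    κ′-act : ∀ {v} → 1 ≤ v → v ≤ n → κ′ (act K j v) ≡ κ v
    κ′-act a b with onto a b
    ... | x , x∈ , refl = trans (Std.κ-cell S′ x∈) (sym (κ-cell x∈))

    κ′-off : ∀ {v} → 1 ≤ v → v ≤ n → Off j v → κ′ v ≡ κ v
    κ′-off {v} a b o = trans (cong κ′ (sym (act-off K o))) (κ′-act a b)

    κ′-undo : ∀ v → Slot j v → 1 ≤ v → v ≤ n → κ′ v ≡ κ (act (undo K) j v)
    κ′-undo v s a b = trans (cong κ′ (sym (act-undo′ K j v)))
      (κ′-act (proj₁ (act-in (undo K) j s) a) (proj₂ (act-in (undo K) j s) j< b))

    κ′-tri : (κ′ (1 + j) , κ′ (2 + j) , κ′ (3 + j)) ≡ Walks.tri lt cl α β γ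
    κ′-tri = trans (cong₂ _,_ (κ′-undo _ isA 1≤ a≤) (cong₂ _,_ (κ′-undo _ isB 1≤ b≤) (κ′-undo _ isC 1≤ j<)))
      (trans (images K) (sym (tri-place lt cl α β γ)))
      where
      images : ∀ K → (κ (act (undo K) j (1 + j)) , κ (act (undo K) j (2 + j)) , κ (act (undo K) j (3 + j))) ≡ place K α β γ
      images K with act-abc (undo K) j
      images none   | p , q , r = cong₂ _,_ (cong κ p) (cong₂ _,_ (cong κ q) (cong κ r))
      images swap₁  | p , q , r = cong₂ _,_ (cong κ p) (cong₂ _,_ (cong κ q) (cong κ r))
      images swap₂  | p , q , r = cong₂ _,_ (cong κ p) (cong₂ _,_ (cong κ q) (cong κ r))
      images cycle₁ | p , q , r = cong₂ _,_ (cong κ p) (cong₂ _,_ (cong κ q) (cong κ r))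
      images cycle₂ | p , q , r = cong₂ _,_ (cong κ p) (cong₂ _,_ (cong κ q) (cong κ r))

    mv-cw : ∀ d → d + (3 + j) ≤ n → Walks.mv lt cl d (cw κ (d + (3 + j))) ≡ cw κ′ (d + (3 + j))
    mv-cw zero l = trans (cong (λ t → Walks.put lt cl t (cw κ j)) (sym κ′-tri))
      (cong (λ u → κ′ (3 + j) ∷ κ′ (2 + j) ∷ κ′ (1 + j) ∷ u) (cw-cong j λ v a b → sym (κ′-off a (≤-trans b (≤-trans (n≤1+n j) a≤)) (below b))))
      where
      below : ∀ {v} → v ≤ j → Off j v
      below l = (λ e → <-irrefl e (s≤s l)) , (λ e → <-irrefl e (≤-trans (s≤s l) (n≤1+n _))) , λ e → <-irrefl e (≤-trans (s≤s l) (≤-trans (n≤1+n _) (n≤1+n _)))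
    mv-cw (suc d) l = cong₂ _∷_ (sym (κ′-off (s≤s z≤n) l above)) (mv-cw d (≤-trans (n≤1+n _) l))
      where
      above : Off j (suc (d + (3 + j)))
      above = (λ e → <-irrefl (sym e) (≤-trans (n≤1+n (2 + j)) (≤-trans (n≤1+n (3 + j)) (s≤s (m≤n+m (3 + j) d))))) ,
              (λ e → <-irrefl (sym e) (≤-trans (n≤1+n (3 + j)) (s≤s (m≤n+m (3 + j) d)))) ,
              (λ e → <-irrefl (sym e) (s≤s (m≤n+m (3 + j) d)))

mv-beyond : ∀ {A : Set} (lt cl : A → A → Bool) d u → length u < 3 + d → Walks.mv lt cl d u ≡ u
mv-beyond lt cl zero [] l = refl
mv-beyond lt cl zero (_ ∷ []) l = refl
mv-beyond lt cl zero (_ ∷ _ ∷ []) l = refl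
mv-beyond lt cl zero (_ ∷ _ ∷ _ ∷ u) (s≤s (s≤s (s≤s ())))
mv-beyond lt cl (suc d) [] l = refl
mv-beyond lt cl (suc d) (x ∷ u) (s≤s l) = cong (x ∷_) (mv-beyond lt cl d u l)

cw-cong⁻ : ∀ {A : Set} {κ κ′ : ℕ → A} m → cw κ m ≡ cw κ′ m → ∀ v → 1 ≤ v → v ≤ m → κ v ≡ κ′ v
cw-cong⁻ (suc m) e v a b with m≤n⇒m<n∨m≡n b
... | inj₂ refl = ∷-injectiveˡ e
... | inj₁ l = cw-cong⁻ m (∷-injectiveʳ e) v a (≤-pred l)
cw-cong⁻ zero e (suc v) a ()

toSign : Bool → Sign
toSign b = if b then Sg.+ else Sg.-

toSign-not : ∀ b → toSign (not b) ≡ opposite (toSign b)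
toSign-not true  = refl
toSign-not false = refl

toSign-opp : ∀ {a b} → toSign a ≡ opposite (toSign b) → a ≡ not b
toSign-opp {true}  {false} _ = refl
toSign-opp {false} {true}  _ = refl

-- The LLT graph as a graph of content words.

module Graph (ν : List Skew) where
  open Fillings ν public
  open Operators ν public
  open Vertices ν public

  G : SCGraph
  G = LLT ν

  Vtx : List ℕ → Set
  Vtx = IsLLTVertex ν

  κ : List ℕ → ℕ → ℤ
  κ w v = c̃ ν (pos w v)

  Dν : ℕ → List ℕ → List ℕ
  Dν = D (τ ν)

  D-vtx : ∀ {w} j → 3 + j ≤ n → Vtx w → Vtx (Dν (2 + j) w)
  D-vtx j l (T , S , refl) = Next.T′ S j l , Next.S′ S j l , Next.word-D S j l

  κ-D : ∀ {w} j (l : 3 + j ≤ n) → ((T , S , e) : Vtx w) → ∀ v → κ (Dν (2 + j) w) v ≡ Next.κ′ S j l v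
  κ-D j l (T , S , refl) v = cong (λ w → κ w v) (Next.word-D S j l)

  D-off : ∀ {w} j → 3 + j ≤ n → Vtx w → ∀ {v} → 1 ≤ v → v ≤ n → Off j v → κ (Dν (2 + j) w) v ≡ κ w v
  D-off j l x@(T , S , refl) {v} a b o = trans (κ-D j l x v) (Next.κ′-off S j l a b o)

  D-tri : ∀ {w} j → 3 + j ≤ n → Vtx w →
          (κ (Dν (2 + j) w) (1 + j) , κ (Dν (2 + j) w) (2 + j) , κ (Dν (2 + j) w) (3 + j)) ≡
          Walks.tri lt cl (κ w (1 + j)) (κ w (2 + j)) (κ w (3 + j))
  D-tri j l x@(T , S , refl) = trans (cong₂ _,_ (κ-D j l x _) (cong₂ _,_ (κ-D j l x _) (κ-D j l x _))) (Next.κ′-tri S j l)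

  D-mv : ∀ {w} d j → d + (3 + j) ≤ n → Vtx w → cw (κ (Dν (2 + j) w)) (d + (3 + j)) ≡ Walks.mv lt cl d (cw (κ w) (d + (3 + j)))
  D-mv d j l x@(T , S , refl) = trans (cw-cong (d + (3 + j)) (λ v _ _ → κ-D j (≤-trans (m≤n+m (3 + j) d) l) x v))
    (sym (Next.mv-cw S j (≤-trans (m≤n+m (3 + j) d) l) d l))

  module _ {T T′} (S : IsStandardFilling ν T) (S′ : IsStandardFilling ν T′) where
    private
      module A = Std S
      module B = Std S′

    -- Induction on the entry. On a diagonal of one component the entries increase to the northeast,
    -- so the next entry with a given content takes the first free cell of its diagonal, and the
    -- free cells agree in both fillings.
    same-cells : ∀ m → m ≤ n → (∀ v → 1 ≤ v → v ≤ m → A.κ v ≡ B.κ v) →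
                 ∀ {x y} → x ∈ cells ν → y ∈ cells ν → T x ≡ T′ y → T x ≤ m → x ≡ y
    same-cells zero _ _ x∈ y∈ _ l with () ← ≤-trans (proj₁ (A.range _ x∈)) l
    same-cells (suc m) m≤ h {x} {y} x∈ y∈ e l with m≤n⇒m<n∨m≡n l
    ... | inj₁ l′ = same-cells m (≤-trans (n≤1+n m) m≤) (λ v a b → h v a (≤-trans b (n≤1+n m))) x∈ y∈ e (≤-pred l′)
    ... | inj₂ top = go x y x∈ y∈ e top
      where
      ih : ∀ {x y} → x ∈ cells ν → y ∈ cells ν → T x ≡ T′ y → T x ≤ m → x ≡ y
      ih = same-cells m (≤-trans (n≤1+n m) m≤) (λ v a b → h v a (≤-trans b (n≤1+n m)))
      go : ∀ x y → x ∈ cells ν → y ∈ cells ν → T x ≡ T′ y → T x ≡ suc m → x ≡ y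
      go (i , r , c) (i′ , r′ , c′) x∈ y∈ e top with same-diagonal {i , r , c} {i′ , r′ , c′} (comp-< {ν} x∈) (comp-< {ν} y∈)
            (trans (sym (A.κ-cell x∈)) (trans (h (T (i , r , c)) (proj₁ (A.range _ x∈)) (≤-reflexive top)) (trans (cong B.κ e) (B.κ-cell y∈))))
      ... | refl , d with <-cmp r r′
      ... | tri≈ _ refl _ with +-cancelʳ-≡ r c c′ d
      ... | refl = refl
      go (i , r , c) (i′ , r′ , c′) x∈ y∈ e top | refl , d | tri< q _ _ = ⊥-elim (<-irrefl refl absurd)
        where
        c≤ : c ≤ c′
        c≤ = +-cancelʳ-≤ r c c′ (≤-trans (+-monoʳ-≤ c (<⇒≤ q)) (≤-reflexive d))
        lower : T′ (i , r , c) < T′ (i , r′ , c′)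
        lower = ≤∧≢⇒< (B.mono-≤ x∈ y∈ (<⇒≤ q) c≤) λ eq → <-irrefl (cong rowOf (B.injective _ _ x∈ y∈ eq)) q
        small : suc (T′ (i , r , c)) ≤ suc m
        small = subst (T′ (i , r , c) <_) (trans (sym e) top) lower
        absurd : T (i , r , c) < T (i , r , c)
        absurd with A.onto (proj₁ (B.range _ x∈)) (proj₂ (B.range _ x∈))
        ... | z , z∈ , ez with ih z∈ x∈ ez (subst (_≤ m) (sym ez) (≤-pred small))
        ... | refl = subst₂ _<_ (sym ez) (sym e) lower
      go (i , r , c) (i′ , r′ , c′) x∈ y∈ e top | refl , d | tri> _ _ q = ⊥-elim (<-irrefl refl absurd)
        where
        c≤ : c′ ≤ c
        c≤ = +-cancelʳ-≤ r′ c′ c (≤-trans (+-monoʳ-≤ c′ (<⇒≤ q)) (≤-reflexive (sym d)))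
        lower : T (i , r′ , c′) < T (i , r , c)
        lower = ≤∧≢⇒< (A.mono-≤ y∈ x∈ (<⇒≤ q) c≤) λ eq → <-irrefl (cong rowOf (A.injective _ _ y∈ x∈ eq)) q
        small : suc (T (i , r′ , c′)) ≤ suc m
        small = subst (T (i , r′ , c′) <_) top lower
        absurd : T (i , r , c) < T (i , r , c)
        absurd with B.onto (proj₁ (A.range _ y∈)) (proj₂ (A.range _ y∈))
        ... | z , z∈ , ez with ih y∈ z∈ (sym ez) (≤-pred small)
        ... | refl = subst (_< T (i , r , c)) (trans (sym ez) (sym e)) lower

    words-equal : (∀ v → 1 ≤ v → v ≤ n → A.κ v ≡ B.κ v) → scWord ν T ≡ scWord ν T′
    words-equal h = map-cong-local (All.tabulate λ {x} x∈ → eq (ro⁻ x∈))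
      where
      eq : ∀ {x} → x ∈ cells ν → T x ≡ T′ x
      eq {x} x∈ with B.onto (proj₁ (A.range x x∈)) (proj₂ (A.range x x∈))
      ... | z , z∈ , e with same-cells n ≤-refl h x∈ z∈ (sym e) (proj₂ (A.range x x∈))
      ... | refl = sym e

  word-inj : ∀ {w w′} → Vtx w → Vtx w′ → (∀ v → 1 ≤ v → v ≤ n → κ w v ≡ κ w′ v) → w ≡ w′
  word-inj (T , S , refl) (T′ , S′ , refl) = words-equal S S′

  sig-lt : ∀ {w h} → Vtx w → 1 ≤ h → h < n → sig w h ≡ toSign (lt (κ w h) (κ w (suc h)))
  sig-lt {h = h} (T , S , refl) a b = cong toSign (Act.pos-lt S a (<⇒≤ b) (s≤s z≤n) b
    (Act.distinct S a b ≤-refl (n≤1+n (2 + h))))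

  D-still : ∀ {w} j → 3 + j ≤ n → Vtx w → lt (κ w (1 + j)) (κ w (2 + j)) ≡ lt (κ w (2 + j)) (κ w (3 + j)) → Dν (2 + j) w ≡ w
  D-still j l x@(T , S , refl) e = trans (Next.word-D S j l) (cong (λ K → map (λ y → act K j (T y)) ro) (no-move _ _ e))
    where
    no-move : ∀ a b {c d f} → a ≡ b → kind a b c d f ≡ none
    no-move true  .true  refl = refl
    no-move false .false refl = refl

  module Narrow (narrow : ∀ {w x y z} → w ∈ cells ν → x ∈ cells ν → y ∈ cells ν → z ∈ cells ν →
                  lt (sc w) (sc x) ≡ true → lt (sc x) (sc y) ≡ true → lt (sc y) (sc z) ≡ true → cl (sc w) (sc z) ≡ false) where

    -- The vertex is kept as a witness, because the restrictions on repeated letters come from its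
    -- filling.
    Good : List ℤ → Set
    Good u = ∃ λ w → Vtx w × ∃ λ m → m ≤ n × u ≡ cw (κ w) m

    good-cw : ∀ {w m} → Vtx w → m ≤ n → Good (cw (κ w) m)
    good-cw x l = _ , x , _ , l , refl

    good-mv : ∀ d {u} → Good u → Good (Walks.mv lt cl d u)
    good-mv d (w , x , m , l , refl) with 3 + d ≤? m
    ... | no s = w , x , m , l , mv-beyond lt cl d _ (subst (_< 3 + d) (sym (cw-length (κ w) m)) (≰⇒> s))
    ... | yes s = Dν (2 + j) w , D-vtx j (≤-trans (m≤n+m (3 + j) d) (subst (_≤ n) (sym eq) l)) x , m , l ,
          subst (λ m → Walks.mv lt cl d (cw (κ w) m) ≡ cw (κ (Dν (2 + j) w)) m) eq (sym (D-mv d j (subst (_≤ n) (sym eq) l) x))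
      where
      j = m ∸ (3 + d)
      eq : d + (3 + j) ≡ m
      eq = trans (sym (+-assoc d 3 j)) (trans (cong (_+ j) (+-comm d 3)) (m+[n∸m]≡n s))

    good-tail : ∀ {t u} → Good (t ∷ u) → Good u
    good-tail (w , x , suc m , l , e) = w , x , m , ≤-trans (n≤1+n m) l , ∷-injectiveʳ e

    letter : ∀ {u a} → Good u → a ∈ u → ∃ λ x → x ∈ cells ν × sc x ≡ a
    letter (w , (T , S , refl) , m , l , refl) a∈ with cw-∈ (κ w) m a∈
    ... | v , p , q , refl with Std.onto S p (≤-trans q l)
    ... | x , x∈ , refl = x , x∈ , sym (Std.κ-cell S x∈)

    distinct₃ : ∀ {r q p α} → Good (r ∷ q ∷ p ∷ α) → p ≢ q × q ≢ r × p ≢ r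
    distinct₃ (w , (T , S , refl) , suc (suc (suc j)) , l , refl) =
      Act.distinct S (s≤s z≤n) (≤-trans (n≤1+n _) l) ≤-refl (n≤1+n (3 + j)) ,
      Act.distinct S (s≤s z≤n) l ≤-refl (n≤1+n (4 + j)) ,
      Act.distinct S (s≤s z≤n) l (s≤s (n≤1+n (suc j))) ≤-refl

    -- The two occurrences are entries of one diagonal; `lo` and `hi` are the contents of the cells
    -- above and to the right of the earlier one, whose entries lie between.
    tie-gap : ∀ {t β γ} → Good (t ∷ β ++ t ∷ γ) → t ∉ β → ∃ λ lo → ∃ λ hi → lo ∈ β × hi ∈ β × IsTie lt cl lo t hi
    tie-gap {t} {β} (w , (T , S , refl) , suc m , l , e) _ with cw-split (κ w) m β (sym (∷-injectiveʳ e))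
    ... | v , v₁ , v≤m , ev , inner with Std.onto S v₁ (≤-trans v≤m (≤-trans (n≤1+n m) l)) | Std.onto S (s≤s z≤n) l
    ... | x , x∈ , refl | y , y∈ , ey with Std.square S x∈ y∈ (trans (sym (Std.κ-cell S x∈)) (trans ev (trans (∷-injectiveˡ e) (trans (cong (κ w) (sym ey)) (Std.κ-cell S y∈)))))
                                             (subst (T x <_) (sym ey) (s≤s v≤m))
    ... | s = sc above , sc right , in-β above∈ above-< , in-β right∈ right-< , record
          { lo<t = lt-true (subst (sc above ℤ.<_) lo-k up) ; t<hi = lt-true (subst (t ℤ.<_) hi-k up)
          ; lo-t = cl-true (subst (sc above ℤ.≤_) lo-k (≤+k _)) (ℤP.≤-reflexive (sym lo-k))
          ; t-hi = cl-true (subst (t ℤ.≤_) hi-k (≤+k _)) (ℤP.≤-reflexive (sym hi-k))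
          ; below = λ z p → cl-false (subst (z ℤ.+ + k ℤ.<_) lo-k (ℤP.+-monoˡ-< (+ k) (lt-true⁻ p)))
          ; above = λ z p → cl-false (subst (ℤ._< z) (sym hi-k) (lt-true⁻ p))
          ; lo-wide = λ z p → cl-false (subst (ℤ._< z) (sym lo-k) (lt-true⁻ p))
          ; hi-wide = λ z p → cl-false (subst (z ℤ.+ + k ℤ.<_) hi-k (ℤP.+-monoˡ-< (+ k) (lt-true⁻ p))) }
      where
      open Std.Square s
      t≡ : sc x ≡ t
      t≡ = trans (sym (Std.κ-cell S x∈)) ev
      lo-k : sc above ℤ.+ + k ≡ t
      lo-k = trans (sym above-c) t≡
      hi-k : t ℤ.+ + k ≡ sc right
      hi-k = trans (cong (ℤ._+ + k) (sym t≡)) (sym right-c)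
      up : ∀ {z} → z ℤ.< z ℤ.+ + k
      up {z} = subst (ℤ._< z ℤ.+ + k) (ℤP.+-identityʳ z) (ℤP.+-monoʳ-< z (ℤ.+<+ (≤-trans (s≤s z≤n) (comp-< {ν} x∈))))
      in-β : ∀ {z} → z ∈ cells ν → T x < T z × T z < T y → sc z ∈ β
      in-β {z} z∈ (p , q) = subst (_∈ β) (Std.κ-cell S z∈) (inner _ p (≤-pred (subst (T z <_) ey q)))

    letters : Letters
    letters = record
      { A = ℤ ; lt = lt ; cl = cl
      ; lt-irr = λ x → lt-false ℤP.≤-refl
      ; lt-tr = λ p q → lt-true (ℤP.<-trans (lt-true⁻ p) (lt-true⁻ q))
      ; lt-tri = λ x y → case ℤP.<-cmp x y of λ { (tri< l _ _) → inj₁ (lt-true l) ; (tri≈ _ e _) → inj₂ (inj₁ e) ; (tri> _ _ l) → inj₂ (inj₂ (lt-true l)) }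
      ; cl-sym = cl-sym ; Good = Good ; good-mv = good-mv ; good-tail = good-tail ; distinct = distinct₃
      ; narrow = λ g a b c d p q r → four (letter g a) (letter g b) (letter g c) (letter g d) p q r
      ; tie-gap = tie-gap }
      where
      four : ∀ {a b c d} → (∃ λ x → x ∈ cells ν × sc x ≡ a) → (∃ λ x → x ∈ cells ν × sc x ≡ b) → (∃ λ x → x ∈ cells ν × sc x ≡ c) → (∃ λ x → x ∈ cells ν × sc x ≡ d) →
             lt a b ≡ true → lt b c ≡ true → lt c d ≡ true → cl a d ≡ false
      four (_ , x∈ , refl) (_ , y∈ , refl) (_ , z∈ , refl) (_ , w∈ , refl) = narrow x∈ y∈ z∈ w∈

    module S = System (Windows.system letters)
 

-- A graph on words of letters, the vertex w having letter κ w v at time v.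
record WordGraph (S : System) : Set₁ where
  field
    X   : Set
    Vtx : X → Set
    n   : ℕ
    σ   : X → ℕ → Sign
    Dν  : ℕ → X → X
    κ   : X → ℕ → System.A S
  open System S public
  field
    good-cw  : ∀ {w m} → Vtx w → m ≤ n → Good (cw (κ w) m)
    D-vtx    : ∀ {w} j → 3 + j ≤ n → Vtx w → Vtx (Dν (2 + j) w)
    D-off    : ∀ {w} j → 3 + j ≤ n → Vtx w → ∀ {v} → 1 ≤ v → v ≤ n → Off j v → κ (Dν (2 + j) w) v ≡ κ w v
    D-tri    : ∀ {w} j → 3 + j ≤ n → Vtx w →
               (κ (Dν (2 + j) w) (1 + j) , κ (Dν (2 + j) w) (2 + j) , κ (Dν (2 + j) w) (3 + j)) ≡
               tri (κ w (1 + j)) (κ w (2 + j)) (κ w (3 + j))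
    word-inj : ∀ {w w′} → Vtx w → Vtx w′ → (∀ v → 1 ≤ v → v ≤ n → κ w v ≡ κ w′ v) → w ≡ w′
    sig-lt   : ∀ {w h} → Vtx w → 1 ≤ h → h < n → σ w h ≡ toSign (lt (κ w h) (κ w (suc h)))

  E : ℕ → X → X → Set
  E i v w = 1 < i × i < n × Vtx v × Vtx w × v ≢ w × (w ≡ Dν i v ⊎ v ≡ Dν i w)

  G : SCGraph
  G = record { X = X ; Vtx = Vtx ; m = 1 ; n = n ; N = n ; σ = σ ; E = E }

-- The local axioms, and (Ax6) from recording chains.

module Axioms {S : System} (W : WordGraph S) where
  open WordGraph W

  Opp : X → ℕ → Set
  Opp w j = lt (κ w (1 + j)) (κ w (2 + j)) ≡ not (lt (κ w (2 + j)) (κ w (3 + j)))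

  admits⁻ : ∀ {w} j → 3 + j ≤ n → Vtx w → Admits G (2 + j) w → Opp w j
  admits⁻ j l x a = toSign-opp (trans (sym (sig-lt x (s≤s z≤n) (≤-trans (n≤1+n _) l))) (trans a (cong opposite (sig-lt x (s≤s z≤n) l))))

  admits⁺ : ∀ {w} j → 3 + j ≤ n → Vtx w → Opp w j → Admits G (2 + j) w
  admits⁺ {w} j l x o = trans (sig-lt x (s≤s z≤n) (≤-trans (n≤1+n _) l)) (trans (cong toSign o)
    (trans (toSign-not _) (cong opposite (sym (sig-lt x (s≤s z≤n) l)))))

  D-mv : ∀ {w} e j → e + (3 + j) ≤ n → Vtx w → cw (κ (Dν (2 + j) w)) (e + (3 + j)) ≡ mv e (cw (κ w) (e + (3 + j)))
  D-mv {w} zero j l x = trans (cong (λ u → κ (Dν (2 + j) w) (3 + j) ∷ κ (Dν (2 + j) w) (2 + j) ∷ κ (Dν (2 + j) w) (1 + j) ∷ u)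
      (cw-cong j λ v a b → D-off j l x a (≤-trans b (≤-trans (m≤n+m j 3) l)) (low b)))
      (cong (λ t → put t (cw (κ w) j)) (D-tri j l x))
    where
    low : ∀ {u} → u ≤ j → Off j u
    low q = (λ e → <-irrefl e (s≤s q)) , (λ e → <-irrefl e (s≤s (≤-trans q (n≤1+n j)))) , λ e → <-irrefl e (s≤s (≤-trans q (m≤n+m j 2)))
  D-mv (suc e) j l x = cong₂ _∷_ (D-off j (≤-trans (m≤n+m (3 + j) (suc e)) l) x (s≤s z≤n) l above) (D-mv e j (≤-trans (n≤1+n _) l) x)
    where
    above : Off j (suc (e + (3 + j)))
    above = (λ q → <-irrefl (sym q) (≤-trans (n≤1+n (2 + j)) (≤-trans (n≤1+n (3 + j)) (s≤s (m≤n+m (3 + j) e))))) ,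
            (λ q → <-irrefl (sym q) (≤-trans (n≤1+n (3 + j)) (s≤s (m≤n+m (3 + j) e)))) ,
            (λ q → <-irrefl (sym q) (s≤s (m≤n+m (3 + j) e)))

  D-still : ∀ {w} j → 3 + j ≤ n → Vtx w → lt (κ w (1 + j)) (κ w (2 + j)) ≡ lt (κ w (2 + j)) (κ w (3 + j)) → Dν (2 + j) w ≡ w
  D-still {w} j l x e = word-inj (D-vtx j l x) x λ v a b → go v a b (slot j v)
    where
    still : (κ (Dν (2 + j) w) (1 + j) , κ (Dν (2 + j) w) (2 + j) , κ (Dν (2 + j) w) (3 + j)) ≡ (κ w (1 + j) , κ w (2 + j) , κ w (3 + j))
    still = trans (D-tri j l x) (same e)
      where
      same : lt (κ w (1 + j)) (κ w (2 + j)) ≡ lt (κ w (2 + j)) (κ w (3 + j)) → tri (κ w (1 + j)) (κ w (2 + j)) (κ w (3 + j)) ≡ (κ w (1 + j) , κ w (2 + j) , κ w (3 + j))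
      same e rewrite e with lt (κ w (2 + j)) (κ w (3 + j))
      ... | true  = refl
      ... | false = refl
    go : ∀ v → 1 ≤ v → v ≤ n → Slot j v → κ (Dν (2 + j) w) v ≡ κ w v
    go _ a b isA = cong proj₁ still
    go _ a b isB = cong (proj₁ ∘ proj₂) still
    go _ a b isC = cong (proj₂ ∘ proj₂) still
    go _ a b (off o) = D-off j l x a b o

  ≡-not : ∀ {a b} → a ≡ not b → b ≡ not a
  ≡-not {b = true}  refl = refl
  ≡-not {b = false} refl = refl

  long : ∀ {w} m {i} → i ≤ m → i ≤ length (cw (κ w) m)
  long {w} m {i} l = subst (i ≤_) (sym (cw-length (κ w) m)) l

  D-flip : ∀ {w} j → 3 + j ≤ n → Vtx w → Opp w j →
           lt (κ (Dν (2 + j) w) (2 + j)) (κ (Dν (2 + j) w) (3 + j)) ≡ lt (κ w (1 + j)) (κ w (2 + j)) ×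
           lt (κ (Dν (2 + j) w) (1 + j)) (κ (Dν (2 + j) w) (2 + j)) ≡ lt (κ w (2 + j)) (κ w (3 + j))
  D-flip {w} j l x o with flip-sgn (good-cw x l) (long {w} (3 + j) (m≤m+n 3 j)) (≡-not o)
  ... | p , q = trans (cong (sgn 0) (D-mv 0 j l x)) p , trans (cong (sgn 1) (D-mv 0 j l x)) q

  D-moves : ∀ {w} j → 3 + j ≤ n → Vtx w → Opp w j → w ≢ Dν (2 + j) w
  D-moves {w} j l x o e = no-fix _ (trans (sym o) (trans (sym (proj₁ (D-flip j l x o))) (cong (λ w → lt (κ w (2 + j)) (κ w (3 + j))) (sym e))))
    where
    no-fix : ∀ b → not b ≢ b
    no-fix true ()
    no-fix false ()

  D-invol : ∀ {w} j → 3 + j ≤ n → Vtx w → Dν (2 + j) (Dν (2 + j) w) ≡ w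
  D-invol {w} j l x = word-inj (D-vtx j l (D-vtx j l x)) x (cw-cong⁻ n
    (subst (λ m → cw (κ (Dν (2 + j) (Dν (2 + j) w))) m ≡ cw (κ w) m) (m∸n+n≡m l)
      (trans (D-mv e j l′ (D-vtx j l x)) (trans (cong (mv e) (D-mv e j l′ x)) (invol e (good-cw x l′))))))
    where
    e = n ∸ (3 + j)
    l′ : e + (3 + j) ≤ n
    l′ = ≤-reflexive (m∸n+n≡m l)

  edge⁻ : ∀ {j v w} → E (2 + j) v w → 3 + j ≤ n × Vtx v × w ≡ Dν (2 + j) v
  edge⁻ (_ , l , x , y , _ , inj₁ e) = l , x , e
  edge⁻ {j} (_ , l , x , y , _ , inj₂ e) = l , x , trans (sym (D-invol j l y)) (cong (Dν (2 + j)) (sym e))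

  edge-opp : ∀ {j v w} → E (2 + j) v w → Opp v j
  edge-opp {j} {v} ed@(_ , _ , _ , _ , ne , _) with edge⁻ ed
  ... | l , x , e with lt (κ v (1 + j)) (κ v (2 + j)) in p | lt (κ v (2 + j)) (κ v (3 + j)) in q
  ... | true  | false = refl
  ... | false | true  = refl
  ... | true  | true  = ⊥-elim (ne (sym (trans e (D-still j l x (trans p (sym q))))))
  ... | false | false = ⊥-elim (ne (sym (trans e (D-still j l x (trans p (sym q))))))

  edge⁺ : ∀ {j v} → 3 + j ≤ n → Vtx v → Opp v j → E (2 + j) v (Dν (2 + j) v)
  edge⁺ {j} l x o = s≤s (s≤s z≤n) , l , x , D-vtx j l x , D-moves j l x o , inj₁ refl

  edge-sym : ∀ {i v w} → E i v w → E i w v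
  edge-sym (a , b , x , y , ne , e) = a , b , y , x , ne ∘ sym , ⊎-swap e

  ax1 : ∀ i → 1 < i → i < n → ∀ v → Vtx v →
        (Admits G i v → Σ (X) (λ w → E i v w × (∀ w′ → E i v w′ → w′ ≡ w))) × (∀ w → E i v w → Admits G i v)
  ax1 (suc (suc j)) _ l v x = (λ a → Dν (2 + j) v , edge⁺ l x (admits⁻ j l x a) , λ w′ e → proj₂ (proj₂ (edge⁻ e))) ,
                              λ w e → admits⁺ j l x (edge-opp e)
  ax1 (suc zero) (s≤s ())

  ax2 : ∀ i → 1 < i → i < n → ∀ v w → E i v w →
        σ v i ≡ opposite (σ w i) × σ v (i ∸ 1) ≡ opposite (σ w (i ∸ 1)) ×
        (∀ h → 1 ≤ h → h < n → (h + 2 < i ⊎ i + 1 < h) → σ v h ≡ σ w h)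
  ax2 (suc zero) (s≤s ())
  ax2 (suc (suc j)) _ l v w ed with edge⁻ ed
  ... | _ , x , refl with D-flip j l x (edge-opp ed) | D-vtx j l x
  ... | p , q | y =
    trans (sig-lt x (s≤s z≤n) l) (trans (cong toSign (trans (≡-not (edge-opp ed)) (cong not (sym p)))) (trans (toSign-not _) (cong opposite (sym (sig-lt y (s≤s z≤n) l))))) ,
    trans (sig-lt x (s≤s z≤n) l₁) (trans (cong toSign (trans (edge-opp ed) (cong not (sym q)))) (trans (toSign-not _) (cong opposite (sym (sig-lt y (s≤s z≤n) l₁))))) ,
    λ h a b c → trans (sig-lt x a b) (trans (cong toSign (sym (cong₂ lt (D-off j l x a (<⇒≤ b) (away c)) (D-off j l x (s≤s z≤n) b (away′ c))))) (sym (sig-lt y a b)))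
    where
    l₁ = ≤-trans (n≤1+n (2 + j)) l
    low : ∀ {u} → u ≤ j → Off j u
    low q = (λ e → <-irrefl e (s≤s q)) , (λ e → <-irrefl e (s≤s (≤-trans q (n≤1+n j)))) , λ e → <-irrefl e (s≤s (≤-trans q (m≤n+m j 2)))
    high : ∀ {u} → 3 + j < u → Off j u
    high q = (λ e → <-irrefl (sym e) (≤-trans (s≤s (s≤s (m≤n+m j 2))) q)) , (λ e → <-irrefl (sym e) (≤-trans (n≤1+n (3 + j)) q)) , λ e → <-irrefl (sym e) q
    lo : ∀ {h} → h + 2 < 2 + j → suc h ≤ j
    lo {h} q = ≤-pred (≤-pred (subst (_< 2 + j) (+-comm h 2) q))
    hi : ∀ {h} → 2 + j + 1 < h → 3 + j < h
    hi {h} q = subst (_< h) (+-comm (2 + j) 1) q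
    away : ∀ {h} → h + 2 < 2 + j ⊎ 2 + j + 1 < h → Off j h
    away (inj₁ q) = low (≤-trans (n≤1+n _) (lo q))
    away (inj₂ q) = high (hi q)
    away′ : ∀ {h} → h + 2 < 2 + j ⊎ 2 + j + 1 < h → Off j (suc h)
    away′ (inj₁ q) = low (lo q)
    away′ (inj₂ q) = high (≤-trans (hi q) (n≤1+n _))

  bool-eq? : ∀ a b → a ≡ not b ⊎ a ≡ b
  bool-eq? true  true  = inj₂ refl
  bool-eq? true  false = inj₁ refl
  bool-eq? false true  = inj₁ refl
  bool-eq? false false = inj₂ refl

  -- Suppose `v` does not admit the neighbouring colour. Then `k4m` or `k4a` shows that the move
  -- keeps the outer of the two signs concerned, while `D-flip` reverses the inner one, so the other
  -- end admits it.
  ax3 : ∀ i → 1 < i → i < n → ∀ v w → E i v w →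
        (3 ≤ i → Admits G (i ∸ 1) v ⊎ Admits G (i ∸ 1) w) × (i + 2 ≤ n → Admits G (suc i) v ⊎ Admits G (suc i) w)
  ax3 (suc zero) (s≤s ())
  ax3 (suc (suc j)) _ l v w ed with edge⁻ ed
  ... | _ , x , refl = below j refl , above
    where
    y = D-vtx j l x
    o = edge-opp ed
    below : ∀ j′ → j′ ≡ j → 3 ≤ 2 + j → Admits G (1 + j) v ⊎ Admits G (1 + j) (Dν (2 + j) v)
    below zero refl (s≤s (s≤s ()))
    below (suc h) refl _ with bool-eq? (lt (κ v (1 + h)) (κ v (2 + h))) (lt (κ v (2 + h)) (κ v (3 + h)))
    ... | inj₁ p = inj₁ (admits⁺ h (≤-trans (n≤1+n _) l) x p)
    ... | inj₂ p = inj₂ (admits⁺ h (≤-trans (n≤1+n _) l) y (trans top (trans o (cong not (sym mid)))))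
      where
      mid = proj₂ (D-flip j l x o)
      top : lt (κ (Dν (2 + j) v) (1 + h)) (κ (Dν (2 + j) v) (2 + h)) ≡ lt (κ v (2 + h)) (κ v (3 + h))
      top = trans (cong (sgn 2) (D-mv 0 j l x)) (trans (k4m _ (good-cw x l) (long {v} (4 + h) (m≤m+n 4 h)) refl o (trans p o)) (sym o))
    above : 2 + j + 2 ≤ n → Admits G (3 + j) v ⊎ Admits G (3 + j) (Dν (2 + j) v)
    above l″ with bool-eq? (lt (κ v (2 + j)) (κ v (3 + j))) (lt (κ v (3 + j)) (κ v (4 + j)))
      | subst (_≤ n) (+-comm (2 + j) 2) l″
    ... | inj₁ p | l′ = inj₁ (admits⁺ (suc j) l′ x p)
    ... | inj₂ p | l′ = inj₂ (admits⁺ (suc j) l′ y (trans (proj₁ (D-flip j l x o)) (trans o (trans (cong not p) (cong not (sym top))))))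
      where
      top : lt (κ (Dν (2 + j) v) (3 + j)) (κ (Dν (2 + j) v) (4 + j)) ≡ lt (κ v (3 + j)) (κ v (4 + j))
      top = trans (cong (sgn 0) (D-mv 1 j l′ x)) (k4a _ (good-cw x l′) (long {v} (4 + j) (m≤m+n 4 j)) refl p (trans o (cong not p)))

  Apart : ℕ → ℕ → Set
  Apart a b = ∀ v → Off a v ⊎ Off b v

  apart-sym : ∀ {a b} → Apart a b → Apart b a
  apart-sym h v = ⊎-swap (h v)

  offA : ∀ {a b} → Apart a b → Off b (1 + a) × Off b (2 + a) × Off b (3 + a)
  offA {a} h = pick (1 + a) (h (1 + a)) (λ o → proj₁ o refl) , pick (2 + a) (h (2 + a)) (λ o → proj₁ (proj₂ o) refl) ,
               pick (3 + a) (h (3 + a)) (λ o → proj₂ (proj₂ o) refl)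
    where
    pick : ∀ {b} v → Off a v ⊎ Off b v → ¬ Off a v → Off b v
    pick v (inj₁ o) n = ⊥-elim (n o)
    pick v (inj₂ o) n = o

  apart< : ∀ {a b} → 3 + a ≤ b → Apart a b
  apart< {a} {b} l v with v ≤? 3 + a
  ... | yes p = inj₂ ((λ e → <-irrefl e (s≤s (≤-trans p l))) , (λ e → <-irrefl e (s≤s (≤-trans (≤-trans p l) (n≤1+n b)))) ,
                      λ e → <-irrefl e (s≤s (≤-trans (≤-trans p l) (m≤n+m b 2))))
  ... | no p = inj₁ ((λ e → p (≤-trans (≤-reflexive e) (s≤s (m≤n+m a 2)))) , (λ e → p (≤-trans (≤-reflexive e) (s≤s (s≤s (n≤1+n a))))) ,
                     λ e → p (≤-reflexive e))

  triple-of : ∀ {v w} j (l : 3 + j ≤ n) → Vtx v → Vtx w → κ v (1 + j) ≡ κ w (1 + j) → κ v (2 + j) ≡ κ w (2 + j) → κ v (3 + j) ≡ κ w (3 + j) →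
              (κ (Dν (2 + j) v) (1 + j) , κ (Dν (2 + j) v) (2 + j) , κ (Dν (2 + j) v) (3 + j)) ≡
              (κ (Dν (2 + j) w) (1 + j) , κ (Dν (2 + j) w) (2 + j) , κ (Dν (2 + j) w) (3 + j))
  triple-of j l x y p q r = trans (D-tri j l x) (trans (cong₃ (tri) p q r) (sym (D-tri j l y)))
    where
    cong₃ : ∀ {A B : Set} (f : A → A → A → B) {a a′ b b′ c c′} → a ≡ a′ → b ≡ b′ → c ≡ c′ → f a b c ≡ f a′ b′ c′
    cong₃ f refl refl refl = refl

  half : ∀ {a b v} → 3 + a ≤ n → 3 + b ≤ n → Apart a b → Vtx v → ∀ u → 1 ≤ u → u ≤ n → Slot a u → Off b u →
         κ (Dν (2 + b) (Dν (2 + a) v)) u ≡ κ (Dν (2 + a) (Dν (2 + b) v)) u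
  half {a} {b} {v} la lb h x u p q s o = trans (D-off b lb (D-vtx a la x) p q o) (go s)
    where
    t : _
    t = triple-of a la x (D-vtx b lb x) (sym (D-off b lb x (s≤s z≤n) (≤-trans (s≤s (m≤n+m a 2)) la) (proj₁ (offA h))))
          (sym (D-off b lb x (s≤s z≤n) (≤-trans (n≤1+n _) la) (proj₁ (proj₂ (offA h))))) (sym (D-off b lb x (s≤s z≤n) la (proj₂ (proj₂ (offA h)))))
    go : Slot a u → κ (Dν (2 + a) v) u ≡ κ (Dν (2 + a) (Dν (2 + b) v)) u
    go isA = cong proj₁ t
    go isB = cong (proj₁ ∘ proj₂) t
    go isC = cong (proj₂ ∘ proj₂) t
    go (off o′) = trans (D-off a la x p q o′) (sym (trans (D-off a la (D-vtx b lb x) p q o′) (D-off b lb x p q o)))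

  -- Each value avoids at least one of the two triples, and `half` compares the letters at the
  -- values that avoid a given one.
  D-comm : ∀ {a b v} → 3 + a ≤ n → 3 + b ≤ n → Apart a b → Vtx v → Dν (2 + b) (Dν (2 + a) v) ≡ Dν (2 + a) (Dν (2 + b) v)
  D-comm {a} {b} la lb h x = word-inj (D-vtx b lb (D-vtx a la x)) (D-vtx a la (D-vtx b lb x)) λ u p q → go u p q (h u)
    where
    go : ∀ u → 1 ≤ u → u ≤ n → Off a u ⊎ Off b u → _
    go u p q (inj₂ o) = half la lb h x u p q (slot a u) o
    go u p q (inj₁ o) = sym (half lb la (apart-sym h) x u p q (slot b u) o)

  opp-off : ∀ {a b v} → 3 + a ≤ n → 3 + b ≤ n → Apart a b → Vtx v → Opp (Dν (2 + b) v) a → Opp v a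
  opp-off {a} {b} la lb h x o = trans (sym (cong₂ lt e₁ e₂)) (trans o (cong not (cong₂ lt e₂ e₃)))
    where
    e₁ = D-off b lb x (s≤s z≤n) (≤-trans (s≤s (m≤n+m a 2)) la) (proj₁ (offA h))
    e₂ = D-off b lb x (s≤s z≤n) (≤-trans (n≤1+n _) la) (proj₁ (proj₂ (offA h)))
    e₃ = D-off b lb x (s≤s z≤n) la (proj₂ (proj₂ (offA h)))

  opp-off′ : ∀ {a b v} → 3 + a ≤ n → 3 + b ≤ n → Apart a b → Vtx v → Opp v a → Opp (Dν (2 + b) v) a
  opp-off′ {a} {b} la lb h x o = opp-off la lb h (D-vtx b lb x) (subst (λ w → Opp w a) (sym (D-invol b lb x)) o)

  ax5 : ∀ i j v w x → (i + 2 < j ⊎ j + 2 < i) → E i v w → E j w x → Σ X (λ y → E j v y × E i x y)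
  ax5 (suc (suc a)) (suc (suc b)) v w x far e e′ with edge⁻ e
  ... | la , xv , refl with edge⁻ e′
  ... | lb , xw , refl = Dν (2 + b) v , edge⁺ lb xv ob ,
        edge-sym (subst (E (2 + a) (Dν (2 + b) v)) (sym (D-comm la lb ap xv)) (edge⁺ la (D-vtx b lb xv) (opp-off′ la lb ap xv (edge-opp e))))
    where
    sep : ∀ {a b} → 2 + a + 2 < 2 + b → 3 + a ≤ b
    sep {a} {b} q = ≤-pred (≤-pred (subst (_< 2 + b) (+-comm (2 + a) 2) q))
    ap : Apart a b
    ap = case far of λ { (inj₁ q) → apart< (sep q) ; (inj₂ q) → apart-sym (apart< (sep q)) }
    ob : Opp v b
    ob = opp-off lb la (apart-sym ap) xv (edge-opp e′)
  ax5 (suc zero) _ _ _ _ _ (s≤s () , _) _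
  ax5 zero _ _ _ _ _ (() , _) _
  ax5 (suc (suc _)) (suc zero) _ _ _ _ _ (s≤s () , _)
  ax5 (suc (suc _)) zero _ _ _ _ _ (() , _)

  -- Moves at depth d of the word of the values up to m = 3 + j are the moves of colour 2 + j − d.
  record Lift (P : ℕ → Set) (m : ℕ) (v : X) (u : List A) : Set where
    constructor lifted
    field
      {end} : X
      path  : Reach G P v end
      vtx   : Vtx end
      image : cw (κ end) m ≡ u
      fixed : ∀ h → m < h → h ≤ n → κ end h ≡ κ v h

  lift-step : ∀ {P m v} d → m ≤ n → (∀ j → d + (3 + j) ≡ m → P (2 + j)) → Vtx v → Lift P m v (mv d (cw (κ v) m))
  lift-step {P} {m} {v} d l h x with 3 + d ≤? m
  ... | no s = lifted ε x (sym (mv-beyond lt cl d _ (subst (_< 3 + d) (sym (cw-length (κ v) m)) (≰⇒> s)))) λ _ _ _ → refl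
  ... | yes s = go (bool-eq? (lt (κ v (1 + j)) (κ v (2 + j))) (lt (κ v (2 + j)) (κ v (3 + j))))
    where
    j = m ∸ (3 + d)
    eq : d + (3 + j) ≡ m
    eq = trans (sym (+-assoc d 3 j)) (trans (cong (_+ j) (+-comm d 3)) (m+[n∸m]≡n s))
    lj : 3 + j ≤ n
    lj = ≤-trans (subst (3 + j ≤_) eq (m≤n+m (3 + j) d)) l
    image′ : cw (κ (Dν (2 + j) v)) m ≡ mv d (cw (κ v) m)
    image′ = subst (λ m → cw (κ (Dν (2 + j) v)) m ≡ mv d (cw (κ v) m)) eq (D-mv d j (subst (_≤ n) (sym eq) l) x)
    go : _ → Lift P m v (mv d (cw (κ v) m))
    go (inj₂ same) = lifted ε x (subst (λ w → cw (κ w) m ≡ mv d (cw (κ v) m)) (D-still j lj x same) image′) λ _ _ _ → refl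
    go (inj₁ o) = lifted ((2 + j , h j eq , edge⁺ lj x o) ◅ ε) (D-vtx j lj x) image′ λ u p q → D-off j lj x (≤-trans (s≤s z≤n) p) q
      (let r = ≤-<-trans (subst (3 + j ≤_) eq (m≤n+m (3 + j) d)) p in
       (λ e → <-irrefl (sym e) (≤-trans (s≤s (s≤s (m≤n+m j 2))) r)) , (λ e → <-irrefl (sym e) (≤-trans (n≤1+n _) r)) , λ e → <-irrefl (sym e) r)

  lift-run : ∀ {P m v} ds → m ≤ n → (∀ d → d ∈ ds → ∀ j → d + (3 + j) ≡ m → P (2 + j)) → Vtx v → Lift P m v (run ds (cw (κ v) m))
  lift-run [] l h x = lifted ε x refl λ _ _ _ → refl
  lift-run {P} {m} {v} (d ∷ ds) l h x with lift-step {P} {m} d l (h d (here refl)) x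
  ... | lifted {v′} p y e f with lift-run {P} ds l (λ d i → h d (there i)) y
  ... | lifted {v″} p′ y′ e′ f′ = lifted (p ◅◅ p′) y′ (trans e′ (cong (run ds) e)) λ u a b → trans (f′ u a b) (f u a b)

  record Trace (m : ℕ) (v w : X) : Set where
    constructor trace
    field
      ds    : List ℕ
      vtx   : Vtx w
      image : cw (κ w) m ≡ run ds (cw (κ v) m)
      fixed : ∀ h → m < h → h ≤ n → κ w h ≡ κ v h

  trace-reach : ∀ {P m v w} → m ≤ n → (∀ c → P c → 2 ≤ c × c < m) → Vtx v → Reach G P v w → Trace m v w
  trace-reach l h x ε = trace [] x refl λ _ _ _ → refl
  trace-reach {P} {m} {v} {w} l h x ((c , pc , ed) ◅ r) with h c pc
  trace-reach {P} {m} {v} {w} l h x ((suc (suc j) , pc , ed) ◅ r) | s≤s (s≤s z≤n) , lm with edge⁻ ed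
  ... | lj , _ , refl with trace-reach l h (D-vtx j lj x) r
  ... | trace ds y e f = trace (m ∸ (3 + j) ∷ ds) y
        (trans e (cong (run ds) (subst (λ i → cw (κ (Dν (2 + j) v)) i ≡ mv (m ∸ (3 + j)) (cw (κ v) i)) (m∸n+n≡m lm)
          (D-mv (m ∸ (3 + j)) j (≤-trans (≤-reflexive (m∸n+n≡m lm)) l) x))))
        λ u a b → trans (f u a b) (D-off j lj x (≤-trans (s≤s z≤n) a) b
          ((λ q → <-irrefl (sym q) (≤-trans (s≤s (s≤s (m≤n+m j 2))) (≤-<-trans lm a))) , (λ q → <-irrefl (sym q) (≤-trans (n≤1+n _) (≤-<-trans lm a))) , λ q → <-irrefl (sym q) (≤-<-trans lm a)))

  same-end : ∀ {m v w} → m ≤ n → Vtx v → Vtx w → cw (κ v) m ≡ cw (κ w) m → (∀ h → m < h → h ≤ n → κ v h ≡ κ w h) → v ≡ w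
  same-end {m} l x y e f = word-inj x y λ u a b → case u ≤? m of λ { (yes p) → cw-cong⁻ m e u a p ; (no p) → f u (≰⇒> p) b }

  open Recording S n using (few; Few; within; cross)

  -- The path is a walk on the letters up to `i + 1`; `few` replaces it and the replacement is
  -- turned back into edges. If its move at depth 0 fixes the vertex, the two middle vertices
  -- coincide.
  ax6 : ∀ i → 1 < i → i < n → ∀ v w → Vtx v → Reach G (λ c → 1 < c × c ≤ i) v w →
        Σ X (λ a → Σ X (λ b → Reach G (λ c → 1 < c × c < i) v a × (a ≡ b ⊎ E i a b) × Reach G (λ c → 1 < c × c < i) b w))
  ax6 (suc zero) (s≤s ())
  ax6 (suc (suc j)) _ l v w x r with trace-reach {m = 3 + j} l (λ c p → proj₁ p , s≤s (proj₂ p)) x r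
  ... | trace ds y e f = go (few (good-cw x l) (≤-trans (≤-reflexive (cw-length (κ v) (3 + j))) l) ds)
    where
    P : ℕ → Set
    P c = 1 < c × c < 2 + j
    inside-P : ∀ ds d → d ∈ map suc ds → ∀ j′ → d + (3 + j′) ≡ 3 + j → P (2 + j′)
    inside-P ds d d∈ j′ q with ∈-map⁻ suc d∈
    ... | d′ , _ , refl = s≤s (s≤s z≤n) , ≤-trans (m≤n+m (3 + j′) d′) (≤-reflexive (suc-injective q))
    go : Few (cw (κ v) (3 + j)) (run ds (cw (κ v) (3 + j))) → _
    go (within es q) with lift-run {P} (map suc es) l (inside-P es) x
    ... | lifted {v′} p y′ e′ f′ with same-end l y′ y (trans e′ (trans q (sym e))) (λ h a b → trans (f′ h a b) (sym (f h a b)))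
    ... | refl = _ , _ , p , inj₁ refl , ε
    go (cross es fs q) with lift-run {P} (map suc es) l (inside-P es) x
    ... | lifted {a} p ya ea fa = pick (bool-eq? (lt (κ a (1 + j)) (κ a (2 + j))) (lt (κ a (2 + j)) (κ a (3 + j))))
      where
      finish : ∀ b → Vtx b → cw (κ b) (3 + j) ≡ mv 0 (cw (κ a) (3 + j)) → (∀ h → 3 + j < h → h ≤ n → κ b h ≡ κ a h) → (a ≡ b ⊎ E (2 + j) a b) → _
      finish b yb eb fb ab with lift-run {P} (map suc fs) l (inside-P fs) yb
      ... | lifted {v′} p′ y′ e′ f′ with same-end l y′ y (trans e′ (trans (cong (run (map suc fs)) (trans eb (cong (mv 0) ea)))
              (trans (sym (run-++ (map suc es) (0 ∷ map suc fs) _)) (trans q (sym e)))))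
              (λ h s t → trans (f′ h s t) (trans (fb h s t) (trans (fa h s t) (sym (f h s t)))))
      ... | refl = a , b , p , ab , p′
      pick : _ → _
      pick (inj₂ same) = finish a ya (trans (cong (λ z → cw (κ z) (3 + j)) (sym (D-still j l ya same))) (D-mv 0 j l ya)) (λ _ _ _ → refl) (inj₁ refl)
      pick (inj₁ o) = finish (Dν (2 + j) a) (D-vtx j l ya) (D-mv 0 j l ya) (λ h s t → D-off j l ya (≤-trans (s≤s z≤n) s) t
            ((λ e → <-irrefl (sym e) (≤-trans (s≤s (s≤s (m≤n+m j 2))) s)) , (λ e → <-irrefl (sym e) (≤-trans (n≤1+n _) s)) , λ e → <-irrefl (sym e) s))
            (inj₂ (edge⁺ l ya o))

-- The diameter as a condition on four contents.

max-∈ : ∀ xs → 0 < foldr _⊔_ 0 xs → foldr _⊔_ 0 xs ∈ xs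
max-∈ (x ∷ xs) l with ≤-total x (foldr _⊔_ 0 xs)
... | inj₂ p = here (m≥n⇒m⊔n≡m p)
... | inj₁ p = there (subst (_∈ xs) (sym (m≤n⇒m⊔n≡n p)) (max-∈ xs (subst (0 <_) (m≤n⇒m⊔n≡n p) l)))

filter-sublist : ∀ {A : Set} {P : A → Set} (P? : ∀ x → Dec (P x)) xs → Data.List.filter P? xs ∈ sublists xs
filter-sublist P? []       = here refl
filter-sublist P? (x ∷ xs) with P? x
... | yes _ = ∈-++⁺ʳ (sublists xs) (∈-map⁺ (x ∷_) (filter-sublist P? xs))
... | no _  = ∈-++⁺ˡ (filter-sublist P? xs)

sublist-⊆ : ∀ {A : Set} (xs : List A) {R} → R ∈ sublists xs → ∀ {x} → x ∈ R → x ∈ xs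
sublist-⊆ [] (here refl) ()
sublist-⊆ (y ∷ xs) R∈ x∈ with ∈-++⁻ (sublists xs) R∈
... | inj₁ i = there (sublist-⊆ xs i x∈)
... | inj₂ i with ∈-map⁻ (y ∷_) i
sublist-⊆ (y ∷ xs) R∈ (here e)  | inj₂ i | R′ , j , refl = here e
sublist-⊆ (y ∷ xs) R∈ (there x) | inj₂ i | R′ , j , refl = there (sublist-⊆ xs j x)

sublist-unique : ∀ {A : Set} {xs : List A} → Unique xs → ∀ {R} → R ∈ sublists xs → Unique R
sublist-unique [] (here refl) = []
sublist-unique {xs = y ∷ xs} (a ∷ as) R∈ with ∈-++⁻ (sublists xs) R∈
... | inj₁ i = sublist-unique as i
... | inj₂ i with ∈-map⁻ (y ∷_) i
... | R′ , j , refl = All.tabulate (λ z∈ → All.lookup a (sublist-⊆ xs j z∈)) ∷ sublist-unique as j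

allB⁺ : ∀ {A : Set} {p : A → Bool} xs → (∀ {x} → x ∈ xs → p x ≡ true) → allB p xs ≡ true
allB⁺ []       h = refl
allB⁺ (x ∷ xs) h = ∧-true⁺ (h (here refl)) (allB⁺ xs (h ∘ there))

allB⁻ : ∀ {A : Set} {p : A → Bool} xs → allB p xs ≡ true → ∀ {x} → x ∈ xs → p x ≡ true
allB⁻ {p = p} (x ∷ xs) e (here refl) = proj₁ (∧-true⁻ {p x} e)
allB⁻ {p = p} (x ∷ xs) e (there i)     = allB⁻ xs (proj₂ (∧-true⁻ {p x} e)) i

≤ᵇ-true : ∀ {m k} → m ≤ k → (m ≤ᵇ k) ≡ true
≤ᵇ-true {zero}  _ = refl
≤ᵇ-true {suc m} l = <ᵇ-true l

≤ᵇ-true⁻ : ∀ {m k} → (m ≤ᵇ k) ≡ true → m ≤ k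
≤ᵇ-true⁻ {zero}  _ = z≤n
≤ᵇ-true⁻ {suc m} e = <ᵇ-true⁻ e

record LetterGraph : Set₁ where
  field
    letters : Letters
    graph     : WordGraph (Windows.system letters)
    _≟X_      : (v w : WordGraph.X graph) → Dec (v ≡ w)

module Diameter (ν : List Skew) where
  open Graph ν

  abs-≤ : ∀ x y → x ℤ.≤ y ℤ.+ + k → y ℤ.≤ x ℤ.+ + k → ℤ.∣ x ℤ.- y ∣ ≤ k
  abs-≤ x y l l′ with x ℤ.- y in e
  ... | + m = ℤP.drop‿+≤+ (subst (ℤ._≤ + k) e (proj₂ (diff-≤ {y} {x}) l))
  ... | ℤ.-[1+ m ] = ℤP.drop‿+≤+ (subst (ℤ._≤ + k) (trans (flip y x) (cong ℤ.-_ e)) (proj₂ (diff-≤ {x} {y}) l′))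
    where
    flip : ∀ y x → y ℤ.- x ≡ ℤ.- (x ℤ.- y)
    flip y x = solve 2 (λ y x → y :- x := :- (x :- y)) refl y x
      where open +-*-Solver

  abs-≤⁻ : ∀ x y → ℤ.∣ x ℤ.- y ∣ ≤ k → x ℤ.≤ y ℤ.+ + k
  abs-≤⁻ x y l = proj₁ (diff-≤ {y} {x}) (≤-abs (x ℤ.- y) l)
    where
    ≤-abs : ∀ z → ℤ.∣ z ∣ ≤ k → z ℤ.≤ + k
    ≤-abs (+ m) l = ℤ.+≤+ l
    ≤-abs ℤ.-[1+ m ] l = ℤ.-≤+

  contents : List ℤ
  contents = Data.List.deduplicate ℤ._≟_ (map sc (cells ν))

  contents⁺ : ∀ {x} → x ∈ cells ν → sc x ∈ contents
  contents⁺ x∈ = ∈-deduplicate⁺ ℤ._≟_ (∈-map⁺ sc x∈)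

  contents⁻ : ∀ {a} → a ∈ contents → ∃ λ x → x ∈ cells ν × a ≡ sc x
  contents⁻ a∈ = ∈-map⁻ sc (∈-deduplicate⁻ ℤ._≟_ (map sc (cells ν)) a∈)

  close-set : ∀ R → pairwiseClose k R ≡ true → R ∈ sublists contents → length R ≤ diam ν
  close-set R c R∈ = max-≥ (∈-map⁺ length (∈-filter⁺ (λ R → T? (pairwiseClose k R)) R∈ (subst Data.Bool.T (sym c) tt)))
    where open import Relation.Nullary.Decidable using (T?)

  narrow : diam ν ≤ 3 → ∀ {w x y z} → w ∈ cells ν → x ∈ cells ν → y ∈ cells ν → z ∈ cells ν →
           lt (sc w) (sc x) ≡ true → lt (sc x) (sc y) ≡ true → lt (sc y) (sc z) ≡ true → cl (sc w) (sc z) ≡ false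
  narrow d≤3 {w} {x} {y} {z} w∈ x∈ y∈ z∈ p q r with cl (sc w) (sc z) in e
  ... | false = refl
  ... | true = ⊥-elim (<-irrefl refl (≤-trans (unique-⊆ four-unique sub) (≤-trans (close-set R near-all (filter-sublist (_∈? four) contents)) d≤3)))
    where
    four = sc w ∷ sc x ∷ sc y ∷ sc z ∷ []
    p′ = lt-true⁻ p
    q′ = lt-true⁻ q
    r′ = lt-true⁻ r
    wy = ℤP.<-trans p′ q′
    xz = ℤP.<-trans q′ r′
    wz = ℤP.<-trans wy r′
    four-unique : Unique four
    four-unique = (ℤP.<⇒≢ p′ ∷ ℤP.<⇒≢ wy ∷ ℤP.<⇒≢ wz ∷ []) ∷ (ℤP.<⇒≢ q′ ∷ ℤP.<⇒≢ xz ∷ []) ∷ (ℤP.<⇒≢ r′ ∷ []) ∷ [] ∷ []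
    -- The same four contents, in the order of `contents`, so that they form one of the listed
    -- sublists.
    R = Data.List.filter (_∈? four) contents
    sub : ∀ {a} → a ∈ four → a ∈ R
    sub a∈ = ∈-filter⁺ (_∈? four) (inC a∈) a∈
      where
      inC : ∀ {a} → a ∈ four → a ∈ contents
      inC (here refl) = contents⁺ w∈
      inC (there (here refl)) = contents⁺ x∈
      inC (there (there (here refl))) = contents⁺ y∈
      inC (there (there (there (here refl)))) = contents⁺ z∈
    range : ∀ {a} → a ∈ R → sc w ℤ.≤ a × a ℤ.≤ sc z
    range a∈ with proj₂ (∈-filter⁻ (_∈? four) {xs = contents} a∈)
    ... | here refl = ℤP.≤-refl , ℤP.<⇒≤ wz
    ... | there (here refl) = ℤP.<⇒≤ p′ , ℤP.<⇒≤ xz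
    ... | there (there (here refl)) = ℤP.<⇒≤ wy , ℤP.<⇒≤ r′
    ... | there (there (there (here refl))) = ℤP.<⇒≤ wz , ℤP.≤-refl
    near : ∀ {a b} → a ∈ R → b ∈ R → a ℤ.≤ b ℤ.+ + k
    near a∈ b∈ = ℤP.≤-trans (proj₂ (range a∈)) (ℤP.≤-trans (proj₁ (cl-true⁻ e)) (+k-mono (proj₁ (range b∈))))
    near-all : pairwiseClose k R ≡ true
    near-all = allB⁺ R λ {a} a∈ → allB⁺ R λ {b} b∈ → ≤ᵇ-true (abs-≤ a b (near a∈ b∈) (near b∈ a∈))

  wide : 3 < diam ν → ∃ λ R → Unique R × 4 ≤ length R × (∀ {a} → a ∈ R → a ∈ contents) × (∀ {a b} → a ∈ R → b ∈ R → a ℤ.≤ b ℤ.+ + k)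
  wide l with ∈-map⁻ length (max-∈ _ (≤-trans (s≤s z≤n) l))
  ... | R , R∈ , e with ∈-filter⁻ (λ R → T? (pairwiseClose k R)) {xs = sublists contents} R∈
    where open import Relation.Nullary.Decidable using (T?)
  ... | R∈′ , c = R , sublist-unique (deduplicate-! ℤ._≟_ (map sc (cells ν))) R∈′ , subst (4 ≤_) e l , sublist-⊆ contents R∈′ ,
        λ {a} {b} a∈ b∈ → abs-≤⁻ a b (≤ᵇ-true⁻ (allB⁻ R (allB⁻ R (T-true c) a∈) b∈))
    where
    T-true : ∀ {b} → Data.Bool.T b → b ≡ true
    T-true {true} _ = refl

  module _ (d≤3 : diam ν ≤ 3) where
    open Narrow (narrow d≤3)

    letterGraph : LetterGraph
    letterGraph = record { letters = letters ; graph = record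
      { X = List ℕ ; Vtx = IsLLTVertex ν ; n = n ; σ = sig ; Dν = D (τ ν) ; κ = κ
      ; good-cw = good-cw ; D-vtx = D-vtx ; D-off = D-off ; D-tri = D-tri ; word-inj = word-inj ; sig-lt = sig-lt } ; _≟X_ = ≡-dec _≟_ }

    graph-eq : WordGraph.G (LetterGraph.graph letterGraph) ≡ LLT ν
    graph-eq = refl

-- Permutations under the plain operators.

pos-map : ∀ {φ : ℕ → ℕ} → (∀ {x y} → φ x ≡ φ y → x ≡ y) → ∀ w v → pos (map φ w) (φ v) ≡ pos w v
pos-map inj []      v = refl
pos-map {φ} inj (x ∷ w) v with x ≟ v
... | yes refl rewrite ≡ᵇ-refl (φ x) | ≡ᵇ-refl x = refl
... | no n rewrite ≡ᵇ-≢ {φ x} {φ v} (n ∘ inj) | ≡ᵇ-≢ n | pos-map {φ} inj w v = refl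

pos-inj : ∀ {w u v} → u ∈ w → v ∈ w → pos w u ≡ pos w v → u ≡ v
pos-inj {x ∷ w} {u} {v} u∈ v∈ e with x ≟ u | x ≟ v
... | yes p | yes q = trans (sym p) q
... | yes refl | no q = ⊥-elim (<-irrefl (trans (sym (pos-here x w)) (trans e (pos-there w q (pos-pos (tail∈ v∈ q))))) (s≤s (pos-pos (tail∈ v∈ q))))
  where
  tail∈ : ∀ {v} → v ∈ x ∷ w → x ≢ v → v ∈ w
  tail∈ (here e) n = ⊥-elim (n (sym e))
  tail∈ (there i) n = i
... | no p | yes refl = ⊥-elim (<-irrefl (trans (sym (pos-here x w)) (trans (sym e) (pos-there w p (pos-pos (tail∈ u∈ p))))) (s≤s (pos-pos (tail∈ u∈ p))))
  where
  tail∈ : ∀ {v} → v ∈ x ∷ w → x ≢ v → v ∈ w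
  tail∈ (here e) n = ⊥-elim (n (sym e))
  tail∈ (there i) n = i
... | no p | no q = pos-inj i j (suc-injective (trans (sym (pos-there w p (pos-pos i))) (trans e (pos-there w q (pos-pos j)))))
  where
  tail∈ : ∀ {v} → v ∈ x ∷ w → x ≢ v → v ∈ w
  tail∈ (here e) n = ⊥-elim (n (sym e))
  tail∈ (there i) n = i
  i = tail∈ u∈ p
  j = tail∈ v∈ q

pos-determines : ∀ {w w′} → Unique w → Unique w′ → (∀ {v} → v ∈ w → v ∈ w′) → (∀ {v} → v ∈ w′ → v ∈ w) →
                 (∀ {v} → v ∈ w → pos w v ≡ pos w′ v) → w ≡ w′
pos-determines {[]} {[]} _ _ _ _ _ = refl
pos-determines {[]} {y ∷ w′} _ _ _ b _ with () ← b (here refl)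
pos-determines {x ∷ w} {[]} _ _ f _ _ with () ← f (here refl)
pos-determines {x ∷ w} {y ∷ w′} (a ∷ as) (b ∷ bs) f g h = first (y ≟ x)
  where
  first : Dec (y ≡ x) → x ∷ w ≡ y ∷ w′
  first (no n) with f (here refl)
  ... | here e = ⊥-elim (n (sym e))
  ... | there i = ⊥-elim (<-irrefl (trans (sym (pos-here x w)) (trans (h (here refl)) (pos-there w′ n (pos-pos i)))) (s≤s (pos-pos i)))
  first (yes refl) = cong (x ∷_) (pos-determines as bs
    (λ i → case f (there i) of λ { (here refl) → ⊥-elim (All.lookup a i refl) ; (there j) → j })
    (λ i → case g (there i) of λ { (here refl) → ⊥-elim (All.lookup b i refl) ; (there j) → j })
    same)
    where
    same : ∀ {v} → v ∈ w → pos w v ≡ pos w′ v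
    same {v} i with f (there i)
    ... | here refl = ⊥-elim (All.lookup a i refl)
    ... | there j = suc-injective (trans (sym (pos-there w (All.lookup a i) (pos-pos i))) (trans (h (there i)) (pos-there w′ (All.lookup b j) (pos-pos j))))

-- The constant bound 0 makes every triple far, so `d` is a case of `D` and the evaluation of `D`
-- applies.
d-act : ∀ {w} j → 0 < pos w (1 + j) → pos w (1 + j) ≢ pos w (2 + j) → pos w (2 + j) ≢ pos w (3 + j) → pos w (1 + j) ≢ pos w (3 + j) →
        d (2 + j) w ≡ map (act (kind (pos w (1 + j) <ᵇ pos w (2 + j)) (pos w (2 + j) <ᵇ pos w (3 + j)) (pos w (1 + j) <ᵇ pos w (3 + j)) false false) j) w
d-act {w} j l n₁ n₂ n₃ = trans (sym (far (<ᵇ-true (≤-trans l (≤-trans (m≤m⊔n (pos w (1 + j)) (pos w (2 + j))) (m≤m⊔n _ (pos w (3 + j))))))))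
  (D-kind (λ _ → 0) w j (order₃ (λ _ → 0) w j n₁ n₂ n₃) false false (λ _ q → <ᵇ-true (≤-trans (s≤s z≤n) q)) (λ _ q → <ᵇ-true (≤-trans (s≤s z≤n) q)))
  where
  far : (0 <ᵇ pos w (1 + j) ⊔ pos w (2 + j) ⊔ pos w (3 + j)) ≡ true → D (λ _ → 0) (2 + j) w ≡ d (2 + j) w
  far e rewrite e = refl

-- Permutations with `d` also form a word graph, the letter of a value being its position. Facts
-- about tableaux are obtained from it through row reading words.
module Plain (n : ℕ) where

  record Perm (w : List ℕ) : Set where
    constructor perm
    field
      uniq : Unique w
      fwd  : ∀ {v} → v ∈ w → 1 ≤ v × v ≤ n
      bwd  : ∀ {v} → 1 ≤ v → v ≤ n → v ∈ w

  open Perm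

  d-perm : ∀ {w} j → 3 + j ≤ n → Perm w → ∀ K → Perm (map (act K j) w)
  d-perm {w} j l (perm u f b) K = perm (UniqueP.map⁺ (act-inj K j) u) to from
    where
    to : ∀ {v} → v ∈ map (act K j) w → 1 ≤ v × v ≤ n
    to v∈ with ∈-map⁻ (act K j) v∈
    ... | x , x∈ , refl = proj₁ (act-in K j (slot j x)) (proj₁ (f x∈)) , proj₂ (act-in K j (slot j x)) l (proj₂ (f x∈))
    from : ∀ {v} → 1 ≤ v → v ≤ n → v ∈ map (act K j) w
    from {v} p q = subst (_∈ map (act K j) w) (act-undo′ K j v)
      (∈-map⁺ (act K j) (b (proj₁ (act-in (undo K) j (slot j v)) p) (proj₂ (act-in (undo K) j (slot j v)) l q)))

  module _ {w} (j : ℕ) (l : 3 + j ≤ n) (x : Perm w) where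
    private
      in-w : ∀ {v} → 1 ≤ v → v ≤ 3 + j → v ∈ w
      in-w p q = bwd x p (≤-trans q l)
      a∈ = in-w (s≤s z≤n) (s≤s (m≤n+m j 2))
      b∈ = in-w (s≤s z≤n) (n≤1+n (2 + j))
      c∈ = in-w (s≤s z≤n) ≤-refl
      K = kind (pos w (1 + j) <ᵇ pos w (2 + j)) (pos w (2 + j) <ᵇ pos w (3 + j)) (pos w (1 + j) <ᵇ pos w (3 + j)) false false
      d≡ : d (2 + j) w ≡ map (act K j) w
      d≡ = d-act j (pos-pos a∈) (λ e → 1+n≢n (sym (pos-inj a∈ b∈ e))) (λ e → 1+n≢n (sym (pos-inj b∈ c∈ e)))
             (λ e → <-irrefl (pos-inj a∈ c∈ e) (s≤s (n≤1+n (suc j))))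

    d-vtx : Perm (d (2 + j) w)
    d-vtx = subst Perm (sym d≡) (d-perm j l x K)

    pos-act : ∀ v → pos (d (2 + j) w) (act K j v) ≡ pos w v
    pos-act v = trans (cong (λ z → pos z (act K j v)) d≡) (pos-map (act-inj K j) w v)

    d-off : ∀ {v} → 1 ≤ v → v ≤ n → Off j v → pos (d (2 + j) w) v ≡ pos w v
    d-off {v} _ _ o = trans (cong (pos (d (2 + j) w)) (sym (act-off K o))) (pos-act v)

    d-tri : (pos (d (2 + j) w) (1 + j) , pos (d (2 + j) w) (2 + j) , pos (d (2 + j) w) (3 + j)) ≡
            Walks.tri _<ᵇ_ never (pos w (1 + j)) (pos w (2 + j)) (pos w (3 + j))
    d-tri = trans (cong₂ _,_ (back _) (cong₂ _,_ (back _) (back _))) (trans (images K) (sym (tri-place _<ᵇ_ never _ _ _)))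
      where
      back : ∀ v → pos (d (2 + j) w) v ≡ pos w (act (undo K) j v)
      back v = trans (cong (pos (d (2 + j) w)) (sym (act-undo′ K j v))) (pos-act _)
      images : ∀ K → (pos w (act (undo K) j (1 + j)) , pos w (act (undo K) j (2 + j)) , pos w (act (undo K) j (3 + j))) ≡ place K (pos w (1 + j)) (pos w (2 + j)) (pos w (3 + j))
      images K with act-abc (undo K) j
      images none   | p , q , r = cong₂ _,_ (cong (pos w) p) (cong₂ _,_ (cong (pos w) q) (cong (pos w) r))
      images swap₁  | p , q , r = cong₂ _,_ (cong (pos w) p) (cong₂ _,_ (cong (pos w) q) (cong (pos w) r))
      images swap₂  | p , q , r = cong₂ _,_ (cong (pos w) p) (cong₂ _,_ (cong (pos w) q) (cong (pos w) r))
      images cycle₁ | p , q , r = cong₂ _,_ (cong (pos w) p) (cong₂ _,_ (cong (pos w) q) (cong (pos w) r))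
      images cycle₂ | p , q , r = cong₂ _,_ (cong (pos w) p) (cong₂ _,_ (cong (pos w) q) (cong (pos w) r))

  d-mv : ∀ {w} e j → e + (3 + j) ≤ n → Perm w → cw (pos (d (2 + j) w)) (e + (3 + j)) ≡ Walks.mv _<ᵇ_ never e (cw (pos w) (e + (3 + j)))
  d-mv {w} zero j l x = trans (cong (λ u → pos (d (2 + j) w) (3 + j) ∷ pos (d (2 + j) w) (2 + j) ∷ pos (d (2 + j) w) (1 + j) ∷ u)
      (cw-cong j λ v a b → d-off j l x a (≤-trans b (≤-trans (m≤n+m j 3) l)) (off-below b)))
      (cong (λ t → Walks.put _<ᵇ_ never t (cw (pos w) j)) (d-tri j l x))
  d-mv (suc e) j l x = cong₂ _∷_ (d-off j (≤-trans (m≤n+m (3 + j) (suc e)) l) x (s≤s z≤n) l (off-above (s≤s (m≤n+m (3 + j) e)))) (d-mv e j (≤-trans (n≤1+n _) l) x)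

  Good : List ℕ → Set
  Good u = ∃ λ w → Perm w × ∃ λ m → m ≤ n × u ≡ cw (pos w) m

  letters : Letters
  letters = record
    { A = ℕ ; lt = _<ᵇ_ ; cl = never
    ; lt-irr = λ x → <ᵇ-false (≤-refl {x})
    ; lt-tr = λ {x} {y} {z} p q → <ᵇ-true (<-trans (<ᵇ-true⁻ {x} {y} p) (<ᵇ-true⁻ {y} {z} q))
    ; lt-tri = λ x y → case <-cmp x y of λ { (tri< l _ _) → inj₁ (<ᵇ-true l) ; (tri≈ _ e _) → inj₂ (inj₁ e) ; (tri> _ _ l) → inj₂ (inj₂ (<ᵇ-true l)) }
    ; cl-sym = λ _ _ → refl ; Good = Good
    ; good-mv = good-mv ; good-tail = λ { (w , x , suc m , l , e) → w , x , m , ≤-trans (n≤1+n m) l , ∷-injectiveʳ e }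
    ; distinct = distinct ; narrow = λ _ _ _ _ _ _ _ _ → refl
    ; tie-gap = λ {t} {β} {γ} g _ → ⊥-elim (no-tie β g) }
    where
    good-mv : ∀ e {u} → Good u → Good (Walks.mv _<ᵇ_ never e u)
    good-mv e (w , x , m , l , refl) with 3 + e ≤? m
    ... | no s = w , x , m , l , mv-beyond _<ᵇ_ never e _ (subst (_< 3 + e) (sym (cw-length (pos w) m)) (≰⇒> s))
    ... | yes s = d (2 + j) w , d-vtx j (≤-trans (m≤n+m (3 + j) e) (subst (_≤ n) (sym eq) l)) x , m , l ,
          subst (λ m → Walks.mv _<ᵇ_ never e (cw (pos w) m) ≡ cw (pos (d (2 + j) w)) m) eq (sym (d-mv e j (subst (_≤ n) (sym eq) l) x))
      where
      j = m ∸ (3 + e)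
      eq : e + (3 + j) ≡ m
      eq = trans (sym (+-assoc e 3 j)) (trans (cong (_+ j) (+-comm e 3)) (m+[n∸m]≡n s))
    distinct : ∀ {r q p α} → Good (r ∷ q ∷ p ∷ α) → p ≢ q × q ≢ r × p ≢ r
    distinct (w , x , suc (suc (suc j)) , l , refl) =
      (λ e → 1+n≢n (sym (pos-inj a∈ b∈ e))) , (λ e → 1+n≢n (sym (pos-inj b∈ c∈ e))) , λ e → <-irrefl (pos-inj a∈ c∈ e) (s≤s (n≤1+n (suc j)))
      where
      a∈ = bwd x {1 + j} (s≤s z≤n) (≤-trans (s≤s (m≤n+m j 2)) l)
      b∈ = bwd x {2 + j} (s≤s z≤n) (≤-trans (n≤1+n (2 + j)) l)
      c∈ = bwd x {3 + j} (s≤s z≤n) l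
    no-tie : ∀ {t} β {γ} → Good (t ∷ β ++ t ∷ γ) → ⊥
    no-tie β (w , x , suc m , l , e) with cw-split (pos w) m β (sym (∷-injectiveʳ e))
    ... | v , p , q , r , _ = <-irrefl (pos-inj (bwd x p (≤-trans q (≤-trans (n≤1+n m) l))) (bwd x (s≤s z≤n) l) (trans r (∷-injectiveˡ e))) (s≤s q)

  wordGraph : WordGraph (Windows.system letters)
  wordGraph = record
    { X = List ℕ ; Vtx = Perm ; n = n ; σ = sig ; Dν = d ; κ = pos
    ; good-cw = λ x l → _ , x , _ , l , refl ; D-vtx = d-vtx ; D-off = d-off ; D-tri = d-tri
    ; word-inj = λ x y h → pos-determines (uniq x) (uniq y) (λ i → let a , b = fwd x i in bwd y a b) (λ i → let a , b = fwd y i in bwd x a b)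
                   (λ i → let a , b = fwd x i in h _ a b)
    ; sig-lt = λ _ _ _ → refl }

-- Matching orbits of patterns with small tableaux, by evaluation.

Tableau : Set
Tableau = List (List ℕ)

walk : {X : Set} → (ℕ → X → X) → List ℕ → X → X
walk D []      x = x
walk D (e ∷ ω) x = walk D ω (D e x)

walk-∷ʳ : ∀ {X : Set} (D : ℕ → X → X) ω e x → walk D (ω ++ e ∷ []) x ≡ D e (walk D ω x)
walk-∷ʳ D []      e x = refl
walk-∷ʳ D (f ∷ ω) e x = walk-∷ʳ D ω e (D f x)

increasing : List ℕ → Bool
increasing []          = true
increasing (x ∷ [])    = true
increasing (x ∷ y ∷ r) = (x <ᵇ y) ∧ increasing (y ∷ r)

supports : List ℕ → List ℕ → Bool
supports _       []      = true
supports []      (_ ∷ _) = false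
supports (x ∷ r) (y ∷ s) = (x <ᵇ y) ∧ supports r s

nonempty : List ℕ → Bool
nonempty []      = false
nonempty (_ ∷ _) = true

standard : Tableau → Bool
standard []          = true
standard (r ∷ [])    = nonempty r ∧ increasing r
standard (r ∷ s ∷ Y) = nonempty r ∧ increasing r ∧ supports r s ∧ standard (s ∷ Y)

extensions : ℕ → Tableau → List Tableau
extensions a []      = ((a ∷ []) ∷ []) ∷ []
extensions a (r ∷ Y) = ((r ++ a ∷ []) ∷ Y) ∷ map (r ∷_) (extensions a Y)

select : {A : Set} → (A → Bool) → List A → List A
select P []       = []
select P (x ∷ xs) = if P x then x ∷ select P xs else select P xs

tableaux : ℕ → List Tableau
tableaux zero    = [] ∷ []
tableaux (suc m) = concatMap (λ Y → select standard (extensions (suc m) Y)) (tableaux m)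

eqTableau : Tableau → Tableau → Bool
eqTableau []      []      = true
eqTableau (r ∷ Y) (s ∷ Z) = eqList r s ∧ eqTableau Y Z
eqTableau _       _       = false

take-out : ℕ → List ℕ → List ℕ
take-out x []       = []
take-out x (y ∷ ys) = if x ≡ᵇ y then ys else y ∷ take-out x ys

anagram : List ℕ → List ℕ → Bool
anagram []       ys = eqList [] ys
anagram (x ∷ xs) ys = anyᵇ (x ≡ᵇ_) ys ∧ anagram xs (take-out x ys)

-- The colour m − 1 − e moves the letters at depth e of a word of length m.
stepT : ℕ → ℕ → Tableau → Tableau
stepT m e = dT (m ∸ suc e)

module Search (mv : ℕ → List ℕ → List ℕ) (k : ℕ) where

  insertNew : List ℕ → List ℕ → List (List ℕ × List ℕ) → List (List ℕ × List ℕ)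
  insertNew ω p O = if anyᵇ (λ ωp → eqList p (proj₂ ωp)) O then O else (ω , p) ∷ O

  spread : List (List ℕ × List ℕ) → List (List ℕ × List ℕ) → List (List ℕ × List ℕ)
  spread []             O = O
  spread ((ω , p) ∷ xs) O = spread xs (foldr (λ e → insertNew (ω ++ e ∷ []) (mv e p)) O (upTo k))

  orbit : ℕ → List (List ℕ × List ℕ) → List (List ℕ × List ℕ)
  orbit zero       O = O
  orbit (suc fuel) O = orbit fuel (spread O O)

fillsOut : ℕ → Tableau → Bool
fillsOut m Y = standard Y ∧ anagram (concat Y) (range1 m)

Pair : Set
Pair = List ℕ × Tableau

module Check (m : ℕ) (gl : List Bool) where

  closedAt : List Pair → Pair → Bool
  closedAt O (p , Y) = allᵇ (λ e → anyᵇ (λ pY → eqList (proj₁ pY) (R.mv gl e p) ∧ eqTableau (proj₂ pY) (stepT m e Y)) O) (upTo (m ∸ 2))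

  agreeAt : List Pair → Pair → Bool
  agreeAt O (p , Y) = allᵇ (λ pY → eqList p (proj₁ pY) == eqTableau Y (proj₂ pY)) O

  -- The same walks are run from the pattern and from the tableau. If the pairs of ends are closed
  -- under all moves and equalities on the two sides coincide, the two orbits are isomorphic.
  good : List ℕ → List Pair → Bool
  good s O = allᵇ (λ pY → eqList s (map length (proj₂ pY)) ∧ fillsOut m (proj₂ pY)) O ∧ allᵇ (closedAt O) O ∧ allᵇ (agreeAt O) O

  pairs : List ℕ → Tableau → List (List ℕ) → List Pair
  pairs p U = map (λ ω → R.run gl ω p , walk (stepT m) ω U)

  -- Depth `i` compares the entries `m − 1 − i` and `m − i`. Comparing signs selects candidate
  -- tableaux before the costlier test.
  sameSigns : List ℕ → List ℕ → Bool
  sameSigns p w = allᵇ (λ i → R.sgn gl i p == (pos w (m ∸ suc i) <ᵇ pos w (suc (m ∸ suc i)))) (upTo (m ∸ 1))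

  matched : List ℕ → List (List ℕ) → Bool
  matched p Ws = anyᵇ (eqList []) Ws ∧ allᵇ (deep m) Ws ∧
    anyᵇ (λ U → sameSigns p (rowWord U) ∧ good (map length U) (pairs p U Ws)) (tableaux m)

  isomorphic : List ℕ → Bool
  -- Five rounds are enough: at most six standard tableaux of size five share a shape, so any two
  -- are at most five moves apart. An incomplete list of walks would fail `closedAt`.
  isomorphic p = matched p (map proj₁ (Search.orbit (R.mv gl) (m ∸ 2) 5 (([] , p) ∷ [])))

record Modelled (m : ℕ) : Set where
  constructor modelled
  field
    checked : everyWindow m (λ _ _ → true) (λ gl p → Check.isomorphic m gl p) ≡ true

-- Four letters serve the colour 3, for which (Ax4) involves two colours only; five letters serve
-- all larger colours.
modelled₄ : Modelled 4
modelled₄ = modelled refl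

modelled₅ : Modelled 5
modelled₅ = modelled refl

-- Standard tableaux, and their embedding into larger ones.

data Supports : List ℕ → List ℕ → Set where
  []  : ∀ {r} → Supports r []
  _∷_ : ∀ {x y r s} → x < y → Supports r s → Supports (x ∷ r) (y ∷ s)

supports-trans : ∀ {r s t} → Supports r s → Supports s t → Supports r t
supports-trans _       []      = []
supports-trans (p ∷ u) (q ∷ v) = <-trans p q ∷ supports-trans u v

supports-length : ∀ {r s} → Supports r s → length s ≤ length r
supports-length []      = z≤n
supports-length (_ ∷ u) = s≤s (supports-length u)

supports-∷ : ∀ {x r s} → Linked _<_ (x ∷ r) → Supports r s → Supports (x ∷ r) s
supports-∷ l       []      = []
supports-∷ (l ∷ m) (p ∷ u) = <-trans l p ∷ supports-∷ m u

supports-++ : ∀ q {r s} → Linked _<_ (q ++ r) → Supports r s → Supports (q ++ r) s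
supports-++ []      l u = u
supports-++ (x ∷ q) l u = supports-∷ l (supports-++ q (tail l) u)
  where
  tail : ∀ {x r} → Linked _<_ (x ∷ r) → Linked _<_ r
  tail [-]     = []
  tail (_ ∷ l) = l

record Standard (Y : Tableau) : Set where
  constructor mkStandard
  field
    rows≢[] : All (λ r → 0 < length r) Y
    rows-<  : All (Linked _<_) Y
    cols-<  : Linked Supports Y

increasing-true : ∀ r → increasing r ≡ true → Linked _<_ r
increasing-true []          _ = []
increasing-true (x ∷ [])    _ = [-]
increasing-true (x ∷ y ∷ r) e = let a , b = ∧-true⁻ {x <ᵇ y} e in <ᵇ-true⁻ a ∷ increasing-true (y ∷ r) b

supports-true : ∀ r s → supports r s ≡ true → Supports r s
supports-true _       []      _ = []
supports-true (x ∷ r) (y ∷ s) e with ∧-true⁻ {x <ᵇ y} e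
... | a , b = <ᵇ-true⁻ a ∷ supports-true r s b

nonempty-true : ∀ r → nonempty r ≡ true → 0 < length r
nonempty-true (_ ∷ _) _ = s≤s z≤n

standard-true : ∀ Y → standard Y ≡ true → Standard Y
standard-true []          _ = mkStandard [] [] []
standard-true (r ∷ [])    e = let a , b = ∧-true⁻ {nonempty r} e in mkStandard (nonempty-true r a ∷ []) (increasing-true r b ∷ []) [-]
standard-true (r ∷ s ∷ Y) e =
  let a , e₁ = ∧-true⁻ {nonempty r} e
      b , e₂ = ∧-true⁻ {increasing r} e₁
      c , e₃ = ∧-true⁻ {supports r s} e₂
      mkStandard u v w = standard-true (s ∷ Y) e₃
  in mkStandard (nonempty-true r a ∷ u) (increasing-true r b ∷ v) (supports-true r s c ∷ w)

nthL-∈ : ∀ {A : Set} (xs : List A) c {a} → nthL xs c ≡ a ∷ [] → a ∈ xs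
nthL-∈ (x ∷ xs) zero    refl = here refl
nthL-∈ (x ∷ xs) (suc c) e      = there (nthL-∈ xs c e)

nthL-< : ∀ {r} → AllPairs _<_ r → ∀ c c′ {a b} → nthL r c ≡ a ∷ [] → nthL r c′ ≡ b ∷ [] → c < c′ → a < b
nthL-< (p ∷ _) zero    (suc c′) refl f _       = All.lookup p (nthL-∈ _ c′ f)
nthL-< (_ ∷ l) (suc c) (suc c′) e      f (s≤s q) = nthL-< l c c′ e f q

nthL-supports : ∀ {r s} → Supports r s → ∀ c {a b} → nthL r c ≡ a ∷ [] → nthL s c ≡ b ∷ [] → a < b
nthL-supports (p ∷ _) zero    refl refl = p
nthL-supports (_ ∷ u) (suc c) e      f      = nthL-supports u c e f

entry-head : ∀ r (Y : Tableau) c {a} → entry (r ∷ Y) 0 c ≡ a ∷ [] → nthL r c ≡ a ∷ []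
entry-head r Y c e = trans (sym (++-identityʳ (nthL r c))) e

entry-row : ∀ (Y : Tableau) i c {a} → entry Y i c ≡ a ∷ [] → ∃ λ r → r ∈ Y × nthL r c ≡ a ∷ []
entry-row (r ∷ Y) zero    c e = r , here refl , entry-head r Y c e
entry-row (r ∷ Y) (suc i) c e with entry-row Y i c e
... | s , s∈ , f = s , there s∈ , f

entry-rows : ∀ {Y} → All (Linked _<_) Y → ∀ i c c′ a b → entry Y i c ≡ a ∷ [] → entry Y i c′ ≡ b ∷ [] → c < c′ → a < b
entry-rows {r ∷ Y} (l ∷ _) zero    c c′ a b e f q = nthL-< (Linked⇒AllPairs <-trans l) c c′ (entry-head r Y c e) (entry-head r Y c′ f) q
entry-rows         (_ ∷ l) (suc i) c c′ a b e f q = entry-rows l i c c′ a b e f q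

entry-cols : ∀ {Y} → AllPairs Supports Y → ∀ i i′ c a b → entry Y i c ≡ a ∷ [] → entry Y i′ c ≡ b ∷ [] → i < i′ → a < b
entry-cols {r ∷ Y} (u ∷ _) zero (suc i′) c a b e f _ with entry-row Y i′ c f
... | s , s∈ , f′ = nthL-supports (All.lookup u s∈) c (entry-head r Y c e) f′
entry-cols (_ ∷ l) (suc i) (suc i′) c a b e f (s≤s q) = entry-cols l i i′ c a b e f q

standard-syt : ∀ {Y n} → Standard Y → concat Y ↭ range1 n → foldr _+_ 0 (map length Y) ≡ n → IsSYT (map length Y) Y
standard-syt (mkStandard _ r c) p refl = record
  { shape = refl ; perm = p ; rowIncr = entry-rows r ; colIncr = entry-cols (Linked⇒AllPairs supports-trans c) }

standard-partition : ∀ {Y} → Standard Y → IsPartition (map length Y)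
standard-partition (mkStandard n _ c) = LinkedP.map⁺ (Data.List.Relation.Unary.Linked.map supports-length c) , AllP.map⁺ n

-- The tableau Y with entries raised by q, and 1, …, q inserted at the start of its bottom row.
shift : ℕ → Tableau → Tableau
shift q []      = []
shift q (r ∷ Y) = (range1 q ++ map (_+_ q) r) ∷ map (map (_+_ q)) Y

linked-raise : ∀ q {r} → Linked _<_ r → Linked _<_ (map (_+_ q) r)
linked-raise q l = LinkedP.map⁺ (Data.List.Relation.Unary.Linked.map (+-monoʳ-< q) l)

supports-raise : ∀ q {r s} → Supports r s → Supports (map (_+_ q) r) (map (_+_ q) s)
supports-raise q []      = []
supports-raise q (p ∷ u) = +-monoʳ-< q p ∷ supports-raise q u

range1-≡ : ∀ n → range1 n ≡ applyUpTo suc n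
range1-≡ n = map-applyUpTo id suc n

applyUpTo-+ : ∀ {A : Set} (f : ℕ → A) q m → applyUpTo f (q + m) ≡ applyUpTo f q ++ applyUpTo (f ∘ (_+_ q)) m
applyUpTo-+ f zero    m = refl
applyUpTo-+ f (suc q) m = cong (f 0 ∷_) (applyUpTo-+ (f ∘ suc) q m)

range1-+ : ∀ q m → range1 (q + m) ≡ range1 q ++ map (_+_ q) (range1 m)
range1-+ q m = trans (range1-≡ (q + m)) (trans (applyUpTo-+ suc q m) (cong₂ _++_ (sym (range1-≡ q))
  (sym (trans (sym (map-∘ {g = _+_ q} {f = suc} (upTo m))) (trans (map-cong (+-suc q) (upTo m)) (map-applyUpTo id (λ x → suc (q + x)) m))))))

linked-range : ∀ q {r} → Linked _<_ r → All (0 <_) r → Linked _<_ (range1 q ++ map (_+_ q) r)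
linked-range q {r} l a = subst (λ t → Linked _<_ (t ++ map (_+_ q) r)) (sym (range1-≡ q)) (go suc q (λ i j p → s≤s p) (linked-raise q l)
  (λ i p → AllP.map⁺ (All.map (λ {x} x>0 → ≤-trans (s≤s p) (≤-trans (≤-reflexive (+-comm 1 q)) (+-monoʳ-≤ q x>0))) a)))
  where
  go : ∀ f n {t} → (∀ i j → i < j → f i < f j) → Linked _<_ t → (∀ i → i < n → All (f i <_) t) → Linked _<_ (applyUpTo f n ++ t)
  go f zero    m l b = l
  go f (suc n) m l b = cons n (go (f ∘ suc) n (λ i j p → m _ _ (s≤s p)) l (λ i p → b (suc i) (s≤s p))) (b 0 (s≤s z≤n)) l
    where
    cons : ∀ n {t} → Linked _<_ (applyUpTo (f ∘ suc) n ++ t) → All (f 0 <_) t → Linked _<_ t → Linked _<_ (f 0 ∷ applyUpTo (f ∘ suc) n ++ t)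
    cons zero    {[]}    l b [] = [-]
    cons zero    {x ∷ t} l (c ∷ b) _ = c ∷ l
    cons (suc n) l b _ = m 0 1 (s≤s z≤n) ∷ l

shift-standard : ∀ q {Y} → Standard Y → All (All (0 <_)) Y → Standard (shift q Y)
shift-standard q {[]} s a = mkStandard [] [] []
shift-standard q {r ∷ Y} (mkStandard (n ∷ ns) (l ∷ ls) c) (a ∷ _) = mkStandard
  (≤-trans n (≤-trans (≤-reflexive (sym (length-map (_+_ q) r))) (≤-trans (m≤n+m _ (length (range1 q))) (≤-reflexive (sym (length-++ (range1 q)))))) ∷
     AllP.map⁺ (All.map (λ {r} p → subst (0 <_) (sym (length-map (_+_ q) r)) p) ns))
  (linked-range q l a ∷ AllP.map⁺ (All.map (linked-raise q) ls))
  (cols c)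
  where
  cols : ∀ {Y} → Linked Supports (r ∷ Y) → Linked Supports (shift q (r ∷ Y))
  cols [-] = [-]
  cols (u ∷ c) = supports-++ (range1 q) (linked-range q l a) (supports-raise q u) ∷ LinkedP.map⁺ (Data.List.Relation.Unary.Linked.map (supports-raise q) c)

concat-shift : ∀ q {Y} → 0 < length Y → concat (shift q Y) ≡ range1 q ++ map (_+_ q) (concat Y)
concat-shift q {r ∷ Y} _ = trans (++-assoc (range1 q) _ _) (cong (range1 q ++_) (concat-map (r ∷ Y)))

sum-length : ∀ Y → foldr _+_ 0 (map length Y) ≡ length (concat {A = ℕ} Y)
sum-length []      = refl
sum-length (r ∷ Y) = trans (cong (_+_ (length r)) (sum-length Y)) (sym (length-++ r))

range1-length : ∀ n → length (range1 n) ≡ n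
range1-length n = trans (length-map suc (upTo n)) (length-upTo n)

take-out-↭ : ∀ x ys → anyᵇ (x ≡ᵇ_) ys ≡ true → ys ↭ x ∷ take-out x ys
take-out-↭ x (y ∷ ys) e with x ≡ᵇ y in q
... | true  = subst (λ z → y ∷ ys ↭ z ∷ ys) (sym (≡ᵇ-true⁻ {x} {y} q)) ↭-refl
... | false = ↭-trans (prep y (take-out-↭ x ys e)) (swap y x ↭-refl)

anagram-true : ∀ xs ys → anagram xs ys ≡ true → xs ↭ ys
anagram-true []       []       _ = ↭-refl
anagram-true (x ∷ xs) ys       e with ∧-true⁻ {anyᵇ (x ≡ᵇ_) ys} e
... | a , b = ↭-trans (prep x (anagram-true xs _ b)) (↭-sym (take-out-↭ x ys a))

range1-∈⁻ : ∀ {n v} → v ∈ range1 n → 1 ≤ v × v ≤ n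
range1-∈⁻ i with ∈-map⁻ suc i
... | x , x∈ , refl = s≤s z≤n , ∈-upTo⁻ x∈

range1-∈⁺ : ∀ {n v} → 1 ≤ v → v ≤ n → v ∈ range1 n
range1-∈⁺ {v = suc v} _ l = ∈-map⁺ suc (∈-upTo⁺ l)

shift-syt : ∀ q m {Y} → 0 < m → fillsOut m Y ≡ true → Standard (shift q Y) × concat (shift q Y) ↭ range1 (q + m) × foldr _+_ 0 (map length (shift q Y)) ≡ q + m
shift-syt q m {Y} m>0 e with ∧-true⁻ {standard Y} e
... | a , b = shift-standard q (standard-true Y a) positive , perm , trans (sum-length (shift q Y)) (trans (↭-length perm) (range1-length (q + m)))
  where
  p : concat Y ↭ range1 m
  p = anagram-true (concat Y) (range1 m) b
  long : 0 < length Y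
  long = filled Y (trans (↭-length p) (range1-length m))
    where
    filled : ∀ Y → length (concat Y) ≡ m → 0 < length Y
    filled []      z = ⊥-elim (<-irrefl z m>0)
    filled (_ ∷ _) _ = s≤s z≤n
  positive : All (All (0 <_)) Y
  positive = AllP.concat⁻ (All.tabulate λ i → proj₁ (range1-∈⁻ (∈-resp-↭ p i)))
  perm : concat (shift q Y) ↭ range1 (q + m)
  perm = subst (_↭ range1 (q + m)) (sym (concat-shift q {Y} long)) (subst (range1 q ++ map (_+_ q) (concat Y) ↭_) (sym (range1-+ q m))
    (++⁺ˡ (range1 q) (↭-map⁺ (_+_ q) p)))

shift-injective : ∀ q {Y Z} → shift q Y ≡ shift q Z → Y ≡ Z
shift-injective q {[]}    {[]}    _ = refl
shift-injective q {r ∷ Y} {s ∷ Z} e = cong₂ _∷_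
  (map-injective (+-cancelˡ-≡ q _ _) (++-cancelˡ (range1 q) _ _ (∷-injectiveˡ e)))
  (map-injective (map-injective (+-cancelˡ-≡ q _ _)) (∷-injectiveʳ e))

reading-↭ : ∀ Y → rowWord Y ↭ concat Y
reading-↭ []      = ↭-refl
reading-↭ (r ∷ Y) = subst (_↭ r ++ concat Y) (sym (trans (cong concat (unfold-reverse r Y))
  (trans (sym (concat-++ (reverse Y) (r ∷ []))) (cong (rowWord Y ++_) (++-identityʳ r)))))
  (↭-trans (++-comm (rowWord Y) r) (++⁺ˡ r (reading-↭ Y)))

syt-perm : ∀ {λp Y} → IsSYT λp Y → Plain.Perm (foldr _+_ 0 λp) (rowWord Y)
syt-perm {λp} {Y} y = Plain.perm (↭ₛP.Unique-resp-↭ (setoid ℕ) (↭⇒↭ₛ (↭-sym p)) (UniqueP.map⁺ suc-injective (UniqueP.upTo⁺ _)))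
  (λ i → range1-∈⁻ (∈-resp-↭ p i)) (λ a b → ∈-resp-↭ (↭-sym p) (range1-∈⁺ a b))
  where
  p : rowWord Y ↭ range1 (foldr _+_ 0 λp)
  p = ↭-trans (reading-↭ Y) (IsSYT.perm y)

reading-map : ∀ φ Y → rowWord (map (map φ) Y) ≡ map φ (rowWord Y)
reading-map φ Y = trans (cong concat (sym (reverse-map (map φ) Y))) (concat-map (reverse Y))

reading-dT : ∀ i Y → rowWord (dT i Y) ≡ d i (rowWord Y)
reading-dT i Y = reading-map (dMap i (rowWord Y)) Y

map-agree : ∀ (φ ψ : ℕ → ℕ) w → map φ w ≡ map ψ w → ∀ {x} → x ∈ w → φ x ≡ ψ x
map-agree φ ψ (y ∷ w) e (here refl) = ∷-injectiveˡ e
map-agree φ ψ (y ∷ w) e (there i)     = map-agree φ ψ w (∷-injectiveʳ e) i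

reading-reflects : ∀ (φ ψ : ℕ → ℕ) Y → map φ (rowWord Y) ≡ map ψ (rowWord Y) → map (map φ) Y ≡ map (map ψ) Y
reading-reflects φ ψ Y e = map-cong-local (All.tabulate λ {r} r∈ → map-cong-local (All.tabulate λ x∈ →
  map-agree φ ψ (rowWord Y) e (∈-resp-↭ (↭-sym (reading-↭ Y)) (∈-concat⁺′ x∈ r∈))))

-- The involution is known on the row reading word, a permutation. Two relabellings that agree on
-- this word agree on the tableau, because the word contains all entries.
dT-invol : ∀ {λp Y} j → 3 + j ≤ foldr _+_ 0 λp → IsSYT λp Y → dT (2 + j) (dT (2 + j) Y) ≡ Y
dT-invol {λp} {Y} j l y = trans twice (trans (reading-reflects (ψ ∘ φ) id Y (trans back (sym (map-id (rowWord Y)))))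
  (trans (map-cong map-id Y) (map-id Y)))
  where
  φ = dMap (2 + j) (rowWord Y)
  ψ = dMap (2 + j) (rowWord (dT (2 + j) Y))
  twice : dT (2 + j) (dT (2 + j) Y) ≡ map (map (ψ ∘ φ)) Y
  twice = trans (sym (map-∘ Y)) (map-cong (λ r → sym (map-∘ r)) Y)
  back : map (ψ ∘ φ) (rowWord Y) ≡ rowWord Y
  back = trans (map-∘ (rowWord Y)) (trans (cong (map ψ) (sym (reading-map φ Y)))
    (trans (cong (λ w → map (dMap (2 + j) w) w) (reading-dT (2 + j) Y)) (Axioms.D-invol (Plain.wordGraph _) j l (syt-perm y))))

pos-++ : ∀ {v} w u → v ∉ w → pos (w ++ u) v ≡ (if pos u v ≡ᵇ 0 then 0 else length w + pos u v)
pos-++ {v} []      u n with pos u v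
... | zero  = refl
... | suc _ = refl
pos-++ {v} (x ∷ w) u n rewrite ≡ᵇ-≢ {x} {v} (λ e → n (here (sym e))) | pos-++ w u (n ∘ there) with pos u v
... | zero  = refl
... | suc p rewrite +-suc (length w) p = refl

-- The new position after a block of length `ℓ` is inserted behind position `a`. It preserves order,
-- which is all that the moves depend on.
spread : ℕ → ℕ → ℕ → ℕ
spread a ℓ p = if p ≤ᵇ a then p else ℓ + p

pos-insert : ∀ {v} w z u → v ∉ z → pos (w ++ z ++ u) v ≡ spread (length w) (length z) (pos (w ++ u) v)
pos-insert {v} [] z u n = trans (pos-++ z u n) (at-start (pos u v))
  where
  at-start : ∀ p → (if p ≡ᵇ 0 then 0 else length z + p) ≡ spread 0 (length z) p
  at-start zero    = refl
  at-start (suc p) = refl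
pos-insert {v} (x ∷ w) z u n with x ≡ᵇ v
... | true  = refl
... | false rewrite pos-insert w z u n = later (pos (w ++ u) v)
  where
  later : ∀ p → (if spread (length w) (length z) p ≡ᵇ 0 then 0 else suc (spread (length w) (length z) p)) ≡
                spread (suc (length w)) (length z) (if p ≡ᵇ 0 then 0 else suc p)
  later zero = refl
  later (suc p) with p <ᵇ length w
  ... | true  = refl
  ... | false rewrite +-suc (length z) p | +-suc (length z) (suc p) | +-suc (length z) p = refl

spread-< : ∀ a ℓ {p q} → p < q → spread a ℓ p < spread a ℓ q
spread-< a ℓ {p} {q} l with p ≤ᵇ a in e | q ≤ᵇ a in f
... | true  | true  = l
... | true  | false = ≤-trans l (m≤n+m q ℓ)
... | false | false = +-monoʳ-< ℓ l
... | false | true  with () ← trans (sym e) (≤ᵇ-true (≤-trans (<⇒≤ l) (≤ᵇ-true⁻ f)))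

spread-<ᵇ : ∀ a ℓ p q → (spread a ℓ p <ᵇ spread a ℓ q) ≡ (p <ᵇ q)
spread-<ᵇ a ℓ p q with <-cmp p q
... | tri< l _ _ = trans (<ᵇ-true (spread-< a ℓ l)) (sym (<ᵇ-true l))
... | tri≈ _ refl _ = trans (<ᵇ-false (≤-refl {spread a ℓ p})) (sym (<ᵇ-false (≤-refl {p})))
... | tri> _ _ l = trans (<ᵇ-false (<⇒≤ (spread-< a ℓ l))) (sym (<ᵇ-false (<⇒≤ l)))

-- `dMap` with its comparisons of positions abstracted to Booleans, so that raising the values and
-- changing the positions are treated separately.
choose : ℕ → ℕ → ℕ → Bool → Bool → Bool → ℕ → ℕ
choose a i c fixed low ac =
  if fixed then id else if low then swapV i (if ac then c else a) else swapV i (if ac then a else c)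

+-≡ᵇ : ∀ q x y → (q + x ≡ᵇ q + y) ≡ (x ≡ᵇ y)
+-≡ᵇ zero    x y = refl
+-≡ᵇ (suc q) x y = +-≡ᵇ q x y

swapV-+ : ∀ q a b x → swapV (q + a) (q + b) (q + x) ≡ q + swapV a b x
swapV-+ q a b x rewrite +-≡ᵇ q x a | +-≡ᵇ q x b with x ≡ᵇ a | x ≡ᵇ b
... | true  | _     = refl
... | false | true  = refl
... | false | false = refl

choose-+ : ∀ q a i c b₁ b₂ b₃ x → choose (q + a) (q + i) (q + c) b₁ b₂ b₃ (q + x) ≡ q + choose a i c b₁ b₂ b₃ x
choose-+ q a i c true  _     _     x = refl
choose-+ q a i c false true  true  x = swapV-+ q i c x
choose-+ q a i c false true  false x = swapV-+ q i a x
choose-+ q a i c false false true  x = swapV-+ q i a x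
choose-+ q a i c false false false x = swapV-+ q i c x

swapV-other : ∀ {a b x} → x < a → x < b → swapV a b x ≡ x
swapV-other {a} {b} {x} p q rewrite ≡ᵇ-≢ (<⇒≢ p) | ≡ᵇ-≢ (<⇒≢ q) = refl

choose-low : ∀ {a i c x} b₁ b₂ b₃ → x < a → x < i → x < c → choose a i c b₁ b₂ b₃ x ≡ x
choose-low true  _     _     p q r = refl
choose-low false true  true  p q r = swapV-other q r
choose-low false true  false p q r = swapV-other q p
choose-low false false true  p q r = swapV-other q p
choose-low false false false p q r = swapV-other q r

module _ (q : ℕ) (r : List ℕ) (Y : Tableau) where
  private
    w = rowWord (r ∷ Y)
    W = rowWord (shift q (r ∷ Y))
    front = rowWord Y

    w≡ : w ≡ front ++ r
    w≡ = trans (cong concat (unfold-reverse r Y)) (trans (sym (concat-++ (reverse Y) (r ∷ []))) (cong (front ++_) (++-identityʳ r)))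

    W≡ : W ≡ map (_+_ q) front ++ range1 q ++ map (_+_ q) r
    W≡ = trans (cong concat (unfold-reverse _ (map (map (_+_ q)) Y)))
      (trans (sym (concat-++ (reverse (map (map (_+_ q)) Y)) _))
      (cong₂ _++_ (reading-map (_+_ q) Y) (++-identityʳ _)))

  pos-shift : ∀ v → 0 < v → pos W (q + v) ≡ spread (length (map (_+_ q) front)) (length (range1 q)) (pos w v)
  pos-shift v v>0 = trans (cong (λ z → pos z (q + v)) W≡) (trans (pos-insert (map (_+_ q) front) (range1 q) _ high)
    (cong (spread _ _) (trans (cong (λ z → pos z (q + v)) (sym (map-++ (_+_ q) front r)))
      (trans (pos-map (+-cancelˡ-≡ q _ _) (front ++ r) v) (cong (λ z → pos z v) (sym w≡))))))
    where
    high : q + v ∉ range1 q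
    high i = <-irrefl refl (≤-trans (≤-trans (≤-reflexive (+-comm 1 q)) (+-monoʳ-≤ q v>0)) (proj₂ (range1-∈⁻ i)))

  before-shift : ∀ u v → 0 < u → 0 < v → (pos W (q + u) <ᵇ pos W (q + v)) ≡ (pos w u <ᵇ pos w v)
  before-shift u v a b = trans (cong₂ _<ᵇ_ (pos-shift u a) (pos-shift v b)) (spread-<ᵇ (length (map (_+_ q) front)) (length (range1 q)) (pos w u) (pos w v))

  private
    between-outer first-of-three : List ℕ → ℕ → ℕ → ℕ → Bool
    between-outer w a i c = ((pos w a <ᵇ pos w i) ∧ (pos w i <ᵇ pos w c)) ∨ ((pos w c <ᵇ pos w i) ∧ (pos w i <ᵇ pos w a))
    first-of-three w a i c = (pos w i <ᵇ pos w a) ∧ (pos w i <ᵇ pos w c)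

    flag : List ℕ → ℕ → ℕ → ℕ → ℕ → ℕ
    flag w a i c = choose a i c (between-outer w a i c) (first-of-three w a i c) (pos w a <ᵇ pos w c)

    flags : ∀ j → let a = 1 + j ; i = 2 + j ; c = 3 + j in ∀ x →
      flag W (q + a) (q + i) (q + c) x ≡ choose (q + a) (q + i) (q + c)
        (between-outer w a i c) (first-of-three w a i c) (pos w a <ᵇ pos w c) x
    flags j x rewrite before-shift (1 + j) (2 + j) (s≤s z≤n) (s≤s z≤n) | before-shift (2 + j) (3 + j) (s≤s z≤n) (s≤s z≤n)
      | before-shift (3 + j) (2 + j) (s≤s z≤n) (s≤s z≤n) | before-shift (2 + j) (1 + j) (s≤s z≤n) (s≤s z≤n)
      | before-shift (1 + j) (3 + j) (s≤s z≤n) (s≤s z≤n) = refl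

    dMap-shift : ∀ j x → dMap (q + (2 + j)) W x ≡ flag W (q + (1 + j)) (q + (2 + j)) (q + (3 + j)) x
    dMap-shift j x rewrite +-suc q (2 + j) | +-suc q (1 + j) | +-suc q j = refl

  dMap-raise : ∀ j x → dMap (q + (2 + j)) W (q + x) ≡ q + dMap (2 + j) w x
  dMap-raise j x = trans (dMap-shift j _) (trans (flags j _) (choose-+ q (1 + j) (2 + j) (3 + j)
    (between-outer w (1 + j) (2 + j) (3 + j)) (first-of-three w (1 + j) (2 + j) (3 + j)) (pos w (1 + j) <ᵇ pos w (3 + j)) x))

  dMap-below : ∀ j {x} → x ≤ q → dMap (q + (2 + j)) W x ≡ x
  dMap-below j {x} l = trans (dMap-shift j x) (choose-low
    (between-outer W (q + (1 + j)) (q + (2 + j)) (q + (3 + j))) (first-of-three W (q + (1 + j)) (q + (2 + j)) (q + (3 + j))) _ (up j) (up (1 + j)) (up (2 + j)))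
    where
    up : ∀ h → x < q + suc h
    up h = ≤-trans (s≤s l) (≤-trans (s≤s (m≤m+n q h)) (≤-reflexive (sym (+-suc q h))))

-- The inserted entries 1, ..., q change no relative order among the larger ones and are not moved
-- by the raised colours, so a move of the small tableau is a move of the shifted one.
shift-dT : ∀ q j Y → dT (q + (2 + j)) (shift q Y) ≡ shift q (dT (2 + j) Y)
shift-dT q j []      = refl
shift-dT q j (r ∷ Y) = cong₂ _∷_
  (trans (map-++ Φ (range1 q) (map (_+_ q) r)) (cong₂ _++_
    (trans (map-cong-local {g = id} (All.tabulate λ i → dMap-below q r Y j (proj₂ (range1-∈⁻ i)))) (map-id (range1 q)))
    (row r)))
  (trans (sym (map-∘ Y)) (trans (map-cong row Y) (map-∘ Y)))
  where
  Φ = dMap (q + (2 + j)) (rowWord (shift q (r ∷ Y)))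
  φ = dMap (2 + j) (rowWord (r ∷ Y))
  row : ∀ s → map Φ (map (_+_ q) s) ≡ map (_+_ q) (map φ s)
  row s = trans (sym (map-∘ s)) (trans (map-cong (dMap-raise q r Y j) s) (map-∘ s))

-- Isomorphisms of components from walks run in parallel.

∧-true⁻³ : ∀ {a b c} → a ∧ b ∧ c ≡ true → a ≡ true × b ≡ true × c ≡ true
∧-true⁻³ {true} {true} {true} _ = refl , refl , refl

anyᵇ-∈⁻ : ∀ {A : Set} {P : A → Bool} {xs} → anyᵇ P xs ≡ true → ∃ λ x → x ∈ xs × P x ≡ true
anyᵇ-∈⁻ {P = P} {x ∷ xs} e with P x in q
... | true  = x , here refl , q
... | false = let y , i , r = anyᵇ-∈⁻ e in y , there i , r

eqList-refl : ∀ xs → eqList xs xs ≡ true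
eqList-refl []       = refl
eqList-refl (x ∷ xs) = ∧-true⁺ (≡ᵇ-refl x) (eqList-refl xs)

eqTableau⇒≡ : ∀ Y Z → eqTableau Y Z ≡ true → Y ≡ Z
eqTableau⇒≡ []      []      _ = refl
eqTableau⇒≡ (r ∷ Y) (s ∷ Z) e with ∧-true⁻ {eqList r s} e
... | a , b = cong₂ _∷_ (eqList⇒≡ r s a) (eqTableau⇒≡ Y Z b)

eqTableau-refl : ∀ Y → eqTableau Y Y ≡ true
eqTableau-refl []      = refl
eqTableau-refl (r ∷ Y) = ∧-true⁺ (eqList-refl r) (eqTableau-refl Y)

-- Vertices are named by the walks in `Ws` that lead to them, and several walks may name one vertex.
-- A step may also fix a vertex; only the steps that move it are edges.
record Covered (G : SCGraph) (P : ℕ → Set) (colour : ℕ → ℕ) (K : ℕ) (Ws : List (List ℕ)) (v₀ : SCGraph.X G) : Set where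
  open SCGraph G
  field
    _≟X_  : (v w : X) → Dec (v ≡ w)
    step  : ℕ → X → X
    edge⁻ : ∀ {ω c w} → ω ∈ Ws → P c → E c (walk step ω v₀) w →
            ∃ λ e → e < K × c ≡ colour e × w ≡ step e (walk step ω v₀) × w ≢ walk step ω v₀
    edge⁺ : ∀ {ω e} → ω ∈ Ws → e < K → step e (walk step ω v₀) ≢ walk step ω v₀ →
            E (colour e) (walk step ω v₀) (step e (walk step ω v₀))

  end : List ℕ → X
  end ω = walk step ω v₀

module Matching {G H : SCGraph} {P : ℕ → Set} {colour : ℕ → ℕ} {K : ℕ} {Ws : List (List ℕ)} {v₀ : SCGraph.X G} {u₀ : SCGraph.X H}
                (A : Covered G P colour K Ws v₀) (B : Covered H P colour K Ws u₀) where
  module A = Covered A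
  module B = Covered B

  record Matched : Set where
    field
      []∈    : [] ∈ Ws
      closed : ∀ {ω} → ω ∈ Ws → ∀ e → e < K → ∃ λ ω′ → ω′ ∈ Ws × A.end ω′ ≡ A.step e (A.end ω) × B.end ω′ ≡ B.step e (B.end ω)
      agree  : ∀ {ω ω′} → ω ∈ Ws → ω′ ∈ Ws → A.end ω ≡ A.end ω′ → B.end ω ≡ B.end ω′
      agree′ : ∀ {ω ω′} → ω ∈ Ws → ω′ ∈ Ws → B.end ω ≡ B.end ω′ → A.end ω ≡ A.end ω′

  search : SCGraph.X G → List (List ℕ) → List ℕ
  -- A default for vertices that no walk of the list reaches.
  search v []       = []
  search v (ω ∷ ωs) with A.end ω A.≟X v
  ... | yes _ = ω
  ... | no _  = search v ωs

  search-end : ∀ {v ω ωs} → ω ∈ ωs → A.end ω ≡ v → search v ωs ∈ ωs × A.end (search v ωs) ≡ v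
  search-end {v} {ωs = ω′ ∷ ωs} i e with A.end ω′ A.≟X v
  search-end i e | yes q = here refl , q
  search-end (here refl) e | no n = ⊥-elim (n e)
  search-end (there i) e | no n = let j , q = search-end i e in there j , q

  transfer : SCGraph.X G → SCGraph.X H
  transfer v = B.end (search v Ws)

  module _ (M : Matched) where
    open Matched M

    transfer-end : ∀ {ω} → ω ∈ Ws → transfer (A.end ω) ≡ B.end ω
    transfer-end i with search-end {ωs = Ws} i refl
    ... | j , e = agree j i e

    edge-end : ∀ {ω c w} → ω ∈ Ws → P c → SCGraph.E G c (A.end ω) w → ∃ λ ω′ → ω′ ∈ Ws × w ≡ A.end ω′ × SCGraph.E H c (B.end ω) (B.end ω′)
    edge-end i p ed with A.edge⁻ i p ed
    ... | e , e<K , refl , refl , n with closed i e e<K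
    ... | ω′ , i′ , q , q′ = ω′ , i′ , sym q , subst (SCGraph.E H _ _) (sym q′)
          (B.edge⁺ i e<K λ z → n (trans (sym q) (agree′ i′ i (trans q′ z))))

    covered : ∀ {ω w} → ω ∈ Ws → Reach G P (A.end ω) w → ∃ λ ω′ → ω′ ∈ Ws × w ≡ A.end ω′ × Reach H P (B.end ω) (B.end ω′)
    covered i ε = _ , i , refl , ε
    covered i ((c , p , ed) ◅ r) with edge-end i p ed
    ... | ω′ , i′ , refl , ed′ with covered i′ r
    ... | ω″ , i″ , e , r′ = ω″ , i″ , e , (c , p , ed′) ◅ r′

    edge-map : ∀ {ω ω′ c} → ω ∈ Ws → ω′ ∈ Ws → P c → SCGraph.E G c (A.end ω) (A.end ω′) → SCGraph.E H c (B.end ω) (B.end ω′)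
    edge-map i i′ p ed with edge-end i p ed
    ... | ω″ , i″ , e , ed′ = subst (SCGraph.E H _ _) (agree i″ i′ (sym e)) ed′

flip-matched : ∀ {G H P colour K Ws v₀ u₀} {A : Covered G P colour K Ws v₀} {B : Covered H P colour K Ws u₀} →
               Matching.Matched A B → Matching.Matched B A
flip-matched m = record { []∈ = []∈ ; closed = λ i e l → let ω , j , q , q′ = closed i e l in ω , j , q′ , q ; agree = agree′ ; agree′ = agree }
  where open Matching.Matched m

compIso : ∀ {G H P colour K Ws v₀ u₀} {A : Covered G P colour K Ws v₀} {B : Covered H P colour K Ws u₀} →
          Matching.Matched A B → CompIso G H P v₀ u₀
compIso {G} {H} {P} {A = A} {B} m = record
  { f = AB.transfer ; g = BA.transfer
  ; f∈ = λ v r → let ω , i , e , r′ = AB.covered m []∈ r in subst (Reach H P _) (sym (trans (cong AB.transfer e) (AB.transfer-end m i))) r′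
  ; g∈ = λ u r → let ω , i , e , r′ = BA.covered m′ []∈ r in subst (Reach G P _) (sym (trans (cong BA.transfer e) (BA.transfer-end m′ i))) r′
  ; gf = λ v r → let ω , i , e , _ = AB.covered m []∈ r in
      trans (cong (BA.transfer ∘ AB.transfer) e) (trans (cong BA.transfer (AB.transfer-end m i)) (trans (BA.transfer-end m′ i) (sym e)))
  ; fg = λ u r → let ω , i , e , _ = BA.covered m′ []∈ r in
      trans (cong (AB.transfer ∘ BA.transfer) e) (trans (cong AB.transfer (BA.transfer-end m′ i)) (trans (AB.transfer-end m i) (sym e)))
  ; edge = λ c v w p r r′ → let ω , i , e , _ = AB.covered m []∈ r ; ω′ , i′ , e′ , _ = AB.covered m []∈ r′ in
      edges p i i′ e e′ }
  where
  module AB = Matching A B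
  module BA = Matching B A
  open Matching.Matched m
  m′ = flip-matched m
  edges : ∀ {c v w ω ω′} → P c → ω ∈ _ → ω′ ∈ _ → v ≡ AB.A.end ω → w ≡ AB.A.end ω′ → SCGraph.E G c v w ⇔ SCGraph.E H c (AB.transfer v) (AB.transfer w)
  edges p i i′ refl refl = mk⇔
    (λ ed → subst₂ (SCGraph.E H _) (sym (AB.transfer-end m i)) (sym (AB.transfer-end m i′)) (AB.edge-map m i i′ p ed))
    (λ ed → BA.edge-map m′ i i′ p (subst₂ (SCGraph.E H _) (AB.transfer-end m i) (AB.transfer-end m i′) ed))

map-length-raise : ∀ q (Y : Tableau) → map length (map (map (_+_ q)) Y) ≡ map length Y
map-length-raise q Y = trans (sym (map-∘ Y)) (map-cong (length-map (_+_ q)) Y)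

shift-shape : ∀ q Y Z → map length Y ≡ map length Z → map length (shift q Y) ≡ map length (shift q Z)
shift-shape q []      []      _ = refl
shift-shape q (r ∷ Y) (s ∷ Z) e = cong₂ _∷_
  (trans (size r) (trans (cong (_+_ (length (range1 q))) (∷-injectiveˡ e)) (sym (size s))))
  (trans (map-length-raise q Y) (trans (∷-injectiveʳ e) (sym (map-length-raise q Z))))
  where
  size : ∀ r → length (range1 q ++ map (_+_ q) r) ≡ length (range1 q) + length r
  size r = trans (length-++ (range1 q)) (cong (_+_ (length (range1 q))) (length-map (_+_ q) r))

𝒢-edge⁻ : ∀ {λp j v w} → SCGraph.E (𝒢 λp) (2 + j) v w → w ≡ dT (2 + j) v × w ≢ v
𝒢-edge⁻ (_ , l , _ , _ , ne , inj₁ e) = e , ne ∘ sym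
𝒢-edge⁻ {j = j} (_ , l , _ , y , ne , inj₂ e) = trans (sym (dT-invol j l y)) (cong (dT (2 + j)) (sym e)) , ne ∘ sym

-- The outcome of the evaluated check for one pattern, as statements about its walks.
record Certificate (m : ℕ) (gl : List Bool) (p : List ℕ) (Ws : List (List ℕ)) : Set where
  field
    U         : Tableau
    []∈       : [] ∈ Ws
    deep-at   : ∀ {ω} → ω ∈ Ws → deep m ω ≡ true
    shape-at  : ∀ {ω} → ω ∈ Ws → map length U ≡ map length (walk (stepT m) ω U)
    fills-at  : ∀ {ω} → ω ∈ Ws → fillsOut m (walk (stepT m) ω U) ≡ true
    closed-at : ∀ {ω} → ω ∈ Ws → ∀ {e} → e < m ∸ 2 → ∃ λ ω′ → ω′ ∈ Ws ×
                R.run gl ω′ p ≡ R.mv gl e (R.run gl ω p) × walk (stepT m) ω′ U ≡ stepT m e (walk (stepT m) ω U)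
    agree-at  : ∀ {ω ω′} → ω ∈ Ws → ω′ ∈ Ws → eqList (R.run gl ω p) (R.run gl ω′ p) ≡ eqTableau (walk (stepT m) ω U) (walk (stepT m) ω′ U)

module _ (m : ℕ) (gl : List Bool) (p : List ℕ) (Ws : List (List ℕ)) where
  open Check m gl

  good-certificate : [] ∈ Ws → (∀ {ω} → ω ∈ Ws → deep m ω ≡ true) → ∀ U → good (map length U) (pairs p U Ws) ≡ true → Certificate m gl p Ws
  good-certificate []∈ deep-at U g with ∧-true⁻³ {allᵇ (λ pY → eqList (map length U) (map length (proj₂ pY)) ∧ fillsOut m (proj₂ pY)) (pairs p U Ws)}
                                          {allᵇ (closedAt (pairs p U Ws)) (pairs p U Ws)} g
  ... | shapes , closures , agreements = record
    { U = U ; []∈ = []∈ ; deep-at = deep-at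
    ; shape-at = λ i → eqList⇒≡ _ _ (proj₁ (shape i)) ; fills-at = λ i → proj₂ (shape i)
    ; closed-at = λ i l → closed i l
    ; agree-at = λ i i′ → ==⇒≡ (allᵇ-∈ (allᵇ-∈ {P = agreeAt (pairs p U Ws)} agreements (pair∈ i)) (pair∈ i′)) }
    where
    pair : List ℕ → Pair
    pair ω = R.run gl ω p , walk (stepT m) ω U
    pair∈ : ∀ {ω} → ω ∈ Ws → pair ω ∈ pairs p U Ws
    pair∈ = ∈-map⁺ pair
    shape : ∀ {ω} → ω ∈ Ws → _
    shape {ω} i = ∧-true⁻ {eqList (map length U) (map length (walk (stepT m) ω U))} (allᵇ-∈ shapes (pair∈ i))
    closed : ∀ {ω} → ω ∈ Ws → ∀ {e} → e < m ∸ 2 → ∃ λ ω′ → ω′ ∈ Ws ×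
             R.run gl ω′ p ≡ R.mv gl e (R.run gl ω p) × walk (stepT m) ω′ U ≡ stepT m e (walk (stepT m) ω U)
    closed {ω} i {e} l with anyᵇ-∈⁻ {xs = pairs p U Ws} (allᵇ-∈ (allᵇ-∈ {P = closedAt (pairs p U Ws)} closures (pair∈ i)) (∈-upTo⁺ l))
    ... | pY , j , q with ∈-map⁻ pair j
    ... | ω′ , i′ , refl with ∧-true⁻ {eqList (R.run gl ω′ p) (R.mv gl e (R.run gl ω p))} q
    ... | a , b = ω′ , i′ , eqList⇒≡ _ _ a , eqTableau⇒≡ _ _ b

  certificate : matched p Ws ≡ true → Certificate m gl p Ws
  certificate ok with ∧-true⁻³ {anyᵇ (eqList []) Ws} {allᵇ (deep m) Ws} ok
  ... | has-[] , deeps , some with anyᵇ-∈⁻ {xs = tableaux m} some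
  ... | U , _ , e = good-certificate
        (let ω , i , e = anyᵇ-∈⁻ {xs = Ws} has-[] in subst (_∈ Ws) (sym (eqList⇒≡ [] ω e)) i)
        (allᵇ-∈ {P = deep m} deeps) U (proj₂ (∧-true⁻ {sameSigns p (rowWord U)} e))

-- (Ax4): the component of a vertex compared with that of a shifted tableau.

module Window-Component {L : Letters} (W : WordGraph (Windows.system L)) (_≟X_ : (v w : WordGraph.X W) → Dec (v ≡ w))
  (m q : ℕ) (m≥3 : 3 ≤ m) (q+m≤n : q + m ≤ WordGraph.n W) (P : ℕ → Set) where
  open WordGraph W
  open Axioms W

  colour : ℕ → ℕ
  colour e = q + (m ∸ suc e)

  stepG : ℕ → X → X
  stepG e = Dν (colour e)

  stepH : ℕ → Tableau → Tableau
  stepH e = dT (colour e)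

  record Depth (e : ℕ) : Set where
    field
      r       : ℕ
      m≡      : m ≡ e + (3 + r)
      local   : m ∸ suc e ≡ 2 + r
    colour≡ : colour e ≡ 2 + (q + r)
    colour≡ = trans (cong (_+_ q) local) (trans (sym (+-assoc q 2 r)) (cong (_+ r) (+-comm q 2)))
    total   : e + (3 + (q + r)) ≡ q + m
    total   = trans (cong (_+_ e) (trans (cong (_+ r) (+-comm 3 q)) (+-assoc q 3 r)))
      (trans (sym (+-assoc e q (3 + r))) (trans (cong (_+ (3 + r)) (+-comm e q)) (trans (+-assoc q e (3 + r)) (cong (_+_ q) (sym m≡)))))
    in-n    : 3 + (q + r) ≤ n
    in-n    = ≤-trans (≤-trans (m≤n+m _ e) (≤-reflexive total)) q+m≤n
    top     : 3 + (q + r) ≤ q + m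
    top     = ≤-trans (m≤n+m _ e) (≤-reflexive total)

  depth : ∀ {e} → 3 + e ≤ m → Depth e
  depth {e} l = record { r = r ; m≡ = eq ; local = trans (cong (_∸ suc e) eq) (trans (cong (_∸ suc e) (+-suc e (2 + r))) (m+n∸m≡n e (2 + r))) }
    where
    r = m ∸ (3 + e)
    eq : m ≡ e + (3 + r)
    eq = trans (sym (m+[n∸m]≡n l)) (trans (cong (_+ r) (+-comm 3 e)) (+-assoc e 3 r))

  depth< : ∀ {e} → e < m ∸ 2 → 3 + e ≤ m
  depth< l = ≤-trans (+-monoʳ-≤ 2 l) (≤-reflexive (m+[n∸m]≡n (≤-trans (n≤1+n 2) m≥3)))

  record Follows (ω : List ℕ) (v w : X) : Set where
    field
      vtx   : Vtx w
      image : cw (κ w) (q + m) ≡ run ω (cw (κ v) (q + m))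
      fixed : ∀ h → q + m < h → h ≤ n → κ w h ≡ κ v h

  follow-step : ∀ {e v} → 3 + e ≤ m → Vtx v → Follows (e ∷ []) v (stepG e v)
  follow-step {e} {v} l x = subst (λ c → Follows (e ∷ []) v (Dν c v)) (sym colour≡) record
    { vtx = D-vtx (q + r) in-n x
    ; image = subst (λ i → cw (κ (Dν (2 + (q + r)) v)) i ≡ mv e (cw (κ v) i)) total (D-mv e (q + r) (≤-trans (≤-reflexive total) q+m≤n) x)
    ; fixed = λ h a b → D-off (q + r) in-n x (≤-trans (s≤s z≤n) a) b (away a) }
    where
    open Depth (depth l)
    away : ∀ {h} → q + m < h → Off (q + r) h
    away a = let z = ≤-<-trans top a in
      (λ p → <-irrefl (sym p) (≤-trans (s≤s (s≤s (m≤n+m (q + r) 2))) z)) , (λ p → <-irrefl (sym p) (≤-trans (n≤1+n _) z)) , λ p → <-irrefl (sym p) z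

  edge-stepG : ∀ {e v w} → 3 + e ≤ m → E (colour e) v w → w ≡ stepG e v
  edge-stepG {e} {v} {w} l ed = trans (proj₂ (proj₂ (edge⁻ {q + r} {v} {w} (subst (λ c → E c v w) colour≡ ed))))
                                        (cong (λ c → Dν c v) (sym colour≡))
    where open Depth (depth l)

  edge-moves : ∀ {c v w} → E c v w → w ≢ v
  edge-moves (_ , _ , _ , _ , ne , _) = ne ∘ sym

  edge-stepH : ∀ {λp e v w c} → foldr _+_ 0 λp ≡ q + m → 3 + e ≤ m → c ≡ colour e → SCGraph.E (𝒢 λp) c v w → w ≡ stepH e v × w ≢ v
  edge-stepH {λp} {e} {v} {w} {c} size l z ed =
    let a , b = 𝒢-edge⁻ {λp} {q + r} {v} {w} (subst (λ c → SCGraph.E (𝒢 λp) c v w) (trans z colour≡) ed) in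
    trans a (cong (λ c → dT c v) (sym colour≡)) , b
    where open Depth (depth l)

  stepH-edge : ∀ {λp e v} → foldr _+_ 0 λp ≡ q + m → 3 + e ≤ m → IsSYT λp v → IsSYT λp (stepH e v) → stepH e v ≢ v →
               SCGraph.E (𝒢 λp) (colour e) v (stepH e v)
  stepH-edge {λp} {e} {v} size l x y ne = subst (1 <_) (sym colour≡) (s≤s (s≤s z≤n)) , subst₂ _<_ (sym colour≡) (sym size) top ,
      x , y , ne ∘ sym , inj₁ refl
    where open Depth (depth l)

  follow : ∀ ω {v} → deep m ω ≡ true → Vtx v → Follows ω v (walk stepG ω v)
  follow []      _ x = record { vtx = x ; image = refl ; fixed = λ _ _ _ → refl }
  follow (e ∷ ω) {v} l x = record
    { vtx = F.vtx ; image = trans F.image (cong (run ω) S.image) ; fixed = λ h a b → trans (F.fixed h a b) (S.fixed h a b) }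
    where
    ls = ∧-true⁻ {2 + e <ᵇ m} l
    module S = Follows (follow-step {e} {v} (<ᵇ-true⁻ (proj₁ ls)) x)
    module F = Follows (follow ω (proj₂ ls) S.vtx)

  follow-shift : ∀ ω Y → deep m ω ≡ true → walk stepH ω (shift q Y) ≡ shift q (walk (stepT m) ω Y)
  follow-shift []      Y _ = refl
  follow-shift (e ∷ ω) Y l = trans (cong (walk stepH ω) one) (follow-shift ω _ (proj₂ ls))
    where
    ls = ∧-true⁻ {2 + e <ᵇ m} l
    open Depth (depth (<ᵇ-true⁻ {2 + e} (proj₁ ls)))
    one : stepH e (shift q Y) ≡ shift q (stepT m e Y)
    one = trans (cong (λ c → dT (q + c) (shift q Y)) local) (trans (shift-dT q r Y) (cong (λ c → shift q (dT c Y)) (sym local)))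

  module Matched-Walks {v₀ : X} (x₀ : Vtx v₀) (colours : ∀ {c} → P c → ∃ λ e → e < m ∸ 2 × c ≡ colour e)
    (gl : List Bool) (M : ℕ) (f : ℕ → A) (p : List ℕ) (β : List A)
    (small-run : ∀ ω → All (_< M) (R.run gl ω p))
    (run-word : ∀ ω → deep m ω ≡ true → run ω (cw (κ v₀) (q + m)) ≡ map f (R.run gl ω p) ++ β)
    (f-inj : ∀ {x y} → x < M → y < M → f x ≡ f y → x ≡ y)
    (Ws : List (List ℕ)) (certified : Certificate m gl p Ws) where
    open Certificate certified

    pat : List ℕ → List ℕ
    pat ω = R.run gl ω p

    tab : List ℕ → Tableau
    tab ω = walk (stepT m) ω U

    endG : List ℕ → X
    endG ω = walk stepG ω v₀

    endH : List ℕ → Tableau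
    endH ω = walk stepH ω (shift q U)

    endH≡ : ∀ {ω} → ω ∈ Ws → endH ω ≡ shift q (tab ω)
    endH≡ {ω} i = follow-shift ω U (deep-at i)

    word : ∀ {ω} → ω ∈ Ws → cw (κ (endG ω)) (q + m) ≡ map f (pat ω) ++ β
    word {ω} i = trans (Follows.image (follow ω (deep-at i) x₀)) (run-word ω (deep-at i))

    patG : ∀ {ω ω′} → ω ∈ Ws → ω′ ∈ Ws → pat ω ≡ pat ω′ → endG ω ≡ endG ω′
    patG {ω} {ω′} i i′ e = same-end q+m≤n F.vtx F′.vtx (trans (word i) (trans (cong (λ p → map f p ++ β) e) (sym (word i′))))
        λ h a b → trans (F.fixed h a b) (sym (F′.fixed h a b))
      where
      module F = Follows (follow ω (deep-at i) x₀)
      module F′ = Follows (follow ω′ (deep-at i′) x₀)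

    map-f-inj : ∀ {xs ys} → All (_< M) xs → All (_< M) ys → map f xs ≡ map f ys → xs ≡ ys
    map-f-inj []      []      _ = refl
    map-f-inj (a ∷ s) (b ∷ t) e = cong₂ _∷_ (f-inj a b (∷-injectiveˡ e)) (map-f-inj s t (∷-injectiveʳ e))

    Gpat : ∀ {ω ω′} → ω ∈ Ws → ω′ ∈ Ws → endG ω ≡ endG ω′ → pat ω ≡ pat ω′
    Gpat {ω} {ω′} i i′ e = map-f-inj (small-run ω) (small-run ω′)
      (++-cancelʳ β _ _ (trans (sym (word i)) (trans (cong (λ v → cw (κ v) (q + m)) e) (word i′))))

    pat-step : ∀ {ω e} → ω ∈ Ws → e < m ∸ 2 → ∀ {ω′} → ω′ ∈ Ws → pat ω′ ≡ R.mv gl e (pat ω) → endG ω′ ≡ stepG e (endG ω)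
    pat-step {ω} {e} i l {ω′} i′ eq = trans
      (same-end q+m≤n F′.vtx F″.vtx (trans (word i′) (trans (cong (λ p → map f p ++ β) (trans eq (sym (R.run-++ gl ω (e ∷ []) p))))
        (trans (sym (run-word ω″ deep″)) (sym F″.image))))
        λ h a b → trans (F′.fixed h a b) (sym (F″.fixed h a b)))
      (walk-∷ʳ stepG ω e v₀)
      where
      ω″ = ω ++ e ∷ []
      deep″ : deep m ω″ ≡ true
      deep″ = go ω (deep-at i)
        where
        go : ∀ ω → deep m ω ≡ true → deep m (ω ++ e ∷ []) ≡ true
        go []      _ = ∧-true⁺ (<ᵇ-true (depth< l)) refl
        go (d ∷ ω) z = let a , b = ∧-true⁻ {2 + d <ᵇ m} z in ∧-true⁺ a (go ω b)
      module F′ = Follows (follow ω′ (deep-at i′) x₀)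
      module F″ = Follows (follow ω″ deep″ x₀)

    -- A partition of `q + m`, which may be smaller than `n`: the colours concerned move no larger
    -- entry.
    λp : List ℕ
    λp = map length (shift q U)

    fills : ∀ {ω} → ω ∈ Ws → Standard (shift q (tab ω)) × concat (shift q (tab ω)) ↭ range1 (q + m) × foldr _+_ 0 (map length (shift q (tab ω))) ≡ q + m
    fills i = shift-syt q m (≤-trans (s≤s z≤n) m≥3) (fills-at i)

    size : foldr _+_ 0 λp ≡ q + m
    size = proj₂ (proj₂ (fills []∈))

    syt : ∀ {ω} → ω ∈ Ws → IsSYT λp (endH ω)
    syt {ω} i = subst₂ IsSYT (shift-shape q (tab ω) U (sym (shape-at i))) (sym (endH≡ i))
      (standard-syt (proj₁ (fills i)) (proj₁ (proj₂ (fills i))) (proj₂ (proj₂ (fills i))))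

    tab-step : ∀ {ω e} → ω ∈ Ws → e < m ∸ 2 → ∀ {ω′} → ω′ ∈ Ws → tab ω′ ≡ stepT m e (tab ω) → endH ω′ ≡ stepH e (endH ω)
    tab-step {ω} {e} i l i′ eq = trans (endH≡ i′) (trans (cong (shift q) eq)
      (trans (sym (trans (cong (λ c → dT (q + c) (shift q (tab ω))) local) (trans (shift-dT q r (tab ω)) (cong (λ c → shift q (dT c (tab ω))) (sym local)))))
        (cong (stepH e) (sym (endH≡ i)))))
      where open Depth (depth (depth< l))

    coveredG : Covered G P colour (m ∸ 2) Ws v₀
    coveredG = record { _≟X_ = _≟X_ ; step = stepG ; edge⁻ = edge⁻G ; edge⁺ = edge⁺G }
      where
      edge⁻G : ∀ {ω c w} → ω ∈ Ws → P c → E c (endG ω) w → ∃ λ e → e < m ∸ 2 × c ≡ colour e × w ≡ stepG e (endG ω) × w ≢ endG ω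
      edge⁻G {ω} {c} {w} i pc ed with colours pc
      ... | e , l , refl = e , l , refl , edge-stepG {e} {endG ω} {w} (depth< l) ed , edge-moves {colour e} {endG ω} {w} ed
      edge⁺G : ∀ {ω e} → ω ∈ Ws → e < m ∸ 2 → stepG e (endG ω) ≢ endG ω → E (colour e) (endG ω) (stepG e (endG ω))
      edge⁺G {ω} {e} i l ne = subst (1 <_) (sym colour≡) (s≤s (s≤s z≤n)) , subst (_< n) (sym colour≡) in-n ,
          vtx , subst (λ c → Vtx (Dν c (endG ω))) (sym colour≡) (D-vtx (q + r) in-n vtx) , ne ∘ sym , inj₁ refl
        where
        open Depth (depth (depth< l))
        vtx = Follows.vtx (follow ω (deep-at i) x₀)

    coveredH : Covered (𝒢 λp) P colour (m ∸ 2) Ws (shift q U)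
    coveredH = record { _≟X_ = ≡-dec (≡-dec _≟_) ; step = stepH ; edge⁻ = edge⁻H ; edge⁺ = edge⁺H }
      where
      edge⁻H : ∀ {ω c w} → ω ∈ Ws → P c → SCGraph.E (𝒢 λp) c (endH ω) w →
               ∃ λ e → e < m ∸ 2 × c ≡ colour e × w ≡ stepH e (endH ω) × w ≢ endH ω
      edge⁻H {ω} {c} {w} i pc ed = let e , l , z = colours pc in e , l , z , edge-stepH {λp} {e} {endH ω} {w} size (depth< l) z ed
      edge⁺H : ∀ {ω e} → ω ∈ Ws → e < m ∸ 2 → stepH e (endH ω) ≢ endH ω → SCGraph.E (𝒢 λp) (colour e) (endH ω) (stepH e (endH ω))
      edge⁺H {ω} {e} i l ne = let ω′ , i′ , _ , eq = closed-at i l in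
        stepH-edge {λp} {e} {endH ω} size (depth< l) (syt i) (subst (IsSYT λp) (tab-step i l i′ eq) (syt i′)) ne

    matched : Matching.Matched coveredG coveredH
    matched = record
      { []∈ = []∈
      ; closed = λ i e l → let ω′ , i′ , a , b = closed-at i l in ω′ , i′ , pat-step i l i′ a , tab-step i l i′ b
      ; agree = λ {ω} {ω′} i i′ e → trans (endH≡ i) (trans (cong (shift q) (eqTableau⇒≡ _ _
          (trans (sym (agree-at i i′)) (subst (λ p → eqList (pat ω) p ≡ true) (Gpat i i′ e) (eqList-refl (pat ω)))))) (sym (endH≡ i′)))
      ; agree′ = λ {ω} {ω′} i i′ e → patG i i′ (eqList⇒≡ _ _ (trans (agree-at i i′)
          (subst (λ Y → eqTableau (tab ω) Y ≡ true) (shift-injective q (trans (sym (endH≡ i)) (trans e (endH≡ i′)))) (eqTableau-refl (tab ω))))) }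

    component : Σ (List ℕ) (λ λp → IsPartition λp × Σ Tableau (λ T₀ → IsSYT λp T₀ × CompIso G (𝒢 λp) P v₀ T₀))
    component = λp , standard-partition (proj₁ (fills []∈)) , shift q U , syt []∈ , compIso matched

  module _ (iso : Modelled m) where
    component : ∀ {v₀} → Vtx v₀ → (∀ {c} → P c → ∃ λ e → e < m ∸ 2 × c ≡ colour e) →
                Σ (List ℕ) (λ λp → IsPartition λp × Σ Tableau (λ T₀ → IsSYT λp T₀ × CompIso G (𝒢 λp) P v₀ T₀))
    component {v₀} x₀ colours = Matched-Walks.component x₀ colours RW.gl RW.M RW.f RW.p RW.β (λ ω → RW.small-run ω RW.small) RW.run-u RW.f-inj
        (map proj₁ (Search.orbit (R.mv RW.gl) (m ∸ 2) 5 (([] , RW.p) ∷ [])))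
        (certificate m RW.gl RW.p _ (RW.everyWindow-true {λ _ _ → true} {λ gl p → Check.isomorphic m gl p} (Modelled.checked iso) refl))
      where
      module RW = Windows.Read L (good-cw x₀ q+m≤n)
        (Windows.window L (κ v₀ 0) m (cw (κ v₀) (q + m)) (≤-trans (m≤n+m m q) (≤-reflexive (sym (cw-length (κ v₀) (q + m))))))

ax4 : ∀ {L : Letters} (W : WordGraph (Windows.system L)) → ((v w : WordGraph.X W) → Dec (v ≡ w)) → ∀ i → 2 < i → i < WordGraph.n W →
      ∀ v₀ → WordGraph.Vtx W v₀ → Σ (List ℕ) (λ λp → IsPartition λp × Σ Tableau (λ T₀ → IsSYT λp T₀ ×
        CompIso (WordGraph.G W) (𝒢 λp) (Cols 1 i) v₀ T₀))
ax4 {L} W dec (suc zero) (s≤s ()) _ _ _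
ax4 {L} W dec (suc (suc zero)) (s≤s (s≤s ())) _ _ _
ax4 {L} W dec (suc (suc (suc zero))) _ l v₀ x₀ =
  Window-Component.component {L} W dec 4 0 (s≤s (s≤s (s≤s z≤n))) l (Cols 1 3) modelled₄ x₀ colours
  where
  colours : ∀ {c} → Cols 1 3 c → ∃ λ e → e < 2 × c ≡ 0 + (4 ∸ suc e)
  colours (inj₁ e)              = 0 , s≤s z≤n , e
  colours (inj₂ (inj₁ e))       = 1 , s≤s (s≤s z≤n) , e
  colours (inj₂ (inj₂ (refl , s≤s ())))
ax4 {L} W dec (suc (suc (suc (suc q)))) _ l v₀ x₀ =
  Window-Component.component {L} W dec 5 q (s≤s (s≤s (s≤s z≤n))) (≤-trans (≤-reflexive (+-comm q 5)) l) (Cols 1 (4 + q)) modelled₅ x₀ colours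
  where
  colours : ∀ {c} → Cols 1 (4 + q) c → ∃ λ e → e < 3 × c ≡ q + (5 ∸ suc e)
  colours (inj₁ e)              = 0 , s≤s z≤n , trans e (+-comm 4 q)
  colours (inj₂ (inj₁ e))       = 1 , s≤s (s≤s z≤n) , trans e (+-comm 3 q)
  colours (inj₂ (inj₂ (e , _))) = 2 , s≤s (s≤s (s≤s z≤n)) , trans e (+-comm 2 q)

isDEG : (Γ : LetterGraph) → IsDEG (WordGraph.G (LetterGraph.graph Γ))
isDEG Γ = record { ax1 = A.ax1 ; ax2 = A.ax2 ; ax3 = A.ax3 ; ax4 = ax4 {letters} graph _≟X_ ; ax5 = A.ax5 ; ax6 = A.ax6 }
  where
  open LetterGraph Γ
  module A = Axioms {Windows.system letters} graph

narrow-DEG : ∀ ν → diam ν ≤ 3 → IsDEG (LLT ν)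
narrow-DEG ν d≤3 = subst IsDEG (Diameter.graph-eq ν d≤3) (isDEG (Diameter.letterGraph ν d≤3))

-- Fillings with prescribed consecutive entries.

_⊑_ : Cell → Cell → Set
x ⊑ y = compOf x ≡ compOf y × rowOf x ≤ rowOf y × colOf x ≤ colOf y

-- Meant for `x` listed before `y`: a list with `AllPairs _⋢_` is a linear extension of the order on
-- cells.
_⋢_ : Cell → Cell → Set
x ⋢ y = ¬ (y ⊑ x)

_⊑?_ : (x y : Cell) → Dec (x ⊑ y)
x ⊑? y = (compOf x ≟ compOf y) ×-dec (rowOf x ≤? rowOf y) ×-dec (colOf x ≤? colOf y)

_≟ᶜ_ : (x y : Cell) → Dec (x ≡ y)
_≟ᶜ_ = ×-≡-dec _≟_ (×-≡-dec _≟_ _≟_)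

⊑-refl : ∀ {x} → x ⊑ x
⊑-refl = refl , ≤-refl , ≤-refl

⊑-trans : ∀ {x y z} → x ⊑ y → y ⊑ z → x ⊑ z
⊑-trans (a , b , c) (a′ , b′ , c′) = trans a a′ , ≤-trans b b′ , ≤-trans c c′

⊑-antisym : ∀ {x y} → x ⊑ y → y ⊑ x → x ≡ y
⊑-antisym (a , b , c) (_ , b′ , c′) = cong₂ _,_ a (cong₂ _,_ (≤-antisym b b′) (≤-antisym c c′))

skew-extension : ∀ i s → AllPairs _⋢_ (cellsSkew i s)
skew-extension i s = AllPairsP.concat⁺ (AllP.map⁺ (All.tabulate λ {r} _ → row r))
  (AllPairsP.map⁺ (AllPairs.map across (AllPairsP.applyUpTo⁺₁ id (length (outer s)) λ l _ → l)))
  where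
  row : ∀ r → AllPairs _⋢_ (rowCells i s r)
  row r = AllPairsP.map⁺ (AllPairsP.applyUpTo⁺₁ id _ λ l _ z → <-irrefl refl (≤-trans (+-monoʳ-< (part (inner s) r) l) (proj₂ (proj₂ z))))
  row-of : ∀ {r x} → x ∈ rowCells i s r → rowOf x ≡ r
  row-of {r} x∈ with ∈-map⁻ (λ c → (i , r , part (inner s) r + c)) x∈
  ... | _ , _ , refl = refl
  across : ∀ {r r′} → r < r′ → All (λ x → All (x ⋢_) (rowCells i s r′)) (rowCells i s r)
  across l = All.tabulate λ x∈ → All.tabulate λ y∈ z → <-irrefl refl (≤-trans l (subst₂ _≤_ (row-of y∈) (row-of x∈) (proj₁ (proj₂ z))))

cells-extension : ∀ i ν → AllPairs _⋢_ (cellsFrom i ν)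
cells-extension i []      = []
cells-extension i (s ∷ ν) = AllPairsP.++⁺ (skew-extension i s) (cells-extension (suc i) ν)
  (All.tabulate λ x∈ → All.tabulate λ y∈ z → apart x∈ y∈ (proj₁ z))
  where
  apart : ∀ {x y} → x ∈ cellsSkew i s → y ∈ cellsFrom (suc i) ν → compOf y ≢ compOf x
  apart x∈ y∈ e with skew⁻ {i} {s} x∈ | cells⁻ {suc i} ν y∈
  ... | _ , _ , refl , _ | j , _ , _ , _ , refl , _ = <-irrefl (sym e) (s≤s (m≤m+n i j))

rank : List Cell → Cell → ℕ
rank []       z = 0
rank (x ∷ xs) z = if ⌊ x ≟ᶜ z ⌋ then 1 else suc (rank xs z)

rank-here : ∀ x xs → rank (x ∷ xs) x ≡ 1
rank-here x xs with x ≟ᶜ x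
... | yes _ = refl
... | no n  = ⊥-elim (n refl)

rank-there : ∀ {x z} xs → x ≢ z → rank (x ∷ xs) z ≡ suc (rank xs z)
rank-there {x} {z} xs n with x ≟ᶜ z
... | yes e = ⊥-elim (n e)
... | no _  = refl

rank-++ : ∀ {z} xs ys → z ∉ xs → rank (xs ++ ys) z ≡ length xs + rank ys z
rank-++ []       ys n = refl
rank-++ (x ∷ xs) ys n = trans (rank-there (xs ++ ys) (λ e → n (here (sym e)))) (cong suc (rank-++ xs ys (n ∘ there)))

∈-tail : ∀ {x z : Cell} {xs} → z ∈ x ∷ xs → x ≢ z → z ∈ xs
∈-tail (here e)  n = ⊥-elim (n (sym e))
∈-tail (there i) n = i

rank-bounds : ∀ {z xs} → z ∈ xs → 1 ≤ rank xs z × rank xs z ≤ length xs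
rank-bounds {z} {x ∷ xs} i with x ≟ᶜ z
... | yes _ = ≤-refl , s≤s z≤n
... | no n  = s≤s z≤n , s≤s (proj₂ (rank-bounds (∈-tail i n)))

rank-inj : ∀ {y z xs} → y ∈ xs → z ∈ xs → rank xs y ≡ rank xs z → y ≡ z
rank-inj {y} {z} {x ∷ xs} i j e with x ≟ᶜ y | x ≟ᶜ z
... | yes p | yes q = trans (sym p) q
... | yes p | no q  = ⊥-elim (<-irrefl (suc-injective e) (proj₁ (rank-bounds (∈-tail j q))))
... | no p  | yes q = ⊥-elim (<-irrefl (suc-injective (sym e)) (proj₁ (rank-bounds (∈-tail i p))))
... | no p  | no q  = rank-inj (∈-tail i p) (∈-tail j q) (suc-injective e)

rank-< : ∀ {y z xs} → AllPairs _⋢_ xs → y ∈ xs → z ∈ xs → y ⊑ z → y ≢ z → rank xs y < rank xs z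
rank-< {y} {z} {x ∷ xs} (a ∷ as) i j l n with x ≟ᶜ y | x ≟ᶜ z
... | yes p | yes q = ⊥-elim (n (trans (sym p) q))
... | yes p | no q  = s≤s (proj₁ (rank-bounds (∈-tail j q)))
... | no p  | yes refl = ⊥-elim (All.lookup a (∈-tail i p) l)
... | no p  | no q  = s≤s (rank-< as (∈-tail i p) (∈-tail j q) l n)

-- Cells S that nothing separates can be filled consecutively: everything below some cell
-- of S comes before them, everything else after.
module Consecutive (ν : List Skew) (S : List Cell) (S⊆ : ∀ {s} → s ∈ S → s ∈ cells ν) (S-order : AllPairs _⋢_ S)
                   (convex : ∀ {s s′ x} → s ∈ S → s′ ∈ S → x ∈ cells ν → s ⊑ x → x ⊑ s′ → x ∈ S) where

  Below : Cell → Set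
  Below x = Any (x ⊑_) S

  below? : ∀ x → Dec (Below x)
  below? x = any? (x ⊑?_) S

  Low : Cell → Set
  Low x = Below x × x ∉ S

  low? : ∀ x → Dec (Low x)
  low? x = below? x ×-dec ¬? (any? (x ≟ᶜ_) S)

  low high order : List Cell
  low   = Data.List.filter low? (cells ν)
  high  = Data.List.filter (¬? ∘ below?) (cells ν)
  order = low ++ S ++ high

  -- A low cell above some cell of `S` would lie between two cells of `S` and so belong to `S` by
  -- convexity. A high cell is below no cell of `S`, hence below no low cell.
  order-⋢ : AllPairs _⋢_ order
  order-⋢ = AllPairsP.++⁺ (AllPairsP.filter⁺ low? (cells-extension 0 ν))
    (AllPairsP.++⁺ S-order (AllPairsP.filter⁺ (¬? ∘ below?) (cells-extension 0 ν))
      (All.tabulate λ s∈ → All.tabulate λ y∈ z → proj₂ (∈-filter⁻ (¬? ∘ below?) {xs = cells ν} y∈) (lose s∈ z)))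
    (All.tabulate λ x∈ → AllP.++⁺ (All.tabulate λ s∈ z → low-S x∈ s∈ z) (All.tabulate λ y∈ z → low-high x∈ y∈ z))
    where
    low-S : ∀ {x s} → x ∈ low → s ∈ S → ¬ (s ⊑ x)
    low-S x∈ s∈ z with ∈-filter⁻ low? {xs = cells ν} x∈
    ... | x∈ν , b , x∉ with find b
    ... | s′ , s′∈ , z′ = x∉ (convex s∈ s′∈ x∈ν z z′)
    low-high : ∀ {x y} → x ∈ low → y ∈ high → ¬ (y ⊑ x)
    low-high x∈ y∈ z with ∈-filter⁻ low? {xs = cells ν} x∈
    ... | _ , b , _ with find b
    ... | s′ , s′∈ , z′ = proj₂ (∈-filter⁻ (¬? ∘ below?) {xs = cells ν} y∈) (lose s′∈ (⊑-trans z z′))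

  order-unique : Unique order
  order-unique = AllPairs.map (λ n e → n (subst (_⊑ _) e ⊑-refl)) order-⋢

  order⁺ : ∀ {x} → x ∈ cells ν → x ∈ order
  order⁺ {x} x∈ with below? x | any? (x ≟ᶜ_) S
  ... | no n  | _      = ∈-++⁺ʳ low (∈-++⁺ʳ S (∈-filter⁺ (¬? ∘ below?) x∈ n))
  ... | yes b | yes s∈ = ∈-++⁺ʳ low (∈-++⁺ˡ s∈)
  ... | yes b | no n   = ∈-++⁺ˡ (∈-filter⁺ low? x∈ (b , n))

  order⁻ : ∀ {x} → x ∈ order → x ∈ cells ν
  order⁻ x∈ with ∈-++⁻ low x∈
  ... | inj₁ i = proj₁ (∈-filter⁻ low? {xs = cells ν} i)
  ... | inj₂ j with ∈-++⁻ S j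
  ... | inj₁ i = S⊆ i
  ... | inj₂ i = proj₁ (∈-filter⁻ (¬? ∘ below?) {xs = cells ν} i)

  T : Cell → ℕ
  T = rank order

  length-order : length order ≤ length (cells ν)
  length-order = unique-⊆ order-unique order⁻

  T-< : ∀ {x y} → x ∈ cells ν → y ∈ cells ν → x ⊑ y → x ≢ y → T x < T y
  T-< x∈ y∈ = rank-< order-⋢ (order⁺ x∈) (order⁺ y∈)

  filling : IsStandardFilling ν T
  filling = record
    { range = λ x x∈ → let a , b = rank-bounds (order⁺ x∈) in a , ≤-trans b length-order
    ; injective = λ x y x∈ y∈ → rank-inj (order⁺ x∈) (order⁺ y∈)
    ; rowIncr = λ x y x∈ y∈ a b l → T-< x∈ y∈ (a , ≤-reflexive b , <⇒≤ l) λ e → <-irrefl (cong colOf e) l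
    ; colIncr = λ x y x∈ y∈ a b l → T-< x∈ y∈ (a , <⇒≤ l , ≤-reflexive b) λ e → <-irrefl (cong rowOf e) l }

  T-special : ∀ {s} → s ∈ S → T s ≡ length low + rank (S ++ high) s
  T-special s∈ = rank-++ low (S ++ high) λ i → proj₂ (proj₂ (∈-filter⁻ low? {xs = cells ν} i)) s∈

-- The ascents of the four letters alternate, and the move of colour `2 + j` reverses the last of
-- them. Under these signs `k4d` identifies the two moves.
double : ∀ {S} (W : WordGraph S) → let open WordGraph W ; open Axioms W in
         ∀ j {w} → 4 + j ≤ n → Vtx w → Opp w j → Opp w (1 + j) → Opp (Dν (2 + j) w) (1 + j) → Dν (3 + j) w ≡ Dν (2 + j) w
double W j {w} l x o o′ o″ = same-end l (D-vtx (1 + j) l x) (D-vtx j l₁ x)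
  (trans (D-mv 0 (1 + j) l x) (trans alternate (sym (D-mv 1 j l x))))
  λ h a b → trans (D-off (1 + j) l x (≤-trans (s≤s z≤n) a) b (off-above a)) (sym (D-off j l₁ x (≤-trans (s≤s z≤n) a) b (off-above (≤-trans (n≤1+n _) a))))
  where
  open WordGraph W
  open Axioms W
  l₁ : 3 + j ≤ n
  l₁ = ≤-trans (n≤1+n _) l
  u = cw (κ w) (4 + j)
  o₀ = lt (κ w (3 + j)) (κ w (4 + j))
  third : lt (κ w (1 + j)) (κ w (2 + j)) ≡ o₀
  third = trans o (trans (cong not o′) (not-involutive o₀))
  flipped : lt (κ (Dν (2 + j) w) (3 + j)) (κ (Dν (2 + j) w) (4 + j)) ≡ not o₀
  flipped = ≡-not (trans (sym third) (trans (sym (proj₁ (D-flip j l₁ x o))) o″))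
  alternate : mv 0 u ≡ mv 1 u
  alternate = k4d o₀ (good-cw x l) (long {w} (4 + j) (m≤m+n 4 j)) refl o′ third
    (trans (cong (sgn 0) (sym (D-mv 1 j l x))) flipped)

module _ (λp : List ℕ) where
  private
    n = foldr _+_ 0 λp
    module PA = Axioms (Plain.wordGraph n)

  𝒢-opp : ∀ {Y Z} j → SCGraph.E (𝒢 λp) (2 + j) Y Z → PA.Opp (rowWord Y) j
  𝒢-opp {Y} {Z} j ed@(_ , l , y , _ , _ , _) = go (PA.bool-eq? _ _)
    where
    w = rowWord Y
    go : PA.Opp w j ⊎ _ → PA.Opp w j
    go (inj₁ o) = o
    go (inj₂ e) = ⊥-elim (proj₂ (𝒢-edge⁻ {λp} {j} {Y} {Z} ed) (trans (proj₁ (𝒢-edge⁻ {λp} {j} {Y} {Z} ed))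
      (trans (reading-reflects (dMap (2 + j) w) id Y (trans (PA.D-still j l (syt-perm y) e) (sym (map-id w))))
        (trans (map-cong map-id Y) (map-id Y)))))

  -- A property that the colours of the edges express without signatures. (Ax4) therefore transports
  -- it to any dual equivalence graph.
  double-edge : ∀ {X Y Z U} j → SCGraph.E (𝒢 λp) (2 + j) X Y → SCGraph.E (𝒢 λp) (3 + j) X Z → SCGraph.E (𝒢 λp) (3 + j) Y U → Y ≡ Z
  double-edge {X} {Y} {Z} {U} j xy xz@(_ , l′ , x , _) yu =
    trans Y≡ (trans (sym (reading-reflects (dMap (3 + j) w) (dMap (2 + j) w) X same)) (sym (proj₁ (𝒢-edge⁻ {λp} {1 + j} {X} {Z} xz))))
    where
    w = rowWord X
    l : 3 + j ≤ n
    l = ≤-trans (n≤1+n _) l′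
    Y≡ = proj₁ (𝒢-edge⁻ {λp} {j} {X} {Y} xy)
    P = syt-perm x
    same : d (3 + j) w ≡ d (2 + j) w
    same = double {Windows.system (Plain.letters n)} (Plain.wordGraph n) j l′ P (𝒢-opp {X} {Y} j xy) (𝒢-opp {X} {Z} (1 + j) xz)
      (subst (λ w → PA.Opp w (1 + j)) (trans (cong rowWord Y≡) (reading-dT (2 + j) X)) (𝒢-opp {Y} {U} (1 + j) yu))

-- The letters p₁, p₂, p₃, p₄ are in the relative order 2143 (o = false) or 3412 (o = true), and all close.
record Pattern {A : Set} (lt cl : A → A → Bool) (o : Bool) (p₁ p₂ p₃ p₄ : A) : Set where
  field
    lt₁₂ : lt p₁ p₂ ≡ o
    lt₂₃ : lt p₂ p₃ ≡ not o
    lt₁₃ : lt p₁ p₃ ≡ not o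
    lt₂₄ : lt p₂ p₄ ≡ not o
    lt₁₄ : lt p₁ p₄ ≡ not o
    lt₃₄ : lt p₃ p₄ ≡ o
    lt₃₁ : lt p₃ p₁ ≡ o
    cl₂₃ : cl p₂ p₃ ≡ true
    cl₃₁ : cl p₃ p₁ ≡ true
    p₁≢₂ : p₁ ≢ p₂
    p₂≢₄ : p₂ ≢ p₄
    p₃≢₄ : p₃ ≢ p₄

module _ {A : Set} {lt cl : A → A → Bool} {p₁ p₂ p₃ p₄ : A} where
  open Walks lt cl

  tri₁₂₃ : ∀ {o} → Pattern lt cl o p₁ p₂ p₃ p₄ → tri p₁ p₂ p₃ ≡ (p₂ , p₃ , p₁)
  tri₁₂₃ {true}  P rewrite Pattern.lt₁₂ P | Pattern.lt₂₃ P | Pattern.lt₁₃ P | Pattern.cl₂₃ P = refl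
  tri₁₂₃ {false} P rewrite Pattern.lt₁₂ P | Pattern.lt₂₃ P | Pattern.lt₁₃ P | Pattern.cl₂₃ P = refl

  tri₂₃₄ : ∀ {o} → Pattern lt cl o p₁ p₂ p₃ p₄ → tri p₂ p₃ p₄ ≡ (p₄ , p₂ , p₃)
  tri₂₃₄ {true}  P rewrite Pattern.lt₂₃ P | Pattern.lt₃₄ P | Pattern.lt₂₄ P | Pattern.cl₂₃ P = refl
  tri₂₃₄ {false} P rewrite Pattern.lt₂₃ P | Pattern.lt₃₄ P | Pattern.lt₂₄ P | Pattern.cl₂₃ P = refl

  tri₃₁₄ : ∀ {o} → Pattern lt cl o p₁ p₂ p₃ p₄ → tri p₃ p₁ p₄ ≡ (p₄ , p₃ , p₁)
  tri₃₁₄ {true}  P rewrite Pattern.lt₃₁ P | Pattern.lt₁₄ P | Pattern.lt₃₄ P | Pattern.cl₃₁ P = refl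
  tri₃₁₄ {false} P rewrite Pattern.lt₃₁ P | Pattern.lt₁₄ P | Pattern.lt₃₄ P | Pattern.cl₃₁ P = refl

-- Four close contents contradict (Ax4).

module Wide (ν : List Skew) where
  open Graph ν

  E : ℕ → List ℕ → List ℕ → Set
  E = SCGraph.E (LLT ν)

  -- From p₁p₂p₃p₄ the colour `2 + q` leads to p₂p₃p₁p₄ and the colour `3 + q` to p₁p₄p₂p₃. The
  -- former has a further edge of colour `3 + q`, so `double-edge` would make the two ends equal,
  -- but their first letters differ.
  pattern-clash : IsDEG (LLT ν) → ∀ q v → 4 + q ≤ n → Vtx v → ∀ o → Pattern lt cl o (κ v (1 + q)) (κ v (2 + q)) (κ v (3 + q)) (κ v (4 + q)) → ⊥
  pattern-clash deg q v l x o P = p₁≢₂ (trans (sym v′₁) (trans (cong (λ w → κ w (1 + q)) v′≡v₁) v₁₁))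
    where
    open Pattern P
    l₁ : 3 + q ≤ n
    l₁ = ≤-trans (n≤1+n _) l
    v₁ = Dν (2 + q) v
    v′ = Dν (3 + q) v
    v₁′ = Dν (3 + q) v₁
    x₁ : Vtx v₁
    x₁ = D-vtx q l₁ x
    x′ : Vtx v′
    x′ = D-vtx (1 + q) l x
    x₁′ : Vtx v₁′
    x₁′ = D-vtx (1 + q) l x₁
    t₁ = trans (D-tri q l₁ x) (tri₁₂₃ P)
    t′ = trans (D-tri (1 + q) l x) (tri₂₃₄ P)
    v₁₁ : κ v₁ (1 + q) ≡ κ v (2 + q)
    v₁₁ = cong proj₁ t₁
    v₁₄ : κ v₁ (4 + q) ≡ κ v (4 + q)
    v₁₄ = D-off q l₁ x (s≤s z≤n) l (off-above ≤-refl)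
    v′₁ : κ v′ (1 + q) ≡ κ v (1 + q)
    v′₁ = D-off (1 + q) l x (s≤s z≤n) (≤-trans (s≤s (m≤n+m q 3)) l) (off-below ≤-refl)
    t₁′ : (κ v₁′ (2 + q) , κ v₁′ (3 + q) , κ v₁′ (4 + q)) ≡ (κ v (4 + q) , κ v (3 + q) , κ v (1 + q))
    t₁′ = trans (D-tri (1 + q) l x₁) (trans (cong₂ (λ ab c → Walks.tri lt cl (proj₁ ab) (proj₂ ab) c)
      (cong₂ _,_ (cong (proj₁ ∘ proj₂) t₁) (cong (proj₂ ∘ proj₂) t₁)) v₁₄) (tri₃₁₄ P))
    e₁ : E (2 + q) v v₁
    e₁ = s≤s (s≤s z≤n) , l₁ , x , x₁ , (λ e → p₁≢₂ (trans (cong (λ w → κ w (1 + q)) e) v₁₁)) , inj₁ refl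
    e′ : E (3 + q) v v′
    e′ = s≤s (s≤s z≤n) , l , x , x′ , (λ e → p₂≢₄ (trans (cong (λ w → κ w (2 + q)) e) (cong proj₁ t′))) , inj₁ refl
    e₁′ : E (3 + q) v₁ v₁′
    e₁′ = s≤s (s≤s z≤n) , l , x₁ , x₁′ , (λ e → p₃≢₄ (trans (sym (cong (proj₁ ∘ proj₂) t₁)) (trans (cong (λ w → κ w (2 + q)) e) (cong proj₁ t₁′)))) , inj₁ refl
    C = Cols 1 (3 + q)
    model = IsDEG.ax4 deg (3 + q) (s≤s (s≤s (s≤s z≤n))) l v x
    λp = proj₁ model
    open CompIso (proj₂ (proj₂ (proj₂ (proj₂ model))))
    r₁ : Reach (LLT ν) C v v₁
    r₁ = (2 + q , inj₂ (inj₁ refl) , e₁) ◅ ε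
    r′ : Reach (LLT ν) C v v′
    r′ = (3 + q , inj₁ refl , e′) ◅ ε
    r₁′ : Reach (LLT ν) C v v₁′
    r₁′ = (2 + q , inj₂ (inj₁ refl) , e₁) ◅ (3 + q , inj₁ refl , e₁′) ◅ ε
    same-image : f v₁ ≡ f v′
    same-image = double-edge λp {f v} {f v₁} {f v′} {f v₁′} q
      (Equivalence.to (edge (2 + q) v v₁ (inj₂ (inj₁ refl)) ε r₁) e₁)
      (Equivalence.to (edge (3 + q) v v′ (inj₁ refl) ε r′) e′)
      (Equivalence.to (edge (3 + q) v₁ v₁′ (inj₁ refl) r₁ r₁′) e₁′)
    v′≡v₁ : v′ ≡ v₁
    v′≡v₁ = trans (sym (gf v′ r′)) (trans (cong g (sym same-image)) (gf v₁ r₁))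

  -- The cells `s₂` and `s₃` carry the extreme contents and are the only pair that may share a
  -- component. Then no further cell may lie between them, so that the four can be filled
  -- consecutively in this order.
  record Quadruple : Set where
    field
      o : Bool
      s₁ s₂ s₃ s₄ : Cell
      ∈₁ : s₁ ∈ cells ν
      ∈₂ : s₂ ∈ cells ν
      ∈₃ : s₃ ∈ cells ν
      ∈₄ : s₄ ∈ cells ν
      apart₁₂ : compOf s₁ ≢ compOf s₂
      apart₁₃ : compOf s₁ ≢ compOf s₃
      apart₁₄ : compOf s₁ ≢ compOf s₄
      apart₂₄ : compOf s₂ ≢ compOf s₄
      apart₃₄ : compOf s₃ ≢ compOf s₄
      order₂₃ : ¬ (s₃ ⊑ s₂)
      thin₂₃  : ∀ {z} → s₂ ⊑ z → z ⊑ s₃ → z ≡ s₂ ⊎ z ≡ s₃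
      shape   : Pattern lt cl o (sc s₁) (sc s₂) (sc s₃) (sc s₄)

  module _ (Q : Quadruple) where
    open Quadruple Q
    private
      S : List Cell
      S = s₁ ∷ s₂ ∷ s₃ ∷ s₄ ∷ []

      S⊆ : ∀ {s} → s ∈ S → s ∈ cells ν
      S⊆ (here refl) = ∈₁
      S⊆ (there (here refl)) = ∈₂
      S⊆ (there (there (here refl))) = ∈₃
      S⊆ (there (there (there (here refl)))) = ∈₄

      other : ∀ x y → compOf x ≢ compOf y → x ⋢ y
      other x y n z = n (sym (proj₁ z))

      S-order : AllPairs _⋢_ S
      S-order = (other s₁ s₂ apart₁₂ ∷ other s₁ s₃ apart₁₃ ∷ other s₁ s₄ apart₁₄ ∷ []) ∷ (order₂₃ ∷ other s₂ s₄ apart₂₄ ∷ []) ∷ (other s₃ s₄ apart₃₄ ∷ []) ∷ [] ∷ []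

      far : ∀ {s s′} x {B : Set} → compOf s ≢ compOf s′ → s ⊑ x → x ⊑ s′ → B
      far x n a b = ⊥-elim (n (trans (proj₁ a) (proj₁ b)))

      convex : ∀ {s s′ x} → s ∈ S → s′ ∈ S → x ∈ cells ν → s ⊑ x → x ⊑ s′ → x ∈ S
      convex (here refl) (here refl) _ a b = here (⊑-antisym b a)
      convex {x = x} (here refl) (there (here refl)) _ a b = far x apart₁₂ a b
      convex {x = x} (here refl) (there (there (here refl))) _ a b = far x apart₁₃ a b
      convex {x = x} (here refl) (there (there (there (here refl)))) _ a b = far x apart₁₄ a b
      convex {x = x} (there (here refl)) (here refl) _ a b = far x (apart₁₂ ∘ sym) a b
      convex (there (here refl)) (there (here refl)) _ a b = there (here (⊑-antisym b a))
      convex (there (here refl)) (there (there (here refl))) _ a b = case thin₂₃ a b of λ { (inj₁ e) → there (here e) ; (inj₂ e) → there (there (here e)) }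
      convex {x = x} (there (here refl)) (there (there (there (here refl)))) _ a b = far x apart₂₄ a b
      convex {x = x} (there (there (here refl))) (here refl) _ a b = far x (apart₁₃ ∘ sym) a b
      convex (there (there (here refl))) (there (here refl)) _ a b = ⊥-elim (order₂₃ (⊑-trans a b))
      convex (there (there (here refl))) (there (there (here refl))) _ a b = there (there (here (⊑-antisym b a)))
      convex {x = x} (there (there (here refl))) (there (there (there (here refl)))) _ a b = far x apart₃₄ a b
      convex {x = x} (there (there (there (here refl)))) (here refl) _ a b = far x (apart₁₄ ∘ sym) a b
      convex {x = x} (there (there (there (here refl)))) (there (here refl)) _ a b = far x (apart₂₄ ∘ sym) a b
      convex {x = x} (there (there (there (here refl)))) (there (there (here refl))) _ a b = far x (apart₃₄ ∘ sym) a b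
      convex (there (there (there (here refl)))) (there (there (there (here refl)))) _ a b = there (there (there (here (⊑-antisym b a))))

      module K = Consecutive ν S S⊆ S-order convex
      module F = Std K.filling

      q = length K.low

      T₁ : K.T s₁ ≡ 1 + q
      T₁ = trans (K.T-special (here refl)) (trans (cong (_+_ q) (rank-here s₁ (s₂ ∷ s₃ ∷ s₄ ∷ K.high))) (+-comm q 1))
      T₂ : K.T s₂ ≡ 2 + q
      T₂ = trans (K.T-special (there (here refl))) (trans (cong (_+_ q) (trans (rank-there (s₂ ∷ s₃ ∷ s₄ ∷ K.high) (λ e → apart₁₂ (cong compOf e))) (cong suc (rank-here s₂ (s₃ ∷ s₄ ∷ K.high))))) (+-comm q 2))
      T₃ : K.T s₃ ≡ 3 + q
      T₃ = trans (K.T-special (there (there (here refl)))) (trans (cong (_+_ q)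
        (trans (rank-there (s₂ ∷ s₃ ∷ s₄ ∷ K.high) (λ e → apart₁₃ (cong compOf e))) (cong suc (trans (rank-there (s₃ ∷ s₄ ∷ K.high) (λ e → order₂₃ (subst (_⊑ s₂) e (⊑-refl {s₂})))) (cong suc (rank-here s₃ (s₄ ∷ K.high))))))) (+-comm q 3))
      T₄ : K.T s₄ ≡ 4 + q
      T₄ = trans (K.T-special (there (there (there (here refl))))) (trans (cong (_+_ q)
        (trans (rank-there (s₂ ∷ s₃ ∷ s₄ ∷ K.high) (λ e → apart₁₄ (cong compOf e))) (cong suc (trans (rank-there (s₃ ∷ s₄ ∷ K.high) (λ e → apart₂₄ (cong compOf e)))
          (cong suc (trans (rank-there (s₄ ∷ K.high) (λ e → apart₃₄ (cong compOf e))) (cong suc (rank-here s₄ K.high)))))))) (+-comm q 4))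

      letter : ∀ {s i} → s ∈ cells ν → K.T s ≡ i → sc s ≡ κ F.word i
      letter s∈ e = trans (sym (F.κ-cell s∈)) (cong (κ F.word) e)

    quadruple-clash : IsDEG (LLT ν) → ⊥
    quadruple-clash deg = pattern-clash deg q F.word (subst (_≤ n) T₄ (proj₂ (F.range s₄ ∈₄))) (K.T , K.filling , refl) o
      (subst₂ (λ a b → Pattern lt cl o a b (κ F.word (3 + q)) (κ F.word (4 + q))) (letter ∈₁ T₁) (letter ∈₂ T₂)
        (subst₂ (Pattern lt cl o (sc s₁) (sc s₂)) (letter ∈₃ T₃) (letter ∈₄ T₄) shape))

-- Choice of the four cells when the diameter exceeds 3.

module Integers = Data.List.Sort ℤP.≤-decTotalOrder

module Converse (ν : List Skew) where
  open Wide ν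
  open Graph ν
  open Diameter ν using (wide; contents⁻)

  Four : List ℤ → Set
  Four R = ∃ λ a → ∃ λ b → ∃ λ c → ∃ λ e → (a ∈ R × b ∈ R × c ∈ R × e ∈ R) × a ℤ.< b × b ℤ.< c × c ℤ.< e

  four : ∀ R → Unique R → 4 ≤ length R → Four R
  four R u l = go (Integers.sort R) (Integers.sort-↗ R) (↭ₛP.Unique-resp-↭ (setoid ℤ) (↭⇒↭ₛ (↭-sym p)) u)
                 (subst (4 ≤_) (sym (↭-length p)) l) (λ i → ∈-resp-↭ p i)
    where
    p = Integers.sort-↭ R
    strict : ∀ {x y} → x ℤ.≤ y → x ≢ y → x ℤ.< y
    strict l n = ℤP.≤∧≢⇒< l n
    go : ∀ R′ → Linked ℤ._≤_ R′ → Unique R′ → 4 ≤ length R′ → (∀ {x} → x ∈ R′ → x ∈ R) → Four R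
    go (a ∷ b ∷ c ∷ e ∷ _) (l₁ ∷ l₂ ∷ l₃ ∷ _) ((n₁ ∷ _) ∷ (n₂ ∷ _) ∷ (n₃ ∷ _) ∷ _) _ sub =
      a , b , c , e , (sub (here refl) , sub (there (here refl)) , sub (there (there (here refl))) , sub (there (there (there (here refl))))) ,
      strict l₁ n₁ , strict l₂ n₂ , strict l₃ n₃
    go (_ ∷ []) _ _ (s≤s ())
    go (_ ∷ _ ∷ []) _ _ (s≤s (s≤s ()))
    go (_ ∷ _ ∷ _ ∷ []) _ _ (s≤s (s≤s (s≤s ())))

  -- Within one component shifted contents differ by multiples of k.
  same-component : ∀ x y → compOf x ≡ compOf y → sc x ℤ.< sc y → sc x ℤ.+ + k ℤ.≤ sc y
  same-component x@(i , r , c) y@(.i , r′ , c′) refl l = near⁺′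
    where
    near⁺′ : sc x ℤ.+ + k ℤ.≤ sc y
    near⁺′ = subst (ℤ._≤ sc y) (sym shuffle) (ℤP.+-monoˡ-≤ (+ i) (ℤP.*-monoˡ-≤-nonNeg (+ k) up))
      where
      up : ℤ.suc (content x) ℤ.≤ content y
      up = ℤP.i<j⇒suc[i]≤j (ℤP.≰⇒> λ z → ℤP.<⇒≱ l (ℤP.+-monoˡ-≤ (+ i) (ℤP.*-monoˡ-≤-nonNeg (+ k) z)))
      shuffle : sc x ℤ.+ + k ≡ + k ℤ.* ℤ.suc (content x) ℤ.+ + i
      shuffle = solve 3 (λ κ z ι → (κ :* z :+ ι) :+ κ := κ :* (con (+ 1) :+ z) :+ ι) refl (+ k) (content x) (+ i)
        where open +-*-Solver

  module _ {w x y z} (w∈ : w ∈ cells ν) (x∈ : x ∈ cells ν) (y∈ : y ∈ cells ν) (z∈ : z ∈ cells ν)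
           (wx : sc w ℤ.< sc x) (xy : sc x ℤ.< sc y) (yz : sc y ℤ.< sc z) (wz : sc z ℤ.≤ sc w ℤ.+ + k) where

    private
      apart : ∀ {s t} → sc s ℤ.< sc t → sc t ℤ.< sc s ℤ.+ + k → compOf s ≢ compOf t
      apart {s} {t} l l′ e = ℤP.<⇒≱ l′ (same-component s t e l)

      +k : ∀ {a b} → a ℤ.< b → a ℤ.+ + k ℤ.< b ℤ.+ + k
      +k l = ℤP.+-monoˡ-< (+ k) l

      module Gaps {w z} (wx : sc w ℤ.< sc x) (yz : sc y ℤ.< sc z) (wz : sc z ℤ.≤ sc w ℤ.+ + k) where
        y<w+k = ℤP.<-≤-trans yz wz
        x<w+k = ℤP.<-trans xy y<w+k
        y<x+k = ℤP.<-trans y<w+k (+k wx)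
        z<x+k = ℤP.≤-<-trans wz (+k wx)
        z<y+k = ℤP.<-trans z<x+k (+k xy)
        wy = ℤP.<-trans wx xy
        xz = ℤP.<-trans xy yz
      not-lt : ∀ {a b} → a ℤ.< b → lt b a ≡ false
      not-lt l = lt-false (ℤP.<⇒≤ l)
      near : ∀ {a b} → a ℤ.< b → b ℤ.≤ a ℤ.+ + k → cl a b ≡ true × cl b a ≡ true
      near {a} {b} l l′ = cl-true (ℤP.<⇒≤ l) l′ , trans (cl-sym b a) (cl-true (ℤP.<⇒≤ l) l′)

      -- The relative order 2143, with the cell `w` of lowest content filled before the cell `z` of
      -- highest content.
      ascending : ∀ {w z} → w ∈ cells ν → z ∈ cells ν → sc w ℤ.< sc x → sc y ℤ.< sc z → sc z ℤ.≤ sc w ℤ.+ + k →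
                  ¬ (z ⊑ w) → (∀ {t} → w ⊑ t → t ⊑ z → t ≡ w ⊎ t ≡ z) → Quadruple
      ascending {w} {z} w∈ z∈ wx yz wz order thin = record
        { o = false ; s₁ = x ; s₂ = w ; s₃ = z ; s₄ = y ; ∈₁ = x∈ ; ∈₂ = w∈ ; ∈₃ = z∈ ; ∈₄ = y∈
        ; apart₁₂ = apart {w} {x} wx x<w+k ∘ sym ; apart₁₃ = apart {x} {z} xz z<x+k ; apart₁₄ = apart {x} {y} xy y<x+k
        ; apart₂₄ = apart {w} {y} wy y<w+k ; apart₃₄ = apart {y} {z} yz z<y+k ∘ sym ; order₂₃ = order ; thin₂₃ = thin
        ; shape = record { lt₁₂ = not-lt wx ; lt₂₃ = lt-true (ℤP.<-trans wx xz) ; lt₁₃ = lt-true xz ; lt₂₄ = lt-true wy ; lt₁₄ = lt-true xy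
          ; lt₃₄ = not-lt yz ; lt₃₁ = not-lt xz ; cl₂₃ = proj₁ (near (ℤP.<-trans wx xz) wz) ; cl₃₁ = proj₂ (near xz (ℤP.<⇒≤ z<x+k))
          ; p₁≢₂ = ℤP.<⇒≢ wx ∘ sym ; p₂≢₄ = ℤP.<⇒≢ wy ; p₃≢₄ = ℤP.<⇒≢ yz ∘ sym } }
        where open Gaps {w} {z} wx yz wz

      -- The relative order 3412, for the case in which `z` has to be filled before `w`.
      descending : ∀ {w z} → w ∈ cells ν → z ∈ cells ν → sc w ℤ.< sc x → sc y ℤ.< sc z → sc z ℤ.≤ sc w ℤ.+ + k →
                   ¬ (w ⊑ z) → (∀ {t} → z ⊑ t → t ⊑ w → t ≡ z ⊎ t ≡ w) → Quadruple
      descending {w} {z} w∈ z∈ wx yz wz order thin = record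
        { o = true ; s₁ = y ; s₂ = z ; s₃ = w ; s₄ = x ; ∈₁ = y∈ ; ∈₂ = z∈ ; ∈₃ = w∈ ; ∈₄ = x∈
        ; apart₁₂ = apart {y} {z} yz z<y+k ; apart₁₃ = apart {w} {y} wy y<w+k ∘ sym ; apart₁₄ = apart {x} {y} xy y<x+k ∘ sym
        ; apart₂₄ = apart {x} {z} xz z<x+k ∘ sym ; apart₃₄ = apart {w} {x} wx x<w+k ; order₂₃ = order ; thin₂₃ = thin
        ; shape = record { lt₁₂ = lt-true yz ; lt₂₃ = not-lt (ℤP.<-trans wx xz) ; lt₁₃ = not-lt wy ; lt₂₄ = not-lt xz ; lt₁₄ = not-lt xy
          ; lt₃₄ = lt-true wx ; lt₃₁ = lt-true wy ; cl₂₃ = proj₂ (near (ℤP.<-trans wx xz) wz) ; cl₃₁ = proj₁ (near wy (ℤP.<⇒≤ y<w+k))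
          ; p₁≢₂ = ℤP.<⇒≢ yz ; p₂≢₄ = ℤP.<⇒≢ xz ∘ sym ; p₃≢₄ = ℤP.<⇒≢ wx } }
        where open Gaps {w} {z} wx yz wz

    -- If the extreme contents lie in one component they are k apart, and their diagonals
    -- contain two adjacent cells.
    quadruple : Quadruple
    quadruple with compOf w ≟ compOf z
    ... | no n = ascending w∈ z∈ wx yz wz (λ u → n (sym (proj₁ u))) λ a b → ⊥-elim (n (trans (proj₁ a) (proj₁ b)))
    ... | yes e = neighbours w∈ z∈ e wx yz wz
      where
      neighbours : ∀ {w z} → w ∈ cells ν → z ∈ cells ν → compOf w ≡ compOf z → sc w ℤ.< sc x → sc y ℤ.< sc z → sc z ℤ.≤ sc w ℤ.+ + k → Quadruple
      neighbours {w@(i , r , c)} {z@(.i , r′ , c′)} w∈ z∈ refl wx yz wz = pick (r ≤? r′)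
        where
        gap : sc z ≡ sc w ℤ.+ + k
        gap = ℤP.≤-antisym wz (same-component w z refl (ℤP.<-trans wx (ℤP.<-trans xy yz)))
        i<k = comp-< {ν} w∈
        pick : Dec (r ≤ r′) → Quadruple
        -- If `z` is not in a lower row than `w`, the right neighbour of `w` has the content of `z`
        -- and replaces it. Otherwise the cell above `z` has the content of `w` and replaces `w`.
        pick (yes r≤) = ascending w∈ right∈ wx (subst (sc y ℤ.<_) (sym right≡) yz) (subst (ℤ._≤ sc w ℤ.+ + k) (sym right≡) wz)
            (λ u → <-irrefl refl (proj₂ (proj₂ u))) thin
          where
          right : Cell
          right = i , r , suc c
          right≡ : sc right ≡ sc z
          right≡ = trans (row-step i r c) (sym gap)
          c<c′ : suc c ≤ c′
          c<c′ = +-cancelʳ-≤ r′ (suc c) c′ (≤-trans (≤-reflexive (proj₂ (same-diagonal {right} {z} i<k i<k right≡))) (+-monoʳ-≤ c′ r≤))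
          right∈ : right ∈ cells ν
          right∈ = cells-convex {ν} w∈ z∈ refl ≤-refl r≤ (n≤1+n c) c<c′
          thin : ∀ {t} → w ⊑ t → t ⊑ right → t ≡ w ⊎ t ≡ right
          thin (refl , a , b) (_ , a′ , b′) with ≤-antisym a a′ | m≤n⇒m<n∨m≡n b′
          ... | refl | inj₂ refl = inj₂ refl
          ... | refl | inj₁ (s≤s l) = inj₁ (cong (λ c → i , r , c) (≤-antisym l b))
        pick (no r≰) = descending above∈ z∈ (subst (ℤ._< sc x) (sym above≡) wx) yz (subst (λ a → sc z ℤ.≤ a ℤ.+ + k) (sym above≡) wz)
            (λ u → <-irrefl refl (proj₁ (proj₂ u))) thin
          where
          r′<r : suc r′ ≤ r
          r′<r = ≰⇒> r≰
          above : Cell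
          above = i , suc r′ , c′
          above≡ : sc above ≡ sc w
          above≡ = +ℤ-cancelʳ (+ k) _ _ (trans (sym (col-step i r′ c′)) gap)
          c′≤c : c′ ≤ c
          c′≤c = +-cancelʳ-≤ r c′ c (≤-trans (≤-reflexive (proj₂ (same-diagonal {above} {w} i<k i<k above≡))) (+-monoʳ-≤ c r′<r))
          above∈ : above ∈ cells ν
          above∈ = cells-convex {ν} z∈ w∈ refl (n≤1+n r′) r′<r ≤-refl c′≤c
          thin : ∀ {t} → z ⊑ t → t ⊑ above → t ≡ z ⊎ t ≡ above
          thin (refl , a , b) (_ , a′ , b′) with ≤-antisym b b′ | m≤n⇒m<n∨m≡n a′
          ... | refl | inj₂ refl = inj₂ refl
          ... | refl | inj₁ (s≤s l) = inj₁ (cong (λ r → i , r , c′) (≤-antisym l a))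

  DEG-narrow : IsDEG (LLT ν) → diam ν ≤ 3
  DEG-narrow deg with diam ν ≤? 3
  ... | yes l = l
  ... | no n with wide (≰⇒> n)
  ... | R , u , l , R⊆ , close with four R u l
  ... | a , b , c , e , (a∈ , b∈ , c∈ , e∈) , ab , bc , ce with contents⁻ (R⊆ a∈) | contents⁻ (R⊆ b∈) | contents⁻ (R⊆ c∈) | contents⁻ (R⊆ e∈)
  ... | w , w∈ , refl | x , x∈ , refl | y , y∈ , refl | z , z∈ , refl =
    ⊥-elim (quadruple-clash (quadruple w∈ x∈ y∈ z∈ ab bc ce (close e∈ a∈)) deg)

theorem4p11 : (ν : List Skew) → IsDEG (LLT ν) ⇔ diam ν ≤ 3
theorem4p11 ν = mk⇔ (Converse.DEG-narrow ν) (narrow-DEG ν)
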